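{- Let $g \geqslant 2$ be a fixed integer. There exists an infinite sequence $\mathcal{D} = \{d_i\}_{i=0}^\infty \in \{0,1,\ldots,g-1\}^\infty$ with infinitely many non-zero elements such that $$\varpi_{\mathcal{D},g}(N) \geqslant \left(\frac{1}{\log(12/5)} + o(1)\right)\log N \qquad \text{as } N \to \infty.$$
   Context: For a sequence $\mathcal{D} = \{d_i\}_{i=0}^\infty$ of $g$-ary digits $d_i \in \{0,\ldots,g-1\}$ and an integer $n \geqslant 1$, define $u_{\mathcal{D},g}(n) = \sum_{i=0}^{n-1} d_i g^i$. Let $\varpi_{\mathcal{D},g}(N)$ denote the number of integers $n$ with $1 \leqslant n \leqslant N$ for which $u_{\mathcal{D},g}(n)$ is prime. The term $o(1)$ denotes a quantity tending to $0$ as $N \to \infty$. -}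

module Defs where

open import Data.Nat using (ℕ; zero; suc; _+_; _*_; _^_)
open import Data.Fin using (Fin; toℕ)
open import Data.Bool using (if_then_else_)
open import Data.Nat.Primality using (prime?)
open import Relation.Nullary using (does)

u : (g : ℕ) → (ℕ → Fin g) → ℕ → ℕ
u g D zero    = 0
u g D (suc n) = u g D n + toℕ (D n) * g ^ n

ϖ : (g : ℕ) → (ℕ → Fin g) → ℕ → ℕ
ϖ g D zero    = 0
ϖ g D (suc N) = ϖ g D N + (if does (prime? (u g D (suc N))) then 1 else 0)

{-# OPTIONS --safe #-}

-- If the digits of 𝒟 above a prime p vanish for a long time, then u(n) = p for many n in a row. So it suffices that every
-- class a prime to g modulo gⁿ contains a prime p with gⁿ ≤ p < 2^(2ⁿ), for infinitely many n: then there are primes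
-- p₀, p₁, … with p_{i+1} ≡ p_i modulo g^{n_i}, where n_i exceeds any multiple of the number of digits of p_i, and 𝒟 is
-- their g-adic limit; ϖ(N) then even exceeds (1 - o(1)) log₂ N.
--
-- For the primes in classes, let L_k and R_k be the class functions (on the units modulo Q = gⁿ) obtained by summing
-- Λ(d) (log d)^k / k! and (log d)^k / k! with weight d^{-1-σ} over the integers d without prime factors below z. From
-- Λ * 1 = log one gets (k+1) R_{k+1} = Σ_{i ≤ k} L_i ⋆ R_{k-i}. Brun's sieve shows that R_k is almost constant, so the
-- mean-zero parts l_k of L_k satisfy l_{k+1} ≈ - l_0 ⋆ l_k and l_5 ≈ - G ⋆ G ⋆ G with G = l_0 ⋆ l_0. A class without
-- primes forces G ⋆ G ⋆ G to be as large there as the trivial bound on G allows. By Cauchy-Schwarz G then correlates with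
-- its translates by squares, that is, L_0 is unevenly distributed over the cosets of the squares. Modulo gⁿ those cosets
-- only depend on residues modulo g³, and L(1, χ) ≠ 0 for the real characters modulo g³ excludes this.
module Submission where

open import Data.Empty using (⊥; ⊥-elim)
open import Data.List using (List; []; _++_; _∷_; length)
open import Data.List.Membership.Propositional using (_∈_)
open import Data.List.Membership.Propositional.Properties using (∈-map⁺)
open import Data.List.Properties using (length-++; length-map; map-++)
open import Data.List.Relation.Unary.All as All using (All; []; _∷_; all?)
open import Data.List.Relation.Unary.Any as Any using (Any; any?; here; there)
open import Data.Nat as N using (NonZero; _!; suc; zero; ℕ)
open import Data.Nat.Coprimality as Cop using (Coprime; coprime-Bézout; coprime?)
open import Data.Nat.DivMod using (%-distribˡ-*; %-distribˡ-+; [m+kn]%n≡m%n; _%_; _/_; m%n%n≡m%n; m%n<n; m/n*n≡m; m/n*n≤m; m<n⇒m%n≡m; m≡m%n+[m/n]*n)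
open import Data.Nat.Divisibility using (%-presˡ-∣; *-cancelˡ-∣; *-monoʳ-∣; 1∣_; _∣?_; _∣_; divides; m∣m*n; n∣m*n; ∣-trans; ∣1⇒≡1; ∣n∣m%n⇒∣m; ∣⇒≤)
open import Data.Nat.GCD using (module Bézout)
open import Data.Nat.Induction using (<-rec)
open import Data.Nat.ListAction.Properties using (product-++; sum-++; sum-↭)
open import Data.Nat.Primality using (Prime; euclidsLemma; prime?; prime⇒irreducible; prime⇒nonTrivial; prime⇒nonZero; ¬prime[1])
open import Data.Nat.Primality.Factorisation using (PrimeFactorisation; factorisationHasAllPrimeFactors; factorisationUnique; factorise; factors)
open import Data.Product using (_,_; _×_; proj₁; proj₂; ∃-syntax)
open import Data.Sum using (_⊎_; inj₁; inj₂)
open import Data.Unit using (tt)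
open import Function using (_$_)
open import Relation.Binary using (tri<; tri>; tri≈)
open import Relation.Nullary using (Dec; no; yes; ¬?; ¬_)
open import Relation.Nullary.Decidable using (_×-dec_; map′; recompute)
import Data.List
import Data.List.Membership.DecPropositional as DecMem
import Data.List.Relation.Binary.Permutation.Propositional.Properties as PermP
import Data.List.Relation.Unary.All.Properties as AllP
import Data.Nat.Properties as NP
open import Data.Nat.Tactic.RingSolver using () renaming (solve-∀ to solveℕ)
open import Relation.Binary.PropositionalEquality hiding (J)

-- The obstacle is parity. Positivity of the L_k and equidistribution of sifted integers are
-- consistent with primes on which a real character χ is always -1. In that scenario L_0 = (1 - χ)
-- μ/φ, with φ the number of classes and μ the total mass, so G = χ μ²/φ, and the inequalities of
-- the argument are sharp at the classes with χ = 1. Hence an arithmetic input, L(1, χ) ≠ 0, is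
-- unavoidable. The trivial bound on G has two sources with the same constant: L_1 ≥ 0 bounds G from
-- above and L_0 ⋆ L_0 ≥ 0 bounds it from below. Two factors G would force only a symmetry of G;
-- three force the behaviour of a real character. As g is fixed, the lower bound for L(1, χ) does
-- not change with n, while the total mass grows without limit. The size 2^(2^n) is calibrated by
-- the counting: just before N reaches 2^(n_i), about n_i indices have been won, which is log₂ N.
-- The constant 12/5 enters only as a number above 2. All quantities are rational. Logarithms are
-- rounded on primes and extended additively, so that Λ * 1 = log and the binomial theorem stay
-- exact and only sizes are approximated.

module Q where

 import Data.Rational as R
 import Data.Rational.Properties as RP
 open R public using (ℚ; 0ℚ; 1ℚ; _≤_; _<_)
 open RP public using (≤-refl; ≤-trans; ≤-reflexive; ≤-total; ≤-antisym; <⇒≤; <-irrefl; <-≤-trans; ≤-<-trans; <-trans; <-cmp; _≟_; _≤?_; _<?_; ≰⇒>; ≮⇒≥; module ≤-Reasoning)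
 open import Data.Maybe using (Maybe; just; nothing)
 open import Data.Sum using (_⊎_)
 open import Relation.Nullary using (yes; no)
 open import Relation.Binary.PropositionalEquality
 open import Tactic.RingSolver public using (solve-∀; solve)
 open import Tactic.RingSolver.Core.AlmostCommutativeRing using (AlmostCommutativeRing; fromCommutativeRing)
 open import Level using (0ℓ)
 open import Algebra.Bundles using (CommutativeRing)

 infixl 6 _+_ _-_
 infixl 7 _*_
 infix 8 -_

 -- The operations are sealed so that they behave as injective symbols during unification.
 opaque
  _+_ _*_ : ℚ → ℚ → ℚ
  _+_ = R._+_
  _*_ = R._*_
  -_ ∣_∣ : ℚ → ℚ
  -_ = R.-_
  ∣_∣ = R.∣_∣

 _-_ : ℚ → ℚ → ℚ
 a - b = a + (- b)

 opaque
  unfolding _+_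

  ring : AlmostCommutativeRing 0ℓ 0ℓ
  ring = fromCommutativeRing cr isZero
   where
   cr : CommutativeRing 0ℓ 0ℓ
   cr = record { Carrier = ℚ ; _≈_ = _≡_ ; _+_ = _+_ ; _*_ = _*_ ; -_ = -_ ; 0# = 0ℚ ; 1# = 1ℚ
         ; isCommutativeRing = RP.+-*-isCommutativeRing }
   isZero : ∀ x → Maybe (0ℚ ≡ x)
   isZero x with 0ℚ ≟ x
   ... | yes p = just p
   ... | no _ = nothing

  +-identityˡ : ∀ x → 0ℚ + x ≡ x
  +-identityˡ = RP.+-identityˡ
  +-identityʳ : ∀ x → x + 0ℚ ≡ x
  +-identityʳ = RP.+-identityʳ
  *-identityˡ : ∀ x → 1ℚ * x ≡ x
  *-identityˡ = RP.*-identityˡ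
  *-identityʳ : ∀ x → x * 1ℚ ≡ x
  *-identityʳ = RP.*-identityʳ
  *-zeroˡ : ∀ x → 0ℚ * x ≡ 0ℚ
  *-zeroˡ = RP.*-zeroˡ
  *-zeroʳ : ∀ x → x * 0ℚ ≡ 0ℚ
  *-zeroʳ = RP.*-zeroʳ
  +-assoc : ∀ x y z → (x + y) + z ≡ x + (y + z)
  +-assoc = RP.+-assoc
  *-assoc : ∀ x y z → (x * y) * z ≡ x * (y * z)
  *-assoc = RP.*-assoc
  +-comm : ∀ x y → x + y ≡ y + x
  +-comm = RP.+-comm
  *-comm : ∀ x y → x * y ≡ y * x
  *-comm = RP.*-comm
  *-distribˡ-+ : ∀ x y z → x * (y + z) ≡ x * y + x * z
  *-distribˡ-+ = RP.*-distribˡ-+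
  *-distribʳ-+ : ∀ x y z → (y + z) * x ≡ y * x + z * x
  *-distribʳ-+ = RP.*-distribʳ-+
  +-inverseʳ : ∀ x → x + - x ≡ 0ℚ
  +-inverseʳ = RP.+-inverseʳ
  neg-distrib-+ : ∀ x y → - (x + y) ≡ - x + - y
  neg-distrib-+ = RP.neg-distrib-+
  neg-distribˡ-* : ∀ x y → - (x * y) ≡ - x * y
  neg-distribˡ-* = RP.neg-distribˡ-*
  neg-distribʳ-* : ∀ x y → - (x * y) ≡ x * - y
  neg-distribʳ-* = RP.neg-distribʳ-*
  neg-0 : - 0ℚ ≡ 0ℚ
  neg-0 = refl
  neg-anti : ∀ {x y} → x ≤ y → - y ≤ - x
  neg-anti = RP.neg-antimono-≤

  +-mono : ∀ {a b c d} → a ≤ b → c ≤ d → a + c ≤ b + d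
  +-mono = RP.+-mono-≤
  +-monoʳ : ∀ a {b c} → b ≤ c → a + b ≤ a + c
  +-monoʳ = RP.+-monoʳ-≤
  +-monoˡ : ∀ a {b c} → b ≤ c → b + a ≤ c + a
  +-monoˡ = RP.+-monoˡ-≤
  +-mono-<-≤ : ∀ {a b c d} → a < b → c ≤ d → a + c < b + d
  +-mono-<-≤ = RP.+-mono-<-≤
  +-mono-≤-< : ∀ {a b c d} → a ≤ b → c < d → a + c < b + d
  +-mono-≤-< = RP.+-mono-≤-<

  *-monoˡ : ∀ {a b} c → 0ℚ ≤ c → a ≤ b → c * a ≤ c * b
  *-monoˡ c p h = RP.*-monoˡ-≤-nonNeg c {{R.nonNegative p}} h
  *-monoʳ : ∀ {a b} c → 0ℚ ≤ c → a ≤ b → a * c ≤ b * c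
  *-monoʳ c p h = RP.*-monoʳ-≤-nonNeg c {{R.nonNegative p}} h
  *-cancelˡ : ∀ {a b} c → 0ℚ < c → c * a ≤ c * b → a ≤ b
  *-cancelˡ c p h = RP.*-cancelˡ-≤-pos c {{R.positive p}} h
  0<* : ∀ {a b} → 0ℚ < a → 0ℚ < b → 0ℚ < a * b
  0<* {a} {b} p q = subst (R._< a R.* b) (*-zeroʳ a) (RP.*-monoʳ-<-pos a {{R.positive p}} q)

  reciprocal : ∀ {x} → 0ℚ < x → ℚ
  reciprocal {x} p = R.1/_ x {{RP.pos⇒nonZero x {{R.positive p}}}}
  reciprocal-inverse : ∀ {x} (p : 0ℚ < x) → x * reciprocal p ≡ 1ℚ
  reciprocal-inverse {x} p = RP.*-inverseʳ x {{RP.pos⇒nonZero x {{R.positive p}}}}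

  ∣∣≡ : ∀ x → (∣ x ∣ ≡ x) ⊎ (∣ x ∣ ≡ - x)
  ∣∣≡ = RP.∣p∣≡p∨∣p∣≡-p
  0≤∣∣ : ∀ x → 0ℚ ≤ ∣ x ∣
  0≤∣∣ = RP.0≤∣p∣
  ∣-∣ : ∀ x → ∣ - x ∣ ≡ ∣ x ∣
  ∣-∣ = RP.∣-p∣≡∣p∣
  ∣+∣≤ : ∀ x y → ∣ x + y ∣ ≤ ∣ x ∣ + ∣ y ∣
  ∣+∣≤ = RP.∣p+q∣≤∣p∣+∣q∣
  ∣*∣ : ∀ x y → ∣ x * y ∣ ≡ ∣ x ∣ * ∣ y ∣
  ∣*∣ = RP.∣p*q∣≡∣p∣*∣q∣
  ∣∣-nonneg : ∀ {x} → 0ℚ ≤ x → ∣ x ∣ ≡ x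
  ∣∣-nonneg = RP.0≤p⇒∣p∣≡p

 0≤1 : 0ℚ ≤ 1ℚ
 0≤1 = RP.nonNegative⁻¹ 1ℚ

 0<1 : 0ℚ < 1ℚ
 0<1 = RP.positive⁻¹ 1ℚ

 2ℚ : ℚ
 2ℚ = 1ℚ + 1ℚ

-- Polynomial identities over the rationals.

module Identities where

 -- Collected in one place because only here the ring operations of ℚ may be unfolded.

 open Q renaming (solve-∀ to by)

 opaque
  unfolding ring

  id1 : ∀ a b → a + (b - a) ≡ b
  id1 = by ring
  id2 : ∀ a → (- a) * (- a) ≡ a * a
  id2 = by ring
  id3 : ∀ a b → b + a * b ≡ (1ℚ + a) * b
  id3 = by ring
  id4 : ∀ x i r → x ≡ (i * x) * r + (x - x * (i * r))
  id4 = by ring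
  id5 : ∀ r x → 1ℚ * r + (x - x * 1ℚ) ≡ r
  id5 = by ring
  id6 : ∀ a b c d → a * b * (c * d) ≡ a * c * (b * d)
  id6 = by ring
  id7 : ∀ a b c → a * (b * c) ≡ c * (a * b)
  id7 = by ring
  id8 : ∀ a b c → a * (b * c) ≡ b * (a * c)
  id8 = by ring
  id9 : ∀ x → 1ℚ + 0ℚ * x ≡ 1ℚ
  id9 = by ring
  id10 : ∀ n x → (1ℚ + x) * (1ℚ + n * x) - (1ℚ + (1ℚ + n) * x) ≡ n * (x * x)
  id10 = by ring
  id11 : ∀ x → 1ℚ - 0ℚ * x ≡ 1ℚ
  id11 = by ring
  id12 : ∀ n x → (1ℚ - x) * (1ℚ - n * x) - (1ℚ - (1ℚ + n) * x) ≡ n * (x * x)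
  id12 = by ring
  id13 : ∀ a b c d → a + b + (c + d) ≡ a + c + (b + d)
  id13 = by ring
  id14 : ∀ c n → c + n * c ≡ (1ℚ + n) * c
  id14 = by ring
  id15 : ∀ iv x x' y t s → x + y ≡ (iv - (iv - ((x + x') + ((y + t) + s)))) + - (x' + (t + s))
  id15 = by ring
  id16 : ∀ c f s p x y → c * f - s - p * (c * x - y) ≡ c * (f - p * x) - (s - p * y)
  id16 = by ring
  id17 : ∀ x d → x ≡ d + (x - d)
  id17 = by ring
  id18 : ∀ x y a b → (x + y) - (a + b) ≡ (x - a) + (y - b)
  id18 = by ring
  id19 : ∀ v x → v ≡ x + (1ℚ * v - (x + 0ℚ))
  id19 = by ring
  id20 : ∀ x y z → x - - z ≡ (x + y) - (y - z)
  id20 = by ring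
  id21 : ∀ x → - - x ≡ x
  id21 = by ring
  id22 : ∀ a b c → a - b - (c - b) ≡ a - c
  id22 = by ring
  id23 : ∀ a → a - 0ℚ ≡ a
  id23 = by ring
  id24 : ∀ a m → a + m - (a - m) ≡ m + m
  id24 = by ring
  id25 : ∀ a m → a + m - - (a - m) ≡ a + a
  id25 = by ring
  id26 : ∀ n c u v g → (n * u + n * v - 2ℚ * c * g) * (n * u + n * v - 2ℚ * c * g) ≡ (((n * n) * (u * u) + (n * n) * (v * v)) + (2ℚ * (n * n) * (u * v) + 2ℚ * 2ℚ * (c * c) * (g * g))) - (2ℚ * 2ℚ * (n * c) * (g * u) + 2ℚ * 2ℚ * (n * c) * (g * v))
  id26 = by ring
  id27 : ∀ n c c2 → (((n * n) * n + (n * n) * n) + (2ℚ * (n * n) * c2 + 2ℚ * 2ℚ * (c * c) * n)) - (2ℚ * 2ℚ * (n * c) * c + 2ℚ * 2ℚ * (n * c) * c) ≡ (2ℚ * (n * n * n) + 2ℚ * (n * n) * c2) - 2ℚ * 2ℚ * (n * (c * c))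
  id27 = by ring
  id28 : ∀ a b c d → a * b * (c * d) ≡ a * d * (c * b)
  id28 = by ring
  id29 : ∀ x y → x - 2ℚ * (2ℚ * y) ≡ x - 2ℚ * 2ℚ * y
  id29 = by ring
  id30 : ∀ p n c k → 2ℚ * (p * (n * n * n) + n * n * k) - (2ℚ * (n * n * n) * p + 2ℚ * (n * n) * c) ≡ 2ℚ * (n * n) * (k - c)
  id30 = by ring
  id31 : ∀ a b c → a * (b - c) ≡ a * b - a * c
  id31 = by ring
  id32 : ∀ X Y P → 2ℚ * (X * Y) - 2ℚ * (P * P) ≡ (X * Y + X * Y) - 2ℚ * (P * P)
  id32 = by ring
  id33 : ∀ a b c d → (a * b - c * d) * (a * b - c * d) ≡ ((a * a) * (b * b) + (d * d) * (c * c)) - 2ℚ * ((a * d) * (c * b))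
  id33 = by ring
  id34 : ∀ x → 0ℚ * x + 1ℚ * x ≡ x
  id34 = by ring
  id35 : ∀ x → 1ℚ * x + 0ℚ * x ≡ x
  id35 = by ring
  id36 : ∀ a f b → a * f ≡ b * (0ℚ * f) + a * (1ℚ * f)
  id36 = by ring
  id37 : ∀ a f b → a * f ≡ a * (1ℚ * f) + b * (0ℚ * f)
  id37 = by ring
  id38 : ∀ a b c → a + (b + c) ≡ b + (a + c)
  id38 = by ring
  id39 : ∀ a → 1ℚ * a ≡ 0ℚ * 0ℚ + 1ℚ * a
  id39 = by ring
  id40 : ∀ a b → a * b ≡ 1ℚ * (a * b) + 0ℚ * b
  id40 = by ring
  id41 : ∀ b → 0ℚ + 0ℚ * b ≡ 0ℚ * b
  id41 = by ring
  id42 : ∀ a b c → a * - (b * - c) ≡ (a * b) * c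
  id42 = by ring
  id43 : ∀ a b → 1ℚ * a + (0ℚ * b + 0ℚ) ≡ a
  id43 = by ring
  id44 : ∀ a b c → c - (a - b) ≡ b + c - a
  id44 = by ring
  id45 : ∀ a q r → (a * q + q) * r ≡ a * (q * r) + q * r
  id45 = by ring
  id46 : ∀ a s → a * 0ℚ ≡ a * s - 1ℚ * (a * s)
  id46 = by ring
  id47 : ∀ a s → a * s ≡ a * s - 0ℚ * (a * s)
  id47 = by ring
  id48 : ∀ a b → a * b + a ≡ a * (1ℚ + b)
  id48 = by ring
  id49 : ∀ f v X → 1ℚ + 1ℚ * X - (f - v) ≡ (X + 1ℚ - f) + v
  id49 = by ring
  id50 : ∀ f v X → 1ℚ + 1ℚ * X - - (f - v * X) ≡ (1ℚ + f) + (1ℚ - v) * X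
  id50 = by ring
  id51 : ∀ f f' v r X Y → f - f' - (1ℚ - r) * v * X ≡ ((f - v * X) - (f' - v * Y)) + - (v * (Y - r * X))
  id51 = by ring
  id52 : ∀ a b c → a * (b * c) ≡ b * a * c
  id52 = by ring
  id53 : ∀ r a b q → r * (a - b) * q ≡ (r * a) * q - r * (b * q)
  id53 = by ring
  id54 : ∀ a1 a0 a2 d1 b d2 X Y r w → a2 + d2 * X - ((a1 + d1 * X) + (a0 + b * Y) + 1ℚ * 1ℚ) ≡ ((a2 - (a1 + (a0 + (1ℚ + w)))) + (w - b)) + (b * (1ℚ - (Y - r * X)) + (d2 - (d1 + b * r)) * X)
  id54 = by ring
  id55 : ∀ r → 1ℚ - (1ℚ - r) ≡ r
  id55 = by ring
  id56 : ∀ a x → a * x + (x + (x + x)) ≡ (a + (1ℚ + (1ℚ + 1ℚ))) * x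
  id56 = by ring
  id57 : ∀ f X → 1ℚ - (f - 1ℚ * X) ≡ X + 1ℚ - f
  id57 = by ring
  id58 : ∀ f X → 1ℚ - - (f - 1ℚ * X) ≡ f + 1ℚ - X
  id58 = by ring
  id59 : ∀ a c b x → a + c * (0ℚ * b) * x ≡ a
  id59 = by ring
  id60 : ∀ a r → (1ℚ + (1ℚ + a)) * r - 2ℚ * r ≡ a * r
  id60 = by ring
  id61 : ∀ d r → d * (1ℚ - 0ℚ * r) ≡ d
  id61 = by ring
  id62 : ∀ d c r → (1ℚ - r) * (d * (1ℚ - c * r)) - d * (1ℚ - (1ℚ + c) * r) ≡ (d * c) * (r * r)
  id62 = by ring
  id63 : ∀ r s → (1ℚ - s) - (1ℚ - r) ≡ r - s
  id63 = by ring
  id64 : ∀ i ri c rn → i * ri * (c * rn) ≡ ri * rn * (i * c)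
  id64 = by ring
  id65 : ∀ ri rn t n → ri * rn * (t * n) ≡ t * ri * (n * rn)
  id65 = by ring
  id66 : ∀ f b a ia i → f * (b * a) * (ia * i) ≡ f * (i * b) * (ia * a)
  id66 = by ring
  id67 : ∀ d x y → d * (1ℚ - y) - d * (1ℚ - x) ≡ d * (x - y)
  id67 = by ring
  id68 : ∀ d r → d - d * (1ℚ - r) ≡ d * r
  id68 = by ring
  id69 : ∀ d r → d - (1ℚ - r) * d ≡ d * r
  id69 = by ring
  id70 : ∀ i s → (1ℚ + i) * s - s ≡ i * s
  id70 = by ring
  id71 : ∀ f a h b → f * a * (h * b) ≡ (f * h) * (a * b)
  id71 = by ring
  id72 : ∀ a b c → a * b * c ≡ b * (a * c)
  id72 = by ring
  id73 : ∀ k r → k * r + k * r ≡ ((1ℚ + 1ℚ) * k) * r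
  id73 = by ring
  id74 : ∀ r → 1ℚ - (1ℚ + r) * (1ℚ - r) ≡ r * r
  id74 = by ring
  id75 : ∀ a → (1ℚ - a) + ((1ℚ - a) + ((a + a) - 1ℚ)) ≡ 1ℚ
  id75 = by ring
  id76 : ∀ p a → p * (a + (a + (1ℚ - 1ℚ))) ≡ p * a + p * a
  id76 = by ring
  id77 : ∀ a b → a - a * b ≡ a * (1ℚ - b)
  id77 = by ring
  id78 : ∀ i t u → i * t - (1ℚ - u) ≡ u - (1ℚ - i * t)
  id78 = by ring
  id80 : ∀ r i s → (1ℚ + r) * (i * s) ≡ (i + r * i) * s
  id80 = by ring
  id81 : ∀ p r → p + p * r ≡ (1ℚ + r) * p
  id81 = by ring
  id82 : ∀ a b c d → a * (b - d) + - (d * (c - a)) ≡ a * b - c * d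
  id82 = by ring
  id83 : ∀ x y → 1ℚ * ((x + y) * 1ℚ) ≡ 1ℚ * (x * 1ℚ) + y * 1ℚ
  id83 = by ring
  id84 : ∀ x y p d0 d1 → (x * p + y * d1 + y * ((x + y) * d0)) - (x * (p + y * d0) + y * d1) ≡ y * (y * d0)
  id84 = by ring
  id85 : ∀ a i d y q → a * q + y * d + y * (i * d) ≡ a * q + y * ((1ℚ + i) * d)
  id85 = by ring
  id86 : ∀ a b y c → a * b + y * (a * c) ≡ a * (b + y * c)
  id86 = by ring
  id87 : ∀ r p → r - ((1ℚ + r) * p - p) ≡ r * ((1ℚ - p) + 0ℚ)
  id87 = by ring
  id88 : ∀ a b p r → (1ℚ + (1ℚ + (1ℚ + (1ℚ + (1ℚ + 1ℚ))))) * p - (a + b) ≡ ((1ℚ + (1ℚ + r) * p - a) + (1ℚ + p - b)) + (((p - 1ℚ) + (p - 1ℚ)) + ((1ℚ - r) * p + p))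
  id88 = by ring
  id89 : ∀ p i r → p * (i * r) ≡ (p * i) * r
  id89 = by ring
  id90 : ∀ a r b → (a - b) - (a - r) ≡ r - b
  id90 = by ring
  id91 : ∀ a p → a - p * a ≡ a * (1ℚ - p)
  id91 = by ring
  id92 : ∀ v r g i → (v - g) * r + - (g * (i - r)) ≡ v * r - g * i
  id92 = by ring
  id93 : ∀ e i G r → e * i + G * (i * r) ≡ i * (e + G * r)
  id93 = by ring
  id94 : ∀ a b p r → 1ℚ - (a - b - p * r) ≡ ((1ℚ + (1ℚ + r) * p) - a) + (b - p)
  id94 = by ring
  id95 : ∀ a b p r → 1ℚ - - (a - b - p * r) ≡ (a - (1ℚ + r) * p) + (1ℚ + p - b)
  id95 = by ring
  id96 : ∀ A d q x1 x0 → (A + d * (x1 * q)) + (A + d * (x0 * q)) + 1ℚ * 1ℚ ≡ 1ℚ + (A + A) + (d * q) * (x1 + x0)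
  id96 = by ring
  id97 : ∀ a b → a + b - b ≡ a
  id97 = by ring
  id98 : ∀ a b → a ≡ a + b - b
  id98 = by ring
  id99 : ∀ a b p r → 1ℚ + p * r - (a - b) ≡ ((1ℚ + (1ℚ + r) * p) - a) + (b - p)
  id99 = by ring
  id100 : ∀ p r i → (1ℚ + p * r) * i ≡ i + (p * i) * r
  id100 = by ring
  id101 : ∀ i r s → (i + r) * s ≡ s * (r + i)
  id101 = by ring
  id102 : ∀ f1 f0 V x1 x0 q w → ((f1 - V * (x1 * q)) - (f0 - V * (x0 * q))) + (V * q) * (x1 - x0 - w) ≡ (f1 - f0) - (V * q) * w
  id102 = by ring
  id103 : ∀ s C g i V p r → (s - C * (g * i)) + (g * i) * (C - V * (p * r)) ≡ s - g * (V * r) * (p * i)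
  id103 = by ring
  id104 : ∀ s G i A p B → s + (G * i) * (1ℚ + (A + A) + B * p) ≡ s + G * (i * (1ℚ + (A + A)) + B * (p * i))
  id104 = by ring
  id105 : ∀ d v → (d - d) - 0ℚ * v ≡ 0ℚ
  id105 = by ring
  id106 : ∀ d2 d1 d0 g s v → ((d2 - d1) - g * v) + ((d1 - d0) - s * v) ≡ (d2 - d0) - (g + s) * v
  id106 = by ring
  id107 : ∀ q e p c c' → q * 0ℚ * e * p * c ≡ q * 0ℚ * e * p * c'
  id107 = by ring
  id108 : ∀ q p c c' → q * 0ℚ * p * c ≡ q * 0ℚ * p * c'
  id108 = by ring
  id109 : ∀ a → a - 1ℚ * a ≡ 0ℚ * a
  id109 = by ring
  id110 : ∀ a → a - 0ℚ * a ≡ 1ℚ * a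
  id110 = by ring
  id111 : ∀ a b c → a * 0ℚ * b * c ≡ 0ℚ
  id111 = by ring
  id112 : ∀ a c → a * 0ℚ * c ≡ 0ℚ
  id112 = by ring
  id113 : ∀ a b → a * (b * 0ℚ) ≡ 0ℚ
  id113 = by ring
  id114 : ∀ q p a b → q * (p * (a * b)) ≡ q * a * b * p
  id114 = by ring
  id115 : ∀ p a b r q c → p * (q * a) * (r * b) * c ≡ (p * r) * (q * a * b * c)
  id115 = by ring
  id116 : ∀ t q a b c → t * (q * a * b * c) ≡ q * a * b * t * c
  id116 = by ring
  id117 : ∀ q p a b → (q * p) * (a * b) ≡ q * a * b * p
  id117 = by ring
  id118 : ∀ q p a b → (q * p) * (a * b) ≡ (q * p) * a * b
  id118 = by ring
  id119 : ∀ a b → a - b ≡ - (b - a)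
  id119 = by ring
  id120 : ∀ a b c d e → a * (b * 0ℚ) * c ≡ d * (e * 0ℚ * c)
  id120 = by ring
  id121 : ∀ a p o c → a * (p * o) * c ≡ (a * p) * (o * c)
  id121 = by ring
  id122 : ∀ i d o c → (i * d) * (o * c) ≡ i * (d * o * c)
  id122 = by ring
  id123 : ∀ a c o → a * (1ℚ * 0ℚ) * c ≡ 0ℚ * o
  id123 = by ring
  id124 : ∀ a o c → a * (1ℚ * o) * c ≡ a * (o * c)
  id124 = by ring
  id125 : ∀ c d w v r s → c * d * (w * v * (r * s)) ≡ (c * (w * r)) * (d * (v * s))
  id125 = by ring
  id126 : ∀ a b → - (a - b) ≡ b - a
  id126 = by ring
  id127 : ∀ t1 r s0 d e → r * s0 - t1 ≡ (r * (s0 + d) - (t1 + e)) + (e - r * d)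
  id127 = by ring
  id128 : ∀ i r d t → (i * r) * d * t ≡ i * (r * (d * t))
  id128 = by ring
  id129 : ∀ a r → (1ℚ + a) * r ≡ a * r + r
  id129 = by ring
  id130 : ∀ r t s0 s1 d0 d1 d1' p → (t * (d1 * p + s1) + d1' * ((1ℚ - t) * p)) - r * (1ℚ - t) * (d0 * p + s0) ≡ ((t * s1 + d1 * p) - r * (1ℚ - t) * s0) + ((1ℚ - t) * p) * (d1' - (d1 + d0 * r))
  id130 = by ring
  id131 : ∀ t → t * 0ℚ + 0ℚ * 1ℚ ≡ 0ℚ
  id131 = by ring
  id132 : ∀ r t s0 s1 d0 d1 d0' d1' p → r * ((d0 * p + s0) + d0' * ((1ℚ - t) * p)) - (t * (d1 * p + s1) + d1' * ((1ℚ - t) * p)) ≡ (r * (s0 + d0 * p) - (t * s1 + d1 * p)) + ((1ℚ - t) * p) * ((d1 + r * d0') - d1')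
  id132 = by ring
  id133 : ∀ t → t * 0ℚ ≡ 1ℚ - 1ℚ
  id133 = by ring
  id134 : ∀ t p → t * (1ℚ * p) + (1ℚ - p) ≡ 1ℚ - (1ℚ - t) * p
  id134 = by ring
  id135 : ∀ r j x → r * (j * x) ≡ (j * r) * x
  id135 = by ring
  id136 : ∀ r j x → r * (j * (r * x)) ≡ (j * r) * (r * x)
  id136 = by ring
  id137 : ∀ j r t s → j * r * (r * (1ℚ - t) * s) ≡ (j * r) * (r * s) - ((j * r) * t) * (r * s)
  id137 = by ring
  id138 : ∀ j r t s1 d → j * r * (t * s1 + d) ≡ r * (j * (t * s1)) + (j * r) * d
  id138 = by ring
  id139 : ∀ M t o p r → (M * (1ℚ - t) + o * (p * 1ℚ * (r + t))) - M * 1ℚ ≡ (o * (p * 1ℚ) - M) * t + (o * (p * 1ℚ)) * r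
  id139 = by ring
  id140 : ∀ M I0 I1 c G r t p → (I1 + (1ℚ + c) * (p * G * (r + t))) - M * (I0 + c * (G * (r + t))) ≡ ((I1 + M * (G * t) - (M * I0 - r * I0)) + (c * (G * (r + t))) * (p - M)) + (((p - M) * G) * t + r * (p * G - I0))
  id140 = by ring
  id141 : ∀ c d f r → 2ℚ * (c * ((d * r) * f)) ≡ c * ((2ℚ * (d * f)) * r)
  id141 = by ring
  id142 : ∀ c n d r p → c * (((n * n - n * d) + p) * r) ≡ (n * n * (c * r) - n * c * (d * r)) + c * (p * r)
  id142 = by ring
  id143 : ∀ d p → d * d - p * (d - p) ≡ d * (d - p) + p * p
  id143 = by ring
  id144 : ∀ a m q r → 2ℚ * a * m * (q * r) + 2ℚ * a * m * (q * r) ≡ 2ℚ * 2ℚ * a * (q * m) * r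
  id144 = by ring
  id145 : ∀ a → 0ℚ * (0ℚ * a) ≡ 0ℚ * a
  id145 = by ring
  id146 : ∀ s c → s * (c * 0ℚ) ≡ c * 0ℚ
  id146 = by ring
  id147 : ∀ n d j → 2ℚ * (n - d * (1ℚ + j)) + j * (2ℚ * n - d * (1ℚ + j)) ≡ (1ℚ + j) * (2ℚ * n - d * (1ℚ + (1ℚ + j)))
  id147 = by ring
  id148 : ∀ n d p → n * n - ((n * n - n * d) + p * (d - p)) ≡ (n - p) * d + p * p
  id148 = by ring
  id149 : ∀ a n s q → (a + n * q) - (a - n * s) ≡ n * (q - - s)
  id149 = by ring
  id150 : ∀ s q m f → 2ℚ * (s * (q * m) * f) ≡ s * m * (2ℚ * (q * f))
  id150 = by ring
  id151 : ∀ m → (2ℚ * m) * (2ℚ * m) * ((2ℚ * m) * (2ℚ * m)) ≡ (2ℚ * 2ℚ) * (2ℚ * 2ℚ) * m * (m * (m * m))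
  id151 = by ring
  id152 : ∀ m A B C n F q → A - 2ℚ * 2ℚ * (m * (m * m)) ≡ (((A + B + C) - 2ℚ * n) + (m * (m * m) - (B + C))) + ((m * (m * m) - 2ℚ * q) + (2ℚ * (q - F) + 2ℚ * ((F + n) - m * ((2ℚ + 1ℚ) * (m * m)))))
  id152 = by ring
  id153 : ∀ m s → (2ℚ * m) * (2ℚ * m) * ((2ℚ * m) * (2ℚ * m)) * s ≡ 2ℚ * 2ℚ * (m * (m * m)) * ((2ℚ * 2ℚ) * m * s)
  id153 = by ring
  id154 : ∀ a b → - (a * b) ≡ a * - b
  id154 = by ring
  id155 : ∀ a → a + - a * 1ℚ ≡ 0ℚ
  id155 = by ring
  id156 : ∀ a → a + - a * 0ℚ ≡ a
  id156 = by ring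
  id157 : ∀ y → y ≡ 1ℚ + - 1ℚ * (1ℚ + - 1ℚ * y)
  id157 = by ring
  id158 : ∀ d g → d * (2ℚ * g) ≡ 2ℚ * (d * g)
  id158 = by ring
  id159 : ∀ d k p → d * (k * (2ℚ * (p + k * d) - d * (1ℚ + k))) ≡ ((p + k * d) * (p + k * d) - (p + k * d) * d) + p * (d - p)
  id159 = by ring
  id160 : ∀ f m d t → 2ℚ * f * m * (t + d) - 1ℚ ≡ (f * m * d - 1ℚ) + (f * m * d - - (2ℚ * f * m * t))
  id160 = by ring
  id161 : ∀ r c g → r + c * (g * r) ≡ (1ℚ + c * g) * r
  id161 = by ring
  id162 : ∀ a b → (a - b) + b ≡ a
  id162 = by ring
  id163 : ∀ q a b → q * (a - b) + q * b ≡ q * a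
  id163 = by ring
  id164 : ∀ f → 0ℚ - 0ℚ * f ≡ 0ℚ
  id164 = by ring
  id165 : ∀ q f → q * (f - f) ≡ 0ℚ
  id165 = by ring
  id166 : ∀ c f s C f' → (s - C * f) + (c + C) * (f - f') ≡ (c * f + s) - (c + C) * f'
  id166 = by ring
  id167 : ∀ q a b c → q * (a - b) + q * (b - c) ≡ q * (a - c)
  id167 = by ring
  id168 : ∀ a b → a + a ≡ (a + b) + (a - b)
  id168 = by ring
  id169 : ∀ a → 2ℚ * a ≡ a + a
  id169 = by ring
  id170 : ∀ a → - a * - a ≡ a * a
  id170 = by ring
  id171 : ∀ a b → a - b ≡ - 1ℚ * (b - a)
  id171 = by ring
  id172 : ∀ s a b → s * a - s * b ≡ s * (a - b)
  id172 = by ring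
  id173 : ∀ b → (b - 1ℚ) + 1ℚ ≡ b
  id173 = by ring
  id174 : ∀ p a → 2ℚ * (p * a) ≡ p * (a + a)
  id174 = by ring
  id175 : ∀ i b → i * (b + b) + i * (b + b) ≡ 2ℚ * (2ℚ * i * b)
  id175 = by ring
  id176 : ∀ c a → c * c * a ≡ c * (a * c)
  id176 = by ring
  id177 : ∀ a → a - a * 0ℚ ≡ a
  id177 = by ring
  id178 : ∀ a → 0ℚ - a * 0ℚ ≡ 0ℚ
  id178 = by ring
  id179 : ∀ a b → a * (b - 1ℚ) ≡ b * a - a
  id179 = by ring
  id180 : ∀ d w r s → d * (s * (w * r)) * 1ℚ ≡ (1ℚ * s) * ((d * w) * r)
  id180 = by ring
  id182 : ∀ d o s x → d * o * 0ℚ ≡ (0ℚ * s) * x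
  id182 = by ring
  id183 : ∀ y h r m → y * h * (r * m) ≡ y * (h * r) * m
  id183 = by ring
  id184 : ∀ a b → a * b + a * b ≡ 2ℚ * a * b
  id184 = by ring
  id185 : ∀ r p s → (s + (r - s)) - (r - p) ≡ p
  id185 = by ring
  id186 : ∀ a → a * (1ℚ * 1ℚ) ≡ a
  id186 = by ring
  id187 : ∀ a b → a - (a - b) ≡ b
  id187 = by ring
  id188 : ∀ c v → c * 0ℚ - c * (v * 0ℚ) ≡ 0ℚ
  id188 = by ring
  id189 : ∀ h R S s f z → R - h ≡ ((f - - (R - s)) + (z - (S - s))) + ((h - (z + f)) + (S - (h + h)))
  id189 = by ring
  id190 : ∀ a f x → a * (f * x) ≡ f * (x * a)
  id190 = by ring
  id191 : ∀ a b x → (a - b) * x ≡ a * x - b * x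
  id191 = by ring
  id192 : ∀ L a b e → (L * (a - b)) * e ≡ 1ℚ * (L * a) * e - 1ℚ * (L * b) * e
  id192 = by ring
  id193 : ∀ a r s → 2ℚ - a ≡ ((1ℚ + s - a) + (1ℚ + s - a)) + (((r * a - s) + (r * a - s)) + a * (1ℚ - 2ℚ * r))
  id193 = by ring
  id194 : ∀ a b x → a * ((b * 1ℚ) * x) ≡ (a * b) * x
  id194 = by ring
  id195 : ∀ a b → a - b - 0ℚ ≡ a - b
  id195 = by ring
  id196 : ∀ c r w → c * ((1ℚ - w) * r) ≡ c * r - c * (1ℚ * w * r)
  id196 = by ring
  id197 : ∀ L c p r → L * (c * p) * r ≡ L * (c * (p * r))
  id197 = by ring
  id198 : ∀ i → 2ℚ * i - (1ℚ + i) ≡ i - 1ℚ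
  id198 = by ring
  id199 : ∀ a b i → a * ((1ℚ + i) * b) - a * i * b ≡ a * b
  id199 = by ring
  id200 : ∀ i a b → i * (a * b) ≡ (i * b) * a
  id200 = by ring
  id201 : ∀ i a b → 2ℚ * i * (a * b) ≡ 2ℚ * ((i * a) * b)
  id201 = by ring
  id202 : ∀ a b → 2ℚ * (a * b) - a * a ≡ a * (2ℚ * b - a)
  id202 = by ring
  id203 : ∀ a → a * 1ℚ * (1ℚ * 1ℚ * 1ℚ) ≡ a
  id203 = by ring
  id204 : ∀ r y h p → r * (y * h * p) ≡ (h * r) * (y * p)
  id204 = by ring
  id205 : ∀ t a b c → t * (a - b) + t * (c - a) ≡ t * (c - b)
  id205 = by ring
  id206 : ∀ a c b d e → a * (c * (0ℚ * b) * d * e) ≡ 0ℚ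
  id206 = by ring
  id207 : ∀ a b d → a * (b * 0ℚ) - 0ℚ * d ≡ 0ℚ
  id207 = by ring
  id208 : ∀ a → a - 1ℚ * a ≡ 0ℚ
  id208 = by ring
  id209 : ∀ a d → a - 0ℚ * d ≡ a
  id209 = by ring
  id210 : ∀ s v h G → s * (v * h) - v * (h * (s + G)) ≡ - (v * h * G)
  id210 = by ring
  id211 : ∀ R D b v → D + (b - v) + ((R - D) - b) ≡ R - v
  id211 = by ring
  id212 : ∀ p q s x → p * (q * s) + q * x + q ≡ q * (p * s + x + 1ℚ)
  id212 = by ring
  id213 : ∀ R D b v d → (D - d) + (b - v) + ((R - D) - b) ≡ R - d - v
  id213 = by ring
  id214 : ∀ q s x → q * s + q * x + q ≡ q * (s + x + 1ℚ)
  id214 = by ring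
  id215 : ∀ a b c e → a * (b * (0ℚ * c)) * e ≡ 0ℚ
  id215 = by ring
  id216 : ∀ a b c r → a * (b * (1ℚ * (c * r))) * 1ℚ ≡ (a * c * b) * r
  id216 = by ring
  id217 : ∀ t a b → t * a - t * (a - b) ≡ t * b
  id217 = by ring
  id218 : ∀ a b y r → a * b * (y * r) ≡ y * (a * (b * r))
  id218 = by ring
  id219 : ∀ c r w z t → c * (t * r * w) * z ≡ c * (t * (z * r) * w)
  id219 = by ring
  id220 : ∀ a b c → a * (b * 0ℚ) * c ≡ 0ℚ
  id220 = by ring
  id221 : ∀ a b c → a * (0ℚ * b) * c ≡ 0ℚ
  id221 = by ring
  id222 : ∀ y → y - 1ℚ + 1ℚ ≡ y
  id222 = by ring
  id223 : ∀ i y' s y x → (1ℚ + i) * (y' - 1ℚ) - ((s - i) + ((y - 1ℚ) + ((1ℚ + i) * y' - (x * y + s)))) ≡ (x - 1ℚ) * y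
  id223 = by ring
  id224 : ∀ x y → (x - 1ℚ) * y + (y - 1ℚ) ≡ x * y - 1ℚ
  id224 = by ring
  id225 : ∀ e d → e * d * 2ℚ + d ≡ (2ℚ * e + 1ℚ) * d
  id225 = by ring
  id226 : ∀ a s i → a - 1ℚ + (s - i) ≡ a + s - (1ℚ + i)
  id226 = by ring
  id227 : ∀ a y → 2ℚ * y * a ≡ 2ℚ * (a * y)
  id227 = by ring
  id228 : ∀ s t d → 2ℚ * (s * d + (t * d + (d + d))) ≡ 2ℚ * (s + (t + (1ℚ + 1ℚ))) * d
  id228 = by ring
  id229 : ∀ p u → 2ℚ * p * u ≡ 2ℚ * (u * p)
  id229 = by ring
  id230 : ∀ a b → a * b + a * b ≡ (a + a) * b
  id230 = by ring
  id231 : ∀ p → 2ℚ * p + 2ℚ * p ≡ 2ℚ * (2ℚ * p)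
  id231 = by ring
  id232 : ∀ x y z → (x * y) * (2ℚ * z) ≡ x * (2ℚ * y * z)
  id232 = by ring
  id233 : ∀ a → a + a ≡ 2ℚ * a
  id233 = by ring
  id234 : ∀ a → 2ℚ * (a * 1ℚ) + 2ℚ * (a * 1ℚ) ≡ 2ℚ * (2ℚ * a)
  id234 = by ring
  id235 : ∀ p μ τ ε s f → (2ℚ * s * 2ℚ + 2ℚ * 2ℚ * 2ℚ * 2ℚ * f) * (p * ε) + (2ℚ * 2ℚ + 2ℚ * 2ℚ * 2ℚ + 2ℚ * 2ℚ * (2ℚ * 2ℚ * 2ℚ + 2ℚ * 2ℚ)) * (p * (μ * τ)) ≡ (s * (2ℚ * p * (ε + ε)) + 2ℚ * (p * μ) * (τ + τ)) + (2ℚ * (2ℚ * (p * μ)) * (τ + τ) + (2ℚ * (2ℚ * p) * (2ℚ * (2ℚ * μ) * (τ + τ) + 2ℚ * μ * (τ + τ)) + f * (2ℚ * (2ℚ * p) * (2ℚ * (ε + ε)))))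
  id235 = by ring
  id236 : ∀ h p e t → h * (p * e) + h * (p * t) ≡ h * (p * (e + t))
  id236 = by ring
  id237 : ∀ t o → t * o + o ≡ (t + 1ℚ) * o
  id237 = by ring
  id238 : ∀ m p o → (1ℚ + o) * p - m ≡ o * p - (m - p)
  id238 = by ring
  id239 : ∀ m p o → m - (1ℚ - o) * p ≡ o * p - - (m - p)
  id239 = by ring
  id240 : ∀ h u p z e → h * (u * p * z) + (2ℚ * (u * 1ℚ) + 2ℚ * (u * 1ℚ)) * (e * (p * z)) ≡ (h + 2ℚ * 2ℚ * e) * (u * p * z)
  id240 = by ring
  id241 : ∀ f c z p → f * (c * z) * p ≡ f * (c * (p * z))
  id241 = by ring
  id242 : ∀ o u p → o * u * p ≡ o * (u * p)
  id242 = by ring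
  id243 : ∀ t o → t * o + o + o ≡ (t + 2ℚ) * o
  id243 = by ring
  id244 : ∀ t o → (t + (1ℚ + 2ℚ)) * o - o - o - o ≡ t * o
  id244 = by ring
  id245 : ∀ o μ → (1ℚ + o + o + o) * (μ * μ) - ((1ℚ + o) * (μ * (μ * 1ℚ)) + o * (μ * (μ * 1ℚ))) ≡ o * (μ * μ)
  id245 = by ring
  id246 : ∀ L M s e → M + e - s ≡ (e - (L - M + s)) + L
  id246 = by ring
  id247 : ∀ o μ → (1ℚ + o + o + o) * (μ * μ) - (1ℚ + o) * (μ * 1ℚ) * ((1ℚ + o) * (μ * 1ℚ)) ≡ o * (1ℚ - o) * (μ * μ)
  id247 = by ring
  id248 : ∀ f s M x → M - - (f * (s - x)) ≡ f * s + (M - f * x)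
  id248 = by ring
  id249 : ∀ a b x → a * - (b * x) ≡ - (a * (b * x))
  id249 = by ring
  id250 : ∀ f g b → f * (f * (g * b * (g * b))) ≡ (f * g) * (f * g) * (b * b)
  id250 = by ring
  id251 : ∀ t o m → (t * (m * 1ℚ) + t * (m * 1ℚ)) * (o * m) ≡ 2ℚ * t * o * (m * m)
  id251 = by ring
  id252 : ∀ o μ M x y → M - x - y - (1ℚ - o - o - o) * ((μ * μ) * (μ * μ) * (μ * μ)) ≡ ((M - (1ℚ - o) * (μ * (μ * (μ * (μ * (μ * (μ * 1ℚ))))))) + (o * (μ * (μ * (μ * (μ * (μ * (μ * 1ℚ)))))) - x)) + (o * (μ * (μ * (μ * (μ * (μ * (μ * 1ℚ)))))) - y)
  id252 = by ring
  id253 : ∀ f M x y → f * (M - x - y) ≡ f * M - f * x - f * y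
  id253 = by ring
  id254 : ∀ L M Y e → Y - (M - L - e) ≡ e - - (L - M - - Y)
  id254 = by ring
  id255 : ∀ f y → 2ℚ * ((f * y) * (f * y)) ≡ f * f * (2ℚ * (y * y))
  id255 = by ring
  id256 : ∀ f n k → f * f * (f * (n * n * n) + n * n * k) ≡ (f * n) * (f * n) * (f * n) + (f * n) * (f * n) * k
  id256 = by ring
  id257 : ∀ a o v → 2ℚ * ((a * o * (v * v * v)) * (a * o * (v * v * v))) ≡ (v * v) * (v * v) * (v * v) * (2ℚ * (a * a)) * (o * o) * (1ℚ * 1ℚ * (1ℚ * 1ℚ) * 1ℚ)
  id257 = by ring
  id258 : ∀ a o v t → (v * v) * (v * v) * (v * v) * (2ℚ * (a * a)) * (o * o) * ((t * o) * (t * o) * ((t * o) * (t * o)) * (t * o)) ≡ (v * v) * (v * v) * (v * v) * ((o * o) * (o * o) * (o * o) * o) * (2ℚ * (a * a) * (t * t * (t * t) * t))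
  id258 = by ring
  id259 : ∀ b d o v → (b * o * v) * (b * o * v) * ((b * o * v) * (b * o * v)) * ((b * o * v) * (b * o * v)) + (b * o * v) * (b * o * v) * ((b * o * v) * (b * o * v)) * ((b * o * v) * (2ℚ * (d * o) * o * v)) ≡ (v * v) * (v * v) * (v * v) * (((b * o) * (b * o)) * ((b * o) * (b * o)) * ((b * o) * (b * o)) * 1ℚ + ((b * o) * (b * o)) * ((b * o) * (b * o)) * (b * o) * (2ℚ * (d * o) * o))
  id259 = by ring
  id260 : ∀ b d o v t → (v * v) * (v * v) * (v * v) * (((b * o) * (b * o)) * ((b * o) * (b * o)) * ((b * o) * (b * o)) * (t * o) + ((b * o) * (b * o)) * ((b * o) * (b * o)) * (b * o) * (2ℚ * (d * o) * o)) ≡ (v * v) * (v * v) * (v * v) * ((o * o) * (o * o) * (o * o) * o) * (b * b * (b * b) * (b * b) * t + b * b * (b * b) * b * (2ℚ * d))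
  id260 = by ring
  id261 : ∀ x d → 2ℚ * x * d ≡ 2ℚ * (x * d)
  id261 = by ring
  id262 : ∀ i d → 2ℚ * (i * d) ≡ i * (2ℚ * d)
  id262 = by ring
  id263 : ∀ a b c d → a * (b * c * d) ≡ a * b * (c * d)
  id263 = by ring
  id264 : ∀ r t i → r * t * i ≡ i * r * t
  id264 = by ring
  id265 : ∀ c e x → x * c * e ≡ c * e * x
  id265 = by ring
  id266 : ∀ f a b c → f * (a * b) * c ≡ f * a * (b * c)
  id266 = by ring
  id267 : ∀ y t r → y * t * r ≡ y * r * t
  id267 = by ring
  id268 : ∀ M f v i → M - 1ℚ - f * (v * i) + 1ℚ ≡ M - f * v * i
  id268 = by ring
  id269 : ∀ i u → 0ℚ - (i - u) ≡ u - i
  id269 = by ring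
  id270 : ∀ i u d → d - - (i - u) ≡ i + d - u
  id270 = by ring
  id271 : ∀ M c i u → (M - c * i) + c * (i - u) ≡ M - c * u
  id271 = by ring
  id272 : ∀ M c u d r → M * (d * r) - (c * d) * (u * r) ≡ (M - c * u) * (d * r)
  id272 = by ring
  id273 : ∀ y s r → 2ℚ * y - (2ℚ - 2ℚ * r) ≡ 2ℚ * ((s - - (y - 1ℚ)) + (r - s))
  id273 = by ring
  id274 : ∀ a b c p q → a * p * (b * (c * q)) ≡ (a * b) * (c * (p * q))
  id274 = by ring
  id275 : ∀ a b s → a * s - b * s ≡ (a - b) * s
  id275 = by ring
  id276 : ∀ a r u → a * (u * r) - u ≡ (a * r - 1ℚ) * u
  id276 = by ring
  id277 : ∀ M c u e → 2ℚ * u - M ≡ (e - (M - c * (u * 1ℚ))) + ((u - e) + (1ℚ - c) * u)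
  id277 = by ring
  id278 : ∀ f k e u t → f * (k * (e + u * t)) ≡ k * (f * e) + k * (f * t) * u
  id278 = by ring
  id279 : ∀ a p b → a * p * b ≡ (a * b) * p
  id279 = by ring
  id280 : ∀ x → x + (x + x) + x ≡ 2ℚ * (2ℚ * x)
  id280 = by ring

-- Inequalities, reciprocals, powers, finite sums and indicators.

module Kit where

 open Q
 open Identities public

 infix 3 _via_
 -- The standard form of a polynomial inequality below: a ring identity rewrites the difference as
 -- an expression whose nonnegativity can be read off term by term.
 _via_ : ∀ {a b d} → b - a ≡ d → 0ℚ ≤ d → a ≤ b
 _via_ {a} {b} eq h = subst₂ _≤_ (+-identityʳ a) (id1 a b) (+-monoʳ a (subst (0ℚ ≤_) (sym eq) h))

 ≤⇒0≤ : ∀ {a b} → a ≤ b → 0ℚ ≤ b - a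
 ≤⇒0≤ {a} {b} h = subst (_≤ b - a) (+-inverseʳ a) (+-monoˡ (- a) h)

 ℕ≡≤ : ∀ {a b c : ℕ} → a ≡ b → b N.≤ c → a N.≤ c
 ℕ≡≤ e = NP.≤-trans (NP.≤-reflexive e)

 ℕ≤≡ : ∀ {a b c : ℕ} → a N.≤ b → b ≡ c → a N.≤ c
 ℕ≤≡ h e = NP.≤-trans h (NP.≤-reflexive e)

 pattern 1≤suc = N.s≤s N.z≤n

 ≡≤ : ∀ {a b c : ℚ} → a ≡ b → b ≤ c → a ≤ c
 ≡≤ e = ≤-trans (≤-reflexive e)

 ≤≡ : ∀ {a b c : ℚ} → a ≤ b → b ≡ c → a ≤ c
 ≤≡ h e = ≤-trans h (≤-reflexive e)

 0≤+ : ∀ {a b} → 0ℚ ≤ a → 0ℚ ≤ b → 0ℚ ≤ a + b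
 0≤+ {a} {b} p q = subst (_≤ a + b) (+-identityˡ 0ℚ) (+-mono p q)

 0≤* : ∀ {a b} → 0ℚ ≤ a → 0ℚ ≤ b → 0ℚ ≤ a * b
 0≤* {a} {b} p q = subst (_≤ a * b) (*-zeroʳ a) (*-monoˡ a p q)

 ≤+ˡ : ∀ {a b} → 0ℚ ≤ a → b ≤ a + b
 ≤+ˡ {a} {b} p = subst (_≤ a + b) (+-identityˡ b) (+-monoˡ b p)

 ≤+ʳ : ∀ {a b} → 0ℚ ≤ a → b ≤ b + a
 ≤+ʳ {a} {b} p = subst (_≤ b + a) (+-identityʳ b) (+-monoʳ b p)

 0<+ : ∀ {a b} → 0ℚ < a → 0ℚ ≤ b → 0ℚ < a + b
 0<+ {a} {b} p q = subst (_< a + b) (+-identityˡ 0ℚ) (+-mono-<-≤ p q)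

 *-mono : ∀ {a b c d} → 0ℚ ≤ a → 0ℚ ≤ c → a ≤ b → c ≤ d → a * c ≤ b * d
 *-mono {a} {b} {c} {d} p q h k =
  ≤-trans (*-monoʳ c q h) (*-monoˡ b (≤-trans p h) k)

 sq≥0 : ∀ a → 0ℚ ≤ a * a
 sq≥0 a with ≤-total 0ℚ a
 ... | inj₁ p = 0≤* p p
 ... | inj₂ p = subst (0ℚ ≤_) (id2 a) (0≤* q q)
  where
  q : 0ℚ ≤ - a
  q = subst (_≤ - a) neg-0 (neg-anti p)

 abs≤ : ∀ {a b} → a ≤ b → - a ≤ b → ∣ a ∣ ≤ b
 abs≤ {a} p q with ∣∣≡ a
 ... | inj₁ e = subst (_≤ _) (sym e) p
 ... | inj₂ e = subst (_≤ _) (sym e) q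

 ≤abs : ∀ a → a ≤ ∣ a ∣
 ≤abs a with ≤-total 0ℚ a
 ... | inj₁ p = ≤-reflexive (sym (∣∣-nonneg p))
 ... | inj₂ p = ≤-trans p (0≤∣∣ a)

 -≤abs : ∀ a → - a ≤ ∣ a ∣
 -≤abs a = subst (- a ≤_) (∣-∣ a) (≤abs (- a))

 abs-+ : ∀ {a b c d} → ∣ a ∣ ≤ c → ∣ b ∣ ≤ d → ∣ a + b ∣ ≤ c + d
 abs-+ {a} {b} p q = ≤-trans (∣+∣≤ a b) (+-mono p q)

 abs-neg : ∀ {a c} → ∣ a ∣ ≤ c → ∣ - a ∣ ≤ c
 abs-neg {a} p = subst (_≤ _) (sym (∣-∣ a)) p

 abs-- : ∀ {a b c d} → ∣ a ∣ ≤ c → ∣ b ∣ ≤ d → ∣ a - b ∣ ≤ c + d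
 abs-- p q = abs-+ p (abs-neg q)

 abs-* : ∀ {a b c d} → ∣ a ∣ ≤ c → ∣ b ∣ ≤ d → ∣ a * b ∣ ≤ c * d
 abs-* {a} {b} p q = subst (_≤ _) (sym (∣*∣ a b)) (*-mono (0≤∣∣ a) (0≤∣∣ b) p q)

 opaque
  -- Sealed, so that numerals such as `ι 34100` stay symbols and are handled only through the laws
  -- that follow.
  ι : ℕ → ℚ
  ι zero = 0ℚ
  ι (suc n) = 1ℚ + ι n

  ι-0 : ι 0 ≡ 0ℚ
  ι-0 = refl

  ι-suc : ∀ n → ι (suc n) ≡ 1ℚ + ι n
  ι-suc n = refl

  ι≥0 : ∀ n → 0ℚ ≤ ι n
  ι≥0 zero = ≤-refl
  ι≥0 (suc n) = 0≤+ 0≤1 (ι≥0 n)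

 ι-1 : ι 1 ≡ 1ℚ
 ι-1 = trans (ι-suc 0) (trans (cong (1ℚ +_) ι-0) (+-identityʳ 1ℚ))

 ι-+ : ∀ m n → ι (m N.+ n) ≡ ι m + ι n
 ι-+ zero n = sym (trans (cong (_+ ι n) ι-0) (+-identityˡ _))
 ι-+ (suc m) n = trans (ι-suc _) (trans (cong (_+_ 1ℚ) (ι-+ m n)) (trans (sym (+-assoc 1ℚ (ι m) (ι n))) (cong (_+ ι n) (sym (ι-suc m)))))

 ι-2 : ι 2 ≡ 2ℚ
 ι-2 = trans (ι-suc 1) (cong (1ℚ +_) ι-1)

 ι-* : ∀ m n → ι (m N.* n) ≡ ι m * ι n
 ι-* zero n = trans ι-0 (sym (trans (cong (_* ι n) ι-0) (*-zeroˡ _)))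
 ι-* (suc m) n = trans (ι-+ n (m N.* n)) (trans (cong (_+_ (ι n)) (ι-* m n)) (trans (id3 (ι m) (ι n)) (cong (_* ι n) (sym (ι-suc m)))))

 ι-mono : ∀ {m n} → m N.≤ n → ι m ≤ ι n
 ι-mono {n = n} N.z≤n = subst (_≤ ι n) (sym ι-0) (ι≥0 n)
 ι-mono (N.s≤s h) = subst₂ _≤_ (sym (ι-suc _)) (sym (ι-suc _)) (+-monoʳ 1ℚ (ι-mono h))

 ι-pos : ∀ {n} → 1 N.≤ n → 0ℚ < ι n
 ι-pos {suc n} _ = subst (0ℚ <_) (sym (ι-suc n)) (0<+ 0<1 (ι≥0 n))

 ι-mono< : ∀ {m n} → m N.< n → ι m < ι n
 ι-mono< {m} {n} h = <-≤-trans (subst₂ _<_ (+-identityˡ (ι m)) (sym (ι-suc m)) (+-mono-<-≤ 0<1 ≤-refl)) (ι-mono h)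

 ι-cancel : ∀ {m n} → ι m ≤ ι n → m N.≤ n
 ι-cancel {m} {n} h with m N.≤? n
 ... | yes p = p
 ... | no p = ⊥-elim (<-irrefl refl (<-≤-trans (ι-mono< (NP.≰⇒> p)) h))

 -- The reciprocal of n, with rec 0 = 0.
 rec : ℕ → ℚ
 rec zero = 0ℚ
 rec (suc n) = reciprocal (ι-pos {suc n} (N.s≤s N.z≤n))

 ι*rec : ∀ {n} → 1 N.≤ n → ι n * rec n ≡ 1ℚ
 ι*rec {suc n} h = reciprocal-inverse (ι-pos {suc n} (N.s≤s N.z≤n))

 rec≥0 : ∀ n → 0ℚ ≤ rec n
 rec≥0 zero = ≤-refl
 rec≥0 n@(suc _) = *-cancelˡ (ι n) (ι-pos (N.s≤s N.z≤n))
  (subst₂ _≤_ (sym (*-zeroʳ (ι n))) (sym (ι*rec {n} (N.s≤s N.z≤n))) 0≤1)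

 rec>0 : ∀ {n} → 1 N.≤ n → 0ℚ < rec n
 rec>0 {n} h with <-cmp 0ℚ (rec n)
 ... | tri< p _ _ = p
 ... | tri≈ _ p _ = ⊥-elim (<-irrefl (trans (trans (sym (*-zeroʳ (ι n))) (cong (ι n *_) p)) (ι*rec h)) 0<1)
 ... | tri> _ _ p = ⊥-elim (<-irrefl refl (<-≤-trans p (rec≥0 n)))

 rec-unique : ∀ {n x} → 1 N.≤ n → ι n * x ≡ 1ℚ → x ≡ rec n
 rec-unique {n} {x} h e = begin
  x                    ≡⟨ id4 x (ι n) (rec n) ⟩
  (ι n * x) * rec n + (x - x * (ι n * rec n)) ≡⟨ cong₂ (λ a b → a * rec n + (x - x * b)) e (ι*rec h) ⟩
  1ℚ * rec n + (x - x * 1ℚ) ≡⟨ id5 (rec n) x ⟩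
  rec n ∎
  where
  open ≡-Reasoning

 rec-* : ∀ m n → rec (m N.* n) ≡ rec m * rec n
 rec-* zero n = sym (*-zeroˡ _)
 rec-* m@(suc m') zero = trans (cong rec (NP.*-zeroʳ m')) (sym (*-zeroʳ (rec m)))
 rec-* m@(suc _) n@(suc _) = sym (rec-unique (N.s≤s N.z≤n) (begin
  ι (m N.* n) * (rec m * rec n) ≡⟨ cong (_* (rec m * rec n)) (ι-* m n) ⟩
  ι m * ι n * (rec m * rec n)   ≡⟨ id6 (ι m) (ι n) (rec m) (rec n) ⟩
  ι m * rec m * (ι n * rec n)   ≡⟨ cong₂ _*_ (ι*rec {m} (N.s≤s N.z≤n)) (ι*rec {n} (N.s≤s N.z≤n)) ⟩
  1ℚ * 1ℚ                       ≡⟨ *-identityˡ 1ℚ ⟩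
  1ℚ ∎))
  where
  open ≡-Reasoning

 rec-mono : ∀ {m n} → 1 N.≤ m → m N.≤ n → rec n ≤ rec m
 rec-mono {m} {n} h k = subst₂ _≤_ e1 e2 (*-monoʳ (rec m * rec n) (0≤* (rec≥0 m) (rec≥0 n)) (ι-mono k))
  where
  e1 : ι m * (rec m * rec n) ≡ rec n
  e1 = trans (id7 (ι m) (rec m) (rec n)) (trans (cong (rec n *_) (ι*rec h)) (*-identityʳ _))
  e2 : ι n * (rec m * rec n) ≡ rec m
  e2 = trans (id8 (ι n) (rec m) (rec n)) (trans (cong (rec m *_) (ι*rec (NP.≤-trans h k))) (*-identityʳ _))

 infixr 8 _^_
 _^_ : ℚ → ℕ → ℚ
 x ^ zero = 1ℚ
 x ^ suc n = x * x ^ n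

 ^≥0 : ∀ {x} n → 0ℚ ≤ x → 0ℚ ≤ x ^ n
 ^≥0 zero h = 0≤1
 ^≥0 (suc n) h = 0≤* h (^≥0 n h)

 ^>0 : ∀ {x} n → 0ℚ < x → 0ℚ < x ^ n
 ^>0 zero h = 0<1
 ^>0 (suc n) h = 0<* h (^>0 n h)

 ^-+ : ∀ x m n → x ^ (m N.+ n) ≡ x ^ m * x ^ n
 ^-+ x zero n = sym (*-identityˡ _)
 ^-+ x (suc m) n = trans (cong (x *_) (^-+ x m n)) (sym (*-assoc x (x ^ m) (x ^ n)))

 ^-mono : ∀ {x y} n → 0ℚ ≤ x → x ≤ y → x ^ n ≤ y ^ n
 ^-mono zero h k = ≤-refl
 ^-mono (suc n) h k = *-mono h (^≥0 n h) k (^-mono n h k)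

 ^≤1 : ∀ {x} n → 0ℚ ≤ x → x ≤ 1ℚ → x ^ n ≤ 1ℚ
 ^≤1 zero h k = ≤-refl
 ^≤1 {x} (suc n) h k = subst (x * x ^ n ≤_) (*-identityˡ 1ℚ) (*-mono h (^≥0 n h) k (^≤1 n h k))

 1≤^ : ∀ {x} n → 1ℚ ≤ x → 1ℚ ≤ x ^ n
 1≤^ zero h = ≤-refl
 1≤^ {x} (suc n) h = subst (_≤ x * x ^ n) (*-identityˡ 1ℚ) (*-mono 0≤1 0≤1 h (1≤^ n h))

 ^-monoʳ : ∀ {x} {m n} → 1ℚ ≤ x → m N.≤ n → x ^ m ≤ x ^ n
 ^-monoʳ {x} {n = n} h N.z≤n = 1≤^ n h
 ^-monoʳ {x} h (N.s≤s k) = *-monoˡ x (≤-trans 0≤1 h) (^-monoʳ h k)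

 ^-antiʳ : ∀ {x} {m n} → 0ℚ ≤ x → x ≤ 1ℚ → m N.≤ n → x ^ n ≤ x ^ m
 ^-antiʳ {x} {n = n} h h1 N.z≤n = ^≤1 n h h1
 ^-antiʳ {x} h h1 (N.s≤s k) = *-monoˡ x h (^-antiʳ h h1 k)

 ^-* : ∀ x y n → (x * y) ^ n ≡ x ^ n * y ^ n
 ^-* x y zero = sym (*-identityˡ 1ℚ)
 ^-* x y (suc n) = trans (cong (x * y *_) (^-* x y n)) (id6 x y (x ^ n) (y ^ n))

 1^ : ∀ n → 1ℚ ^ n ≡ 1ℚ
 1^ zero = refl
 1^ (suc n) = trans (*-identityˡ _) (1^ n)

 ^-^ : ∀ x m n → x ^ (m N.* n) ≡ (x ^ n) ^ m
 ^-^ x zero n = refl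
 ^-^ x (suc m) n = trans (^-+ x n (m N.* n)) (cong (x ^ n *_) (^-^ x m n))

 ι-^ : ∀ m n → ι (m N.^ n) ≡ ι m ^ n
 ι-^ m zero = ι-1
 ι-^ m (suc n) = trans (ι-* m (m N.^ n)) (cong (ι m *_) (ι-^ m n))

 bernoulli : ∀ x n → 0ℚ ≤ x → 1ℚ + ι n * x ≤ (1ℚ + x) ^ n
 bernoulli x zero h = ≤-reflexive (trans (cong (λ z → 1ℚ + z * x) ι-0) (id9 x))
 bernoulli x (suc n) h = ≤-trans (subst (λ z → 1ℚ + z * x ≤ (1ℚ + x) * (1ℚ + ι n * x)) (sym (ι-suc n)) $ id10 (ι n) x via 0≤* (ι≥0 n) (0≤* h h))
   (*-monoˡ (1ℚ + x) (0≤+ 0≤1 h) (bernoulli x n h))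

 bernoulli- : ∀ x n → 0ℚ ≤ x → x ≤ 1ℚ → 1ℚ - ι n * x ≤ (1ℚ - x) ^ n
 bernoulli- x zero h k = ≤-reflexive (trans (cong (λ z → 1ℚ - z * x) ι-0) (id11 x))
 bernoulli- x (suc n) h k = ≤-trans (subst (λ z → 1ℚ - z * x ≤ (1ℚ - x) * (1ℚ - ι n * x)) (sym (ι-suc n)) $ id12 (ι n) x via 0≤* (ι≥0 n) (0≤* h h))
   (*-monoˡ (1ℚ - x) (≤⇒0≤ k) (bernoulli- x n h k))

 private
  variable
   A B : Set

 Σ : List A → (A → ℚ) → ℚ
 Σ [] f = 0ℚ
 Σ (x ∷ xs) f = f x + Σ xs f

 -- Listed downwards, so that a sum over `range (suc n)` unfolds at its last term and inductions on
 -- the length add the largest index.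
 range : ℕ → List ℕ
 range zero = []
 range (suc n) = n ∷ range n

 range-length : ∀ n → length (range n) ≡ n
 range-length zero = refl
 range-length (suc n) = cong suc (range-length n)

 ∈range : ∀ {i n} → i ∈ range n → i N.< n
 ∈range {n = suc n} (here refl) = NP.≤-refl
 ∈range {n = suc n} (there p) = NP.m<n⇒m<1+n (∈range p)

 Σ-cong∈ : ∀ (xs : List A) {f g} → (∀ x → x ∈ xs → f x ≡ g x) → Σ xs f ≡ Σ xs g
 Σ-cong∈ [] h = refl
 Σ-cong∈ (x ∷ xs) h = cong₂ _+_ (h x (here refl)) (Σ-cong∈ xs (λ y m → h y (there m)))

 Σ-cong : ∀ (xs : List A) {f g} → (∀ x → f x ≡ g x) → Σ xs f ≡ Σ xs g
 Σ-cong xs h = Σ-cong∈ xs (λ x _ → h x)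

 Σ-+ : ∀ (xs : List A) f g → Σ xs (λ x → f x + g x) ≡ Σ xs f + Σ xs g
 Σ-+ [] f g = sym (+-identityˡ 0ℚ)
 Σ-+ (x ∷ xs) f g = trans (cong (f x + g x +_) (Σ-+ xs f g)) (id13 (f x) (g x) (Σ xs f) (Σ xs g))

 Σ-*ˡ : ∀ (xs : List A) c f → Σ xs (λ x → c * f x) ≡ c * Σ xs f
 Σ-*ˡ [] c f = sym (*-zeroʳ c)
 Σ-*ˡ (x ∷ xs) c f = trans (cong (c * f x +_) (Σ-*ˡ xs c f)) (sym (*-distribˡ-+ c (f x) (Σ xs f)))

 Σ-*ʳ : ∀ (xs : List A) c f → Σ xs (λ x → f x * c) ≡ Σ xs f * c
 Σ-*ʳ xs c f = trans (Σ-cong xs (λ x → *-comm (f x) c)) (trans (Σ-*ˡ xs c f) (*-comm c (Σ xs f)))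

 Σ-neg : ∀ (xs : List A) f → Σ xs (λ x → - f x) ≡ - Σ xs f
 Σ-neg [] f = sym neg-0
 Σ-neg (x ∷ xs) f = trans (cong (- f x +_) (Σ-neg xs f)) (sym (neg-distrib-+ (f x) (Σ xs f)))

 Σ-- : ∀ (xs : List A) f g → Σ xs (λ x → f x - g x) ≡ Σ xs f - Σ xs g
 Σ-- xs f g = trans (Σ-+ xs f (λ x → - g x)) (cong (Σ xs f +_) (Σ-neg xs g))

 Σ-0 : ∀ (xs : List A) → Σ xs (λ _ → 0ℚ) ≡ 0ℚ
 Σ-0 [] = refl
 Σ-0 (x ∷ xs) = trans (+-identityˡ _) (Σ-0 xs)

 Σ-0∈ : ∀ (xs : List A) {f} → (∀ x → x ∈ xs → f x ≡ 0ℚ) → Σ xs f ≡ 0ℚ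
 Σ-0∈ xs h = trans (Σ-cong∈ xs h) (Σ-0 xs)

 Σ-const : ∀ (xs : List A) c → Σ xs (λ _ → c) ≡ ι (length xs) * c
 Σ-const [] c = sym (trans (cong (_* c) ι-0) (*-zeroˡ c))
 Σ-const (x ∷ xs) c = trans (cong (c +_) (Σ-const xs c)) (trans (id14 c (ι (length xs))) (cong (_* c) (sym (ι-suc _))))

 Σ-swap : ∀ (xs : List A) (ys : List B) (f : A → B → ℚ) →
  Σ xs (λ x → Σ ys (f x)) ≡ Σ ys (λ y → Σ xs (λ x → f x y))
 Σ-swap [] ys f = sym (Σ-0 ys)
 Σ-swap (x ∷ xs) ys f = trans (cong (Σ ys (f x) +_) (Σ-swap xs ys f)) (sym (Σ-+ ys (f x) _))

 Σ-mono∈ : ∀ (xs : List A) {f g} → (∀ x → x ∈ xs → f x ≤ g x) → Σ xs f ≤ Σ xs g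
 Σ-mono∈ [] h = ≤-refl
 Σ-mono∈ (x ∷ xs) h = +-mono (h x (here refl)) (Σ-mono∈ xs (λ y m → h y (there m)))

 Σ-mono : ∀ (xs : List A) {f g} → (∀ x → f x ≤ g x) → Σ xs f ≤ Σ xs g
 Σ-mono xs h = Σ-mono∈ xs (λ x _ → h x)

 Σ≥0 : ∀ (xs : List A) {f} → (∀ x → 0ℚ ≤ f x) → 0ℚ ≤ Σ xs f
 Σ≥0 xs {f} h = subst (_≤ Σ xs f) (Σ-0 xs) (Σ-mono xs h)

 Σ-abs : ∀ (xs : List A) f → ∣ Σ xs f ∣ ≤ Σ xs (λ x → ∣ f x ∣)
 Σ-abs [] f = ≤-reflexive (∣∣-nonneg ≤-refl)
 Σ-abs (x ∷ xs) f = abs-+ (≤-refl {∣ f x ∣}) (Σ-abs xs f)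

 Σ-abs≤ : ∀ (xs : List A) {f g} → (∀ x → x ∈ xs → ∣ f x ∣ ≤ g x) → ∣ Σ xs f ∣ ≤ Σ xs g
 Σ-abs≤ xs {f} h = ≤-trans (Σ-abs xs f) (Σ-mono∈ xs h)

 Σ-** : ∀ (xs : List A) (ys : List B) (f : A → ℚ) (g : B → ℚ) →
  Σ xs (λ x → Σ ys (λ y → f x * g y)) ≡ Σ xs f * Σ ys g
 Σ-** xs ys f g = trans (Σ-cong xs (λ x → Σ-*ˡ ys (f x) g)) (Σ-*ʳ xs (Σ ys g) f)

 χ : {P : Set} → Dec P → ℚ
 χ (yes _) = 1ℚ
 χ (no _) = 0ℚ

 χ-yes : {P : Set} (d : Dec P) → P → χ d ≡ 1ℚ
 χ-yes (yes _) p = refl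
 χ-yes (no n) p = ⊥-elim (n p)

 χ-no : {P : Set} (d : Dec P) → ¬ P → χ d ≡ 0ℚ
 χ-no (yes p) n = ⊥-elim (n p)
 χ-no (no _) n = refl

 χ-⇔ : {P Q : Set} (d : Dec P) (e : Dec Q) → (P → Q) → (Q → P) → χ d ≡ χ e
 χ-⇔ (yes p) e f g = sym (χ-yes e (f p))
 χ-⇔ (no n) e f g = sym (χ-no e (λ q → n (g q)))

 χ≥0 : {P : Set} (d : Dec P) → 0ℚ ≤ χ d
 χ≥0 (yes _) = 0≤1
 χ≥0 (no _) = ≤-refl

 χ≤1 : {P : Set} (d : Dec P) → χ d ≤ 1ℚ
 χ≤1 (yes _) = ≤-refl
 χ≤1 (no _) = 0≤1

 χ-× : {P Q : Set} (d : Dec P) (e : Dec Q) → χ (d ×-dec e) ≡ χ d * χ e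
 χ-× (yes p) (yes q) = sym (*-identityˡ 1ℚ)
 χ-× (yes p) (no q) = sym (*-zeroʳ 1ℚ)
 χ-× (no p) (yes q) = sym (*-zeroˡ 1ℚ)
 χ-× (no p) (no q) = sym (*-zeroˡ 0ℚ)

 χ-mono : {P Q : Set} (d : Dec P) (e : Dec Q) → (P → Q) → χ d ≤ χ e
 χ-mono (yes p) e f = ≤-reflexive (sym (χ-yes e (f p)))
 χ-mono (no _) e f = χ≥0 e

 χ-subst : {P : Set} (d : Dec P) {a b : ℚ} → (P → a ≡ b) → χ d * a ≡ χ d * b
 χ-subst (yes p) h = cong (1ℚ *_) (h p)
 χ-subst (no _) {a} {b} h = trans (*-zeroˡ a) (sym (*-zeroˡ b))

 χ*≤ : {P : Set} (d : Dec P) {a : ℚ} → 0ℚ ≤ a → χ d * a ≤ a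
 χ*≤ (yes _) {a} h = ≤-reflexive (*-identityˡ a)
 χ*≤ (no _) {a} h = subst (_≤ a) (sym (*-zeroˡ a)) h

 Σ-range-χ : ∀ {n k} → k N.< n → Σ (range n) (λ i → χ (i N.≟ k)) ≡ 1ℚ
 Σ-range-χ {suc n} {k} h with n N.≟ k
 ... | yes refl = trans (cong (1ℚ +_) (Σ-0∈ (range n) (λ i m → χ-no (i N.≟ n) (NP.<⇒≢ (∈range m))))) (+-identityʳ 1ℚ)
 ... | no ne = trans (+-identityˡ _) (Σ-range-χ (NP.≤∧≢⇒< (NP.≤-pred h) (λ e → ne (sym e))))

 -- Changes of variables are made by inserting such an indicator and exchanging the sums; this
 -- replaces bijections between index lists.
 Σ-pick : ∀ (xs : List A) (_≟'_ : ∀ x y → Dec (x ≡ y)) k (f : A → ℚ) →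
  Σ xs (λ i → χ (i ≟' k)) ≡ 1ℚ → Σ xs (λ i → χ (i ≟' k) * f i) ≡ f k
 Σ-pick xs _≟'_ k f h = trans (Σ-cong xs (λ i → χ-subst (i ≟' k) (cong f)))
  (trans (Σ-*ʳ xs (f k) _) (trans (cong (_* f k) h) (*-identityˡ (f k))))

 Σ-range-+ : ∀ m n f → Σ (range (m N.+ n)) f ≡ Σ (range m) (λ i → f (i N.+ n)) + Σ (range n) f
 Σ-range-+ zero n f = sym (+-identityˡ _)
 Σ-range-+ (suc m) n f = trans (cong (f (m N.+ n) +_) (Σ-range-+ m n f)) (sym (+-assoc _ _ _))

 Σ-extend : ∀ (f : ℕ → ℚ) → (∀ i → 0ℚ ≤ f i) → ∀ a b → a N.≤ b → Σ (range a) f ≤ Σ (range b) f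
 Σ-extend f f≥0 a b h = subst (λ z → Σ (range a) f ≤ Σ (range z) f) (NP.m∸n+n≡m h)
  (subst (Σ (range a) f ≤_) (sym (Σ-range-+ (b N.∸ a) a f)) (≤+ˡ (Σ≥0 (range (b N.∸ a)) (λ i → f≥0 (i N.+ a)))))

 n≤2^n : ∀ n → n N.≤ 2 N.^ n
 n≤2^n zero = N.z≤n
 n≤2^n (suc n) = NP.≤-trans (NP.+-mono-≤ (NP.m^n>0 2 n) (n≤2^n n)) (NP.≤-reflexive (cong (2 N.^ n N.+_) (sym (NP.+-identityʳ _))))

-- Convolution on finite abelian groups.

module Group where

 open Kit
 open Q

 -- The field `once` says in one equation that the enumeration `els` is complete and free of
 -- repetitions, in the form in which sums over the group use it.
 record FiniteAbelianGroup : Set₁ where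
  infixl 7 _∙_
  field
   G : Set
   _∙_ : G → G → G
   e : G
   inv : G → G
   ∙-assoc : ∀ a b c → (a ∙ b) ∙ c ≡ a ∙ (b ∙ c)
   ∙-comm : ∀ a b → a ∙ b ≡ b ∙ a
   ∙-idˡ : ∀ a → e ∙ a ≡ a
   ∙-invˡ : ∀ a → inv a ∙ a ≡ e
   _≟G_ : ∀ (a b : G) → Dec (a ≡ b)
   els : List G
   once : ∀ k → Σ els (λ i → χ (i ≟G k)) ≡ 1ℚ

 module Analysis (𝔾 : FiniteAbelianGroup) where
  open FiniteAbelianGroup 𝔾

  ∙-idʳ : ∀ a → a ∙ e ≡ a
  ∙-idʳ a = trans (∙-comm a e) (∙-idˡ a)

  cancelˡ : ∀ a b → inv a ∙ (a ∙ b) ≡ b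
  cancelˡ a b = trans (sym (∙-assoc _ a b)) (trans (cong (_∙ b) (∙-invˡ a)) (∙-idˡ b))

  cancelʳ : ∀ a b → a ∙ (inv a ∙ b) ≡ b
  cancelʳ a b = trans (sym (∙-assoc a _ b)) (trans (cong (_∙ b) (trans (∙-comm a _) (∙-invˡ a))) (∙-idˡ b))

  inv-unique : ∀ a b → b ∙ a ≡ e → b ≡ inv a
  inv-unique a b h = trans (sym (cancelˡ a b))
   (trans (cong (inv a ∙_) (trans (∙-comm a b) h)) (∙-idʳ (inv a)))

  inv-inv : ∀ a → inv (inv a) ≡ a
  inv-inv a = sym (inv-unique (inv a) a (trans (∙-comm a _) (∙-invˡ a)))

  inv-∙ : ∀ a b → inv (a ∙ b) ≡ inv a ∙ inv b
  inv-∙ a b = sym (inv-unique (a ∙ b) (inv a ∙ inv b)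
   (trans (cong (_∙ (a ∙ b)) (∙-comm (inv a) (inv b)))
   (trans (∙-assoc (inv b) (inv a) (a ∙ b)) (trans (cong (inv b ∙_) (cancelˡ a b)) (∙-invˡ b)))))

  inv-e : inv e ≡ e
  inv-e = sym (inv-unique e e (∙-idˡ e))

  ∑ : (G → ℚ) → ℚ
  ∑ = Σ els

  ∑-pick : ∀ k f → ∑ (λ i → χ (i ≟G k) * f i) ≡ f k
  ∑-pick k f = Σ-pick els _≟G_ k f (once k)

  -- After inserting the indicator of s = f t and exchanging sums, the inverse `f⁻` turns it into
  -- the indicator of t = f⁻ s, which `once` sums to 1.
  ∑-reindex : ∀ (f f⁻ : G → G) → (∀ x → f (f⁻ x) ≡ x) → (∀ x → f⁻ (f x) ≡ x) →
   ∀ F → ∑ (λ t → F (f t)) ≡ ∑ F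
  ∑-reindex f f⁻ h k F = begin
   ∑ (λ t → F (f t))                               ≡⟨ Σ-cong els (λ t → sym (∑-pick (f t) F)) ⟩
   ∑ (λ t → ∑ (λ s → χ (s ≟G f t) * F s))          ≡⟨ Σ-swap els els _ ⟩
   ∑ (λ s → ∑ (λ t → χ (s ≟G f t) * F s))          ≡⟨ Σ-cong els (λ s → Σ-*ʳ els (F s) _) ⟩
   ∑ (λ s → ∑ (λ t → χ (s ≟G f t)) * F s)
    ≡⟨ Σ-cong els (λ s → cong (_* F s) (trans (Σ-cong els (λ t → χ-⇔ (s ≟G f t) (t ≟G f⁻ s)
       (λ e → trans (sym (k t)) (cong f⁻ (sym e))) (λ e → trans (sym (h s)) (cong f (sym e))))) (once (f⁻ s)))) ⟩
   ∑ (λ s → 1ℚ * F s)                              ≡⟨ Σ-cong els (λ s → *-identityˡ (F s)) ⟩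
   ∑ F ∎
   where open ≡-Reasoning

  ∑-mul : ∀ x F → ∑ (λ t → F (x ∙ t)) ≡ ∑ F
  ∑-mul x = ∑-reindex (x ∙_) (inv x ∙_) (cancelʳ x) (cancelˡ x)

  refl-invol : ∀ b t → inv (inv t ∙ b) ∙ b ≡ t
  refl-invol b t = trans (cong (_∙ b) (trans (inv-∙ (inv t) b) (cong (_∙ inv b) (inv-inv t))))
   (trans (∙-assoc t (inv b) b) (trans (cong (t ∙_) (∙-invˡ b)) (∙-idʳ t)))

  ∑-refl : ∀ b F → ∑ (λ t → F (inv t ∙ b)) ≡ ∑ F
  ∑-refl b = ∑-reindex (λ t → inv t ∙ b) (λ t → inv t ∙ b) (refl-invol b) (refl-invol b)

  infixl 7 _⋆_
  _⋆_ : (G → ℚ) → (G → ℚ) → G → ℚ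
  (F ⋆ H) b = ∑ (λ t → F t * H (inv t ∙ b))

  ⋆-cong : ∀ {F F' H H'} → F ≗ F' → H ≗ H' → F ⋆ H ≗ F' ⋆ H'
  ⋆-cong p q b = Σ-cong els (λ t → cong₂ _*_ (p t) (q _))

  ⋆-comm : ∀ F H → F ⋆ H ≗ H ⋆ F
  ⋆-comm F H b = trans (sym (∑-refl b (λ t → F t * H (inv t ∙ b))))
   (Σ-cong els (λ t → trans (cong (F (inv t ∙ b) *_) (cong H (refl-invol b t))) (*-comm _ _)))

  ⋆-assoc : ∀ F H K → (F ⋆ H) ⋆ K ≗ F ⋆ (H ⋆ K)
  ⋆-assoc F H K b = begin
   ∑ (λ s → ∑ (λ t → F t * H (inv t ∙ s)) * K (inv s ∙ b))
    ≡⟨ Σ-cong els (λ s → sym (Σ-*ʳ els (K (inv s ∙ b)) _)) ⟩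
   ∑ (λ s → ∑ (λ t → F t * H (inv t ∙ s) * K (inv s ∙ b)))
    ≡⟨ Σ-swap els els _ ⟩
   ∑ (λ t → ∑ (λ s → F t * H (inv t ∙ s) * K (inv s ∙ b)))
    ≡⟨ Σ-cong els (λ t → sym (∑-mul t _)) ⟩
   ∑ (λ t → ∑ (λ r → F t * H (inv t ∙ (t ∙ r)) * K (inv (t ∙ r) ∙ b)))
    ≡⟨ Σ-cong els (λ t → trans (Σ-cong els (λ r → trans (cong₂ (λ x y → F t * H x * K y) (cancelˡ t r) (swp t r))
       (*-assoc (F t) _ _))) (Σ-*ˡ els (F t) _)) ⟩
   ∑ (λ t → F t * ∑ (λ r → H r * K (inv r ∙ (inv t ∙ b)))) ∎
   where
   open ≡-Reasoning
   swp : ∀ t r → inv (t ∙ r) ∙ b ≡ inv r ∙ (inv t ∙ b)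
   swp t r = trans (cong (_∙ b) (trans (inv-∙ t r) (∙-comm (inv t) (inv r)))) (∙-assoc (inv r) (inv t) b)

  ⋆-left-comm : ∀ F H K → F ⋆ (H ⋆ K) ≗ H ⋆ (F ⋆ K)
  ⋆-left-comm F H K b = trans (sym (⋆-assoc F H K b))
   (trans (⋆-cong {H = K} (⋆-comm F H) (λ _ → refl) b) (⋆-assoc H F K b))

  ⋆-+ʳ : ∀ F H K → F ⋆ (λ b → H b + K b) ≗ (λ b → (F ⋆ H) b + (F ⋆ K) b)
  ⋆-+ʳ F H K b = trans (Σ-cong els (λ t → *-distribˡ-+ (F t) _ _)) (Σ-+ els _ _)

  ⋆--ʳ : ∀ F H K → F ⋆ (λ b → H b - K b) ≗ (λ b → (F ⋆ H) b - (F ⋆ K) b)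
  ⋆--ʳ F H K b = trans (Σ-cong els (λ t → id31 (F t) _ _)) (Σ-- els _ _)

  ⋆-*ʳ : ∀ F c H → F ⋆ (λ b → c * H b) ≗ (λ b → c * (F ⋆ H) b)
  ⋆-*ʳ F c H b = trans (Σ-cong els (λ t → id8 (F t) c _)) (Σ-*ˡ els c _)

  ⋆-negʳ : ∀ F H → F ⋆ (λ b → - H b) ≗ (λ b → - (F ⋆ H) b)
  ⋆-negʳ F H b = trans (Σ-cong els (λ t → sym (neg-distribʳ-* (F t) _))) (Σ-neg els _)

  ⋆-Σʳ : ∀ {A : Set} (xs : List A) F (H : A → G → ℚ) →
   F ⋆ (λ b → Σ xs (λ i → H i b)) ≗ (λ b → Σ xs (λ i → (F ⋆ H i) b))
  ⋆-Σʳ xs F H b = trans (Σ-cong els (λ t → sym (Σ-*ˡ xs (F t) _))) (Σ-swap els xs _)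

  ⋆-const : ∀ F c → F ⋆ (λ _ → c) ≗ (λ _ → ∑ F * c)
  ⋆-const F c b = Σ-*ʳ els c F

  ∑-⋆ : ∀ F H → ∑ (F ⋆ H) ≡ ∑ F * ∑ H
  ∑-⋆ F H = trans (Σ-swap els els _) (trans (Σ-cong els (λ t → trans (Σ-*ˡ els (F t) _)
   (cong (F t *_) (∑-mul (inv t) H)))) (Σ-*ʳ els (∑ H) F))

  δ : G → ℚ
  δ b = χ (b ≟G e)

  ⋆-δ : ∀ F → F ⋆ δ ≗ F
  ⋆-δ F b = trans (⋆-comm F δ b) (trans (∑-pick e (λ t → F (inv t ∙ b)))
   (cong F (trans (cong (_∙ b) inv-e) (∙-idˡ b))))

  ∑-δ : ∑ δ ≡ 1ℚ
  ∑-δ = once e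

  Sup : (G → ℚ) → ℚ → Set
  Sup F s = ∀ b → ∣ F b ∣ ≤ s

  ∥_∥₁ : (G → ℚ) → ℚ
  ∥ F ∥₁ = ∑ (λ t → ∣ F t ∣)

  -- Young's inequality for the norms L¹ and L∞.
  Sup-⋆ : ∀ {F H a s} → ∥ F ∥₁ ≤ a → 0ℚ ≤ s → Sup H s → Sup (F ⋆ H) (a * s)
  Sup-⋆ {F} {H} {a} {s} p s0 q b = ≤-trans (Σ-abs≤ els (λ t _ → abs-* (≤-refl {∣ F t ∣}) (q _)))
   (≡≤ (Σ-*ʳ els s _) (*-monoʳ s s0 p))

  φ : ℚ
  φ = ∑ (λ _ → 1ℚ)

  module Mean (φ⁻ : ℚ) (φφ⁻ : φ * φ⁻ ≡ 1ℚ) (φ⁻≥0 : 0ℚ ≤ φ⁻) where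

   ∑-const : ∀ c → ∑ (λ _ → c) ≡ φ * c
   ∑-const c = trans (Σ-cong els (λ _ → sym (*-identityˡ c))) (Σ-*ʳ els c _)

   mean : (G → ℚ) → ℚ
   mean F = φ⁻ * ∑ F

   π : (G → ℚ) → G → ℚ
   π F b = F b - mean F

   φ-cancel : ∀ x → φ * (φ⁻ * x) ≡ x
   φ-cancel x = trans (sym (*-assoc φ φ⁻ x)) (trans (cong (_* x) φφ⁻) (*-identityˡ x))

   ∑-π : ∀ F → ∑ (π F) ≡ 0ℚ
   ∑-π F = trans (Σ-- els F _) (trans (cong (λ z → ∑ F - z) (trans (∑-const (mean F)) (φ-cancel (∑ F)))) (+-inverseʳ (∑ F)))

   mean-mono : ∀ {F s} → (∀ b → F b ≤ s) → mean F ≤ s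
   mean-mono {F} {s} h = ≤≡ (*-monoˡ φ⁻ φ⁻≥0 (≤≡ (Σ-mono els h) (∑-const s)))
    (trans (id8 φ⁻ φ s) (φ-cancel s))

   mean-neg : ∀ F → mean (λ b → - F b) ≡ - mean F
   mean-neg F = trans (cong (φ⁻ *_) (Σ-neg els F)) (sym (neg-distribʳ-* φ⁻ _))

   mean-+ : ∀ F H → mean (λ b → F b + H b) ≡ mean F + mean H
   mean-+ F H = trans (cong (φ⁻ *_) (Σ-+ els F H)) (*-distribˡ-+ φ⁻ _ _)

   mean-const : ∀ c → mean (λ _ → c) ≡ c
   mean-const c = trans (cong (φ⁻ *_) (∑-const c)) (trans (id8 φ⁻ φ c) (φ-cancel c))

   mean-abs : ∀ {F s} → Sup F s → ∣ mean F ∣ ≤ s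
   mean-abs {F} h = abs≤ (mean-mono (λ b → ≤-trans (≤abs (F b)) (h b)))
    (subst (_≤ _) (mean-neg F) (mean-mono (λ b → ≤-trans (-≤abs (F b)) (h b))))

   π-Sup : ∀ {F s} → Sup F s → Sup (π F) (s + s)
   π-Sup h b = abs-- (h b) (mean-abs h)

   -- The projection does not see constants, so any approximate value `c` may stand in for the mean.
   π-osc : ∀ {F s} c → (∀ b → ∣ F b - c ∣ ≤ s) → Sup (π F) (s + s)
   π-osc {F} {s} c h b = subst (λ z → ∣ z ∣ ≤ s + s)
    (trans (cong (λ z → F b - c - z) (trans (mean-+ F _) (cong (mean F +_) (mean-const (- c))))) (id22 (F b) c (mean F)))
    (π-Sup {λ b → F b - c} h b)

   ⋆-π : ∀ F H → F ⋆ π H ≗ π (F ⋆ H)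
   ⋆-π F H b = trans (⋆--ʳ F H (λ _ → mean H) b) (cong (λ z → (F ⋆ H) b - z)
    (trans (⋆-const F (mean H) b) (trans (id8 (∑ F) φ⁻ (∑ H)) (cong (φ⁻ *_) (sym (∑-⋆ F H))))))

   -- Convolution with a function of mean zero annihilates constants; hence projecting both factors
   -- equals projecting the product.
   π⋆π : ∀ F H → π F ⋆ π H ≗ π (F ⋆ H)
   π⋆π F H b = trans (⋆-comm (π F) (π H) b) (trans (⋆--ʳ (π H) F (λ _ → mean F) b)
    (trans (cong₂ _-_ (⋆-comm (π H) F b) (trans (⋆-const (π H) (mean F) b) (trans (cong (_* mean F) (∑-π H)) (*-zeroˡ _))))
    (trans (id23 ((F ⋆ π H) b)) (⋆-π F H b))))

   ⋆-πδ : ∀ F → ∑ F ≡ 0ℚ → F ⋆ π δ ≗ F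
   ⋆-πδ F h b = trans (⋆--ʳ F δ (λ _ → mean δ) b) (trans (cong₂ _-_ (⋆-δ F b)
    (trans (⋆-const F (mean δ) b) (trans (cong (_* mean δ) h) (*-zeroˡ _)))) (id23 (F b)))

   ∥π∥₁ : ∀ {F} → (∀ b → 0ℚ ≤ F b) → ∥ π F ∥₁ ≤ ∑ F + ∑ F
   ∥π∥₁ {F} h = ≤≡ (Σ-mono els {g = λ t → F t + mean F} (λ t → abs≤ (id24 (F t) (mean F) via 0≤+ m0 m0) (id25 (F t) (mean F) via 0≤+ (h t) (h t))))
    (trans (Σ-+ els F _) (cong (∑ F +_) (trans (∑-const (mean F)) (φ-cancel (∑ F)))))
    where
    m0 : 0ℚ ≤ mean F
    m0 = 0≤* φ⁻≥0 (Σ≥0 els h)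

   -- Since U ⋆ R₀ ≈ δ, convolving (k+1) R_{k+1} ≈ Σ_{i ≤ k} L_i ⋆ R_{k-i} with U isolates L_k; only R₀
   -- and R₁ contribute, because the mean-zero parts of R₂, R₃, … are small.
   module Recurrence
    (L R : ℕ → G → ℚ) (U : G → ℚ) (K : ℕ) (τ ε u : ℚ) (r̄ : ℕ → ℚ)
    (L≥0 : ∀ k b → 0ℚ ≤ L k b)
    (τ≥0 : 0ℚ ≤ τ) (ε≥0 : 0ℚ ≤ ε)
    (conv-R : ∀ k → k N.≤ K → Sup (λ b → ι (suc k) * R (suc k) b - Σ (range (suc k)) (λ i → (L i ⋆ R (k N.∸ i)) b)) τ)
    (conv-U : Sup (λ b → (U ⋆ R 0) b - δ b) τ)
    (R-osc : ∀ k → 2 N.≤ k → k N.≤ suc K → ∀ b → ∣ R k b - r̄ k ∣ ≤ ε)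
    (U₁ : ∥ U ∥₁ ≤ u) (u≥0 : 0ℚ ≤ u)
    where

    l : ℕ → G → ℚ
    l k = π (L k)

    m : ℕ → ℚ
    m k = ∑ (L k)

    a₀ : G → ℚ
    a₀ b = (U ⋆ R 0) b - δ b

    E : ℕ → G → ℚ
    E k b = ι (suc k) * R (suc k) b - Σ (range (suc k)) (λ i → (L i ⋆ R (k N.∸ i)) b)

    -- Because `U` nearly inverts `R 0`, this plays the part of R_k / R_0 in the convolution
    -- algebra: `V 0` is nearly the unit, `V 1` nearly `l 0`, and `V k` is small for k ≥ 2.
    V : ℕ → G → ℚ
    V k = U ⋆ π (R k)

    W : ℕ → G → ℚ
    W k = U ⋆ π (E k)

    W-sup : ∀ k → k N.≤ K → Sup (W k) (u * (τ + τ))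
    W-sup k h = Sup-⋆ U₁ (0≤+ τ≥0 τ≥0) (π-Sup (conv-R k h))

    V-sup : ∀ k → 2 N.≤ k → k N.≤ suc K → Sup (V k) (u * (ε + ε))
    V-sup k h h' = Sup-⋆ U₁ (0≤+ ε≥0 ε≥0) (π-osc (r̄ k) (R-osc k h h'))

    l₁ : ∀ k → ∥ l k ∥₁ ≤ m k + m k
    l₁ k = ∥π∥₁ (L≥0 k)

    π-linear : ∀ c F {n} (H : ℕ → G → ℚ) → π (λ b → c * F b - Σ (range n) (λ i → H i b)) ≗
     (λ b → c * π F b - Σ (range n) (λ i → π (H i) b))
    π-linear c F {n} H b = begin
     c * F b - S - φ⁻ * ∑ (λ t → c * F t - Σ (range n) (λ i → H i t))
      ≡⟨ cong (λ z → c * F b - S - φ⁻ * z) (trans (Σ-- els _ _) (cong₂ _-_ (Σ-*ˡ els c F) (Σ-swap els (range n) _))) ⟩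
     c * F b - S - φ⁻ * (c * ∑ F - Σ (range n) (λ i → ∑ (H i)))
      ≡⟨ id16 c (F b) S φ⁻ (∑ F) _ ⟩
     c * (F b - φ⁻ * ∑ F) - (S - φ⁻ * Σ (range n) (λ i → ∑ (H i)))
      ≡⟨ cong (λ z → c * π F b - z) (trans (cong (λ z → S - z) (sym (Σ-*ˡ (range n) φ⁻ _))) (sym (Σ-- (range n) _ _))) ⟩
     c * π F b - Σ (range n) (λ i → π (H i) b) ∎
     where
     open ≡-Reasoning
     S : ℚ
     S = Σ (range n) (λ i → H i b)

    W-eq : ∀ k → W k ≗ (λ b → ι (suc k) * V (suc k) b - Σ (range (suc k)) (λ i → (l i ⋆ V (k N.∸ i)) b))
    W-eq k b = begin
     (U ⋆ π (E k)) b
      ≡⟨ ⋆-cong (λ _ → refl) (π-linear (ι (suc k)) (R (suc k)) {suc k} (λ i → L i ⋆ R (k N.∸ i))) b ⟩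
     (U ⋆ (λ b → ι (suc k) * π (R (suc k)) b - Σ (range (suc k)) (λ i → π (L i ⋆ R (k N.∸ i)) b))) b
      ≡⟨ ⋆--ʳ U (λ b → ι (suc k) * π (R (suc k)) b) (λ b → Σ (range (suc k)) (λ i → π (L i ⋆ R (k N.∸ i)) b)) b ⟩
     (U ⋆ (λ b → ι (suc k) * π (R (suc k)) b)) b - (U ⋆ (λ b → Σ (range (suc k)) (λ i → π (L i ⋆ R (k N.∸ i)) b))) b
      ≡⟨ cong₂ _-_ (⋆-*ʳ U (ι (suc k)) (π (R (suc k))) b)
        (trans (⋆-Σʳ (range (suc k)) U (λ i → π (L i ⋆ R (k N.∸ i))) b)
         (Σ-cong (range (suc k)) (λ i → trans (⋆-cong {F = U} (λ _ → refl) (λ c → sym (π⋆π (L i) (R (k N.∸ i)) c)) b)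
          (⋆-left-comm U (l i) (π (R (k N.∸ i))) b)))) ⟩
     ι (suc k) * V (suc k) b - Σ (range (suc k)) (λ i → (l i ⋆ V (k N.∸ i)) b) ∎
     where open ≡-Reasoning

    V0-eq : V 0 ≗ (λ b → π δ b + π a₀ b)
    V0-eq b = trans (⋆-π U (R 0) b) (trans (cong₂ (λ x y → x - y) (id17 ((U ⋆ R 0) b) (δ b))
      (trans (cong (φ⁻ *_) (trans (Σ-cong els (λ t → id17 ((U ⋆ R 0) t) (δ t))) (Σ-+ els δ a₀))) (*-distribˡ-+ φ⁻ _ _)))
     (id18 (δ b) (a₀ b) _ _))

    l⋆V0 : ∀ k → l k ⋆ V 0 ≗ (λ b → l k b + (l k ⋆ π a₀) b)
    l⋆V0 k b = trans (⋆-cong {F = l k} (λ _ → refl) V0-eq b) (trans (⋆-+ʳ (l k) (π δ) (π a₀) b)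
     (cong (_+ (l k ⋆ π a₀) b) (⋆-πδ (l k) (∑-π (L k)) b)))

    -- The equation `W-eq` at k = 0 reads `W 0` = `V 1` - `l 0` ⋆ `V 0`, and `V 0` is the unit up to
    -- `π a₀`.
    V1-eq : V 1 ≗ (λ b → l 0 b + ((l 0 ⋆ π a₀) b + W 0 b))
    V1-eq b = trans (lem (V 1 b) ((l 0 ⋆ V 0) b) (W 0 b) (ι 1) (W-eq 0 b) ι-1)
     (trans (cong (_+ W 0 b) (l⋆V0 0 b)) (+-assoc _ _ _))
     where
     lem : ∀ v x w i → w ≡ i * v - (x + 0ℚ) → i ≡ 1ℚ → v ≡ x + w
     lem v x w i p refl = trans (id19 v x) (cong (x +_) (sym p))

    -- One summand for each defect: the small `V (j+2)`, the error `W (j+1)`, the distance of `V 0`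
    -- from the unit, the distance of `V 1` from `l 0`, and the small `V k` with k ≥ 2 paired with
    -- `l i`, i < j.
    η : ℕ → ℚ
    η zero = 0ℚ
    η (suc j) = (ι (suc (suc j)) * (u * (ε + ε)) + u * (τ + τ)) + ((m (suc j) + m (suc j)) * (τ + τ)
     + ((m j + m j) * ((m 0 + m 0) * (τ + τ) + u * (τ + τ)) + Σ (range j) (λ i → (m i + m i) * (u * (ε + ε)))))

    -- In `W-eq` at k = j+1 the term i = j+1 contains `V 0` and yields `l (j+1)`; the term i = j
    -- contains `V 1` and yields `l 0 ⋆ l j`; all other terms contain some `V k` with k ≥ 2.
    recurrence : ∀ j → suc j N.≤ K → Sup (λ b → l (suc j) b + (l 0 ⋆ l j) b) (η (suc j))
    recurrence j h b = subst (λ z → ∣ z ∣ ≤ η (suc j)) (sym main)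
     (abs-+ (abs-- (abs-* (≤-reflexive (∣∣-nonneg (ι≥0 (suc (suc j))))) (V-sup (suc (suc j)) (N.s≤s 1≤suc) (N.s≤s h) b)) (W-sup (suc j) h b))
      (abs-neg (abs-+ (Sup-⋆ (l₁ (suc j)) τ2 (π-Sup conv-U) b)
       (abs-+ (Sup-⋆ {H = λ b → (l 0 ⋆ π a₀) b + W 0 b} (l₁ j) (0≤+ (0≤* (0≤+ m0 m0) τ2) (0≤* u≥0 τ2))
            (λ c → abs-+ (Sup-⋆ (l₁ 0) τ2 (π-Sup conv-U) c) (W-sup 0 N.z≤n c)) b)
        (Σ-abs≤ (range j) (λ i i∈ → Sup-⋆ (l₁ i) (0≤* u≥0 (0≤+ ε≥0 ε≥0))
          (V-sup (suc j N.∸ i) (two i (∈range i∈)) (NP.≤-trans (NP.m∸n≤m (suc j) i) (NP.m≤n⇒m≤1+n h))) b))))))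
     where
     τ2 : 0ℚ ≤ τ + τ
     τ2 = 0≤+ τ≥0 τ≥0
     m0 : 0ℚ ≤ m 0
     m0 = Σ≥0 els (L≥0 0)
     two : ∀ i → i N.< j → 2 N.≤ suc j N.∸ i
     two i p = ℕ≡≤ (sym (NP.m+n∸n≡m 2 i)) (NP.∸-monoˡ-≤ i (N.s≤s p))
     T S : ℚ
     S = Σ (range j) (λ i → (l i ⋆ V (suc j N.∸ i)) b)
     T = (l j ⋆ (λ b → (l 0 ⋆ π a₀) b + W 0 b)) b
     e1 : (l (suc j) ⋆ V (suc j N.∸ suc j)) b ≡ l (suc j) b + (l (suc j) ⋆ π a₀) b
     e1 = trans (cong (λ i → (l (suc j) ⋆ V i) b) (NP.n∸n≡0 j)) (l⋆V0 (suc j) b)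
     e2 : (l j ⋆ V (suc j N.∸ j)) b ≡ (l 0 ⋆ l j) b + T
     e2 = trans (cong (λ i → (l j ⋆ V i) b) (NP.m+n∸n≡m 1 j)) (trans (⋆-cong {F = l j} (λ _ → refl) V1-eq b)
      (trans (⋆-+ʳ (l j) (l 0) (λ b → (l 0 ⋆ π a₀) b + W 0 b) b) (cong (_+ T) (⋆-comm (l j) (l 0) b))))
     lem : ∀ iv w x x' y t s → w ≡ iv - ((x + x') + ((y + t) + s)) → x + y ≡ (iv - w) + - (x' + (t + s))
     lem iv _ x x' y t s refl = id15 iv x x' y t s
     main : l (suc j) b + (l 0 ⋆ l j) b ≡
      (ι (suc (suc j)) * V (suc (suc j)) b - W (suc j) b) + - ((l (suc j) ⋆ π a₀) b + (T + S))
     main = lem _ _ _ _ _ _ _ (trans (W-eq (suc j) b)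
      (cong (λ z → ι (suc (suc j)) * V (suc (suc j)) b - z) (cong₂ _+_ e1 (cong (_+ S) e2))))

    -- (-1)^k times the (k+1)-st convolution power of l₀
    power : ℕ → G → ℚ
    power zero = l 0
    power (suc k) b = - (l 0 ⋆ power k) b

    err : ℕ → ℚ
    err zero = 0ℚ
    err (suc k) = η (suc k) + (m 0 + m 0) * err k

    err≥0 : ∀ k → k N.≤ K → 0ℚ ≤ err k
    err≥0 zero _ = ≤-refl
    err≥0 (suc k) h = 0≤+ (≤-trans (0≤∣∣ _) (recurrence k h e)) (0≤* (0≤+ m0 m0) (err≥0 k (NP.<⇒≤ h)))
     where
     m0 : 0ℚ ≤ m 0
     m0 = Σ≥0 els (L≥0 0)

    l≈power : ∀ k → k N.≤ K → Sup (λ b → l k b - power k b) (err k)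
    l≈power zero _ b = ≤-reflexive (trans (cong ∣_∣ (+-inverseʳ (l 0 b))) (∣∣-nonneg ≤-refl))
    l≈power (suc k) h b = subst (λ z → ∣ z ∣ ≤ err (suc k)) (sym eq)
     (abs-- (recurrence k h b) (Sup-⋆ (l₁ 0) (err≥0 k (NP.<⇒≤ h)) (l≈power k (NP.<⇒≤ h)) b))
     where
     eq : l (suc k) b - power (suc k) b ≡ (l (suc k) b + (l 0 ⋆ l k) b) - (l 0 ⋆ (λ c → l k c - power k c)) b
     eq = trans (id20 (l (suc k) b) ((l 0 ⋆ l k) b) ((l 0 ⋆ power k) b))
      (cong (λ z → (l (suc k) b + (l 0 ⋆ l k) b) - z) (sym (⋆--ʳ (l 0) (l k) (power k) b)))

    square : G → ℚ
    square = l 0 ⋆ l 0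

    power-step2 : ∀ k → power (suc (suc k)) ≗ square ⋆ power k
    power-step2 k b = trans (cong -_ (⋆-negʳ (l 0) (l 0 ⋆ power k) b))
     (trans (id21 _) (sym (⋆-assoc (l 0) (l 0) (power k) b)))

    power5 : power 5 ≗ (λ b → - (square ⋆ (square ⋆ square)) b)
    power5 b = trans (power-step2 3 b) (trans (⋆-cong {F = square} (λ _ → refl)
     (λ c → trans (power-step2 1 c) (⋆-negʳ square square c)) b) (⋆-negʳ square (square ⋆ square) b))

  -- Lagrange's identity: twice the difference of the two sides is the sum of the squares of all 2 ×
  -- 2 minors.
  cauchy-schwarz : ∀ (x y : G → ℚ) → ∑ (λ t → x t * y t) * ∑ (λ t → x t * y t) ≤ ∑ (λ t → x t * x t) * ∑ (λ t → y t * y t)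
  cauchy-schwarz x y = *-cancelˡ 2ℚ (0<+ 0<1 0≤1) (id32 (∑ (λ t → x t * x t)) (∑ (λ t → y t * y t)) (∑ (λ t → x t * y t))
    via subst (0ℚ ≤_) total (Σ≥0 els (λ s → Σ≥0 els (λ t → sq≥0 (x s * y t - x t * y s)))))
   where
   X Y P : ℚ
   X = ∑ (λ t → x t * x t)
   Y = ∑ (λ t → y t * y t)
   P = ∑ (λ t → x t * y t)
   open ≡-Reasoning
   total : ∑ (λ s → ∑ (λ t → (x s * y t - x t * y s) * (x s * y t - x t * y s))) ≡ (X * Y + X * Y) - 2ℚ * (P * P)
   total = begin
    ∑ (λ s → ∑ (λ t → (x s * y t - x t * y s) * (x s * y t - x t * y s)))
     ≡⟨ Σ-cong els (λ s → trans (Σ-cong els (λ t → id33 (x s) (y t) (x t) (y s)))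
        (trans (Σ-- els _ _) (cong₂ _-_ (trans (Σ-+ els _ _) (cong₂ _+_ (Σ-*ˡ els _ _) (Σ-*ˡ els _ _)))
         (trans (Σ-*ˡ els 2ℚ _) (cong (2ℚ *_) (Σ-*ˡ els (x s * y s) _)))))) ⟩
    ∑ (λ s → ((x s * x s) * Y + (y s * y s) * X) - 2ℚ * ((x s * y s) * P))
     ≡⟨ trans (Σ-- els _ _) (cong₂ _-_ (trans (Σ-+ els _ _) (cong₂ _+_ (Σ-*ʳ els Y _) (trans (Σ-*ʳ els X _) (*-comm Y X))))
        (trans (Σ-*ˡ els 2ℚ _) (cong (2ℚ *_) (Σ-*ʳ els P _)))) ⟩
    (X * Y + X * Y) - 2ℚ * (P * P) ∎

  -- For a real function S the autocorrelation C(s) = ⟨S, S(·s)⟩ satisfies C(s²) ≥ 2 C(s)²/N - N with N = ‖S‖², so a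
  -- large triple convolution forces the mean of S over cosets of the squares to be far from zero.
  module Squares (S : G → ℚ) where

   N : ℚ
   N = ∑ (λ t → S t * S t)

   C : G → ℚ
   C s = ∑ (λ t → S t * S (t ∙ s))

   C-inv : ∀ s → ∑ (λ t → S t * S (t ∙ inv s)) ≡ C s
   C-inv s = trans (sym (∑-mul s _)) (Σ-cong els (λ t → trans (*-comm (S (s ∙ t)) _)
    (cong₂ (λ a b → S a * S b) (trans (cong (_∙ inv s) (∙-comm s t)) (trans (∙-assoc t s (inv s))
     (trans (cong (t ∙_) (trans (∙-comm s _) (∙-invˡ s))) (∙-idʳ t)))) (∙-comm s t))))

   ∑-mulʳ : ∀ x F → ∑ (λ t → F (t ∙ x)) ≡ ∑ F
   ∑-mulʳ x F = trans (Σ-cong els (λ t → cong F (∙-comm t x))) (∑-mul x F)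

   C-square : ∀ s → ∑ (λ t → S (t ∙ s) * S (t ∙ inv s)) ≡ C (s ∙ s)
   C-square s = trans (sym (∑-mulʳ s _)) (Σ-cong els (λ t → trans (*-comm _ _)
    (cong₂ (λ a b → S a * S b) (trans (∙-assoc t s (inv s)) (trans (cong (t ∙_) (trans (∙-comm s _) (∙-invˡ s))) (∙-idʳ t))) (∙-assoc t s s))))

   -- The squared norm of N·S(ts) + N·S(ts⁻¹) - 2C(s)·S(t), which is N times the part of the sum of
   -- the two translates orthogonal to S. The translates have inner product C(s) with S and C(s²)
   -- with each other.
   pointwise : ∀ s → 0ℚ ≤ (2ℚ * (N * N * N) + 2ℚ * (N * N) * C (s ∙ s)) - 2ℚ * 2ℚ * (N * (C s * C s))
   pointwise s = subst (0ℚ ≤_) total (Σ≥0 els (λ t → sq≥0 (N * S (t ∙ s) + N * S (t ∙ inv s) - 2ℚ * C s * S t)))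
    where
    total : ∑ (λ t → (N * S (t ∙ s) + N * S (t ∙ inv s) - 2ℚ * C s * S t) * (N * S (t ∙ s) + N * S (t ∙ inv s) - 2ℚ * C s * S t))
     ≡ (2ℚ * (N * N * N) + 2ℚ * (N * N) * C (s ∙ s)) - 2ℚ * 2ℚ * (N * (C s * C s))
    total = trans (Σ-cong els (λ t → id26 N (C s) (S (t ∙ s)) (S (t ∙ inv s)) (S t)))
     (trans (trans (Σ-- els _ _) (cong₂ _-_
      (trans (Σ-+ els _ _) (cong₂ _+_
       (trans (Σ-+ els _ _) (cong₂ _+_ (trans (Σ-*ˡ els (N * N) _) (cong (N * N *_) (∑-mulʳ s (λ t → S t * S t))))
                       (trans (Σ-*ˡ els (N * N) _) (cong (N * N *_) (∑-mulʳ (inv s) (λ t → S t * S t))))))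
       (trans (Σ-+ els _ _) (cong₂ _+_ (trans (Σ-*ˡ els (2ℚ * (N * N)) _) (cong (2ℚ * (N * N) *_) (C-square s)))
                       (Σ-*ˡ els (2ℚ * 2ℚ * (C s * C s)) _)))))
      (trans (Σ-+ els _ _) (cong₂ _+_ (Σ-*ˡ els (2ℚ * 2ℚ * (N * C s)) _)
        (trans (Σ-*ˡ els (2ℚ * 2ℚ * (N * C s)) _) (cong (2ℚ * 2ℚ * (N * C s) *_) (C-inv s)))))))
     (id27 N (C s) (C (s ∙ s))))

   -- Both sides are the multiplicative energy of S. After expanding the squares into triple sums,
   -- the substitution b = t u s exchanges the factors S(ts) and S(us).
   ∑C²≡∑S⋆S² : ∑ (λ s → C s * C s) ≡ ∑ (λ b → (S ⋆ S) b * (S ⋆ S) b)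
   ∑C²≡∑S⋆S² = trans (triple (λ s t → S t * S (t ∙ s))) (trans (Σ-cong els (λ t → Σ-cong els (λ u →
     trans (Σ-cong els (λ s → trans (id28 (S t) (S (t ∙ s)) (S u) (S (u ∙ s)))
       (cong₂ (λ a b → S t * S a * (S u * S b)) (sym (e1 t u s)) (sym (e2 t u s)))))
      (∑-mul (t ∙ u) (λ b → S t * S (inv t ∙ b) * (S u * S (inv u ∙ b))))))) (sym (triple (λ b t → S t * S (inv t ∙ b)))))
    where
    triple : ∀ (f : G → G → ℚ) → ∑ (λ s → ∑ (f s) * ∑ (f s)) ≡ ∑ (λ t → ∑ (λ u → ∑ (λ s → f s t * f s u)))
    triple f = trans (Σ-cong els (λ s → sym (Σ-** els els (f s) (f s)))) (trans (Σ-swap els els _)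
     (Σ-cong els (λ t → Σ-swap els els _)))
    e1 : ∀ t u s → inv t ∙ (t ∙ u ∙ s) ≡ u ∙ s
    e1 t u s = trans (cong (inv t ∙_) (∙-assoc t u s)) (cancelˡ t (u ∙ s))
    e2 : ∀ t u s → inv u ∙ (t ∙ u ∙ s) ≡ t ∙ s
    e2 t u s = trans (cong (λ z → inv u ∙ (z ∙ s)) (∙-comm t u)) (e1 u t s)

   -- Cauchy-Schwarz for S against S ⋆ S bounds the square of the triple convolution by N ∑ C(s)²,
   -- and summing `pointwise` over s bounds that energy by ∑ C(s²).
   triple-bound : ∀ a {κ} → ∑ (λ s → C (s ∙ s)) ≤ κ →
    2ℚ * ((S ⋆ (S ⋆ S)) a * (S ⋆ (S ⋆ S)) a) ≤ φ * (N * N * N) + N * N * κ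
   triple-bound a {κ} hκ = *-cancelˡ 2ℚ (0<+ 0<1 0≤1) (≤-trans (*-monoˡ 2ℚ 2≥0 (*-monoˡ 2ℚ 2≥0 cs))
    (≤-trans summed (id30 φ N (∑ (λ s → C (s ∙ s))) κ via 0≤* (0≤* 2≥0 (sq≥0 N)) (≤⇒0≤ hκ))))
    where
    2≥0 : 0ℚ ≤ 2ℚ
    2≥0 = 0≤+ 0≤1 0≤1
    cs : (S ⋆ (S ⋆ S)) a * (S ⋆ (S ⋆ S)) a ≤ N * ∑ (λ s → C s * C s)
    cs = ≤≡ (cauchy-schwarz S (λ t → (S ⋆ S) (inv t ∙ a)))
     (cong (N *_) (trans (∑-refl a (λ t → (S ⋆ S) t * (S ⋆ S) t)) (sym ∑C²≡∑S⋆S²)))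
    sumeq : ∑ (λ s → (2ℚ * (N * N * N) + 2ℚ * (N * N) * C (s ∙ s)) - 2ℚ * 2ℚ * (N * (C s * C s))) ≡
     (2ℚ * (N * N * N) * φ + 2ℚ * (N * N) * ∑ (λ s → C (s ∙ s))) - 2ℚ * 2ℚ * (N * ∑ (λ s → C s * C s))
    sumeq = trans (Σ-- els _ _) (cong₂ _-_ (trans (Σ-+ els _ _) (cong₂ _+_
      (trans (Σ-cong els (λ _ → sym (*-identityʳ _))) (Σ-*ˡ els (2ℚ * (N * N * N)) (λ _ → 1ℚ))) (Σ-*ˡ els _ _)))
     (trans (Σ-*ˡ els (2ℚ * 2ℚ) _) (cong (2ℚ * 2ℚ *_) (Σ-*ˡ els N _))))
    summed : 2ℚ * (2ℚ * (N * ∑ (λ s → C s * C s))) ≤ 2ℚ * (N * N * N) * φ + 2ℚ * (N * N) * ∑ (λ s → C (s ∙ s))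
    summed = id29 _ _ via subst (0ℚ ≤_) sumeq (Σ≥0 els pointwise)

   N≤ : ∀ {B} → 0ℚ ≤ B → Sup S B → N ≤ φ * (B * B)
   N≤ {B} B≥0 h = ≤≡ (Σ-mono els (λ t → subst (_≤ B * B) (trans (sym (∣*∣ (S t) (S t))) (∣∣-nonneg (sq≥0 (S t)))) (*-mono (0≤∣∣ _) (0≤∣∣ _) (h t) (h t))))
    (trans (Σ-cong els (λ _ → sym (*-identityˡ (B * B)))) (Σ-*ʳ els (B * B) _))

   -- With the sum over s innermost, ∑ C(s²) pairs S with its sums over the cosets of the squares.
   ∑C-squares : ∀ {κ n} → ∥ S ∥₁ ≤ n → 0ℚ ≤ κ → (∀ t → ∣ ∑ (λ s → S (t ∙ (s ∙ s))) ∣ ≤ κ) → ∑ (λ s → C (s ∙ s)) ≤ n * κ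
   ∑C-squares {κ} {n} h κ≥0 hκ = ≡≤ (trans (Σ-swap els els _) (Σ-cong els (λ t → Σ-*ˡ els (S t) _)))
    (≤-trans (≤abs _) (≤-trans (Σ-abs≤ els (λ t _ → abs-* (≤-refl {∣ S t ∣}) (hκ t)))
     (≡≤ (Σ-*ʳ els κ _) (*-monoʳ κ κ≥0 h))))

  ⋆-coset : ∀ F H {n κ} → ∥ F ∥₁ ≤ n → 0ℚ ≤ κ → (∀ t → ∣ ∑ (λ s → H (t ∙ (s ∙ s))) ∣ ≤ κ) →
   ∀ t → ∣ ∑ (λ s → (F ⋆ H) (t ∙ (s ∙ s))) ∣ ≤ n * κ
  ⋆-coset F H {n} {κ} h κ≥0 hκ t = subst (λ z → ∣ z ∣ ≤ n * κ) (sym (trans (Σ-swap els els _)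
    (Σ-cong els (λ x → trans (Σ-*ˡ els (F x) _) (cong (F x *_) (Σ-cong els (λ s → cong H (sym (∙-assoc (inv x) t (s ∙ s)))))))))) 
   (≤-trans (Σ-abs≤ els (λ x _ → abs-* (≤-refl {∣ F x ∣}) (hκ (inv x ∙ t))))
    (≡≤ (Σ-*ʳ els κ _) (*-monoʳ κ κ≥0 h)))

-- Divided powers and their binomial theorem.

module DividedPower where

 open Q
 open Kit

 -- dp k x = xᵏ / k!
 dp : ℕ → ℚ → ℚ
 dp zero x = 1ℚ
 dp (suc k) x = rec (suc k) * (x * dp k x)

 dp-suc : ∀ k x → ι (suc k) * dp (suc k) x ≡ x * dp k x
 dp-suc k x = trans (sym (*-assoc _ _ _)) (trans (cong (_* (x * dp k x)) (ι*rec {suc k} 1≤suc)) (*-identityˡ _))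

 dp≥0 : ∀ k {x} → 0ℚ ≤ x → 0ℚ ≤ dp k x
 dp≥0 zero h = 0≤1
 dp≥0 (suc k) h = 0≤* (rec≥0 (suc k)) (0≤* h (dp≥0 k h))

 dp-mono : ∀ k {x y} → 0ℚ ≤ x → x ≤ y → dp k x ≤ dp k y
 dp-mono zero h l = ≤-refl
 dp-mono (suc k) h l = *-monoˡ (rec (suc k)) (rec≥0 (suc k)) (*-mono h (dp≥0 k h) l (dp-mono k h l))

 rec≤1 : ∀ n → rec (suc n) ≤ 1ℚ
 rec≤1 n = ≤-trans (rec-mono 1≤suc 1≤suc) (≤-reflexive (trans (sym (*-identityˡ _)) (trans (cong (_* rec 1) (sym ι-1)) (ι*rec 1≤suc))))

 dp≤^ : ∀ k {x} → 0ℚ ≤ x → dp k x ≤ x ^ k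
 dp≤^ zero h = ≤-refl
 dp≤^ (suc k) {x} h = subst (dp (suc k) x ≤_) (*-identityˡ _)
  (*-mono (rec≥0 (suc k)) (0≤* h (dp≥0 k h)) (rec≤1 k) (*-monoˡ x h (dp≤^ k h)))

 private
  conv : ℕ → ℚ → ℚ → ℚ
  conv k x y = Σ (range (suc k)) (λ i → dp i x * dp (k N.∸ i) y)

  opaque
   unfolding ring
   swap3 : ∀ a b c → a * (b * c) ≡ b * (a * c)
   swap3 = solve-∀ ring

  Σ-last : ∀ n f → Σ (range (suc n)) f ≡ Σ (range n) (λ i → f (suc i)) + f 0
  Σ-last zero f = trans (+-identityʳ _) (sym (+-identityˡ _))
  Σ-last (suc n) f = trans (cong (f (suc n) +_) (Σ-last n f)) (sym (+-assoc _ _ _))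

  left : ∀ k x y → Σ (range (suc (suc k))) (λ i → ι i * (dp i x * dp (suc k N.∸ i) y)) ≡ x * conv k x y
  left k x y = trans (Σ-last (suc k) _) (trans (cong (Σ (range (suc k)) (λ i → ι (suc i) * (dp (suc i) x * dp (k N.∸ i) y)) +_)
    (trans (cong (_* (dp 0 x * dp (suc k) y)) ι-0) (*-zeroˡ _)))
   (trans (+-identityʳ _) (trans (Σ-cong (range (suc k)) (λ i → trans (sym (*-assoc _ _ _)) (trans (cong (_* dp (k N.∸ i) y) (dp-suc i x)) (*-assoc x _ _))))
    (Σ-*ˡ (range (suc k)) x _))))

  right : ∀ k x y → Σ (range (suc (suc k))) (λ i → ι (suc k N.∸ i) * (dp i x * dp (suc k N.∸ i) y)) ≡ y * conv k x y
  right k x y = trans (cong (_+ Σ (range (suc k)) f) (trans (cong (λ z → ι z * (dp (suc k) x * dp z y)) (NP.n∸n≡0 k)) (trans (cong (_* (dp (suc k) x * dp 0 y)) ι-0) (*-zeroˡ _))))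
   (trans (+-identityˡ _) (trans (Σ-cong∈ (range (suc k)) (λ i i∈ → step i (NP.≤-pred (∈range i∈)))) (Σ-*ˡ (range (suc k)) y _)))
   where
   f : ℕ → ℚ
   f i = ι (suc k N.∸ i) * (dp i x * dp (suc k N.∸ i) y)
   step : ∀ i → i N.≤ k → f i ≡ y * (dp i x * dp (k N.∸ i) y)
   step i h = trans (cong (λ z → ι z * (dp i x * dp z y)) (NP.+-∸-assoc 1 h))
    (trans (swap3 _ _ _) (trans (cong (dp i x *_) (dp-suc (k N.∸ i) y)) (swap3 _ _ _)))

 -- Multiplying the term c_i of degree k+1 by k+1 = i + (k+1-i) and lowering one index by `dp-suc`
 -- gives x plus y times the expansion of degree k. Divided powers keep binomial coefficients out of
 -- all convolutions.
 dp-+ : ∀ k x y → dp k (x + y) ≡ Σ (range (suc k)) (λ i → dp i x * dp (k N.∸ i) y)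
 dp-+ zero x y = lem
  where
  lem : 1ℚ ≡ 1ℚ * 1ℚ + 0ℚ
  lem = sym (trans (+-identityʳ _) (*-identityˡ _))
 dp-+ (suc k) x y = begin
  rec (suc k) * ((x + y) * dp k (x + y)) ≡⟨ cong (λ z → rec (suc k) * ((x + y) * z)) (dp-+ k x y) ⟩
  rec (suc k) * ((x + y) * conv k x y) ≡⟨ cong (rec (suc k) *_) (*-distribʳ-+ (conv k x y) x y) ⟩
  rec (suc k) * (x * conv k x y + y * conv k x y)
   ≡⟨ cong (rec (suc k) *_) (cong₂ _+_ (sym (left k x y)) (sym (right k x y))) ⟩
  rec (suc k) * (Σ R (λ i → ι i * c i) + Σ R (λ i → ι (suc k N.∸ i) * c i))
   ≡⟨ cong (rec (suc k) *_) (trans (sym (Σ-+ R _ _)) (Σ-cong∈ R (λ i i∈ → trans (sym (*-distribʳ-+ (c i) _ _))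
      (cong (_* c i) (trans (sym (ι-+ i (suc k N.∸ i))) (cong ι (NP.m+[n∸m]≡n (NP.≤-pred (∈range i∈))))))))) ⟩
  rec (suc k) * Σ R (λ i → ι (suc k) * c i)
   ≡⟨ cong (rec (suc k) *_) (Σ-*ˡ R _ _) ⟩
  rec (suc k) * (ι (suc k) * conv (suc k) x y)
   ≡⟨ trans (sym (*-assoc _ _ _)) (trans (cong (_* conv (suc k) x y) (trans (*-comm _ _) (ι*rec {suc k} 1≤suc))) (*-identityˡ _)) ⟩
  conv (suc k) x y ∎
  where
  open ≡-Reasoning
  R = range (suc (suc k))
  c : ℕ → ℚ
  c i = dp i x * dp (suc k N.∸ i) y

 -- The terms i = k+1 and i = k of the binomial expansion; the remaining terms are nonnegative.
 dp-+-lower : ∀ k {x y} → 0ℚ ≤ x → 0ℚ ≤ y → dp (suc k) x + dp k x * y ≤ dp (suc k) (x + y)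
 dp-+-lower k {x} {y} hx hy = ≤-trans (≤-reflexive (cong₂ _+_ (sym e1) (trans (sym e2) (sym (+-identityʳ _)))))
   (≤-trans (+-monoʳ (f (suc k)) (+-monoʳ (f k) (Σ≥0 (range k) (λ i → 0≤* (dp≥0 i hx) (dp≥0 (suc k N.∸ i) hy)))))
    (≤-reflexive (sym (dp-+ (suc k) x y))))
  where
  f : ℕ → ℚ
  f i = dp i x * dp (suc k N.∸ i) y
  e1 : f (suc k) ≡ dp (suc k) x
  e1 = trans (cong (λ z → dp (suc k) x * dp z y) (NP.n∸n≡0 k)) (*-identityʳ _)
  e2 : f k ≡ dp k x * y
  e2 = cong (dp k x *_) (trans (cong (λ z → dp z y) (NP.m+n∸n≡m 1 k)) (trans (dp1 y) refl))
   where
   dp1 : ∀ y → dp 1 y ≡ y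
   dp1 y = trans (sym (*-identityˡ _)) (trans (cong (_* dp 1 y) (sym ι-1)) (trans (dp-suc 0 y) (*-identityʳ y)))

-- Prime factorisations, divisor sums, Möbius and von Mangoldt functions.

module Arith where

 open Q
 open Kit
 open import Data.Nat.ListAction using (product)
 open import Data.List.Relation.Binary.Permutation.Propositional using (_↭_; refl; prep; swap; ↭-sym) renaming (trans to ↭trans)
 open DecMem N._≟_ using (_∈?_)
 open PrimeFactorisation using (isFactorisation; factorsPrime)

 -- Prime factors with multiplicity, determined up to permutation. Arithmetic functions are
 -- therefore defined on lists and shown invariant under permutation. The value at 0 is a default.
 fs : ℕ → List ℕ
 fs zero = []
 fs n@(suc _) = factors (factorise n)

 fs-product : ∀ {n} → 1 N.≤ n → n ≡ product (fs n)
 fs-product {n@(suc _)} _ = isFactorisation (factorise n)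

 fs-prime : ∀ n → All Prime (fs n)
 fs-prime zero = []
 fs-prime n@(suc _) = factorsPrime (factorise n)

 fs-unique : ∀ {n} as → 1 N.≤ n → n ≡ product as → All Prime as → fs n ↭ as
 fs-unique {n@(suc _)} as _ e p = factorisationUnique (factorise n)
  (record { factors = as ; isFactorisation = e ; factorsPrime = p })

 fs-* : ∀ {m n} → 1 N.≤ m → 1 N.≤ n → fs (m N.* n) ↭ fs m ++ fs n
 fs-* {m} {n} p q = fs-unique (fs m ++ fs n) (NP.*-mono-≤ p q)
  (trans (cong₂ N._*_ (fs-product p) (fs-product q)) (sym (product-++ (fs m) (fs n))))
  (AllP.++⁺ (fs-prime m) (fs-prime n))

 prime≥1 : ∀ {p} → Prime p → 1 N.≤ p
 prime≥1 {p} pp = N.>-nonZero⁻¹ p {{prime⇒nonZero pp}}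

 prime≥2 : ∀ {p} → Prime p → 2 N.≤ p
 prime≥2 {p} pp = N.nonTrivial⇒n>1 p {{prime⇒nonTrivial pp}}

 fs-p* : ∀ {p n} → Prime p → 1 N.≤ n → fs (p N.* n) ↭ p ∷ fs n
 fs-p* {p} {n} pp q = fs-unique (p ∷ fs n) (NP.*-mono-≤ (prime≥1 pp) q) (cong (p N.*_) (fs-product q)) (pp ∷ fs-prime n)

 fs-p : ∀ {p} → Prime p → fs p ↭ p ∷ []
 fs-p {p} pp = fs-unique (p ∷ []) (prime≥1 pp) (sym (NP.*-identityʳ p)) (pp ∷ [])

 ∈-product : ∀ {p} as → p ∈ as → p ∣ product as
 ∈-product (a ∷ as) (here refl) = m∣m*n _
 ∈-product (a ∷ as) (there h) = ∣-trans (∈-product as h) (n∣m*n a)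

 ∈fs⇒∣ : ∀ {p n} → 1 N.≤ n → p ∈ fs n → p ∣ n
 ∈fs⇒∣ {p} {n} q h = subst (p ∣_) (sym (fs-product q)) (∈-product (fs n) h)

 ∣⇒∈fs : ∀ {p n} → Prime p → 1 N.≤ n → p ∣ n → p ∈ fs n
 ∣⇒∈fs {p} {n} pp q h = factorisationHasAllPrimeFactors pp (subst (p ∣_) (fs-product q) h) (fs-prime n)

 fs≡[]⇒1 : ∀ {n} → 1 N.≤ n → fs n ≡ [] → n ≡ 1
 fs≡[]⇒1 q e = trans (fs-product q) (cong product e)

 factor-induction : (P : ℕ → Set) → P 1 → (∀ p n → Prime p → 1 N.≤ n → P n → P (p N.* n)) → ∀ n → 1 N.≤ n → P n
 factor-induction P base step n q = subst P (sym (fs-product q)) (go (fs n) (fs-prime n))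
  where
  prod≥1 : ∀ as → All Prime as → 1 N.≤ product as
  prod≥1 [] [] = N.s≤s N.z≤n
  prod≥1 (a ∷ as) (p ∷ ps) = NP.*-mono-≤ (prime≥1 p) (prod≥1 as ps)
  go : ∀ as → All Prime as → P (product as)
  go [] [] = base
  go (a ∷ as) (p ∷ ps) = step a (product as) p (prod≥1 as ps) (go as ps)

 divisorSum : (ℕ → ℚ) → ℕ → ℚ
 divisorSum F n = Σ (range (suc n)) (λ d → χ (d ∣? n) * F d)

 ∣⇒≥1 : ∀ {d n} → 1 N.≤ n → d ∣ n → 1 N.≤ d
 ∣⇒≥1 {zero} {n} q (divides k e) = ⊥-elim (NP.<⇒≢ q (sym (trans e (NP.*-zeroʳ k))))
 ∣⇒≥1 {suc d} q h = N.s≤s N.z≤n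

 divisorSum-bound : ∀ F {n} X → 1 N.≤ n → n N.< X → Σ (range X) (λ d → χ (d ∣? n) * F d) ≡ divisorSum F n
 divisorSum-bound F {n} X q h = trans (cong (λ k → Σ (range k) f) (sym (NP.m∸n+n≡m h)))
  (trans (Σ-range-+ (X N.∸ suc n) (suc n) f)
  (trans (cong (_+ divisorSum F n) (Σ-0∈ (range (X N.∸ suc n)) (λ i _ →
    trans (cong (_* F (i N.+ suc n)) (χ-no (i N.+ suc n ∣? n) (λ dv → NP.<⇒≱ (NP.m≤n+m (suc n) i) (∣⇒≤ {{N.>-nonZero q}} dv)))) (*-zeroˡ _))))
   (+-identityˡ _)))
  where
  f : ℕ → ℚ
  f d = χ (d ∣? n) * F d

 χ-∣≡Σ : ∀ d {n} X → 1 N.≤ n → n N.< X → χ (d ∣? n) ≡ Σ (range X) (λ m → χ (d N.* m N.≟ n))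
 χ-∣≡Σ d {n} X q h with d ∣? n
 ... | no nd = sym (Σ-0∈ (range X) (λ m _ → χ-no (d N.* m N.≟ n) (λ e → nd (divides m (trans (sym e) (NP.*-comm d m))))))
 ... | yes dv@(divides k e) = sym (trans (Σ-cong (range X) (λ m → χ-⇔ (d N.* m N.≟ n) (m N.≟ k)
     (λ e' → NP.*-cancelˡ-≡ m k d {{N.>-nonZero d1}} (trans e' (trans e (NP.*-comm k d))))
     (λ { refl → trans (NP.*-comm d m) (sym e) }))) (Σ-range-χ k<X))
  where
  d1 : 1 N.≤ d
  d1 = ∣⇒≥1 q dv
  k<X : k N.< X
  k<X = NP.≤-<-trans (ℕ≤≡ (NP.m≤m*n k d {{N.>-nonZero d1}}) (sym e)) h

 -- Divisors of p n: those prime to p divide n, the others are p e with e ∣ n.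
 divisorSum-p* : ∀ F {p n} → Prime p → 1 N.≤ n →
  divisorSum F (p N.* n) ≡ divisorSum (λ d → χ (¬? (p ∣? d)) * F d) n + divisorSum (λ e → F (p N.* e)) n
 divisorSum-p* F {p} {n} pp q = begin
  Σ (range X) (λ d → χ (d ∣? p N.* n) * F d)
   ≡⟨ Σ-cong (range X) (λ d → split d) ⟩
  Σ (range X) (λ d → χ (d ∣? n) * (χ (¬? (p ∣? d)) * F d) + χ (d ∣? p N.* n) * (χ (p ∣? d) * F d))
   ≡⟨ Σ-+ (range X) _ _ ⟩
  Σ (range X) (λ d → χ (d ∣? n) * (χ (¬? (p ∣? d)) * F d)) + Σ (range X) (λ d → χ (d ∣? p N.* n) * (χ (p ∣? d) * F d))
   ≡⟨ cong₂ _+_ (divisorSum-bound _ X q (N.s≤s (NP.m≤n*m n p {{prime⇒nonZero pp}}))) second ⟩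
  divisorSum (λ d → χ (¬? (p ∣? d)) * F d) n + divisorSum (λ e → F (p N.* e)) n ∎
  where
  open ≡-Reasoning
  X : ℕ
  X = suc (p N.* n)
  pn≥1 : 1 N.≤ p N.* n
  pn≥1 = NP.*-mono-≤ (prime≥1 pp) q
  split : ∀ d → χ (d ∣? p N.* n) * F d ≡ χ (d ∣? n) * (χ (¬? (p ∣? d)) * F d) + χ (d ∣? p N.* n) * (χ (p ∣? d) * F d)
  split d with p ∣? d
  ... | yes h = id36 (χ (d ∣? p N.* n)) (F d) (χ (d ∣? n))
  ... | no h = trans (cong (_* F d) (χ-⇔ (d ∣? p N.* n) (d ∣? n) down (λ k → ∣-trans k (n∣m*n p)))) (id37 (χ (d ∣? n)) (F d) (χ (d ∣? p N.* n)))
   where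
   down : d ∣ p N.* n → d ∣ n
   down (divides k e) with euclidsLemma k d pp (divides n (trans (sym e) (NP.*-comm p n)))
   ... | inj₂ pd = ⊥-elim (h pd)
   ... | inj₁ (divides j e') = divides j (NP.*-cancelˡ-≡ n (j N.* d) p {{prime⇒nonZero pp}}
     (trans e (trans (cong (N._* d) (trans e' (NP.*-comm j p))) (NP.*-assoc p j d))))
  second : Σ (range X) (λ d → χ (d ∣? p N.* n) * (χ (p ∣? d) * F d)) ≡ divisorSum (λ e → F (p N.* e)) n
  second = begin
   Σ (range X) (λ d → χ (d ∣? p N.* n) * (χ (p ∣? d) * F d))
    ≡⟨ Σ-cong∈ (range X) step ⟩
   Σ (range X) (λ d → Σ (range X) (λ e → χ (d N.≟ p N.* e) * (χ (e ∣? n) * F (p N.* e))))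
    ≡⟨ Σ-swap (range X) (range X) _ ⟩
   Σ (range X) (λ e → Σ (range X) (λ d → χ (d N.≟ p N.* e) * (χ (e ∣? n) * F (p N.* e))))
    ≡⟨ Σ-cong∈ (range X) (λ e e∈ → step2 e (∈range e∈)) ⟩
   Σ (range X) (λ e → χ (e ∣? n) * F (p N.* e))
    ≡⟨ divisorSum-bound (λ e → F (p N.* e)) X q (N.s≤s (NP.m≤n*m n p {{prime⇒nonZero pp}})) ⟩
   divisorSum (λ e → F (p N.* e)) n ∎
   where
   step : ∀ d → d ∈ range X → χ (d ∣? p N.* n) * (χ (p ∣? d) * F d) ≡ Σ (range X) (λ e → χ (d N.≟ p N.* e) * (χ (e ∣? n) * F (p N.* e)))
   step d d∈ with 1 N.≤? d
   ... | no d0 = trans (cong (_* (χ (p ∣? d) * F d)) (χ-no (d ∣? p N.* n) (λ dv → d0 (∣⇒≥1 pn≥1 dv)))) (trans (*-zeroˡ _)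
      (sym (Σ-0∈ (range X) (λ e _ → zz e))))
    where
    zz : ∀ e → χ (d N.≟ p N.* e) * (χ (e ∣? n) * F (p N.* e)) ≡ 0ℚ
    zz e with e ∣? n
    ... | no _ = trans (cong (χ (d N.≟ p N.* e) *_) (*-zeroˡ _)) (*-zeroʳ _)
    ... | yes en = trans (cong (_* (1ℚ * F (p N.* e))) (χ-no (d N.≟ p N.* e)
        (λ eq → d0 (subst (1 N.≤_) (sym eq) (NP.*-mono-≤ (prime≥1 pp) (∣⇒≥1 q en)))))) (*-zeroˡ _)
   ... | yes d1 = begin
     χ (d ∣? p N.* n) * (χ (p ∣? d) * F d)
      ≡⟨ cong (λ z → χ (d ∣? p N.* n) * (z * F d)) (χ-∣≡Σ p X d1 (∈range d∈)) ⟩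
     χ (d ∣? p N.* n) * (Σ (range X) (λ e → χ (p N.* e N.≟ d)) * F d)
      ≡⟨ cong (χ (d ∣? p N.* n) *_) (sym (Σ-*ʳ (range X) (F d) _)) ⟩
     χ (d ∣? p N.* n) * Σ (range X) (λ e → χ (p N.* e N.≟ d) * F d)
      ≡⟨ sym (Σ-*ˡ (range X) _ _) ⟩
     Σ (range X) (λ e → χ (d ∣? p N.* n) * (χ (p N.* e N.≟ d) * F d))
      ≡⟨ Σ-cong (range X) (λ e → trans (id8 _ _ _) (trans (cong (_* (χ (d ∣? p N.* n) * F d)) (χ-⇔ (p N.* e N.≟ d) (d N.≟ p N.* e) sym sym))
         (χ-subst (d N.≟ p N.* e) (λ { refl → cong (_* F (p N.* e)) (χ-⇔ (p N.* e ∣? p N.* n) (e ∣? n) (*-cancelˡ-∣ p {{prime⇒nonZero pp}}) (*-monoʳ-∣ p)) })))) ⟩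
     Σ (range X) (λ e → χ (d N.≟ p N.* e) * (χ (e ∣? n) * F (p N.* e))) ∎
   step2 : ∀ e → e N.< X → Σ (range X) (λ d → χ (d N.≟ p N.* e) * (χ (e ∣? n) * F (p N.* e))) ≡ χ (e ∣? n) * F (p N.* e)
   step2 e _ with e ∣? n
   ... | no _ = trans (Σ-0∈ (range X) (λ d _ → trans (cong (χ (d N.≟ p N.* e) *_) (*-zeroˡ _)) (*-zeroʳ _))) (sym (*-zeroˡ _))
   ... | yes en = trans (Σ-*ʳ (range X) _ _) (trans (cong (_* (1ℚ * F (p N.* e))) (Σ-range-χ (N.s≤s (NP.*-monoʳ-≤ p (∣⇒≤ {{N.>-nonZero q}} en))))) (*-identityˡ _))

 -- The Möbius function on factor lists: a repeated prime gives 0, a new one changes the sign.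
 μL : List ℕ → ℚ
 μL [] = 1ℚ
 μL (p ∷ ps) = χ (¬? (p ∈? ps)) * - μL ps

 private
  ∈-↭ : ∀ {p} {xs ys : List ℕ} → xs ↭ ys → p ∈ xs → p ∈ ys
  ∈-↭ = PermP.∈-resp-↭

 μL-↭ : ∀ {xs ys} → xs ↭ ys → μL xs ≡ μL ys
 μL-↭ refl = refl
 μL-↭ (prep {xs} {ys} x h) = cong₂ (λ a b → a * - b) (χ-⇔ (¬? (x ∈? xs)) (¬? (x ∈? ys)) (λ n m → n (∈-↭ (↭-sym h) m)) (λ n m → n (∈-↭ h m))) (μL-↭ h)
 μL-↭ (swap {xs} {ys} x y h) = trans (cong₂ (λ a b → χ (¬? (x ∈? y ∷ xs)) * - (a * - b))
   (χ-⇔ (¬? (y ∈? xs)) (¬? (y ∈? ys)) (λ n m → n (∈-↭ (↭-sym h) m)) (λ n m → n (∈-↭ h m))) (μL-↭ h))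
   (trans (id42 _ _ _) (trans (cong (_* μL ys) inner) (sym (id42 _ _ _))))
  where
  inner : χ (¬? (x ∈? y ∷ xs)) * χ (¬? (y ∈? ys)) ≡ χ (¬? (y ∈? x ∷ ys)) * χ (¬? (x ∈? ys))
  inner = trans (sym (χ-× (¬? (x ∈? y ∷ xs)) (¬? (y ∈? ys)))) (trans (χ-⇔ (¬? (x ∈? y ∷ xs) ×-dec ¬? (y ∈? ys)) (¬? (y ∈? x ∷ ys) ×-dec ¬? (x ∈? ys))
   (λ { (a , b) → (λ { (here e) → a (here (sym e)) ; (there m) → b m }) , (λ m → a (there (∈-↭ (↭-sym h) m))) })
   (λ { (a , b) → (λ { (here e) → a (here (sym e)) ; (there m) → b (∈-↭ h m) }) , (λ m → a (there m)) }))
   (χ-× (¬? (y ∈? x ∷ ys)) (¬? (x ∈? ys))))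
 μL-↭ (↭trans h k) = trans (μL-↭ h) (μL-↭ k)

 μL≤1 : ∀ xs → ∣ μL xs ∣ ≤ 1ℚ
 μL≤1 [] = ≤-reflexive (∣∣-nonneg 0≤1)
 μL≤1 (p ∷ ps) = subst (∣ μL (p ∷ ps) ∣ ≤_) (*-identityˡ 1ℚ)
  (abs-* (≡≤ (∣∣-nonneg (χ≥0 (¬? (p ∈? ps)))) (χ≤1 (¬? (p ∈? ps)))) (abs-neg (μL≤1 ps)))

 μ : ℕ → ℚ
 μ n = μL (fs n)

 μ≤1 : ∀ n → ∣ μ n ∣ ≤ 1ℚ
 μ≤1 n = μL≤1 (fs n)

 χ-∈fs : ∀ {p n} → Prime p → 1 N.≤ n → χ (¬? (p ∈? fs n)) ≡ χ (¬? (p ∣? n))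
 χ-∈fs {p} {n} pp q = χ-⇔ (¬? (p ∈? fs n)) (¬? (p ∣? n)) (λ h d → h (∣⇒∈fs pp q d)) (λ h d → h (∈fs⇒∣ q d))

 μ-p* : ∀ {p n} → Prime p → 1 N.≤ n → μ (p N.* n) ≡ - (χ (¬? (p ∣? n)) * μ n)
 μ-p* {p} {n} pp q = trans (μL-↭ (fs-p* pp q)) (trans (cong (_* - μ n) (χ-∈fs pp q)) (sym (neg-distribʳ-* _ _)))

 divisorSum-neg : ∀ F n → divisorSum (λ d → - F d) n ≡ - divisorSum F n
 divisorSum-neg F n = trans (Σ-cong (range (suc n)) (λ d → sym (neg-distribʳ-* _ _))) (Σ-neg (range (suc n)) _)

 divisorSum-cong : ∀ {F H n} → 1 N.≤ n → (∀ d → 1 N.≤ d → d ∣ n → F d ≡ H d) → divisorSum F n ≡ divisorSum H n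
 divisorSum-cong {n = n} q h = Σ-cong (range (suc n)) (λ d → χ-subst (d ∣? n) (λ dv → h d (∣⇒≥1 q dv) dv))

 divisorSum-+ : ∀ F H n → divisorSum (λ d → F d + H d) n ≡ divisorSum F n + divisorSum H n
 divisorSum-+ F H n = trans (Σ-cong (range (suc n)) (λ d → *-distribˡ-+ _ _ _)) (Σ-+ (range (suc n)) _ _)

 divisorSum-1 : ∀ F → divisorSum F 1 ≡ F 1
 divisorSum-1 F = id43 (F 1) (F 0)

 -- For p n, the divisors prime to p and the divisors p e cancel, since μ(p e) = -μ(e) when p does
 -- not divide e and 0 otherwise.
 μ-sum : ∀ n → 1 N.≤ n → divisorSum μ n ≡ χ (n N.≟ 1)
 μ-sum = factor-induction (λ n → divisorSum μ n ≡ χ (n N.≟ 1)) (divisorSum-1 μ) step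
  where
  step : ∀ p n → Prime p → 1 N.≤ n → divisorSum μ n ≡ χ (n N.≟ 1) → divisorSum μ (p N.* n) ≡ χ (p N.* n N.≟ 1)
  step p n pp q _ = trans (divisorSum-p* μ pp q) (trans (cong (divisorSum _ n +_)
    (trans (divisorSum-cong q (λ d d1 _ → μ-p* pp d1)) (divisorSum-neg _ n)))
   (trans (+-inverseʳ _) (sym (χ-no (p N.* n N.≟ 1) (λ e → NP.<⇒≢ (NP.≤-trans (prime≥2 pp) (NP.m≤m*n p n {{N.>-nonZero q}})) (sym e))))))

 module Additive (lg : ℕ → ℚ) (lg≥0 : ∀ p → 0ℚ ≤ lg p) where

  lam : ℕ → ℚ
  lam n = Σ (fs n) lg

  Σ-++ : ∀ (xs ys : List ℕ) f → Σ (xs ++ ys) f ≡ Σ xs f + Σ ys f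
  Σ-++ [] ys f = sym (+-identityˡ _)
  Σ-++ (x ∷ xs) ys f = trans (cong (f x +_) (Σ-++ xs ys f)) (sym (+-assoc _ _ _))

  Σ-↭ : ∀ {xs ys : List ℕ} f → xs ↭ ys → Σ xs f ≡ Σ ys f
  Σ-↭ f refl = refl
  Σ-↭ f (prep x h) = cong (f x +_) (Σ-↭ f h)
  Σ-↭ f (swap {xs} {ys} x y h) = trans (cong (λ z → f x + (f y + z)) (Σ-↭ f h)) (id38 (f x) (f y) (Σ ys f))
  Σ-↭ f (↭trans h k) = trans (Σ-↭ f h) (Σ-↭ f k)

  lam-* : ∀ {m n} → 1 N.≤ m → 1 N.≤ n → lam (m N.* n) ≡ lam m + lam n
  lam-* {m} {n} p q = trans (Σ-↭ lg (fs-* p q)) (Σ-++ (fs m) (fs n) lg)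

  lam-p : ∀ {p} → Prime p → lam p ≡ lg p
  lam-p pp = trans (Σ-↭ lg (fs-p pp)) (+-identityʳ _)

  lam≥0 : ∀ n → 0ℚ ≤ lam n
  lam≥0 n = Σ≥0 (fs n) lg≥0

  -- The von Mangoldt function on factor lists, with `lg` for the logarithm: nonzero only if all
  -- factors coincide.
  ΛL : List ℕ → ℚ
  ΛL [] = 0ℚ
  ΛL (p ∷ ps) = χ (all? (p N.≟_) ps) * lg p

  ΛL-↭ : ∀ {xs ys} → xs ↭ ys → ΛL xs ≡ ΛL ys
  ΛL-↭ refl = refl
  ΛL-↭ (prep {xs} {ys} x h) = cong (_* lg x) (χ-⇔ (all? (x N.≟_) xs) (all? (x N.≟_) ys) (PermP.All-resp-↭ h) (PermP.All-resp-↭ (↭-sym h)))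
  ΛL-↭ (swap {xs} {ys} x y h) = by (x N.≟ y)
   where
   by : Dec (x ≡ y) → ΛL (x ∷ y ∷ xs) ≡ ΛL (y ∷ x ∷ ys)
   by (yes refl) = cong (_* lg x) (χ-⇔ (all? (x N.≟_) (x ∷ xs)) (all? (x N.≟_) (x ∷ ys)) (PermP.All-resp-↭ (prep x h)) (PermP.All-resp-↭ (↭-sym (prep x h))))
   by (no ne) = trans (cong (_* lg x) (χ-no (all? (x N.≟_) (y ∷ xs)) (λ { (e ∷ _) → ne e })))
    (trans (*-zeroˡ _) (sym (trans (cong (_* lg y) (χ-no (all? (y N.≟_) (x ∷ ys)) (λ { (e ∷ _) → ne (sym e) }))) (*-zeroˡ _))))
  ΛL-↭ (↭trans h k) = trans (ΛL-↭ h) (ΛL-↭ k)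

  Λ : ℕ → ℚ
  Λ n = ΛL (fs n)

  Λ≥0 : ∀ n → 0ℚ ≤ Λ n
  Λ≥0 n with fs n
  ... | [] = ≤-refl
  ... | p ∷ ps = 0≤* (χ≥0 (all? (p N.≟_) ps)) (lg≥0 p)

  ΛL≤ : ∀ xs → ΛL xs ≤ Σ xs lg
  ΛL≤ [] = ≤-refl
  ΛL≤ (p ∷ ps) = ≤-trans (χ*≤ (all? (p N.≟_) ps) (lg≥0 p)) (subst (_≤ lg p + Σ ps lg) (+-identityʳ _) (+-monoʳ (lg p) (Σ≥0 ps lg≥0)))

  Λ≤lam : ∀ n → Λ n ≤ lam n
  Λ≤lam n = ΛL≤ (fs n)

  ΛL-∷ : ∀ p l → ΛL (p ∷ l) ≡ χ (p ∈? l) * ΛL l + χ (length l N.≟ 0) * lg p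
  ΛL-∷ p [] = id39 (lg p)
  ΛL-∷ p (q ∷ l) = by (p N.≟ q)
   where
   d : Dec (All (p ≡_) (q ∷ l))
   d = all? (p N.≟_) (q ∷ l)
   by : Dec (p ≡ q) → ΛL (p ∷ q ∷ l) ≡ χ (p ∈? q ∷ l) * ΛL (q ∷ l) + 0ℚ * lg p
   by (yes refl) = trans (cong (_* lg p) (χ-⇔ d (all? (p N.≟_) l) All.tail (refl ∷_)))
    (trans (id40 (χ (all? (p N.≟_) l)) (lg p)) (cong (λ z → z * (χ (all? (p N.≟_) l) * lg p) + 0ℚ * lg p) (sym (χ-yes (p ∈? p ∷ l) (here refl)))))
   by (no ne) = trans (cong (_* lg p) (χ-no d (λ { (e ∷ _) → ne e }))) (trans (sym (id41 (lg p)))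
     (cong (_+ 0ℚ * lg p) (sym rest)))
    where
    rest : χ (p ∈? q ∷ l) * (χ (all? (q N.≟_) l) * lg q) ≡ 0ℚ
    rest = trans (sym (*-assoc _ _ _)) (trans (cong (_* lg q) (trans (sym (χ-× (p ∈? q ∷ l) (all? (q N.≟_) l)))
     (χ-no (p ∈? q ∷ l ×-dec all? (q N.≟_) l) (λ { (here e , _) → ne e ; (there m , a) → ne (sym (All.lookup a m)) })))) (*-zeroˡ _))

  Λ-p* : ∀ {p n} → Prime p → 1 N.≤ n → Λ (p N.* n) ≡ χ (p ∣? n) * Λ n + χ (n N.≟ 1) * lg p
  Λ-p* {p} {n} pp q = trans (ΛL-↭ (fs-p* pp q)) (trans (ΛL-∷ p (fs n)) (cong₂ (λ a b → a * Λ n + b * lg p)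
   (χ-⇔ (p ∈? fs n) (p ∣? n) (∈fs⇒∣ q) (∣⇒∈fs pp q))
   (χ-⇔ (length (fs n) N.≟ 0) (n N.≟ 1) (λ e → fs≡[]⇒1 q (len0 (fs n) e)) (λ { refl → refl }))))
   where
   len0 : ∀ (l : List ℕ) → length l ≡ 0 → l ≡ []
   len0 [] _ = refl

  -- For the divisors p e of p n one has Λ(p e) = Λ(e) if p divides e, plus `lg p` if e = 1. The
  -- first part completes the sum over divisors prime to p to the full sum for n; the second adds
  -- the logarithm of p.
  Λ-sum : ∀ n → 1 N.≤ n → divisorSum Λ n ≡ lam n
  Λ-sum = factor-induction (λ n → divisorSum Λ n ≡ lam n) (divisorSum-1 Λ) step
   where
   step : ∀ p n → Prime p → 1 N.≤ n → divisorSum Λ n ≡ lam n → divisorSum Λ (p N.* n) ≡ lam (p N.* n)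
   step p n pp q ih = begin
    divisorSum Λ (p N.* n) ≡⟨ divisorSum-p* Λ pp q ⟩
    divisorSum (λ d → χ (¬? (p ∣? d)) * Λ d) n + divisorSum (λ e → Λ (p N.* e)) n
     ≡⟨ cong (divisorSum (λ d → χ (¬? (p ∣? d)) * Λ d) n +_) (trans (divisorSum-cong q (λ d d1 _ → Λ-p* pp d1)) (divisorSum-+ _ _ n)) ⟩
    divisorSum (λ d → χ (¬? (p ∣? d)) * Λ d) n + (divisorSum (λ d → χ (p ∣? d) * Λ d) n + divisorSum (λ e → χ (e N.≟ 1) * lg p) n)
     ≡⟨ sym (+-assoc _ _ _) ⟩
    (divisorSum (λ d → χ (¬? (p ∣? d)) * Λ d) n + divisorSum (λ d → χ (p ∣? d) * Λ d) n) + divisorSum (λ e → χ (e N.≟ 1) * lg p) n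
     ≡⟨ cong₂ _+_ (trans (sym (divisorSum-+ _ _ n)) (divisorSum-cong q (λ d _ _ → compl d))) one ⟩
    divisorSum Λ n + lg p ≡⟨ cong (_+ lg p) ih ⟩
    lam n + lg p ≡⟨ +-comm _ _ ⟩
    lg p + lam n ≡⟨ sym (cong (_+ lam n) (lam-p pp)) ⟩
    lam p + lam n ≡⟨ sym (lam-* (prime≥1 pp) q) ⟩
    lam (p N.* n) ∎
    where
    open ≡-Reasoning
    compl : ∀ d → χ (¬? (p ∣? d)) * Λ d + χ (p ∣? d) * Λ d ≡ Λ d
    compl d with p ∣? d
    ... | yes _ = id34 (Λ d)
    ... | no _ = id35 (Λ d)
    one : divisorSum (λ e → χ (e N.≟ 1) * lg p) n ≡ lg p
    one = trans (Σ-cong (range (suc n)) (λ d → trans (id8 _ _ _) (χ-subst (d N.≟ 1) {b = lg p} (λ { refl → trans (cong (_* lg p) (χ-yes (1 ∣? n) (1∣ n))) (*-identityˡ _) }))))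
     (trans (Σ-*ʳ (range (suc n)) (lg p) _) (trans (cong (_* lg p) (Σ-range-χ (N.s≤s q))) (*-identityˡ _)))

  Λ-support : ∀ n → 1 N.≤ n → (Λ n ≡ 0ℚ) ⊎ (∃[ p ] (Prime p × p ∈ fs n × All (p ≡_) (fs n) × Λ n ≡ lg p))
  Λ-support n q with fs n | fs-prime n
  ... | [] | _ = inj₁ refl
  ... | p ∷ ps | pp ∷ _ with all? (p N.≟_) ps
  ... | yes a = inj₂ (p , pp , here refl , refl ∷ a , *-identityˡ (lg p))
  ... | no _ = inj₁ (*-zeroˡ (lg p))

-- Residue classes and Brun's pure sieve.

module Sieve where

 open Q
 open Kit
 open DividedPower

 module Congruence (Q : ℕ) {{_ : NonZero Q}} where

  infix 4 _≈_ _≈?_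
  _≈_ : ℕ → ℕ → Set
  a ≈ b = a % Q ≡ b % Q

  _≈?_ : ∀ a b → Dec (a ≈ b)
  a ≈? b = a % Q N.≟ b % Q

  +-≈ : ∀ {a b c d} → a ≈ b → c ≈ d → a N.+ c ≈ b N.+ d
  +-≈ {a} {b} {c} {d} p q = trans (%-distribˡ-+ a c Q) (trans (cong₂ (λ x y → (x N.+ y) % Q) p q) (sym (%-distribˡ-+ b d Q)))

  *-≈ : ∀ {a b c d} → a ≈ b → c ≈ d → a N.* c ≈ b N.* d
  *-≈ {a} {b} {c} {d} p q = trans (%-distribˡ-* a c Q) (trans (cong₂ (λ x y → (x N.* y) % Q) p q) (sym (%-distribˡ-* b d Q)))

  %-≈ : ∀ a → a % Q ≈ a
  %-≈ a = m%n%n≡m%n a Q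

  +kQ-≈ : ∀ a k → a N.+ k N.* Q ≈ a
  +kQ-≈ a k = [m+kn]%n≡m%n a k Q

  inverse : ∀ c → Coprime c Q → ∃[ c' ] (c' N.* c ≈ 1)
  inverse c cop with coprime-Bézout cop
  ... | Bézout.+- x y e = x , trans (cong (_% Q) (sym e)) (+kQ-≈ 1 y)
  -- Here 1 + x c = y Q, so the inverse is -x, represented by x (Q - 1).
  ... | Bézout.-+ x y e = (x N.* (Q N.∸ 1)) , trans (sym (+kQ-≈ _ y)) (trans (cong (λ z → (x N.* (Q N.∸ 1) N.* c N.+ z) % Q) (sym e))
    (trans (cong (_% Q) lem) (+kQ-≈ 1 (x N.* c))))
   where
   open import Data.Nat.Tactic.RingSolver using () renaming (solve-∀ to solveℕ)
   re : ∀ x q c → x N.* q N.* c N.+ (1 N.+ x N.* c) ≡ 1 N.+ x N.* c N.* suc q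
   re = solveℕ
   lem : x N.* (Q N.∸ 1) N.* c N.+ (1 N.+ x N.* c) ≡ 1 N.+ x N.* c N.* Q
   lem = trans (re x (Q N.∸ 1) c) (cong (λ z → 1 N.+ x N.* c N.* z) (NP.m+[n∸m]≡n (N.>-nonZero⁻¹ Q)))

  cancel-≈ : ∀ {c a b} → Coprime c Q → c N.* a ≈ c N.* b → a ≈ b
  cancel-≈ {c} {a} {b} cop h with inverse c cop
  ... | c' , e = trans (sym (go a)) (trans (trans (cong (_% Q) (NP.*-assoc c' c a)) (trans (*-≈ {c'} refl h) (cong (_% Q) (sym (NP.*-assoc c' c b))))) (go b))
   where
   go : ∀ a → c' N.* c N.* a ≈ a
   go a = trans (*-≈ {c' N.* c} {1} {a} {a} e refl) (cong (_% Q) (NP.*-identityˡ a))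

  block : ∀ x d → Σ (range Q) (λ i → χ (i N.+ x ≈? d)) ≡ 1ℚ
  block x d = trans (Σ-cong∈ (range Q) (λ i i∈ → χ-⇔ (i N.+ x ≈? d) (i N.≟ r) (λ h → trans (sym (m<n⇒m%n≡m (∈range i∈))) (fwd i h))
    (λ { refl → bwd }))) (Σ-range-χ (m%n<n _ Q))
   where
   r : ℕ
   r = (d N.+ x N.* (Q N.∸ 1)) % Q
   xQ : ∀ i → i N.+ x N.+ x N.* (Q N.∸ 1) ≡ i N.+ x N.* Q
   xQ i = trans (NP.+-assoc i x _) (cong (i N.+_) (trans (sym (NP.*-suc x _)) (cong (x N.*_) (NP.m+[n∸m]≡n (N.>-nonZero⁻¹ Q)))))
   fwd : ∀ i → i N.+ x ≈ d → i % Q ≡ r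
   fwd i h = trans (sym (+kQ-≈ i x)) (trans (cong (_% Q) (sym (xQ i))) (+-≈ {i N.+ x} {d} h refl))
   bwd : r N.+ x ≈ d
   bwd = trans (+-≈ {r} {d N.+ x N.* (Q N.∸ 1)} {x} (%-≈ _) refl) (trans (cong (_% Q) (trans (NP.+-assoc d _ x)
    (trans (cong (d N.+_) (NP.+-comm _ x)) (trans (sym (NP.+-assoc d x _)) (xQ d))))) (+kQ-≈ d x))

  count : ℕ → ℕ → ℚ
  count x d = Σ (range x) (λ m → χ (m ≈? d))

  count-blocks : ∀ q r d → count (q N.* Q N.+ r) d ≡ ι q + count r d
  count-blocks zero r d = sym (trans (cong (_+ count r d) ι-0) (+-identityˡ _))
  count-blocks (suc q) r d = trans (cong (λ z → count z d) (NP.+-assoc Q (q N.* Q) r)) (trans (Σ-range-+ Q (q N.* Q N.+ r) _)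
   (trans (cong₂ _+_ (block (q N.* Q N.+ r) d) (count-blocks q r d)) (trans (sym (+-assoc _ _ _)) (cong (_+ count r d) (sym (ι-suc q))))))

  count≥0 : ∀ x d → 0ℚ ≤ count x d
  count≥0 x d = Σ≥0 (range x) (λ m → χ≥0 (m ≈? d))

  count-short : ∀ r d → r N.≤ Q → count r d ≤ 1ℚ
  count-short r d h = ≤≡ (subst (count r d ≤_) (sym e) (≤+ˡ (Σ≥0 (range (Q N.∸ r)) (λ i → χ≥0 (i N.+ r ≈? d)))))
   (trans (Σ-cong (range Q) (λ i → cong (λ z → χ (z ≈? d)) (sym (NP.+-identityʳ i)))) (block 0 d))
   where
   e : count Q d ≡ Σ (range (Q N.∸ r)) (λ i → χ (i N.+ r ≈? d)) + count r d
   e = trans (cong (λ z → count z d) (sym (NP.m∸n+n≡m h))) (Σ-range-+ (Q N.∸ r) r _)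

  count-upper : ∀ x d → count x d ≤ ι x * rec Q + 1ℚ
  count-upper x d = ≡≤ (trans (cong (λ z → count z d) xe) (count-blocks (x / Q) (x % Q) d))
   (+-mono (≡≤ (sym e2) (*-monoʳ (rec Q) (rec≥0 Q) (ι-mono (m/n*n≤m x Q)))) (count-short (x % Q) d (NP.<⇒≤ (m%n<n x Q))))
   where
   xe : x ≡ x / Q N.* Q N.+ x % Q
   xe = trans (m≡m%n+[m/n]*n x Q) (NP.+-comm (x % Q) _)
   e2 : ι (x / Q N.* Q) * rec Q ≡ ι (x / Q)
   e2 = trans (cong (_* rec Q) (ι-* (x / Q) Q)) (trans (*-assoc _ _ _) (trans (cong (ι (x / Q) *_) (ι*rec (N.>-nonZero⁻¹ Q))) (*-identityʳ _)))

  count-lower : ∀ x d → ι x * rec Q ≤ count x d + 1ℚ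
  count-lower x d = ≤-trans (*-monoʳ (rec Q) (rec≥0 Q) (ι-mono (ℕ≡≤ xe (NP.+-monoʳ-≤ (x / Q N.* Q) (NP.<⇒≤ (m%n<n x Q))))))
   (≡≤ e2 (+-monoˡ 1ℚ (≤≡ (≤+ʳ {b = ι (x / Q)} (count≥0 (x % Q) d))
    (sym (trans (cong (λ z → count z d) xe) (count-blocks (x / Q) (x % Q) d))))))
   where
   xe : x ≡ x / Q N.* Q N.+ x % Q
   xe = trans (m≡m%n+[m/n]*n x Q) (NP.+-comm (x % Q) _)
   e2 : ι (x / Q N.* Q N.+ Q) * rec Q ≡ ι (x / Q) + 1ℚ
   e2 = trans (cong (_* rec Q) (trans (ι-+ _ Q) (cong (_+ ι Q) (ι-* (x / Q) Q)))) (trans (id45 (ι (x / Q)) (ι Q) (rec Q))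
     (trans (cong (λ z → ι (x / Q) * z + z) (ι*rec (N.>-nonZero⁻¹ Q))) (cong (_+ 1ℚ) (*-identityʳ _))))

  -- Brun's pure sieve: numbers m < x with c m ≡ b (mod Q) prime to all members of ps

  sifted? : ∀ ps m → Dec (All (λ p → ¬ (p ∣ m)) ps)
  sifted? ps m = all? (λ p → ¬? (p ∣? m)) ps

  F : List ℕ → ℕ → ℕ → ℕ → ℚ
  F ps c b x = Σ (range x) (λ m → χ (c N.* m ≈? b) * χ (sifted? ps m))

  V : List ℕ → ℚ
  V [] = 1ℚ
  V (p ∷ ps) = (1ℚ - rec p) * V ps

  F[]-eq : ∀ c b → Coprime c Q → ∃[ d ] (∀ x → F [] c b x ≡ count x d)
  F[]-eq c b cop = c' N.* b , λ x → Σ-cong (range x) (λ m → trans (*-identityʳ _) (χ-⇔ (c N.* m ≈? b) (m ≈? c' N.* b) (fwd m) (bwd m)))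
   where
   c' : ℕ
   c' = proj₁ (inverse c cop)
   e : c' N.* c ≈ 1
   e = proj₂ (inverse c cop)
   fwd : ∀ m → c N.* m ≈ b → m ≈ c' N.* b
   fwd m h = trans (cong (_% Q) (sym (NP.*-identityˡ m))) (trans (*-≈ {1} {c' N.* c} {m} (sym e) refl)
    (trans (cong (_% Q) (NP.*-assoc c' c m)) (*-≈ {c'} refl h)))
   bwd : ∀ m → m ≈ c' N.* b → c N.* m ≈ b
   bwd m h = trans (*-≈ {c} refl h) (trans (cong (_% Q) (trans (sym (NP.*-assoc c c' b)) (cong (N._* b) (NP.*-comm c c'))))
    (trans (*-≈ {c' N.* c} {1} {b} e refl) (cong (_% Q) (NP.*-identityˡ b))))

  data Sieving : List ℕ → Set where
   [] : Sieving []
   _∷_ : ∀ {p ps} → (Prime p × Coprime p Q × All (λ q → Prime q × q ≢ p) ps) → Sieving ps → Sieving (p ∷ ps)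

  -- A majorant for the rounding errors that accumulate when inclusion-exclusion over t primes is
  -- cut at depth r; the closed form is chosen to satisfy `A-step`.
  A : ℕ → ℕ → ℚ
  A t r = (ι 3 * ι (suc t)) ^ r

  h : List ℕ → ℚ
  h ps = Σ ps rec

  h≥0 : ∀ ps → 0ℚ ≤ h ps
  h≥0 ps = Σ≥0 ps rec≥0

  1-rec≥0 : ∀ p → 1 N.≤ p → 0ℚ ≤ 1ℚ - rec p
  1-rec≥0 (suc p) _ = ≤⇒0≤ (rec≤1 p)

  V≥0 : ∀ {ps} → Sieving ps → 0ℚ ≤ V ps
  V≥0 [] = 0≤1
  V≥0 {p ∷ ps} ((pp , _) ∷ s) = 0≤* (1-rec≥0 p (N.>-nonZero⁻¹ p {{prime⇒nonZero pp}})) (V≥0 s)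

  V≤1 : ∀ {ps} → Sieving ps → V ps ≤ 1ℚ
  V≤1 [] = ≤-refl
  V≤1 {p ∷ ps} ((pp , _) ∷ s) = subst (V (p ∷ ps) ≤_) (*-identityˡ 1ℚ) (*-mono (1-rec≥0 p (N.>-nonZero⁻¹ p {{prime⇒nonZero pp}})) (V≥0 s)
    (id55 (rec p) via rec≥0 p) (V≤1 s))

  private
   m<[1+m/n]*n : ∀ m n .{{_ : NonZero n}} → m N.< suc (m / n) N.* n
   m<[1+m/n]*n m n = NP.≤-<-trans (NP.≤-reflexive (m≡m%n+[m/n]*n m n)) (NP.+-monoˡ-< (m / n N.* n) (m%n<n m n))

  -- With y = ⌈x/p⌉ the multiples of p below x are exactly the p m with m < y.
  ceil : ∀ x p .{{_ : NonZero p}} → ∃[ y ] ((x N.≤ p N.* y) × (p N.* y N.≤ x N.+ p) × (∀ m → m N.< y → p N.* m N.< x))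
  ceil x p = y , low , high , below
   where
   y = (x N.+ (p N.∸ 1)) / p
   p1 : p N.∸ 1 N.+ 1 ≡ p
   p1 = NP.m∸n+n≡m (N.>-nonZero⁻¹ p)
   high : p N.* y N.≤ x N.+ p
   high = ℕ≡≤ (NP.*-comm p y) (NP.≤-trans (m/n*n≤m _ p) (NP.+-monoʳ-≤ x (NP.m∸n≤m p 1)))
   low : x N.≤ p N.* y
   low = NP.+-cancelʳ-≤ (p N.∸ 1) x (p N.* y) (NP.≤-pred (ℕ≤≡ (m<[1+m/n]*n (x N.+ (p N.∸ 1)) p)
     (trans (NP.+-comm p (y N.* p)) (trans (cong₂ N._+_ (NP.*-comm y p) (sym p1)) (trans (cong (p N.* y N.+_) (NP.+-comm _ 1)) (NP.+-suc _ _))))))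
   below : ∀ m → m N.< y → p N.* m N.< x
   below m l = NP.+-cancelʳ-< p (p N.* m) x (NP.<-≤-trans (NP.≤-<-trans (ℕ≡≤ (trans (NP.+-comm _ p) (sym (NP.*-suc p m))) (NP.*-monoʳ-≤ p l))
     (NP.≤-<-trans (ℕ≡≤ (NP.*-comm p y) (m/n*n≤m _ p)) (NP.+-monoʳ-< x (NP.≤-reflexive (trans (NP.+-comm 1 _) p1))))) NP.≤-refl)

  Σ-multiples : ∀ p x y .{{_ : NonZero p}} → x N.≤ p N.* y → (∀ m → m N.< y → p N.* m N.< x) → ∀ f →
   Σ (range x) (λ m → χ (p ∣? m) * f m) ≡ Σ (range y) (λ m → f (p N.* m))
  Σ-multiples p x y lo hi f = trans (Σ-cong∈ (range x) (λ m m∈ → trans (cong (_* f m) (χd m (∈range m∈))) (sym (Σ-*ʳ (range y) (f m) _))))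
    (trans (Σ-swap (range x) (range y) _) (Σ-cong∈ (range y) (λ k k∈ → trans (Σ-cong (range x) (λ m → χ-subst (m N.≟ p N.* k) {f m} {f (p N.* k)} (cong f)))
      (trans (Σ-*ʳ (range x) _ _) (trans (cong (_* f (p N.* k)) (Σ-range-χ (hi k (∈range k∈)))) (*-identityˡ _))))))
   where
   χd : ∀ m → m N.< x → χ (p ∣? m) ≡ Σ (range y) (λ k → χ (m N.≟ p N.* k))
   χd m l with p ∣? m
   ... | no nd = sym (Σ-0∈ (range y) (λ k _ → χ-no (m N.≟ p N.* k) (λ e → nd (divides k (trans e (NP.*-comm p k))))))
   ... | yes (divides k e) = sym (trans (Σ-cong (range y) (λ i → χ-⇔ (m N.≟ p N.* i) (i N.≟ k)
       (λ e' → NP.*-cancelˡ-≡ i k p (trans (sym e') (trans e (NP.*-comm k p)))) (λ { refl → trans e (NP.*-comm i p) })))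
       (Σ-range-χ (NP.*-cancelˡ-< p k y (NP.<-≤-trans (subst (N._< x) (trans e (NP.*-comm k p)) l) lo))))

  F≥0 : ∀ ps c b x → 0ℚ ≤ F ps c b x
  F≥0 ps c b x = Σ≥0 (range x) (λ m → 0≤* (χ≥0 (c N.* m ≈? b)) (χ≥0 (sifted? ps m)))

  F≤F[] : ∀ ps c b x → F ps c b x ≤ F [] c b x
  F≤F[] ps c b x = Σ-mono (range x) (λ m → *-monoˡ _ (χ≥0 (c N.* m ≈? b)) (χ≤1 (sifted? ps m)))

  -- Legendre's recursion: remove the multiples p m. The other sieving primes differ from p, so p m
  -- is sifted by them exactly when m is.
  F-∷ : ∀ {p ps} → Prime p → All (λ q → Prime q × q ≢ p) ps → ∀ c b x y → x N.≤ p N.* y → (∀ m → m N.< y → p N.* m N.< x) →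
   F (p ∷ ps) c b x ≡ F ps c b x - F ps (c N.* p) b y
  F-∷ {p} {ps} pp dist c b x y lo hi = trans (Σ-cong (range x) split) (trans (Σ-- (range x) _ _)
    (cong (λ z → F ps c b x - z) (trans (Σ-multiples p x y {{prime⇒nonZero pp}} lo hi (λ m → χ (c N.* m ≈? b) * χ (sifted? ps m)))
     (Σ-cong (range y) (λ m → cong₂ _*_ (cong (λ z → χ (z ≈? b)) (sym (NP.*-assoc c p m)))
      (χ-⇔ (sifted? ps (p N.* m)) (sifted? ps m) (All.map (λ nd d → nd (∣-trans d (n∣m*n p)))) (up dist m)))))))
   where
   up : ∀ {qs} → All (λ q → Prime q × q ≢ p) qs → ∀ m → All (λ q → ¬ (q ∣ m)) qs → All (λ q → ¬ (q ∣ p N.* m)) qs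
   up [] m [] = []
   up {q ∷ qs} ((qp , ne) ∷ ds) m (nd ∷ nds) = bad ∷ up ds m nds
    where
    bad : ¬ (q ∣ p N.* m)
    bad d with euclidsLemma p m qp d
    ... | inj₂ dm = nd dm
    ... | inj₁ dp with prime⇒irreducible pp dp
    ... | inj₁ refl = ¬prime[1] qp
    ... | inj₂ e = ne e
   split : ∀ m → χ (c N.* m ≈? b) * χ (sifted? (p ∷ ps) m) ≡ χ (c N.* m ≈? b) * χ (sifted? ps m) - χ (p ∣? m) * (χ (c N.* m ≈? b) * χ (sifted? ps m))
   split m = by (p ∣? m)
    where
    a : ℚ
    a = χ (c N.* m ≈? b)
    s : ℚ
    s = χ (sifted? ps m)
    by : Dec (p ∣ m) → a * χ (sifted? (p ∷ ps) m) ≡ a * s - χ (p ∣? m) * (a * s)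
    by (yes d) = trans (cong (a *_) (χ-no (sifted? (p ∷ ps) m) (λ { (nd ∷ _) → nd d }))) (trans (id46 a s) (cong (λ z → a * s - z * (a * s)) (sym (χ-yes (p ∣? m) d))))
    by (no nd) = trans (cong (a *_) (χ-⇔ (sifted? (p ∷ ps) m) (sifted? ps m) All.tail (nd ∷_))) (trans (id47 a s) (cong (λ z → a * s - z * (a * s)) (sym (χ-no (p ∣? m) nd))))

  coprime-* : ∀ {c p} → Coprime c Q → Coprime p Q → Coprime (c N.* p) Q
  coprime-* {c} {p} hc hp {i} (d , dQ) = hp (Cop.coprime-divisor ci d , dQ)
   where
   ci : Coprime i c
   ci {j} (ji , jc) = hc (jc , ∣-trans ji dQ)

  -- Each of `A t r`, 1 and (t+1)^r is at most (3(t+1))^r, so together they raise one factor 3(t+1)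
  -- to 3(t+2).
  A-step : ∀ t r → A t (suc r) + (A t r + (1ℚ + ι (suc t) ^ r)) ≤ A (suc t) (suc r)
  A-step t r = ≤-trans (+-monoʳ (A t (suc r)) (+-monoʳ (A t r) (+-mono (1≤^ r one≤) (^-mono r (ι≥0 _) le))))
    (≡≤ (id56 (ι 3 * ι (suc t)) (A t r)) (≤≡ (*-monoˡ _ (0≤+ a0 (0≤+ 0≤1 (0≤+ 0≤1 0≤1))) (^-mono r a0 le2)) (cong (_* A (suc t) r) e3)))
   where
   a0 : 0ℚ ≤ ι 3 * ι (suc t)
   a0 = 0≤* (ι≥0 3) (ι≥0 (suc t))
   i3 : ι 3 ≡ 1ℚ + (1ℚ + 1ℚ)
   i3 = trans (ι-suc 2) (cong (1ℚ +_) (trans (ι-suc 1) (cong (1ℚ +_) ι-1)))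
   one3 : 1ℚ ≤ ι 3
   one3 = subst (_≤ ι 3) ι-1 (ι-mono 1≤suc)
   one≤ : 1ℚ ≤ ι 3 * ι (suc t)
   one≤ = subst (_≤ ι 3 * ι (suc t)) (*-identityˡ 1ℚ) (*-mono 0≤1 0≤1 one3 (subst (_≤ ι (suc t)) ι-1 (ι-mono 1≤suc)))
   le : ι (suc t) ≤ ι 3 * ι (suc t)
   le = subst (_≤ ι 3 * ι (suc t)) (*-identityˡ _) (*-monoʳ (ι (suc t)) (ι≥0 _) one3)
   le2 : ι 3 * ι (suc t) ≤ ι 3 * ι (suc (suc t))
   le2 = *-monoˡ (ι 3) (ι≥0 3) (ι-mono (NP.n≤1+n (suc t)))
   e3 : ι 3 * ι (suc t) + (1ℚ + (1ℚ + 1ℚ)) ≡ ι 3 * ι (suc (suc t))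
   e3 = trans (cong (ι 3 * ι (suc t) +_) (sym i3)) (trans (id48 (ι 3) (ι (suc t))) (cong (ι 3 *_) (sym (ι-suc (suc t)))))

  h≤len : ∀ {ps} → Sieving ps → h ps ≤ ι (suc (length ps))
  h≤len [] = ι≥0 1
  h≤len {p ∷ ps} ((pp , _) ∷ s) = ≤≡ (+-mono (subst (rec p ≤_) refl (r1 p (N.>-nonZero⁻¹ p {{prime⇒nonZero pp}}))) (h≤len s)) (sym (ι-suc _))
   where
   r1 : ∀ p → 1 N.≤ p → rec p ≤ 1ℚ
   r1 (suc p) _ = rec≤1 p

  -- By induction on the list, spending one unit of depth r on the multiples of each removed prime.
  -- The truncation error is the r-th elementary symmetric sum of the 1/p, bounded by h^r / r!; the
  -- induction closes because dp (r+1) (h + 1/p) ≥ dp (r+1) h + dp r h / p.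
  brun : ∀ {ps} → Sieving ps → ∀ r c b x → Coprime c Q →
   ∣ F ps c b x - V ps * (ι x * rec Q) ∣ ≤ A (length ps) r + dp r (h ps) * (ι x * rec Q)
  brun {ps} s zero c b x cop = abs≤ (up _ _ _ (≤-trans (F≤F[] ps c b x) (≡≤ (proj₂ (F[]-eq c b cop) x) (count-upper x _))) (0≤* (V≥0 s) X≥0))
    (down _ _ (F≥0 ps c b x) (V≤1 s))
   where
   X : ℚ
   X = ι x * rec Q
   X≥0 : 0ℚ ≤ X
   X≥0 = 0≤* (ι≥0 x) (rec≥0 Q)
   up : ∀ f v X → f ≤ X + 1ℚ → 0ℚ ≤ v → f - v ≤ 1ℚ + 1ℚ * X
   up f v X p q = id49 f v X via 0≤+ (≤⇒0≤ p) q
   down : ∀ f v → 0ℚ ≤ f → v ≤ 1ℚ → - (f - v * X) ≤ 1ℚ + 1ℚ * X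
   down f v p q = id50 f v X via 0≤+ (0≤+ 0≤1 p) (0≤* (≤⇒0≤ q) X≥0)
  brun [] (suc r) c b x cop = ≤-trans (abs≤ (l1 via ≤⇒0≤ (count-upper x d)) (l2 via ≤⇒0≤ (count-lower x d))) (≤≡ (1≤^ (suc r) three) (sym e))
   where
   d = proj₁ (F[]-eq c b cop)
   X : ℚ
   X = ι x * rec Q
   fe : F [] c b x ≡ count x d
   fe = proj₂ (F[]-eq c b cop) x
   l1 : 1ℚ - (F [] c b x - 1ℚ * X) ≡ X + 1ℚ - count x d
   l1 = trans (cong (λ f → 1ℚ - (f - 1ℚ * X)) fe) (id57 (count x d) X)
   l2 : 1ℚ - - (F [] c b x - 1ℚ * X) ≡ count x d + 1ℚ - X
   l2 = trans (cong (λ f → 1ℚ - - (f - 1ℚ * X)) fe) (id58 (count x d) X)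
   three : 1ℚ ≤ ι 3 * ι 1
   three = subst (1ℚ ≤_) (trans (sym (*-identityʳ (ι 3))) (cong (ι 3 *_) (sym ι-1))) (subst (_≤ ι 3) ι-1 (ι-mono 1≤suc))
   e : A 0 (suc r) + dp (suc r) 0ℚ * X ≡ A 0 (suc r)
   e = id59 (A 0 (suc r)) (rec (suc r)) (dp r 0ℚ) X
  brun {p ∷ ps} (pk@(pp , pc , dist) ∷ s) (suc r) c b x cop with ceil x p {{prime⇒nonZero pp}}
  ... | y , lo , hi , be = ≤-trans (subst (λ z → ∣ z ∣ ≤ _) (sym eq) (abs-+ (abs-- (brun s (suc r) c b x cop) (brun s r (c N.* p) b y (coprime-* cop pc))) rest)) final
   where
   X Y : ℚ
   X = ι x * rec Q
   Y = ι y * rec Q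
   v = V ps
   t = length ps
   eq : F (p ∷ ps) c b x - (1ℚ - rec p) * v * X ≡ ((F ps c b x - v * X) - (F ps (c N.* p) b y - v * Y)) + - (v * (Y - rec p * X))
   eq = trans (cong (λ z → z - (1ℚ - rec p) * v * X) (F-∷ pp dist c b x y lo be)) (id51 _ _ v (rec p) X Y)
   p≥1 : 1 N.≤ p
   p≥1 = N.>-nonZero⁻¹ p {{prime⇒nonZero pp}}
   rQ1 : rec Q ≤ 1ℚ
   rQ1 = go Q (N.>-nonZero⁻¹ Q)
    where
    go : ∀ q → 1 N.≤ q → rec q ≤ 1ℚ
    go (suc q) _ = rec≤1 q
   -- 0 ≤ Y - X/p ≤ 1
   ye : ι y ≡ rec p * ι (p N.* y)
   ye = sym (trans (cong (rec p *_) (ι-* p y)) (trans (id52 (rec p) (ι p) (ι y)) (trans (cong (_* ι y) (ι*rec p≥1)) (*-identityˡ _))))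
   D≥0 : 0ℚ ≤ Y - rec p * X
   D≥0 = subst (0ℚ ≤_) (trans (id53 (rec p) (ι (p N.* y)) (ι x) (rec Q)) (cong (λ z → z * rec Q - rec p * X) (sym ye)))
     (0≤* (0≤* (rec≥0 p) (≤⇒0≤ (ι-mono lo))) (rec≥0 Q))
   D≤1 : Y - rec p * X ≤ 1ℚ
   D≤1 = ≡≤ (trans (cong (λ z → z * rec Q - rec p * X) ye) (sym (id53 (rec p) (ι (p N.* y)) (ι x) (rec Q))))
     (≤-trans (*-monoʳ (rec Q) (rec≥0 Q) (*-monoˡ (rec p) (rec≥0 p) sub)) (≡≤ (cong (_* rec Q) (trans (*-comm _ _) (ι*rec p≥1))) (≡≤ (*-identityˡ _) rQ1)))
    where
    sub : ι (p N.* y) - ι x ≤ ι p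
    sub = id44 (ι (p N.* y)) (ι x) (ι p) via ≤⇒0≤ (≤≡ (ι-mono hi) (ι-+ x p))
   rest : ∣ - (v * (Y - rec p * X)) ∣ ≤ 1ℚ * 1ℚ
   rest = abs-neg (abs-* (≡≤ (∣∣-nonneg (V≥0 s)) (V≤1 s)) (≡≤ (∣∣-nonneg D≥0) D≤1))
   B : ℚ
   B = dp r (h ps)
   B≥0 : 0ℚ ≤ B
   B≥0 = dp≥0 r (h≥0 ps)
   B≤ : B ≤ ι (suc t) ^ r
   B≤ = ≤-trans (dp≤^ r (h≥0 ps)) (^-mono r (h≥0 ps) (h≤len s))
   X≥0 : 0ℚ ≤ X
   X≥0 = 0≤* (ι≥0 x) (rec≥0 Q)
   final : (A t (suc r) + dp (suc r) (h ps) * X) + (A t r + B * Y) + 1ℚ * 1ℚ ≤ A (suc t) (suc r) + dp (suc r) (rec p + h ps) * X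
   final = id54 (A t (suc r)) (A t r) (A (suc t) (suc r)) (dp (suc r) (h ps)) B (dp (suc r) (rec p + h ps)) X Y (rec p) (ι (suc t) ^ r) via
    0≤+ (0≤+ (≤⇒0≤ (A-step t r)) (≤⇒0≤ B≤)) (0≤+ (0≤* B≥0 (≤⇒0≤ D≤1)) (0≤* (≤⇒0≤ (≤≡ (dp-+-lower r (h≥0 ps) (rec≥0 p)) (cong (dp (suc r)) (+-comm _ _)))) X≥0))

-- Chebyshev's bound and the density of integers without small prime factors.

module Chebyshev where

 open Q
 open Kit
 open DividedPower using (rec≤1)
 open import Data.Nat.Combinatorics using (_C_; nCk+nC[k+1]≡[n+1]C[k+1]; nCk≡n!/k![n-k]!; k![n∸k]!∣n!)
 open import Data.Nat.ListAction using (product)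

 -- Every dyadic block contributes at most 1, and the initial index 0 contributes `rec 0` = 0.
 harmonic : ∀ I → Σ (range (2 N.^ I)) rec ≤ ι I
 harmonic zero = ≤-reflexive (trans (+-identityˡ _) (sym ι-0))
 harmonic (suc I) = ≡≤ (trans (cong (λ z → Σ (range (2 N.^ I N.+ z)) rec) (NP.+-identityʳ _)) (Σ-range-+ (2 N.^ I) (2 N.^ I) rec))
  (≤≡ (+-mono (≤≡ (Σ-mono (range (2 N.^ I)) (λ i → rec-mono p1 (NP.m≤n+m (2 N.^ I) i)))
    (trans (Σ-const (range (2 N.^ I)) _) (trans (cong (λ z → ι z * rec (2 N.^ I)) (range-length (2 N.^ I))) (ι*rec p1)))) (harmonic I))
   (sym (ι-suc I)))
  where
  p1 : 1 N.≤ 2 N.^ I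
  p1 = NP.m^n>0 2 I

 -- The central binomial coefficient is divisible by every prime in (n, 2n].

 prime∣!⇒≤ : ∀ {p} n → Prime p → p ∣ n ! → p N.≤ n
 prime∣!⇒≤ zero pp d = ⊥-elim (¬prime[1] (subst Prime (NP.≤-antisym (∣⇒≤ d) (N.>-nonZero⁻¹ _ {{prime⇒nonZero pp}})) pp))
 prime∣!⇒≤ (suc n) pp d with euclidsLemma (suc n) (n !) pp d
 ... | inj₁ e = ∣⇒≤ e
 ... | inj₂ e = NP.m≤n⇒m≤1+n (prime∣!⇒≤ n pp e)

 ≤⇒∣! : ∀ {m} n → 1 N.≤ m → m N.≤ n → m ∣ n !
 ≤⇒∣! zero h k = ⊥-elim (NP.<⇒≱ h k)
 ≤⇒∣! {m} (suc n) h k with m N.≟ suc n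
 ... | yes refl = m∣m*n (n !)
 ... | no ne = ∣-trans (≤⇒∣! n h (NP.≤-pred (NP.≤∧≢⇒< k ne))) (n∣m*n (suc n))

 C-factorial : ∀ n → ((n N.+ n) C n) N.* (n ! N.* n !) ≡ (n N.+ n) !
 C-factorial n = trans (cong₂ N._*_ (nCk≡n!/k![n-k]! le) (cong (λ z → n ! N.* z !) (sym (NP.m+n∸n≡m n n)))) (m/n*n≡m {{n NP.!* (n N.+ n N.∸ n) !≢0}} (k![n∸k]!∣n! le))
  where
  le : n N.≤ n N.+ n
  le = NP.m≤m+n n n

 prime∣C : ∀ {p} n → Prime p → n N.< p → p N.≤ n N.+ n → p ∣ (n N.+ n) C n
 prime∣C {p} n pp lo hi with euclidsLemma ((n N.+ n) C n) (n ! N.* n !) pp (subst (p ∣_) (sym (C-factorial n)) (≤⇒∣! (n N.+ n) (N.>-nonZero⁻¹ p {{prime⇒nonZero pp}}) hi))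
 ... | inj₁ d = d
 ... | inj₂ d with euclidsLemma (n !) (n !) pp d
 ... | inj₁ e = ⊥-elim (NP.<⇒≱ lo (prime∣!⇒≤ n pp e))
 ... | inj₂ e = ⊥-elim (NP.<⇒≱ lo (prime∣!⇒≤ n pp e))

 C≤2^ : ∀ n k → n C k N.≤ 2 N.^ n
 C≤2^ zero zero = NP.≤-refl
 C≤2^ zero (suc k) = N.z≤n
 C≤2^ (suc n) zero = NP.m^n>0 2 (suc n)
 C≤2^ (suc n) (suc k) = ℕ≡≤ (sym (nCk+nC[k+1]≡[n+1]C[k+1] n k))
  (NP.+-mono-≤ (C≤2^ n k) (ℕ≤≡ (C≤2^ n (suc k)) (sym (NP.+-identityʳ _))))

 module _ {Ok : ℕ → Set} (ok? : ∀ p → Dec (Ok p)) where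

  primes : ℕ → List ℕ
  primes zero = []
  primes (suc n) with prime? n ×-dec ok? n
  ... | yes _ = n ∷ primes n
  ... | no _ = primes n

  primes-below : ∀ n → All (λ p → Prime p × Ok p × p N.< n) (primes n)
  primes-below zero = []
  primes-below (suc n) with prime? n ×-dec ok? n
  ... | yes (p , o) = (p , o , NP.≤-refl) ∷ All.map (λ { (a , b , c) → a , b , NP.m<n⇒m<1+n c }) (primes-below n)
  ... | no _ = All.map (λ { (a , b , c) → a , b , NP.m<n⇒m<1+n c }) (primes-below n)

  open import Data.List.Membership.Propositional using (_∈_)
  open import Data.List.Relation.Unary.Any using (here; there)

  primes-complete : ∀ {p} n → Prime p → Ok p → p N.< n → p ∈ primes n
  primes-complete {p} (suc n) pp o h with p N.≟ n | prime? n ×-dec ok? n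
  ... | yes refl | yes _ = here refl
  ... | yes refl | no q = ⊥-elim (q (pp , o))
  ... | no ne | yes _ = there (primes-complete n pp o (NP.≤∧≢⇒< (NP.≤-pred h) ne))
  ... | no ne | no _ = primes-complete n pp o (NP.≤∧≢⇒< (NP.≤-pred h) ne)

  length-primes : ∀ n → length (primes n) N.≤ n
  length-primes zero = N.z≤n
  length-primes (suc n) with prime? n ×-dec ok? n
  ... | yes _ = N.s≤s (length-primes n)
  ... | no _ = NP.m≤n⇒m≤1+n (length-primes n)

  -- ∏ (1 - 1/p) over the listed primes
  density : ℕ → ℚ
  density zero = 1ℚ
  density (suc n) with prime? n ×-dec ok? n
  ... | yes _ = (1ℚ - rec n) * density n
  ... | no _ = density n

  recsum≤ : ∀ n → Σ (primes n) rec ≤ Σ (range n) rec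
  recsum≤ zero = ≤-refl
  recsum≤ (suc n) with prime? n ×-dec ok? n
  ... | yes _ = +-monoʳ (rec n) (recsum≤ n)
  ... | no _ = ≤-trans (recsum≤ n) (≤+ˡ (rec≥0 n))

  1-rec≥0 : ∀ {p} → Prime p → 0ℚ ≤ 1ℚ - rec p
  1-rec≥0 {suc p} _ = ≤⇒0≤ (rec≤1 p)

  density≥0 : ∀ n → 0ℚ ≤ density n
  density≥0 zero = 0≤1
  density≥0 (suc n) with prime? n ×-dec ok? n
  ... | yes (p , _) = 0≤* (1-rec≥0 p) (density≥0 n)
  ... | no _ = density≥0 n

  density-step : ∀ n → 1 N.≤ n → density n * (1ℚ - rec n) ≤ density (suc n)
  density-step n@(suc _) h with prime? n ×-dec ok? n
  ... | yes _ = ≤-reflexive (*-comm _ _)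
  ... | no _ = id68 (density n) (rec n) via 0≤* (density≥0 n) (rec≥0 n)

  density-anti : ∀ m n → density (m N.+ n) ≤ density n
  density-anti zero n = ≤-refl
  density-anti (suc m) n with prime? (m N.+ n) ×-dec ok? (m N.+ n)
  ... | no _ = density-anti m n
  ... | yes (p , _) = ≤-trans (id69 (density (m N.+ n)) (rec (m N.+ n)) via 0≤* (density≥0 (m N.+ n)) (rec≥0 (m N.+ n))) (density-anti m n)

  -- The product of 1 - 1/i over all integers i ≥ 2, not only primes, already telescopes to this
  -- value.
  density-trivial : ∀ n → rec (suc n) ≤ density (suc (suc n))
  density-trivial zero = ≤-trans (rec≤1 0) d2
   where
   open import Data.Nat.Primality using (¬prime[0])
   d2 : 1ℚ ≤ density 2
   d2 with prime? 1 ×-dec ok? 1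
   ... | yes (p , _) = ⊥-elim (¬prime[1] p)
   ... | no _ with prime? 0 ×-dec ok? 0
   ... | yes (p , _) = ⊥-elim (¬prime[0] p)
   ... | no _ = ≤-refl
  density-trivial (suc n) = ≡≤ e (≤-trans (*-monoʳ (1ℚ - s) (≤⇒0≤ (rec≤1 (suc n))) (density-trivial n)) (density-step (suc (suc n)) 1≤suc))
   where
   s : ℚ
   s = rec (suc (suc n))
   e1 : 1ℚ - s ≡ ι (suc n) * s
   e1 = trans (cong (λ z → z - s) (trans (sym (ι*rec {suc (suc n)} 1≤suc)) (cong (_* s) (ι-suc (suc n))))) (id70 (ι (suc n)) s)
   e : s ≡ rec (suc n) * (1ℚ - s)
   e = sym (trans (cong (rec (suc n) *_) e1) (trans (sym (*-assoc _ _ _)) (trans (cong (_* s) (trans (*-comm _ _) (ι*rec {suc n} 1≤suc))) (*-identityˡ s))))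

  private
   between : ℕ → ℕ → List ℕ
   between n zero = []
   between n (suc m) with prime? (m N.+ suc n) ×-dec ok? (m N.+ suc n)
   ... | yes _ = m N.+ suc n ∷ between n m
   ... | no _ = between n m

   between-spec : ∀ n m → All (λ p → Prime p × n N.< p × p N.< m N.+ suc n) (between n m)
   between-spec n zero = []
   between-spec n (suc m) with prime? (m N.+ suc n) ×-dec ok? (m N.+ suc n)
   ... | yes (p , _) = (p , NP.m≤n+m (suc n) m , NP.≤-refl) ∷ All.map (λ { (a , b , c) → a , b , NP.m<n⇒m<1+n c }) (between-spec n m)
   ... | no _ = All.map (λ { (a , b , c) → a , b , NP.m<n⇒m<1+n c }) (between-spec n m)

   -- The primes are divided out one at a time: a new prime exceeds all earlier ones, so it does not
   -- divide their product and must divide the cofactor.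
   between-∣ : ∀ n m → m N.≤ n → product (between n m) ∣ (n N.+ n) C n
   between-∣ n zero h = divides ((n N.+ n) C n) (sym (NP.*-identityʳ ((n N.+ n) C n)))
   between-∣ n (suc m) h with prime? (m N.+ suc n) ×-dec ok? (m N.+ suc n)
   ... | no _ = between-∣ n m (NP.<⇒≤ h)
   ... | yes (pp , _) with between-∣ n m (NP.<⇒≤ h)
   ... | divides k e with euclidsLemma k (product (between n m)) pp (subst (m N.+ suc n ∣_) e (prime∣C n pp (NP.m≤n+m (suc n) m)
        (ℕ≡≤ (NP.+-suc m n) (NP.+-monoˡ-≤ n h))))
   ... | inj₁ (divides j e') = divides j (trans e (trans (cong (N._* product (between n m)) e') (NP.*-assoc j _ _)))
   ... | inj₂ d = ⊥-elim (NP.<-irrefl refl (proj₂ (proj₂ (All.lookup (between-spec n m)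
       (factorisationHasAllPrimeFactors pp d (All.map proj₁ (between-spec n m)))))))
    where open import Data.Nat.Primality.Factorisation using (factorisationHasAllPrimeFactors)

   product≥ : ∀ n {l} → All (λ p → n N.≤ p) l → n N.^ length l N.≤ product l
   product≥ n [] = NP.≤-refl
   product≥ n (p ∷ a) = NP.*-mono-≤ p (product≥ n a)

   C≢0 : ∀ n → N.NonZero ((n N.+ n) C n)
   C≢0 n = N.≢-nonZero λ e → N.≢-nonZero⁻¹ ((n N.+ n) !) {{n!≢0 (n N.+ n)}} (trans (sym (C-factorial n)) (cong (N._* (n ! N.* n !)) e))
    where
    n!≢0 : ∀ n → N.NonZero (n !)
    n!≢0 n = NP._!≢0 n

   -- With n = 2^i and c primes in (n, 2n], n^c divides out of the central binomial coefficient in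
   -- size: 2^(i c) ≤ 4^n, and exponents are compared.
   count-between : ∀ i → i N.* length (between (2 N.^ i) (2 N.^ i)) N.≤ 2 N.* 2 N.^ i
   count-between i = NP.≮⇒≥ λ lt → NP.<⇒≱ (NP.^-monoʳ-< 2 (N.s≤s 1≤suc) lt)
    (ℕ≡≤ (sym (NP.^-*-assoc 2 i c))
    (NP.≤-trans (product≥ n (All.map (λ t → NP.<⇒≤ (proj₁ (proj₂ t))) (between-spec n n)))
    (NP.≤-trans (∣⇒≤ {{C≢0 n}} (between-∣ n n NP.≤-refl)) (ℕ≤≡ (C≤2^ (n N.+ n) n)
     (cong (λ z → 2 N.^ (n N.+ z)) (sym (NP.+-identityʳ n)))))))
    where
    n = 2 N.^ i
    c = length (between n n)

   density-between : ∀ n m → 1 N.≤ n → density (suc n) * (1ℚ - ι (length (between n m)) * rec n) ≤ density (m N.+ suc n)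
   density-between n zero h = ≤-reflexive (trans (cong (λ z → density (suc n) * (1ℚ - z * rec n)) ι-0) (id61 (density (suc n)) (rec n)))
   density-between n (suc m) h with prime? (m N.+ suc n) ×-dec ok? (m N.+ suc n)
   ... | no _ = density-between n m h
   ... | yes (pp , _) = ≤-trans (subst (λ z → density (suc n) * (1ℚ - z * rec n) ≤ (1ℚ - rec n) * (density (suc n) * (1ℚ - ι c * rec n))) (sym (ι-suc c))
      (id62 (density (suc n)) (ι c) (rec n) via 0≤* (0≤* (density≥0 (suc n)) (ι≥0 c)) (0≤* (rec≥0 n) (rec≥0 n))))
     (≤-trans (*-monoˡ (1ℚ - rec n) (r1 n h) (density-between n m h))
      (*-monoʳ (density (m N.+ suc n)) (density≥0 (m N.+ suc n)) (id63 (rec n) (rec (m N.+ suc n)) via ≤⇒0≤ (rec-mono h (NP.≤-trans (NP.n≤1+n n) (NP.m≤n+m (suc n) m))))))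
    where
    c = length (between n m)
    r1 : ∀ n → 1 N.≤ n → 0ℚ ≤ 1ℚ - rec n
    r1 (suc n) _ = ≤⇒0≤ (rec≤1 n)

  -- Mertens-type lower bound from π(2n) - π(n) ≤ 2n / log₂ n: the dyadic factors 1 - 2/i telescope.
  density-lower : ∀ j → rec (4 N.* (suc (suc j) N.* suc j)) ≤ density (suc (2 N.^ (3 N.+ j)))
  -- The telescoping starts at i = 3, where 1 - 2/i becomes positive; there the trivial bound 1/8 is
  -- the claim.
  density-lower zero = density-trivial 7
  density-lower (suc j) = ≤-trans key (≤≡ (density-between n n (NP.m^n>0 2 i)) (cong density (trans (NP.+-suc n n) (cong suc (cong (n N.+_) (sym (NP.+-identityʳ n)))))))
   where
   i = 3 N.+ j
   n = 2 N.^ i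
   c = length (between n n)
   D : ℚ
   D = density (suc n)
   n1 : 1 N.≤ n
   n1 = NP.m^n>0 2 i
   -- c / n ≤ 2 / i
   cn : ι c * rec n ≤ 2ℚ * rec i
   cn = ≡≤ (trans (sym (*-identityˡ _)) (trans (cong (_* (ι c * rec n)) (sym (ι*rec {i} 1≤suc))) (id64 (ι i) (rec i) (ι c) (rec n))))
     (≤≡ (*-monoˡ (rec i * rec n) (0≤* (rec≥0 i) (rec≥0 n)) (≡≤ (sym (ι-* i c)) (ι-mono (count-between i))))
      (trans (cong (rec i * rec n *_) (ι-* 2 n)) (trans (id65 (rec i) (rec n) (ι 2) (ι n)) (trans (cong (λ z → ι 2 * rec i * z) (ι*rec n1))
       (trans (*-identityʳ _) (cong (_* rec i) ι2))))))
    where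
    ι2 : ι 2 ≡ 2ℚ
    ι2 = trans (ι-suc 1) (cong (1ℚ +_) ι-1)
   a b : ℕ
   a = suc j
   b = suc (suc j)
   -- 1/(4 (j+3)(j+2)) = 1/(4 (j+2)(j+1)) · (1 - 2/(j+3))
   eq : rec (4 N.* (i N.* b)) ≡ rec (4 N.* (b N.* a)) * (1ℚ - 2ℚ * rec i)
   eq = trans (rec-* 4 (i N.* b)) (trans (cong (rec 4 *_) (rec-* i b)) (sym (trans (cong₂ _*_ (trans (rec-* 4 (b N.* a)) (cong (rec 4 *_) (rec-* b a))) e1)
     (trans (id66 (rec 4) (rec b) (rec a) (ι a) (rec i)) (trans (cong (λ z → rec 4 * (rec i * rec b) * z) (ι*rec {a} 1≤suc)) (*-identityʳ _))))))
    where
    e1 : 1ℚ - 2ℚ * rec i ≡ ι a * rec i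
    e1 = trans (cong (λ z → z - 2ℚ * rec i) (trans (sym (ι*rec {i} 1≤suc)) (cong (_* rec i) (trans (ι-suc _) (cong (1ℚ +_) (ι-suc _)))))) (id60 (ι a) (rec i))
   key : rec (4 N.* (i N.* b)) ≤ D * (1ℚ - ι c * rec n)
   key = ≡≤ eq (≤-trans (*-monoʳ (1ℚ - 2ℚ * rec i) nn (density-lower j)) (id67 D (2ℚ * rec i) (ι c * rec n) via 0≤* (density≥0 (suc n)) (≤⇒0≤ cn)))
    where
    nn : 0ℚ ≤ 1ℚ - 2ℚ * rec i
    nn = subst (0ℚ ≤_) (sym e1) (0≤* (ι≥0 a) (rec≥0 i))
     where
     e1 : 1ℚ - 2ℚ * rec i ≡ ι a * rec i
     e1 = trans (cong (λ z → z - 2ℚ * rec i) (trans (sym (ι*rec {i} 1≤suc)) (cong (_* rec i) (trans (ι-suc _) (cong (1ℚ +_) (ι-suc _)))))) (id60 (ι a) (rec i))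

-- The unit group modulo Q and sums over residue classes.

module Units where

 open Q
 open Kit
 open Group
 open Sieve using (module Congruence)

 coprime-1 : ∀ n → Coprime 1 n
 coprime-1 n (d , _) = ∣1 d
  where
  open import Data.Nat.Divisibility using () renaming (∣1⇒≡1 to ∣1)

 module _ (Q : ℕ) {{nzQ : NonZero Q}} where
  open Congruence Q

  -- The proofs are irrelevant fields, so units with equal representatives are equal.
  record Unit : Set where
   constructor unit
   field
    val : ℕ
    .val< : val N.< Q
    .cop : Coprime val Q
  open Unit public

  Unit≡ : ∀ {a b : Unit} → val a ≡ val b → a ≡ b
  Unit≡ {unit _ _ _} {unit _ _ _} refl = refl

  infix 4 _≟U_
  _≟U_ : ∀ (a b : Unit) → Dec (a ≡ b)
  a ≟U b = map′ Unit≡ (cong val) (val a N.≟ val b)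

  coprime-% : ∀ {m} → Coprime m Q → Coprime (m % Q) Q
  coprime-% {m} c {d} (p , q) = c (∣n∣m%n⇒∣m q p , q)

  coprime-≈ : ∀ {a b} → a ≈ b → Coprime a Q → Coprime b Q
  coprime-≈ {a} {b} e c {d} (p , q) = c (∣n∣m%n⇒∣m q (subst (d ∣_) (sym e) (%-presˡ-∣ p q)) , q)

  mk : ∀ m → .(Coprime m Q) → Unit
  mk m c = unit (m % Q) (m%n<n m Q) (coprime-% c)

  1U : Unit
  1U = mk 1 (coprime-1 Q)

  infixl 7 _*U_
  _*U_ : Unit → Unit → Unit
  unit a _ c *U unit b _ d = mk (a N.* b) (coprime-* c d)

  cop! : ∀ a → Coprime (val a) Q
  cop! (unit a _ c) = recompute (coprime? a Q) c

  val<! : ∀ a → val a N.< Q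
  val<! (unit a l _) = recompute (a N.<? Q) l

  val-% : ∀ a → val a % Q ≡ val a
  val-% a = m<n⇒m%n≡m (val<! a)

  coprime-inverse : ∀ c d → c N.* d ≈ 1 → Coprime c Q
  coprime-inverse c d e {i} (p , q) = coprime-≈ {1} {c N.* d} (sym e) (coprime-1 Q) (∣-trans p (m∣m*n d) , q)
   where open import Data.Nat.Divisibility using (m∣m*n)

  invU : Unit → Unit
  invU a = mk (proj₁ (inverse (val a) (cop! a))) (coprime-inverse _ (val a) (proj₂ (inverse (val a) (cop! a))))

  *U-val : ∀ a b → val (a *U b) ≡ (val a N.* val b) % Q
  *U-val (unit _ _ _) (unit _ _ _) = refl

  *U-assoc : ∀ a b c → (a *U b) *U c ≡ a *U (b *U c)
  *U-assoc a b c = Unit≡ (trans (*U-val (a *U b) c) (trans (cong (λ z → (z N.* val c) % Q) (*U-val a b))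
   (trans (*-≈ {(val a N.* val b) % Q} {val a N.* val b} {val c} (%-≈ _) refl) (trans (cong (_% Q) (NP.*-assoc (val a) (val b) (val c)))
   (trans (*-≈ {val a} refl (sym (%-≈ (val b N.* val c)))) (trans (cong (λ z → (val a N.* z) % Q) (sym (*U-val b c))) (sym (*U-val a (b *U c)))))))))

  *U-comm : ∀ a b → a *U b ≡ b *U a
  *U-comm a b = Unit≡ (trans (*U-val a b) (trans (cong (_% Q) (NP.*-comm (val a) (val b))) (sym (*U-val b a))))

  *U-idˡ : ∀ a → 1U *U a ≡ a
  *U-idˡ a = Unit≡ (trans (*U-val 1U a) (trans (*-≈ {1 % Q} {1} {val a} (%-≈ 1) refl) (trans (cong (_% Q) (NP.*-identityˡ (val a))) (val-% a))))

  invU-l : ∀ a → invU a *U a ≡ 1U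
  invU-l a = Unit≡ (trans (*U-val (invU a) a) (trans (*-≈ {proj₁ (inverse (val a) (cop! a)) % Q} {proj₁ (inverse (val a) (cop! a))} {val a} (%-≈ _) refl)
   (proj₂ (inverse (val a) (cop! a)))))

  elements : ∀ n → .(n N.≤ Q) → List Unit
  elements zero h = []
  elements (suc n) h with coprime? n Q
  ... | yes c = unit n h c ∷ elements n (NP.<⇒≤ h)
  ... | no _ = elements n (NP.<⇒≤ h)

  elements-once : ∀ n .(h : n N.≤ Q) k → Σ (elements n h) (λ i → χ (i ≟U k)) ≡ χ (val k N.<? n)
  elements-once zero h k = refl
  elements-once (suc n) h k with coprime? n Q
  ... | no nc = trans (elements-once n (NP.<⇒≤ h) k) (χ-⇔ (val k N.<? n) (val k N.<? suc n) NP.m<n⇒m<1+n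
      (λ l → NP.≤∧≢⇒< (NP.≤-pred l) (λ e → nc (λ {i} → subst (λ z → Coprime z Q) e (cop! k) {i}))))
  ... | yes c = trans (cong (χ (unit n h c ≟U k) +_) (elements-once n (NP.<⇒≤ h) k)) (by (n N.≟ val k))
   where
   by : Dec (n ≡ val k) → χ (unit n h c ≟U k) + χ (val k N.<? n) ≡ χ (val k N.<? suc n)
   by (yes e) = trans (cong₂ _+_ (χ-yes (unit n h c ≟U k) (Unit≡ e)) (χ-no (val k N.<? n) (λ l → NP.<⇒≢ l (sym e))))
     (trans (+-identityʳ 1ℚ) (sym (χ-yes (val k N.<? suc n) (N.s≤s (NP.≤-reflexive (sym e))))))
   by (no ne) = trans (cong (_+ χ (val k N.<? n)) (χ-no (unit n h c ≟U k) (λ e → ne (cong val e)))) (trans (+-identityˡ _)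
     (χ-⇔ (val k N.<? n) (val k N.<? suc n) NP.m<n⇒m<1+n (λ l → NP.≤∧≢⇒< (NP.≤-pred l) (λ e → ne (sym e)))))

  units : FiniteAbelianGroup
  units = record
   { G = Unit ; _∙_ = _*U_ ; e = 1U ; inv = invU
   ; ∙-assoc = *U-assoc ; ∙-comm = *U-comm ; ∙-idˡ = *U-idˡ ; ∙-invˡ = invU-l
   ; _≟G_ = _≟U_ ; els = elements Q NP.≤-refl
   ; once = λ k → trans (elements-once Q NP.≤-refl k) (χ-yes (val k N.<? Q) (val<! k)) }

  open Analysis units

  -- the class of m, with the junk value 1 when m is not prime to Q
  opaque
   un : ℕ → Unit
   un m with coprime? m Q
   ... | yes c = mk m c
   ... | no _ = 1U

   un-mk : ∀ m (c : Coprime m Q) → un m ≡ mk m c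
   un-mk m c with coprime? m Q
   ... | yes _ = refl
   ... | no n = ⊥-elim (n (λ {i} → c {i}))

  un-* : ∀ {m n} → Coprime m Q → Coprime n Q → un (m N.* n) ≡ un m *U un n
  un-* {m} {n} c d = trans (un-mk (m N.* n) (λ {i} → coprime-* c d {i})) (trans (Unit≡ (%-distribˡ-* m n Q)) (sym (cong₂ _*U_ (un-mk m (λ {i} → c {i})) (un-mk n (λ {i} → d {i})))))

  un-≈ : ∀ {m} t → Coprime m Q → (un m ≡ t → m ≈ val t)
  un-≈ {m} t c refl = sym (trans (cong (λ z → val z % Q) (un-mk m (λ {i} → c {i}))) (%-≈ m))

  ≈-un : ∀ {m} t → m ≈ val t → un m ≡ t
  ≈-un {m} t e = trans (un-mk m (λ {i} → coprime-≈ {val t} {m} (sym e) (cop! t) {i})) (Unit≡ (trans e (val-% t)))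

  -- Guards against the default value of `un`: other functions would add the non-units to the class
  -- of 1.
  Supported : (ℕ → ℚ) → Set
  Supported f = ∀ m → ¬ Coprime m Q → f m ≡ 0ℚ

  module ClassSums (X : ℕ) where

   S : (ℕ → ℚ) → Unit → ℚ
   S f t = Σ (range X) (λ m → f m * χ (un m ≟U t))

   S≥0 : ∀ {f} → (∀ m → 0ℚ ≤ f m) → ∀ t → 0ℚ ≤ S f t
   S≥0 h t = Σ≥0 (range X) (λ m → 0≤* (h m) (χ≥0 (un m ≟U t)))

   S⋆S : ∀ f h b → (S f ⋆ S h) b ≡ Σ (range X) (λ d → Σ (range X) (λ m → f d * h m * χ (un d *U un m ≟U b)))
   S⋆S f h b = trans (Σ-cong els (λ t → trans (sym (Σ-** (range X) (range X) _ _)) (Σ-cong (range X) (λ d → Σ-cong (range X) (λ m → id71 (f d) _ (h m) _)))))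
    (trans (Σ-swap els (range X) _) (Σ-cong (range X) (λ d → trans (Σ-swap els (range X) _) (Σ-cong (range X) (λ m →
     trans (Σ-*ˡ els (f d * h m) _) (cong (f d * h m *_) (pick d m)))))))
    where
    open FiniteAbelianGroup units using (els; once)
    pick : ∀ d m → ∑ (λ t → χ (un d ≟U t) * χ (un m ≟U (invU t *U b))) ≡ χ (un d *U un m ≟U b)
    pick d m = trans (Σ-cong els (λ t → cong (_* χ (un m ≟U (invU t *U b))) (χ-⇔ (un d ≟U t) (t ≟U un d) sym sym)))
     (trans (∑-pick (un d) (λ t → χ (un m ≟U (invU t *U b)))) (χ-⇔ (un m ≟U (invU (un d) *U b)) (un d *U un m ≟U b)
      (λ e → trans (cong (un d *U_) e) (cancelʳ (un d) b)) (λ e → trans (sym (cancelˡ (un d) (un m))) (cong (invU (un d) *U_) e))))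

   S-≈ : ∀ f → Supported f → ∀ t → S f t ≡ Σ (range X) (λ m → f m * χ (m ≈? val t))
   S-≈ f s t = Σ-cong (range X) (λ m → by m (coprime? m Q))
    where
    by : ∀ m → Dec (Coprime m Q) → f m * χ (un m ≟U t) ≡ f m * χ (m ≈? val t)
    by m (yes c) = cong (f m *_) (χ-⇔ (un m ≟U t) (m ≈? val t) (un-≈ t (λ {i} → c {i})) (≈-un t))
    by m (no n) = trans (cong (_* χ (un m ≟U t)) (s m n)) (trans (*-zeroˡ _) (sym (trans (cong (_* χ (m ≈? val t)) (s m n)) (*-zeroˡ _))))

-- Rational logarithms and the geometric blocks of integers.

module Blocks where

 open Q
 open Kit
 open DividedPower
 open Arith
 open import Data.List using (map)
 open import Data.Nat.ListAction using (sum)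

 least : {P : ℕ → Set} → (∀ n → Dec (P n)) → ∀ b → P b → ∃[ n ] (P n × (∀ m → m N.< n → ¬ P m) × n N.≤ b)
 least P? zero p = zero , p , (λ _ ()) , N.z≤n
 least P? (suc b) p with P? zero
 ... | yes p0 = zero , p0 , (λ _ ()) , N.z≤n
 ... | no n0 with least (λ n → P? (suc n)) b p
 ... | n , q , min , le = suc n , q , (λ { zero _ → n0 ; (suc m) h → min m (NP.≤-pred h) }) , N.s≤s le

 -- The mean value inequality: the derivative of dp (k+1) is dp k, which increases.
 dp-lipschitz : ∀ k {x y} → 0ℚ ≤ x → 0ℚ ≤ y → dp (suc k) (x + y) ≤ dp (suc k) x + y * dp k (x + y)
 dp-lipschitz zero {x} {y} hx hy = ≤-reflexive (trans (cong (λ z → z * ((x + y) * 1ℚ)) r1) (trans (id83 x y) (cong (λ z → z * (x * 1ℚ) + y * 1ℚ) (sym r1))))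
  where
  r1 : rec 1 ≡ 1ℚ
  r1 = trans (sym (*-identityˡ _)) (trans (cong (_* rec 1) (sym ι-1)) (ι*rec 1≤suc))
 dp-lipschitz (suc k) {x} {y} hx hy = *-cancelˡ (ι (suc (suc k))) (ι-pos 1≤suc) (subst₂ _≤_ (sym (dp-suc (suc k) (x + y))) e
   (≡≤ (*-distribʳ-+ (dp (suc k) (x + y)) x y) (≤-trans (+-monoˡ (y * D1) (*-monoˡ x hx (dp-lipschitz k hx hy)))
    (l x y (dp (suc k) x) D0 D1 (ι (suc k)) (dp-suc k (x + y)) via 0≤* hy (0≤* hy (dp≥0 k (0≤+ hx hy)))))))
  where
  D0 D1 : ℚ
  D0 = dp k (x + y)
  D1 = dp (suc k) (x + y)
  l : ∀ x y p d0 d1 i → i * d1 ≡ (x + y) * d0 → (x * p + y * d1 + y * (i * d1)) - (x * (p + y * d0) + y * d1) ≡ y * (y * d0)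
  l x y p d0 d1 i e = trans (cong (λ z → (x * p + y * d1 + y * z) - (x * (p + y * d0) + y * d1)) e) (id84 x y p d0 d1)
  e : x * dp (suc k) x + y * D1 + y * (ι (suc k) * D1) ≡ ι (suc (suc k)) * (dp (suc (suc k)) x + y * D1)
  e = trans (id85 x (ι (suc k)) D1 y (dp (suc k) x)) (trans (cong₂ (λ a b → a + y * (b * D1)) (sym (dp-suc (suc k) x)) (sym (ι-suc (suc k))))
    (id86 (ι (suc (suc k))) (dp (suc (suc k)) x) y D1))

 -- The logarithm is replaced by the completely additive function lam with lam p = ⌊log_ρ p⌋ / H, where ρ = 1 + 1/H,
 -- and n^{-σ} by the completely multiplicative function T^{H · lam n}, where T = 1 - 1/J'.
 module Weights (K m P : ℕ) (K≥1 : 1 N.≤ K) (m≥1 : 1 N.≤ m) (P≥1 : 1 N.≤ P) where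

  -- 1/H is the resolution of the logarithm, so ρ^H plays the part of e. The decay T^(H·lam)
  -- resembles exp(-lam/m), hence σ = 1/m; the cutoff X ≈ ρ^J has logarithm P m, so that the weight
  -- has decayed exponentially in P there. W bounds log₂ X, the number of prime factors of integers
  -- up to X, and the harmonic sum up to X.
  H J' J W : ℕ
  H = 2 N.* K
  J' = H N.* m
  J = P N.* J'
  W = suc (2 N.* (P N.* m))

  H≥1 : 1 N.≤ H
  H≥1 = NP.*-mono-≤ {1} {2} 1≤suc K≥1

  J'≥1 : 1 N.≤ J'
  J'≥1 = NP.*-mono-≤ H≥1 m≥1

  Pm≥1 : 1 N.≤ P N.* m
  Pm≥1 = NP.*-mono-≤ P≥1 m≥1

  θ T ρ ρ⁻ : ℚ
  θ = rec J'
  T = 1ℚ - θ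
  ρ = 1ℚ + rec H
  ρ⁻ = ι H * rec (suc H)

  rec≤1' : ∀ {n} → 1 N.≤ n → rec n ≤ 1ℚ
  rec≤1' {suc n} _ = rec≤1 n

  θ≤1 : θ ≤ 1ℚ
  θ≤1 = rec≤1' J'≥1

  θ≥0 : 0ℚ ≤ θ
  θ≥0 = rec≥0 J'

  T≥0 : 0ℚ ≤ T
  T≥0 = ≤⇒0≤ θ≤1

  T≤1 : T ≤ 1ℚ
  T≤1 = id55 θ via θ≥0

  ρ≥1 : 1ℚ ≤ ρ
  ρ≥1 = ≤+ʳ (rec≥0 H)

  ρ≥0 : 0ℚ ≤ ρ
  ρ≥0 = ≤-trans 0≤1 ρ≥1

  ρ>1 : 1ℚ < ρ
  ρ>1 = subst (_< ρ) (+-identityʳ 1ℚ) (+-mono-≤-< ≤-refl (rec>0 H≥1))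

  ρρ⁻ : ρ * ρ⁻ ≡ 1ℚ
  ρρ⁻ = trans (id80 (rec H) (ι H) (rec (suc H))) (trans (cong (λ z → (ι H + z) * rec (suc H)) (trans (*-comm _ _) (ι*rec H≥1)))
    (trans (cong (_* rec (suc H)) (trans (+-comm _ _) (sym (ι-suc H)))) (ι*rec {suc H} 1≤suc)))

  ρ⁻≥0 : 0ℚ ≤ ρ⁻
  ρ⁻≥0 = 0≤* (ι≥0 H) (rec≥0 (suc H))

  ρ⁻≤1 : ρ⁻ ≤ 1ℚ
  ρ⁻≤1 = ≤≡ (*-monoʳ (rec (suc H)) (rec≥0 (suc H)) (ι-mono (NP.n≤1+n H))) (ι*rec {suc H} 1≤suc)

  ρ^ρ⁻^ : ∀ j → ρ ^ j * ρ⁻ ^ j ≡ 1ℚ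
  ρ^ρ⁻^ j = trans (sym (^-* ρ ρ⁻ j)) (trans (cong (_^ j) ρρ⁻) (1^ j))

  ^-strict : ∀ {a b} → ρ ^ a < ρ ^ b → a N.< b
  ^-strict {a} {b} h with a N.<? b
  ... | yes p = p
  ... | no n = ⊥-elim (<-irrefl refl (<-≤-trans h (^-monoʳ ρ≥1 (NP.≮⇒≥ n))))

  ^<suc : ∀ j → ρ ^ j < ρ ^ suc j
  ^<suc j = subst₂ _<_ (+-identityʳ _) (id81 (ρ ^ j) (rec H)) (+-mono-≤-< (≤-refl {ρ ^ j}) (0<* (^>0 j (<-trans 0<1 ρ>1)) (rec>0 H≥1)))

  ^-strict≤ : ∀ {a b} → ρ ^ a ≤ ρ ^ b → a N.≤ b
  ^-strict≤ {a} {b} h = NP.≤-pred (^-strict (≤-<-trans h (^<suc b)))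

  opaque
   -- The integer part of log_ρ x; Bernoulli's inequality shows that the search ends by j = H x.
   lg-exists : ∀ x → ∃[ j ] (ι x < ρ ^ suc j × (∀ i → i N.< j → ¬ (ι x < ρ ^ suc i)) × j N.≤ H N.* x)
   lg-exists x = least (λ j → ι x <? ρ ^ suc j) (H N.* x) (<-≤-trans (subst (_< 1ℚ + ι x) (+-identityˡ _) (+-mono-<-≤ 0<1 ≤-refl))
     (≤-trans (≡≤ e (bernoulli (rec H) (H N.* x) (rec≥0 H))) (<⇒≤ (^<suc (H N.* x)))))
    where
    e : 1ℚ + ι x ≡ 1ℚ + ι (H N.* x) * rec H
    e = cong (1ℚ +_) (sym (trans (cong (_* rec H) (ι-* H x)) (trans (id72 (ι H) (ι x) (rec H)) (trans (cong (ι x *_) (ι*rec H≥1)) (*-identityʳ _)))))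

  lg : ℕ → ℕ
  lg x = proj₁ (lg-exists x)

  lg-upper : ∀ x → ι x < ρ ^ suc (lg x)
  lg-upper x = proj₁ (proj₂ (lg-exists x))

  lg-lower : ∀ {x} → 1 N.≤ x → ρ ^ lg x ≤ ι x
  lg-lower {x} h = go (lg x) (proj₁ (proj₂ (proj₂ (lg-exists x))))
   where
   go : ∀ j → (∀ i → i N.< j → ¬ (ι x < ρ ^ suc i)) → ρ ^ j ≤ ι x
   go zero _ = subst (_≤ ι x) ι-1 (ι-mono h)
   go (suc j) f = ≮⇒≥ (f j NP.≤-refl)

  lg-≥ : ∀ {x j} → ρ ^ j ≤ ι x → j N.≤ lg x
  lg-≥ {x} h = NP.≤-pred (^-strict (≤-<-trans h (lg-upper x)))

  lg-≤ : ∀ {x j} → 1 N.≤ x → ι x ≤ ρ ^ j → lg x N.≤ j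
  lg-≤ h k = ^-strict≤ (≤-trans (lg-lower h) k)

  lg-unique : ∀ {x j} → 1 N.≤ x → ρ ^ j ≤ ι x → ι x < ρ ^ suc j → lg x ≡ j
  lg-unique h p q = NP.≤-antisym (NP.≤-pred (^-strict (≤-<-trans (lg-lower h) q))) (lg-≥ p)

  lamℕ Ω : ℕ → ℕ
  lamℕ n = sum (map lg (fs n))
  Ω n = length (fs n)

  lamℕ-* : ∀ {a b} → 1 N.≤ a → 1 N.≤ b → lamℕ (a N.* b) ≡ lamℕ a N.+ lamℕ b
  lamℕ-* {a} {b} p q = trans (sum-↭ (PermP.map⁺ lg (fs-* p q))) (trans (cong sum (map-++ lg (fs a) (fs b))) (sum-++ (map lg (fs a)) (map lg (fs b))))

  Ω-* : ∀ {a b} → 1 N.≤ a → 1 N.≤ b → Ω (a N.* b) ≡ Ω a N.+ Ω b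
  Ω-* {a} {b} p q = trans (PermP.↭-length (fs-* p q)) (length-++ (fs a))

  lamℕ-p : ∀ {p} → Prime p → lamℕ p ≡ lg p
  lamℕ-p pp = trans (sum-↭ (PermP.map⁺ lg (fs-p pp))) (NP.+-identityʳ _)

  Ω-p : ∀ {p} → Prime p → Ω p ≡ 1
  Ω-p pp = PermP.↭-length (fs-p pp)

  lgQ : ℕ → ℚ
  lgQ p = ι (lg p) * rec H

  open Additive lgQ (λ p → 0≤* (ι≥0 (lg p)) (rec≥0 H)) public

  lam≡ : ∀ n → lam n ≡ ι (lamℕ n) * rec H
  lam≡ n = go (fs n)
   where
   go : ∀ l → Σ l lgQ ≡ ι (sum (map lg l)) * rec H
   go [] = sym (trans (cong (_* rec H) ι-0) (*-zeroˡ _))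
   go (x ∷ l) = trans (cong (lgQ x +_) (go l)) (trans (sym (*-distribʳ-+ (rec H) _ _)) (cong (_* rec H) (sym (ι-+ (lg x) (sum (map lg l))))))

  ρ^lam≤ : ∀ n → 1 N.≤ n → ρ ^ lamℕ n ≤ ι n
  ρ^lam≤ = factor-induction (λ n → ρ ^ lamℕ n ≤ ι n) (≤-reflexive (sym ι-1)) λ p n pp q ih →
   subst₂ _≤_ (sym (trans (cong (ρ ^_) (trans (lamℕ-* (prime≥1 pp) q) (cong (N._+ lamℕ n) (lamℕ-p pp)))) (^-+ ρ (lg p) (lamℕ n)))) (sym (ι-* p n))
    (*-mono (^≥0 (lg p) ρ≥0) (^≥0 (lamℕ n) ρ≥0) (lg-lower (prime≥1 pp)) ih)

  -- Rounding loses less than one step of log_ρ for every prime factor, hence at most Ω(n) steps in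
  -- all.
  ≤ρ^lamΩ : ∀ n → 1 N.≤ n → ι n ≤ ρ ^ (lamℕ n N.+ Ω n)
  ≤ρ^lamΩ = factor-induction (λ n → ι n ≤ ρ ^ (lamℕ n N.+ Ω n)) (≤-reflexive ι-1) λ p n pp q ih →
   subst₂ _≤_ (sym (ι-* p n)) (sym (trans (cong (ρ ^_) (e p n pp q)) (^-+ ρ (suc (lg p)) (lamℕ n N.+ Ω n))))
    (*-mono (ι≥0 p) (ι≥0 n) (<⇒≤ (lg-upper p)) ih)
   where
   open import Data.Nat.Tactic.RingSolver using () renaming (solve-∀ to solveℕ)
   re : ∀ a b c → a N.+ b N.+ (1 N.+ c) ≡ suc a N.+ (b N.+ c)
   re = solveℕ
   e : ∀ p n → Prime p → 1 N.≤ n → lamℕ (p N.* n) N.+ Ω (p N.* n) ≡ suc (lg p) N.+ (lamℕ n N.+ Ω n)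
   e p n pp q = trans (cong₂ N._+_ (trans (lamℕ-* (prime≥1 pp) q) (cong (N._+ lamℕ n) (lamℕ-p pp))) (trans (Ω-* (prime≥1 pp) q) (cong (N._+ Ω n) (Ω-p pp))))
    (re (lg p) (lamℕ n) (Ω n))

  2^Ω≤ : ∀ n → 1 N.≤ n → 2 N.^ Ω n N.≤ n
  2^Ω≤ = factor-induction (λ n → 2 N.^ Ω n N.≤ n) NP.≤-refl λ p n pp q ih →
   ℕ≡≤ (cong (2 N.^_) (trans (Ω-* (prime≥1 pp) q) (cong (N._+ Ω n) (Ω-p pp)))) (NP.*-mono-≤ (prime≥2 pp) ih)

  lamℕ≤lg : ∀ {n} → 1 N.≤ n → lamℕ n N.≤ lg n
  lamℕ≤lg h = lg-≥ (ρ^lam≤ _ h)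

  lg≤lamΩ : ∀ {n} → 1 N.≤ n → lg n N.≤ lamℕ n N.+ Ω n
  lg≤lamΩ h = lg-≤ h (≤ρ^lamΩ _ h)

  opaque
   -- ⌈ρ^j⌉, the left end of the block of integers whose `lg` equals j.
   x-exists : ∀ j → ∃[ x ] (ρ ^ j ≤ ι x × (∀ y → y N.< x → ¬ (ρ ^ j ≤ ι y)) × x N.≤ 2 N.^ j)
   x-exists j = least (λ x → ρ ^ j ≤? ι x) (2 N.^ j) (subst (ρ ^ j ≤_) (sym (ι-^ 2 j)) (^-mono j ρ≥0 (subst (ρ ≤_) (sym ι-2) (+-monoʳ 1ℚ (rec≤1' H≥1)))))

  x : ℕ → ℕ
  x j = proj₁ (x-exists j)

  x-lower : ∀ j → ρ ^ j ≤ ι (x j)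
  x-lower j = proj₁ (proj₂ (x-exists j))

  <x : ∀ {y j} → y N.< x j → ι y < ρ ^ j
  <x {y} {j} h = ≰⇒> (proj₁ (proj₂ (proj₂ (x-exists j))) y h)

  <x⁻ : ∀ {y j} → ι y < ρ ^ j → y N.< x j
  <x⁻ {y} {j} h = NP.≰⇒> (λ le → <-irrefl refl (<-≤-trans h (≤-trans (x-lower j) (ι-mono le))))

  x≥1 : ∀ j → 1 N.≤ x j
  x≥1 j = ι-cancel (subst (_≤ ι (x j)) (sym ι-1) (≤-trans (1≤^ j ρ≥1) (x-lower j)))

  x-upper : ∀ j → ι (x j) ≤ 1ℚ + ρ ^ j
  x-upper j = go (x j) refl
   where
   go : ∀ n → n ≡ x j → ι n ≤ 1ℚ + ρ ^ j
   go zero _ = subst (_≤ 1ℚ + ρ ^ j) (sym ι-0) (0≤+ 0≤1 (^≥0 j ρ≥0))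
   go (suc n) e = subst (_≤ 1ℚ + ρ ^ j) (sym (ι-suc n)) (+-monoʳ 1ℚ (<⇒≤ (<x {n} {j} (NP.≤-reflexive e))))

  x-mono : ∀ j → x j N.≤ x (suc j)
  x-mono j = NP.≮⇒≥ λ h → <-irrefl refl (<-≤-trans (<-trans (<x {x (suc j)} {j} h) (^<suc j)) (x-lower (suc j)))

  X : ℕ
  X = x J

  -- With r = 1/H one has (1+r)^K (1-r)^K ≤ 1 and (1-r)^K ≥ 1 - K r = 1/2, hence ρ^K ≤ 2; H = 2K is
  -- even for this purpose.
  ρ^H≤4 : ρ ^ H ≤ ι 4
  ρ^H≤4 = subst₂ _≤_ (sym e) (trans (sym (ι-* 2 2)) refl) (*-mono (^≥0 K ρ≥0) (^≥0 K ρ≥0) half half)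
   where
   r = rec H
   e : ρ ^ H ≡ ρ ^ K * ρ ^ K
   e = trans (cong (ρ ^_) (cong (K N.+_) (NP.+-identityʳ K))) (^-+ ρ K K)
   Kr : ι K * r + ι K * r ≡ 1ℚ
   Kr = trans (id73 (ι K) r) (trans (cong (λ z → (z * ι K) * r) (sym ι-2)) (trans (cong (_* r) (sym (ι-* 2 K))) (ι*rec H≥1)))
   b : 1ℚ - ι K * r ≤ (1ℚ - r) ^ K
   b = bernoulli- r K (rec≥0 H) (rec≤1' H≥1)
   prod : ρ ^ K * (1ℚ - r) ^ K ≤ 1ℚ
   prod = subst (_≤ 1ℚ) (^-* ρ (1ℚ - r) K) (^≤1 K (0≤* ρ≥0 (≤⇒0≤ (rec≤1' H≥1))) (id74 r via sq≥0 r))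
   h1 : ρ ^ K * (1ℚ - ι K * r) ≤ 1ℚ
   h1 = ≤-trans (*-monoˡ (ρ ^ K) (^≥0 K ρ≥0) b) prod
   half : ρ ^ K ≤ ι 2
   half = subst (ρ ^ K ≤_) (sym ι-2) (≡≤ (trans (sym (*-identityʳ _)) (trans (cong (ρ ^ K *_) (trans (sym (id75 (ι K * r))) (cong (λ z → (1ℚ - ι K * r) + ((1ℚ - ι K * r) + (z - 1ℚ))) Kr))) (id76 (ρ ^ K) (1ℚ - ι K * r))))
     (+-mono h1 h1))

  ρ^≤2^ : ∀ i → ρ ^ (i N.* H) ≤ ι (2 N.^ (2 N.* i))
  ρ^≤2^ i = subst₂ _≤_ (sym (^-^ ρ i H)) (trans (sym (ι-^ 4 i)) (cong ι (trans (NP.^-*-assoc 2 2 i) refl))) (^-mono i (^≥0 H ρ≥0) ρ^H≤4)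

  J≡ : J ≡ (P N.* m) N.* H
  J≡ = trans (cong (P N.*_) (NP.*-comm H m)) (sym (NP.*-assoc P m H))

  X≤ : X N.≤ 2 N.^ W
  X≤ = ι-cancel (≤-trans (x-upper J) (≤≡ (+-mono (subst (1ℚ ≤_) refl (subst (_≤ ι (2 N.^ (2 N.* (P N.* m)))) ι-1 (ι-mono (NP.m^n>0 2 (2 N.* (P N.* m))))))
    (subst (λ z → ρ ^ z ≤ ι (2 N.^ (2 N.* (P N.* m)))) (sym J≡) (ρ^≤2^ (P N.* m))))
   (trans (sym (ι-+ _ _)) (cong (λ z → ι (2 N.^ (2 N.* (P N.* m)) N.+ z)) (sym (NP.+-identityʳ _))))))

  Ω≤W : ∀ {n} → 1 N.≤ n → n N.≤ X → Ω n N.≤ W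
  Ω≤W {n} h l = NP.≮⇒≥ λ lt → NP.<⇒≱ (NP.^-monoʳ-< 2 (N.s≤s 1≤suc) lt) (NP.≤-trans (2^Ω≤ n h) (NP.≤-trans l X≤))

  lg<J : ∀ {n} → 1 N.≤ n → n N.< X → lg n N.< J
  lg<J h l = ^-strict (≤-<-trans (lg-lower h) (<x {_} {J} l))

  w : ℕ → ℚ
  w n = T ^ lamℕ n

  w≥0 : ∀ n → 0ℚ ≤ w n
  w≥0 n = ^≥0 (lamℕ n) T≥0

  w≤1 : ∀ n → w n ≤ 1ℚ
  w≤1 n = ^≤1 (lamℕ n) T≥0 T≤1

  w-* : ∀ {a b} → 1 N.≤ a → 1 N.≤ b → w (a N.* b) ≡ w a * w b
  w-* {a} {b} p q = trans (cong (T ^_) (lamℕ-* p q)) (^-+ T (lamℕ a) (lamℕ b))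

  Gm : ℕ → ℚ
  Gm k = ι (P N.* m) ^ k

  Gm≥0 : ∀ k → 0ℚ ≤ Gm k
  Gm≥0 k = ^≥0 k (ι≥0 _)

  g : ℕ → ℕ → ℚ
  g k j = dp k (ι j * rec H) * T ^ j

  jH≥0 : ∀ j → 0ℚ ≤ ι j * rec H
  jH≥0 j = 0≤* (ι≥0 j) (rec≥0 H)

  jH≤ : ∀ {j} → j N.≤ J → ι j * rec H ≤ ι (P N.* m)
  jH≤ {j} h = ≤≡ (*-monoʳ (rec H) (rec≥0 H) (ι-mono h)) (trans (cong (λ z → ι z * rec H) J≡)
   (trans (cong (_* rec H) (ι-* (P N.* m) H)) (trans (*-assoc _ _ _) (trans (cong (ι (P N.* m) *_) (ι*rec H≥1)) (*-identityʳ _)))))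

  dp≤Gm : ∀ k {y} → 0ℚ ≤ y → y ≤ ι (P N.* m) → dp k y ≤ Gm k
  dp≤Gm k h l = ≤-trans (dp≤^ k h) (^-mono k h l)

  g≥0 : ∀ k j → 0ℚ ≤ g k j
  g≥0 k j = 0≤* (dp≥0 k (jH≥0 j)) (^≥0 j T≥0)

  g≤Gm : ∀ k {j} → j N.≤ J → g k j ≤ Gm k
  g≤Gm k {j} h = subst (g k j ≤_) (*-identityʳ _) (*-mono (dp≥0 k (jH≥0 j)) (^≥0 j T≥0) (dp≤Gm k (jH≥0 j) (jH≤ h)) (^≤1 j T≥0 T≤1))

  v : ℕ → ℕ → ℚ
  v k n = dp k (lam n) * w n

  v≥0 : ∀ k n → 0ℚ ≤ v k n
  v≥0 k n = 0≤* (dp≥0 k (lam≥0 n)) (w≥0 n)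

  E : ℕ → ℚ
  E k = Gm k * (ι W * rec H) + Gm k * (ι W * rec H)

  θ≤recH : θ ≤ rec H
  θ≤recH = rec-mono H≥1 (NP.m≤m*n H m {{N.>-nonZero m≥1}})

  lam≤lgQ : ∀ {n} → 1 N.≤ n → lam n ≤ ι (lg n) * rec H
  lam≤lgQ {n} h = ≡≤ (lam≡ n) (*-monoʳ (rec H) (rec≥0 H) (ι-mono (lamℕ≤lg h)))

  lam≤Pm : ∀ {n} → 1 N.≤ n → n N.< X → lam n ≤ ι (P N.* m)
  lam≤Pm h l = ≤-trans (lam≤lgQ h) (jH≤ (NP.<⇒≤ (lg<J h l)))

  v≤Gm : ∀ k {n} → 1 N.≤ n → n N.< X → v k n ≤ Gm k
  v≤Gm k {n} h l = subst (v k n ≤_) (*-identityʳ _) (*-mono (dp≥0 k (lam≥0 n)) (w≥0 n) (dp≤Gm k (lam≥0 n) (lam≤Pm h l)) (w≤1 n))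

  -- The additive logarithm and `lg` differ by at most W steps of size 1/H, so the weight of n is
  -- determined by its block up to a small error. This permits block-wise counting by the sieve.
  v≈g : ∀ k {n} → 1 N.≤ n → n N.< X → ∣ v k n - g k (lg n) ∣ ≤ E k
  v≈g k {n} h l = subst (λ z → ∣ z ∣ ≤ E k) (id82 (dp k (lam n)) (w n) (dp k j') (T ^ lg n)) (abs-+ part1 part2)
   where
   j' : ℚ
   j' = ι (lg n) * rec H
   d : ℕ
   d = lg n N.∸ lamℕ n
   dW : d N.≤ W
   dW = NP.≤-trans (NP.m≤n+o⇒m∸n≤o (lg n) (lamℕ n) (lg≤lamΩ h)) (Ω≤W h (NP.<⇒≤ l))
   lgd : lg n ≡ lamℕ n N.+ d
   lgd = sym (NP.m+[n∸m]≡n (lamℕ≤lg h))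
   WH≥0 : 0ℚ ≤ ι W * rec H
   WH≥0 = 0≤* (ι≥0 W) (rec≥0 H)
   tw : w n - T ^ lg n ≤ ι W * rec H
   tw = ≡≤ (trans (cong (λ z → w n - z) (trans (cong (T ^_) lgd) (^-+ T (lamℕ n) d))) (id77 (w n) (T ^ d)))
      (≤-trans (subst (w n * (1ℚ - T ^ d) ≤_) (*-identityˡ _) (*-monoʳ (1ℚ - T ^ d) (≤⇒0≤ (^≤1 d T≥0 T≤1)) (w≤1 n)))
      (≤-trans (id78 (ι d) θ (T ^ d) via ≤⇒0≤ (bernoulli- θ d θ≥0 θ≤1)) (*-mono (ι≥0 d) θ≥0 (ι-mono dW) θ≤recH)))
   tw≥0 : 0ℚ ≤ w n - T ^ lg n
   tw≥0 = ≤⇒0≤ (^-antiʳ T≥0 T≤1 (lamℕ≤lg h))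
   part1 : ∣ dp k (lam n) * (w n - T ^ lg n) ∣ ≤ Gm k * (ι W * rec H)
   part1 = abs-* (≡≤ (∣∣-nonneg (dp≥0 k (lam≥0 n))) (dp≤Gm k (lam≥0 n) (lam≤Pm h l)))
          (≡≤ (∣∣-nonneg tw≥0) tw)
   gap : dp k j' - dp k (lam n) ≤ Gm k * (ι W * rec H)
   gap = go k
    where
    y : ℚ
    y = ι d * rec H
    je : j' ≡ lam n + y
    je = trans (cong (λ z → ι z * rec H) lgd) (trans (cong (_* rec H) (ι-+ (lamℕ n) d)) (trans (*-distribʳ-+ (rec H) _ _) (cong (_+ y) (sym (lam≡ n)))))
    1≤Pm : 1ℚ ≤ ι (P N.* m)
    1≤Pm = subst (_≤ ι (P N.* m)) ι-1 (ι-mono Pm≥1)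
    go : ∀ k → dp k j' - dp k (lam n) ≤ Gm k * (ι W * rec H)
    go zero = ≡≤ (+-inverseʳ 1ℚ) (0≤* 0≤1 WH≥0)
    go (suc k) = ≤-trans (id44 _ _ _ via ≤⇒0≤ (subst (λ z → dp (suc k) z ≤ dp (suc k) (lam n) + y * dp k z) (sym je) (dp-lipschitz k (lam≥0 n) (jH≥0 d))))
     (≤≡ (*-mono (jH≥0 d) (dp≥0 k (jH≥0 (lg n))) (*-monoʳ (rec H) (rec≥0 H) (ι-mono dW)) (≤-trans (dp≤Gm k (jH≥0 (lg n)) (jH≤ (NP.<⇒≤ (lg<J h l))))
       (≡≤ (sym (*-identityˡ _)) (*-monoʳ (Gm k) (Gm≥0 k) 1≤Pm)))) (*-comm _ _))
   gap≥0 : 0ℚ ≤ dp k j' - dp k (lam n)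
   gap≥0 = ≤⇒0≤ (dp-mono k (lam≥0 n) (lam≤lgQ h))
   part2 : ∣ - (T ^ lg n * (dp k j' - dp k (lam n))) ∣ ≤ Gm k * (ι W * rec H)
   part2 = abs-neg (subst (∣ T ^ lg n * (dp k j' - dp k (lam n)) ∣ ≤_) (*-identityˡ _) (abs-* (≡≤ (∣∣-nonneg (^≥0 (lg n) T≥0)) (^≤1 (lg n) T≥0 T≤1))
     (≡≤ (∣∣-nonneg gap≥0) gap)))

-- Weighted sums of sifted integers in a residue class.

module Equidistribution where

 open Q
 open Kit
 open DividedPower
 open Sieve
 open Blocks

 module _ (K m P : ℕ) (K≥1 : 1 N.≤ K) (m≥1 : 1 N.≤ m) (P≥1 : 1 N.≤ P) where
  open Weights K m P K≥1 m≥1 P≥1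

  module InClass (Q : ℕ) {{_ : NonZero Q}} where
   open Congruence Q

   module _ {ps : List ℕ} (sv : Sieving ps) (r : ℕ) (b : ℕ) where

    a : ℕ → ℚ
    a n = χ (1 N.* n ≈? b) * χ (sifted? ps n)

    a≥0 : ∀ n → 0ℚ ≤ a n
    a≥0 n = 0≤* (χ≥0 (1 N.* n ≈? b)) (χ≥0 (sifted? ps n))

    a≤1 : ∀ n → a n ≤ 1ℚ
    a≤1 n = ≤-trans (χ*≤ (1 N.* n ≈? b) (χ≥0 (sifted? ps n))) (χ≤1 (sifted? ps n))

    D : ℕ → ℕ → ℚ
    D k j = Σ (range (x j)) (λ n → a n * (v k n * rec n))

    Vv B A₀ : ℚ
    Vv = V ps * rec Q
    B = dp r (h ps) * rec Q
    A₀ = A (length ps) r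

    B≥0 : 0ℚ ≤ B
    B≥0 = 0≤* (dp≥0 r (h≥0 ps)) (rec≥0 Q)

    A₀≥0 : 0ℚ ≤ A₀
    A₀≥0 = ^≥0 r (0≤* (ι≥0 3) (ι≥0 _))

    i : ℕ → ℚ
    i j = ρ⁻ ^ j

    i≥0 : ∀ j → 0ℚ ≤ i j
    i≥0 j = ^≥0 j ρ⁻≥0

    slack : ℕ → ℚ
    slack k = E k + Gm k * rec H

    -- The first part comes from freezing the weight on a block, the second from the sieve: rounding
    -- errors `A₀` relative to the block's scale ρ^j, and the truncation error `B`.
    errb : ℕ → ℕ → ℚ
    errb k j = slack k * (rec H + i j) + Gm k * (i j * (1ℚ + (A₀ + A₀)) + ι 6 * B)

    E≥0 : ∀ k → 0ℚ ≤ E k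
    E≥0 k = 0≤+ e e
     where e = 0≤* (Gm≥0 k) (0≤* (ι≥0 W) (rec≥0 H))

    slack≥0 : ∀ k → 0ℚ ≤ slack k
    slack≥0 k = 0≤+ (E≥0 k) (0≤* (Gm≥0 k) (rec≥0 H))

    module Block (k j : ℕ) (j<J : j N.< J) where

     t : ℕ
     t = x (suc j) N.∸ x j

     split : ∀ f → Σ (range (x (suc j))) f ≡ Σ (range t) (λ n → f (n N.+ x j)) + Σ (range (x j)) f
     split f = trans (cong (λ z → Σ (range z) f) (sym (NP.m∸n+n≡m (x-mono j)))) (Σ-range-+ t (x j) f)

     cancel-split : ∀ f → Σ (range (x (suc j))) f - Σ (range (x j)) f ≡ Σ (range t) (λ n → f (n N.+ x j))
     cancel-split f = trans (cong (λ z → z - Σ (range (x j)) f) (split f)) (id97 _ _)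

     Cj : ℚ
     Cj = Σ (range t) (λ n → a (n N.+ x j))

     width : ι t ≡ ι (x (suc j)) - ι (x j)
     width = trans (id98 (ι t) (ι (x j))) (cong (λ z → z - ι (x j)) (trans (sym (ι-+ t (x j))) (cong ι (NP.m∸n+n≡m (x-mono j)))))

     width-upper : ι t ≤ 1ℚ + ρ ^ j * rec H
     width-upper = ≡≤ width (id99 (ι (x (suc j))) (ι (x j)) (ρ ^ j) (rec H) via 0≤+ (≤⇒0≤ (x-upper (suc j))) (≤⇒0≤ (x-lower j)))

     Cj≤ : Cj ≤ 1ℚ + ρ ^ j * rec H
     Cj≤ = ≤-trans (Σ-mono (range t) (λ n → a≤1 (n N.+ x j))) (≡≤ (trans (Σ-const (range t) 1ℚ) (trans (*-identityʳ _) (cong ι (range-length t)))) width-upper)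

     pij : ρ ^ j * i j ≡ 1ℚ
     pij = ρ^ρ⁻^ j

     Cji≤ : Cj * i j ≤ i j + rec H
     Cji≤ = ≤≡ (*-monoʳ (i j) (i≥0 j) Cj≤) (trans (id100 (ρ ^ j) (rec H) (i j)) (cong (λ z → i j + z * rec H) pij) ⟨trans⟩ cong (i j +_) (*-identityˡ _))
      where
      infixl 5 _⟨trans⟩_
      _⟨trans⟩_ : ∀ {a b c : ℚ} → a ≡ b → b ≡ c → a ≡ c
      _⟨trans⟩_ = trans

     module _ (n : ℕ) (lo : x j N.≤ n) (hi : n N.< x (suc j)) where
      n≥1 : 1 N.≤ n
      n≥1 = NP.≤-trans (x≥1 j) lo
      lgn : lg n ≡ j
      lgn = lg-unique n≥1 (≤-trans (x-lower j) (ι-mono lo)) (<x {n} {suc j} hi)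
      n<X : n N.< X
      n<X = <x⁻ {n} {J} (<-≤-trans (<x {n} {suc j} hi) (^-monoʳ ρ≥1 j<J))
      inv-upper : rec n ≤ i j
      inv-upper = subst₂ _≤_ e1 e2 (*-monoʳ (i j * rec n) (0≤* (i≥0 j) (rec≥0 n)) (≤-trans (x-lower j) (ι-mono lo)))
       where
       e1 : ρ ^ j * (i j * rec n) ≡ rec n
       e1 = trans (id89 (ρ ^ j) (i j) (rec n)) (trans (cong (_* rec n) pij) (*-identityˡ _))
       e2 : ι n * (i j * rec n) ≡ i j
       e2 = trans (id8 (ι n) (i j) (rec n)) (trans (cong (i j *_) (ι*rec n≥1)) (*-identityʳ _))
      inv-lower : i j - rec n ≤ i j * rec H
      inv-lower = ≤-trans (id90 (i j) (rec n) (i (suc j)) via ≤⇒0≤ low) (≡≤ (id91 (i j) ρ⁻) (*-monoˡ (i j) (i≥0 j) gap))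
       where
       low : i (suc j) ≤ rec n
       low = subst₂ _≤_ (trans (id8 (ι n) (i (suc j)) (rec n)) (trans (cong (i (suc j) *_) (ι*rec n≥1)) (*-identityʳ _)))
        (trans (id89 (ρ ^ suc j) (i (suc j)) (rec n)) (trans (cong (_* rec n) (ρ^ρ⁻^ (suc j))) (*-identityˡ _)))
        (*-monoʳ (i (suc j) * rec n) (0≤* (i≥0 (suc j)) (rec≥0 n)) (<⇒≤ (<x {n} {suc j} hi)))
       gap : 1ℚ - ρ⁻ ≤ rec H
       gap = l4 (rec H) ρ⁻ ρρ⁻ via 0≤* (rec≥0 H) (0≤+ (≤⇒0≤ ρ⁻≤1) ≤-refl)
        where
        l4 : ∀ r p → (1ℚ + r) * p ≡ 1ℚ → r - (1ℚ - p) ≡ r * ((1ℚ - p) + 0ℚ)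
        l4 r p e = trans (cong (λ z → r - (z - p)) (sym e)) (id87 r p)
      weight : ∣ v k n * rec n - g k j * i j ∣ ≤ i j * slack k
      weight = subst₂ _≤_ (cong ∣_∣ (id92 (v k n) (rec n) (g k j) (i j))) (id93 (E k) (i j) (Gm k) (rec H))
       (abs-+ (abs-* (subst (λ z → ∣ v k n - g k z ∣ ≤ E k) lgn (v≈g k n≥1 n<X)) (≡≤ (∣∣-nonneg (rec≥0 n)) inv-upper))
        (abs-neg (abs-* (≡≤ (∣∣-nonneg (g≥0 k j)) (g≤Gm k (NP.<⇒≤ j<J))) (≡≤ (∣∣-nonneg (≤⇒0≤ inv-upper)) inv-lower))))

     part1 : ∣ Σ (range t) (λ n → a (n N.+ x j) * (v k (n N.+ x j) * rec (n N.+ x j))) - Cj * (g k j * i j) ∣ ≤ slack k * (rec H + i j)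
     part1 = subst (λ z → ∣ z ∣ ≤ slack k * (rec H + i j)) (trans (Σ-- (range t) _ _) (cong (λ z → Σ (range t) (λ n → a (n N.+ x j) * (v k (n N.+ x j) * rec (n N.+ x j))) - z) (Σ-*ʳ (range t) (g k j * i j) _)))
      (≤-trans (Σ-abs≤ (range t) (λ n n∈ → subst (λ z → ∣ z ∣ ≤ a (n N.+ x j) * (i j * slack k)) (id31 (a (n N.+ x j)) (v k (n N.+ x j) * rec (n N.+ x j)) (g k j * i j))
        (abs-* (≤-reflexive (∣∣-nonneg (a≥0 (n N.+ x j)))) (weight (n N.+ x j) (NP.m≤n+m (x j) n) (NP.<-≤-trans (NP.+-monoˡ-< (x j) (∈range n∈)) (NP.≤-reflexive (NP.m∸n+n≡m (x-mono j))))))))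
       (≡≤ (Σ-*ʳ (range t) (i j * slack k) _) (≡≤ (sym (*-assoc _ _ _)) (≤≡ (*-monoʳ (slack k) (slack≥0 k) Cji≤) (id101 (i j) (rec H) (slack k))))))

     part2 : ∣ Cj - Vv * (ρ ^ j * rec H) ∣ ≤ 1ℚ + (A₀ + A₀) + ι 6 * B * ρ ^ j
     part2 = ≤-trans (subst (λ z → ∣ z ∣ ≤ _) (trans (id102 (F ps 1 b (x (suc j))) (F ps 1 b (x j)) (V ps) (ι (x (suc j))) (ι (x j)) (rec Q) (ρ ^ j * rec H))
         (cong (λ z → z - Vv * (ρ ^ j * rec H)) (cancel-split a)))
        (abs-+ (abs-- (brun sv r 1 b (x (suc j)) coprime1) (brun sv r 1 b (x j) coprime1)) (abs-* {Vv} {ι (x (suc j)) - ι (x j) - ρ ^ j * rec H} {1ℚ} {1ℚ} Vv1 w1)))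
       bound
      where
      open import Data.Nat.Divisibility using (∣1⇒≡1)
      coprime1 : Coprime 1 Q
      coprime1 (d , _) = ∣1⇒≡1 d
      rQ : rec Q ≤ 1ℚ
      rQ = go Q (N.>-nonZero⁻¹ Q)
       where
       go : ∀ q → 1 N.≤ q → rec q ≤ 1ℚ
       go (suc q) _ = rec≤1 q
      Vv≥0 : 0ℚ ≤ Vv
      Vv≥0 = 0≤* (V≥0 sv) (rec≥0 Q)
      Vv1 : ∣ Vv ∣ ≤ 1ℚ
      Vv1 = ≡≤ (∣∣-nonneg Vv≥0) (subst (Vv ≤_) (*-identityˡ 1ℚ) (*-mono (V≥0 sv) (rec≥0 Q) (V≤1 sv) rQ))
      w1 : ∣ ι (x (suc j)) - ι (x j) - ρ ^ j * rec H ∣ ≤ 1ℚ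
      w1 = abs≤ (id94 _ _ _ _ via 0≤+ (≤⇒0≤ (x-upper (suc j))) (≤⇒0≤ (x-lower j))) (id95 _ _ _ _ via 0≤+ (≤⇒0≤ (x-lower (suc j))) (≤⇒0≤ (x-upper j)))
      bound : (A₀ + dp r (h ps) * (ι (x (suc j)) * rec Q)) + (A₀ + dp r (h ps) * (ι (x j) * rec Q)) + 1ℚ * 1ℚ ≤ 1ℚ + (A₀ + A₀) + ι 6 * B * ρ ^ j
      bound = ≡≤ (id96 A₀ (dp r (h ps)) (rec Q) (ι (x (suc j))) (ι (x j))) (+-monoʳ (1ℚ + (A₀ + A₀)) (≤≡ (*-monoˡ B B≥0 six) (id52 B (ι 6) (ρ ^ j))))
       where
       p = ρ ^ j
       p≥1 : 1ℚ ≤ p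
       p≥1 = 1≤^ j ρ≥1
       ι6 : ι 6 ≡ 1ℚ + (1ℚ + (1ℚ + (1ℚ + (1ℚ + 1ℚ))))
       ι6 = trans (ι-suc 5) (cong (1ℚ +_) (trans (ι-suc 4) (cong (1ℚ +_) (trans (ι-suc 3) (cong (1ℚ +_) (trans (ι-suc 2) (cong (1ℚ +_) ι-2)))))))
       -- The two ceilings exceed ρ^(j+1) and ρ^j by at most 1, and ρ ≤ 2, which gives at most 5
       -- ρ^j.
       six : ι (x (suc j)) + ι (x j) ≤ ι 6 * p
       six = subst (λ z → ι (x (suc j)) + ι (x j) ≤ z * p) (sym ι6)
        (id88 _ _ p (rec H) via 0≤+ (0≤+ (≤⇒0≤ (x-upper (suc j))) (≤⇒0≤ (x-upper j))) (0≤+ (0≤+ (≤⇒0≤ p≥1) (≤⇒0≤ p≥1)) (0≤+ (0≤* (≤⇒0≤ (rec≤1' H≥1)) (≤-trans 0≤1 p≥1)) (≤-trans 0≤1 p≥1))))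

     -- On the block of j the weight is frozen at g k j ρ^(-j) (`part1`), and the difference of two
     -- sieve estimates counts the block's members, about ρ^j / H times the sieve density (`part2`).
     -- The powers of ρ cancel.
     block-estimate : ∣ (D k (suc j) - D k j) - g k j * (Vv * rec H) ∣ ≤ errb k j
     block-estimate = subst₂ _≤_ (cong ∣_∣ (trans (re _ Cj (g k j) (i j) Vv (ρ ^ j) (rec H) pij) (cong (λ z → z - g k j * (Vv * rec H)) (sym (cancel-split (λ n → a n * (v k n * rec n))))))) eqn
      (abs-+ part1 (abs-* (≡≤ (∣∣-nonneg (0≤* (g≥0 k j) (i≥0 j))) (*-monoʳ (i j) (i≥0 j) (g≤Gm k (NP.<⇒≤ j<J)))) part2))
      where
      re : ∀ s C g i V p r → p * i ≡ 1ℚ → (s - C * (g * i)) + (g * i) * (C - V * (p * r)) ≡ s - g * (V * r)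
      re s C g i V p r e = trans (id103 s C g i V p r) (cong (λ z → s - z) (trans (cong (g * (V * r) *_) e) (*-identityʳ _)))
      eqn : slack k * (rec H + i j) + (Gm k * i j) * (1ℚ + (A₀ + A₀) + ι 6 * B * ρ ^ j) ≡ errb k j
      eqn = trans (id104 _ (Gm k) (i j) A₀ (ρ ^ j) (ι 6 * B)) (cong (λ z → slack k * (rec H + i j) + Gm k * (i j * (1ℚ + (A₀ + A₀)) + z)) (trans (cong (ι 6 * B *_) pij) (*-identityʳ _)))

    errb-anti : ∀ k j t → errb k (t N.+ j) ≤ errb k j
    errb-anti k j t = +-mono (*-monoˡ (slack k) (slack≥0 k) (+-monoʳ (rec H) ij)) (*-monoˡ (Gm k) (Gm≥0 k) (+-monoˡ (ι 6 * B) (*-monoʳ (1ℚ + (A₀ + A₀)) (0≤+ 0≤1 (0≤+ A₀≥0 A₀≥0)) ij)))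
     where
     ij : i (t N.+ j) ≤ i j
     ij = ^-antiʳ ρ⁻≥0 ρ⁻≤1 (NP.m≤n+m j t)

    equidistribution : ∀ k t j → t N.+ j N.≤ J →
     ∣ (D k (t N.+ j) - D k j) - Σ (range t) (λ s → g k (s N.+ j)) * (Vv * rec H) ∣ ≤ ι t * errb k j
    equidistribution k zero j h = ≤-reflexive (trans (cong ∣_∣ (id105 (D k j) (Vv * rec H))) (trans (∣∣-nonneg ≤-refl) (sym (trans (cong (_* errb k j) ι-0) (*-zeroˡ _)))))
    equidistribution k (suc t) j h = subst₂ _≤_ (cong ∣_∣ (id106 (D k (suc t N.+ j)) (D k (t N.+ j)) (D k j) (g k (t N.+ j)) _ (Vv * rec H))) (trans (id14 (errb k j) (ι t)) (cong (_* errb k j) (sym (ι-suc t))))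
     (abs-+ (≤-trans (Block.block-estimate k (t N.+ j) h) (errb-anti k j t)) (equidistribution k t j (NP.<⇒≤ h)))

-- The series L, R, U in residue classes and their convolution identities.

module Series where

 open Q
 open Kit
 open DividedPower
 open Arith
 open Sieve
 open Group
 open Units
 open Blocks
 open Chebyshev using (harmonic)

 module Sums (K m P : ℕ) (K≥1 : 1 N.≤ K) (m≥1 : 1 N.≤ m) (P≥1 : 1 N.≤ P) (Q : ℕ) {{nzQ : NonZero Q}}
       (ps : List ℕ) (ps-prime : All Prime ps) where
  open Weights K m P K≥1 m≥1 P≥1
  open Congruence Q using (sifted?; coprime-*)
  open FiniteAbelianGroup (units Q) using (els)
  open Analysis (units Q)
  open ClassSums Q X

  Allowed : ℕ → Set
  Allowed n = Coprime n Q × All (λ p → ¬ (p ∣ n)) ps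

  allowed? : ∀ n → Dec (Allowed n)
  allowed? n = coprime? n Q ×-dec sifted? ps n

  allowed-* : ∀ {a b} → Allowed a → Allowed b → Allowed (a N.* b)
  allowed-* {a} {b} (ca , sa) (cb , sb) = (λ {i} → coprime-* ca cb {i}) , go ps ps-prime sa sb
   where
   go : ∀ l → All Prime l → All (λ p → ¬ (p ∣ a)) l → All (λ p → ¬ (p ∣ b)) l → All (λ p → ¬ (p ∣ a N.* b)) l
   go [] _ _ _ = []
   go (p ∷ l) (pp ∷ pr) (na ∷ sa) (nb ∷ sb) = (λ d → by (euclidsLemma a b pp d)) ∷ go l pr sa sb
    where
    by : (p ∣ a) ⊎ (p ∣ b) → ⊥
    by (inj₁ d) = na d
    by (inj₂ d) = nb d

  allowed-∣ : ∀ {a b} → a ∣ b → Allowed b → Allowed a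
  allowed-∣ d (c , s) = (λ {i} (p , q) → c (∣-trans p d , q)) , All.map (λ n p → n (∣-trans p d)) s

  ω : ℕ → ℚ
  ω n = χ (allowed? n) * (w n * rec n)

  ω-0 : ω 0 ≡ 0ℚ
  ω-0 = trans (cong (χ (allowed? 0) *_) (*-zeroʳ (w 0))) (*-zeroʳ _)

  wr≥0 : ∀ n → 0ℚ ≤ w n * rec n
  wr≥0 n = 0≤* (w≥0 n) (rec≥0 n)

  ω≥0 : ∀ n → 0ℚ ≤ ω n
  ω≥0 n = 0≤* (χ≥0 (allowed? n)) (wr≥0 n)

  ω≤wr : ∀ n → ω n ≤ w n * rec n
  ω≤wr n = χ*≤ (allowed? n) (wr≥0 n)

  ω≤rec : ∀ n → ω n ≤ rec n
  ω≤rec n = ≤-trans (ω≤wr n) (subst (w n * rec n ≤_) (*-identityˡ _) (*-monoʳ (rec n) (rec≥0 n) (w≤1 n)))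

  ω-* : ∀ {a b} → 1 N.≤ a → 1 N.≤ b → ω (a N.* b) ≡ ω a * ω b
  ω-* {a} {b} p q = trans (cong₂ _*_ (trans (χ-⇔ (allowed? (a N.* b)) (allowed? a ×-dec allowed? b)
    (λ h → allowed-∣ (m∣m*n b) h , allowed-∣ (n∣m*n a) h) (λ { (h , k) → allowed-* h k })) (χ-× (allowed? a) (allowed? b)))
   (cong₂ _*_ (w-* p q) (rec-* a b))) (id125 _ _ (w a) (w b) (rec a) (rec b))

  ω-¬coprime : ∀ {n} → ¬ Coprime n Q → ω n ≡ 0ℚ
  ω-¬coprime {n} h = trans (cong (_* (w n * rec n)) (χ-no (allowed? n) (λ { (c , _) → h (λ {i} → c {i}) }))) (*-zeroˡ _)

  ω-1 : ω 1 ≡ 1ℚ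
  ω-1 = trans (cong₂ _*_ (χ-yes (allowed? 1) ((λ {i} → coprime-1 Q {i}) , All.map (λ pp d → ¬prime[1] (subst Prime (∣1⇒≡1 d) pp)) ps-prime))
    (trans (*-identityˡ _) (trans (sym (*-identityˡ _)) (trans (cong (_* rec 1) (sym ι-1)) (ι*rec 1≤suc))))) (*-identityˡ 1ℚ)

  rF : ℕ → ℕ → ℚ
  rF k n = dp k (lam n) * ω n

  qF : (ℕ → ℚ) → ℕ → ℕ → ℚ
  qF q k n = dp k (lam n) * (q n * ω n)

  rF-supported : ∀ k → Supported Q (rF k)
  rF-supported k n h = trans (cong (dp k (lam n) *_) (ω-¬coprime (λ c → h (λ {i} → c {i})))) (*-zeroʳ _)

  hs : ℚ
  hs = Σ (range X) rec

  hs≤W : hs ≤ ι W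
  hs≤W = ≤-trans (Σ-extend rec rec≥0 X (2 N.^ W) X≤) (harmonic W)

  hs≥0 : 0ℚ ≤ hs
  hs≥0 = Σ≥0 (range X) rec≥0

  ε∞ : ℚ
  ε∞ = T ^ (J N.∸ (W N.+ W))

  ε∞≥0 : 0ℚ ≤ ε∞
  ε∞≥0 = ^≥0 (J N.∸ (W N.+ W)) T≥0

  -- A product beyond X has `lg` at least J, and its additive logarithm falls short of that by at
  -- most the number of its prime factors, which is at most 2W.
  w-tail : ∀ {d n} → 1 N.≤ d → 1 N.≤ n → d N.< X → n N.< X → X N.≤ d N.* n → w d * w n ≤ ε∞
  w-tail {d} {n} p q ld ln h = subst (_≤ ε∞) (w-* p q) (^-antiʳ T≥0 T≤1 (NP.m≤n+o⇒m∸n≤o J (W N.+ W)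
    (NP.≤-trans (lg-≥ (≤-trans (x-lower J) (ι-mono h))) (NP.≤-trans (lg≤lamΩ (NP.*-mono-≤ p q)) (ℕ≤≡ (NP.+-monoʳ-≤ (lamℕ (d N.* n))
     (ℕ≡≤ (Ω-* p q) (NP.+-mono-≤ (Ω≤W p (NP.<⇒≤ ld)) (Ω≤W q (NP.<⇒≤ ln))))) (NP.+-comm (lamℕ (d N.* n)) _))))))

  -- The Dirichlet convolution q * 1 seen in residue classes. It is exact except for pairs with d e
  -- ≥ X, which lie in the box d, e < X but not in the sum up to X; their weights are tiny. It
  -- serves for q = Λ and q = μ.
  module Convolution (q : ℕ → ℚ) (qb : ℚ) (qb≥0 : 0ℚ ≤ qb) (q≤ : ∀ d → 1 N.≤ d → d N.< X → ∣ q d ∣ ≤ qb) (k : ℕ) where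

   Θ : ℕ → ℕ → ℚ
   Θ d n = q d * ω d * ω n * dp k (lam d + lam n)

   FF : ℕ → ℚ
   FF n = divisorSum q n * (dp k (lam n) * ω n)

   τ : ℚ
   τ = (qb * (ι (P N.* m) + ι (P N.* m)) ^ k) * ε∞ * (hs * hs)

   pm≥0 : 0ℚ ≤ ι (P N.* m) + ι (P N.* m)
   pm≥0 = 0≤+ (ι≥0 _) (ι≥0 _)

   τ≥0 : 0ℚ ≤ τ
   τ≥0 = 0≤* (0≤* (0≤* qb≥0 (^≥0 k pm≥0)) ε∞≥0) (0≤* hs≥0 hs≥0)

   Θ-0 : ∀ d n → d N.* n ≡ 0 → Θ d n ≡ 0ℚ
   Θ-0 d n e with NP.m*n≡0⇒m≡0∨n≡0 d e
   ... | inj₁ refl = trans (cong (λ z → q 0 * z * ω n * dp k (lam 0 + lam n)) ω-0) (id111 (q 0) (ω n) (dp k (lam 0 + lam n)))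
   ... | inj₂ refl = trans (cong (λ z → q d * ω d * z * dp k (lam d + lam 0)) ω-0) (id112 (q d * ω d) (dp k (lam d + lam 0)))

   ≥1-factors : ∀ d n → 1 N.≤ d N.* n → 1 N.≤ d × 1 N.≤ n
   ≥1-factors zero n ()
   ≥1-factors (suc d) zero h = ⊥-elim (NP.<⇒≱ h (NP.≤-reflexive (NP.*-zeroʳ (suc d))))
   ≥1-factors (suc d) (suc n) h = N.s≤s N.z≤n , N.s≤s N.z≤n

   FF≡ : ∀ n → n N.< X → FF n ≡ Σ (range X) (λ d → Σ (range X) (λ e → χ (d N.* e N.≟ n) * Θ d e))
   FF≡ zero _ = trans (cong (λ z → divisorSum q 0 * (dp k (lam 0) * z)) ω-0) (trans (id113 _ _) (sym (Σ-0∈ (range X) (λ d _ → Σ-0∈ (range X) (λ e _ →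
     trans (χ-subst (d N.* e N.≟ 0) {Θ d e} {0ℚ} (Θ-0 d e)) (*-zeroʳ _))))))
   FF≡ n@(suc _) h = begin
    divisorSum q n * c ≡⟨ cong (_* c) (sym (divisorSum-bound q X n1 h)) ⟩
    Σ (range X) (λ d → χ (d ∣? n) * q d) * c ≡⟨ sym (Σ-*ʳ (range X) c _) ⟩
    Σ (range X) (λ d → χ (d ∣? n) * q d * c) ≡⟨ Σ-cong (range X) (λ d → trans (cong (λ z → z * q d * c) (χ-∣≡Σ d X n1 h))
      (trans (*-assoc _ _ _) (trans (sym (Σ-*ʳ (range X) (q d * c) _)) (Σ-cong (range X) (λ e → χ-subst (d N.* e N.≟ n) {q d * c} {Θ d e} (term d e)))))) ⟩
    Σ (range X) (λ d → Σ (range X) (λ e → χ (d N.* e N.≟ n) * Θ d e)) ∎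
    where
    open ≡-Reasoning
    n1 : 1 N.≤ n
    n1 = N.s≤s N.z≤n
    c : ℚ
    c = dp k (lam n) * ω n
    term : ∀ d e → d N.* e ≡ n → q d * c ≡ Θ d e
    term d e eq = trans (cong (λ z → q d * (dp k (lam z) * ω z)) (sym eq)) (trans (cong₂ (λ a b → q d * (dp k a * b)) (lam-* (proj₁ pq) (proj₂ pq)) (ω-* (proj₁ pq) (proj₂ pq))) (id114 _ _ _ _))
     where pq = ≥1-factors d e (subst (1 N.≤_) (sym eq) n1)

   S-FF : ∀ b → S FF b ≡ Σ (range X) (λ d → Σ (range X) (λ e → χ (d N.* e N.<? X) * (Θ d e * χ (_≟U_ Q (un Q (d N.* e)) b))))
   S-FF b = begin
    Σ (range X) (λ n → FF n * c n)
     ≡⟨ Σ-cong∈ (range X) (λ n n∈ → trans (cong (_* c n) (FF≡ n (∈range n∈))) (trans (sym (Σ-*ʳ (range X) (c n) _)) (Σ-cong (range X) (λ d → sym (Σ-*ʳ (range X) (c n) _))))) ⟩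
    Σ (range X) (λ n → Σ (range X) (λ d → Σ (range X) (λ e → χ (d N.* e N.≟ n) * Θ d e * c n)))
     ≡⟨ trans (Σ-swap (range X) (range X) _) (Σ-cong (range X) (λ d → Σ-swap (range X) (range X) _)) ⟩
    Σ (range X) (λ d → Σ (range X) (λ e → Σ (range X) (λ n → χ (d N.* e N.≟ n) * Θ d e * c n)))
     ≡⟨ Σ-cong (range X) (λ d → Σ-cong (range X) (λ e → pick d e)) ⟩
    Σ (range X) (λ d → Σ (range X) (λ e → χ (d N.* e N.<? X) * (Θ d e * c (d N.* e)))) ∎
    where
    open ≡-Reasoning
    c : ℕ → ℚ
    c n = χ (_≟U_ Q (un Q n) b)
    pick : ∀ d e → Σ (range X) (λ n → χ (d N.* e N.≟ n) * Θ d e * c n) ≡ χ (d N.* e N.<? X) * (Θ d e * c (d N.* e))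
    pick d e = trans (Σ-cong (range X) (λ n → trans (*-assoc _ _ _) (χ-subst (d N.* e N.≟ n) {Θ d e * c n} {Θ d e * c (d N.* e)} (λ { refl → refl }))))
     (trans (Σ-*ʳ (range X) _ _) (cong (_* (Θ d e * c (d N.* e))) (by (d N.* e N.<? X))))
     where
     by : (dc : Dec (d N.* e N.< X)) → Σ (range X) (λ n → χ (d N.* e N.≟ n)) ≡ χ dc
     by (yes l) = trans (Σ-cong (range X) (λ n → χ-⇔ (d N.* e N.≟ n) (n N.≟ d N.* e) sym sym)) (Σ-range-χ l)
     by (no nl) = Σ-0∈ (range X) (λ n n∈ → χ-no (d N.* e N.≟ n) (λ { refl → nl (∈range n∈) }))

   -- The binomial theorem for `dp` at lam d + lam e merges the k+1 convolutions into one sum over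
   -- the full box; `S-FF` is the same sum restricted to d e < X.
   box : ∀ b → Σ (range (suc k)) (λ i → (S (qF q i) ⋆ S (rF (k N.∸ i))) b) ≡
    Σ (range X) (λ d → Σ (range X) (λ e → Θ d e * χ (_≟U_ Q (un Q (d N.* e)) b)))
   box b = trans (Σ-cong (range (suc k)) (λ i → S⋆S (qF q i) (rF (k N.∸ i)) b)) (trans (Σ-swap (range (suc k)) (range X) _) (Σ-cong (range X) (λ d →
     trans (Σ-swap (range (suc k)) (range X) _) (Σ-cong (range X) (λ e → step d e)))))
    where
    inner : ∀ d e → Σ (range (suc k)) (λ i → qF q i d * rF (k N.∸ i) e * χ (_≟U_ Q (_*U_ Q (un Q d) (un Q e)) b)) ≡ Θ d e * χ (_≟U_ Q (_*U_ Q (un Q d) (un Q e)) b)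
    inner d e = trans (Σ-cong (range (suc k)) (λ i → id115 (dp i (lam d)) (ω d) (ω e) (dp (k N.∸ i) (lam e)) (q d) _))
     (trans (Σ-*ʳ (range (suc k)) _ _) (trans (cong (_* _) (sym (dp-+ k (lam d) (lam e)))) (id116 _ (q d) (ω d) (ω e) _)))
    zeroed : ∀ d e (c c' : ℚ) → (ω d ≡ 0ℚ) ⊎ (ω e ≡ 0ℚ) → Θ d e * c ≡ Θ d e * c'
    zeroed d e c c' (inj₁ z) = trans (cong (λ y → q d * y * ω e * dp k (lam d + lam e) * c) z) (trans (id107 (q d) (ω e) (dp k (lam d + lam e)) c c') (cong (λ y → q d * y * ω e * dp k (lam d + lam e) * c') (sym z)))
    zeroed d e c c' (inj₂ z) = trans (cong (λ y → q d * ω d * y * dp k (lam d + lam e) * c) z) (trans (id108 (q d * ω d) (dp k (lam d + lam e)) c c') (cong (λ y → q d * ω d * y * dp k (lam d + lam e) * c') (sym z)))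
    step : ∀ d e → Σ (range (suc k)) (λ i → qF q i d * rF (k N.∸ i) e * χ (_≟U_ Q (_*U_ Q (un Q d) (un Q e)) b)) ≡ Θ d e * χ (_≟U_ Q (un Q (d N.* e)) b)
    step d e = trans (inner d e) (by (coprime? d Q) (coprime? e Q))
     where
     by : Dec (Coprime d Q) → Dec (Coprime e Q) → _
     by (yes c) (yes c') = cong (λ z → Θ d e * χ (_≟U_ Q z b)) (sym (un-* Q (λ {i} → c {i}) (λ {i} → c' {i})))
     by (no n) _ = zeroed d e _ _ (inj₁ (ω-¬coprime (λ c → n (λ {i} → c {i}))))
     by _ (no n) = zeroed d e _ _ (inj₂ (ω-¬coprime (λ c → n (λ {i} → c {i}))))

   Θ-tail : ∀ d e → d N.< X → e N.< X → ¬ (d N.* e N.< X) → ∣ Θ d e ∣ ≤ (qb * (ι (P N.* m) + ι (P N.* m)) ^ k) * ε∞ * (rec d * rec e)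
   Θ-tail d e ld le nl = subst₂ _≤_ (cong ∣_∣ (id117 (q d) (dp k (lam d + lam e)) (ω d) (ω e))) (id118 qb _ ε∞ (rec d * rec e))
     (abs-* (abs-* (q≤ d d1 ld) (≡≤ (∣∣-nonneg (dp≥0 k ll≥0)) (≤-trans (dp≤^ k ll≥0) (^-mono k ll≥0 (+-mono (lam≤Pm d1 ld) (lam≤Pm e1 le))))))
         (≡≤ (∣∣-nonneg (0≤* (ω≥0 d) (ω≥0 e))) (≤-trans (*-mono (ω≥0 d) (ω≥0 e) (ω≤wr d) (ω≤wr e)) (≡≤ (id71 (w d) (rec d) (w e) (rec e))
          (*-monoʳ (rec d * rec e) (0≤* (rec≥0 d) (rec≥0 e)) (w-tail d1 e1 ld le (NP.≮⇒≥ nl)))))))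
    where
    X1 : 1 N.≤ d N.* e
    X1 = NP.≤-trans (x≥1 J) (NP.≮⇒≥ nl)
    d1 : 1 N.≤ d
    d1 = proj₁ (≥1-factors d e X1)
    e1 : 1 N.≤ e
    e1 = proj₂ (≥1-factors d e X1)
    ll≥0 : 0ℚ ≤ lam d + lam e
    ll≥0 = 0≤+ (lam≥0 d) (lam≥0 e)

   convolution : Sup (λ b → S FF b - Σ (range (suc k)) (λ i → (S (qF q i) ⋆ S (rF (k N.∸ i))) b)) τ
   convolution b = subst (λ z → ∣ z ∣ ≤ τ) (sym eq) (abs-neg (≤≡ (Σ-abs≤ (range X) (λ d d∈ → Σ-abs≤ (range X) (λ e e∈ → term d e (∈range d∈) (∈range e∈))))
     (trans (Σ-cong (range X) (λ d → trans (Σ-*ˡ (range X) _ _) (cong (cst *_) (Σ-*ˡ (range X) (rec d) rec)))) (trans (Σ-*ˡ (range X) cst _) (cong (cst *_) (Σ-*ʳ (range X) hs rec))))))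
    where
    cst : ℚ
    cst = (qb * (ι (P N.* m) + ι (P N.* m)) ^ k) * ε∞
    cst≥0 : 0ℚ ≤ cst
    cst≥0 = 0≤* (0≤* qb≥0 (^≥0 k pm≥0)) ε∞≥0
    t : ℕ → ℕ → ℚ
    t d e = Θ d e * χ (_≟U_ Q (un Q (d N.* e)) b)
    compl : ∀ d e → t d e - χ (d N.* e N.<? X) * t d e ≡ χ (¬? (d N.* e N.<? X)) * t d e
    compl d e with d N.* e N.<? X
    ... | yes _ = id109 (t d e)
    ... | no _ = id110 (t d e)
    eq : S FF b - Σ (range (suc k)) (λ i → (S (qF q i) ⋆ S (rF (k N.∸ i))) b) ≡ - Σ (range X) (λ d → Σ (range X) (λ e → χ (¬? (d N.* e N.<? X)) * t d e))
    eq = trans (cong₂ (λ a b → a - b) (S-FF b) (box b)) (trans (id119 _ _) (cong -_ (trans (sym (Σ-- (range X) _ _)) (Σ-cong (range X) (λ d →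
     trans (sym (Σ-- (range X) _ _)) (Σ-cong (range X) (λ e → compl d e)))))))
    term : ∀ d e → d N.< X → e N.< X → ∣ χ (¬? (d N.* e N.<? X)) * t d e ∣ ≤ cst * (rec d * rec e)
    term d e ld le with d N.* e N.<? X
    ... | yes _ = ≡≤ (trans (cong ∣_∣ (*-zeroˡ _)) (∣∣-nonneg ≤-refl)) (0≤* cst≥0 (0≤* (rec≥0 d) (rec≥0 e)))
    ... | no nl = subst₂ _≤_ (cong ∣_∣ (sym (*-identityˡ _))) (*-identityʳ _) (abs-* (Θ-tail d e ld le nl)
        (≡≤ (∣∣-nonneg (χ≥0 (_≟U_ Q (un Q (d N.* e)) b))) (χ≤1 (_≟U_ Q (un Q (d N.* e)) b))))

  R : ℕ → Unit Q → ℚ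
  R k = S (rF k)

  L : ℕ → Unit Q → ℚ
  L k = S (qF Λ k)

  U : Unit Q → ℚ
  U = S (qF μ 0)

  L≥0 : ∀ k b → 0ℚ ≤ L k b
  L≥0 k = S≥0 (λ n → 0≤* (dp≥0 k (lam≥0 n)) (0≤* (Λ≥0 n) (ω≥0 n)))

  R≥0 : ∀ k b → 0ℚ ≤ R k b
  R≥0 k = S≥0 (λ n → 0≤* (dp≥0 k (lam≥0 n)) (ω≥0 n))

  Λ≤Pm : ∀ d → 1 N.≤ d → d N.< X → ∣ Λ d ∣ ≤ ι (P N.* m)
  Λ≤Pm d h l = ≡≤ (∣∣-nonneg (Λ≥0 d)) (≤-trans (Λ≤lam d) (lam≤Pm h l))

  τL : ℕ → ℚ
  τL k = Convolution.τ Λ (ι (P N.* m)) (ι≥0 _) Λ≤Pm k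

  τU : ℚ
  τU = Convolution.τ μ 1ℚ 0≤1 (λ d _ _ → μ≤1 d) 0

  -- Λ * 1 is the additive logarithm, and multiplying dp k by its argument gives k+1 times dp (k+1).
  R-convolution : ∀ k → Sup (λ b → ι (suc k) * R (suc k) b - Σ (range (suc k)) (λ i → (L i ⋆ R (k N.∸ i)) b)) (τL k)
  R-convolution k b = subst (λ z → ∣ z - Σ (range (suc k)) (λ i → (L i ⋆ R (k N.∸ i)) b) ∣ ≤ τL k) e (convolution b)
   where
   open Convolution Λ (ι (P N.* m)) (ι≥0 _) Λ≤Pm k
   term : ∀ n → FF n * χ (_≟U_ Q (un Q n) b) ≡ ι (suc k) * (rF (suc k) n * χ (_≟U_ Q (un Q n) b))
   term zero = trans (cong (λ z → divisorSum Λ 0 * (dp k (lam 0) * z) * χ (_≟U_ Q (un Q 0) b)) ω-0) (trans (id120 _ _ _ _ _) (cong (λ z → ι (suc k) * (dp (suc k) (lam 0) * z * χ (_≟U_ Q (un Q 0) b))) (sym ω-0)))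
   term n@(suc _) = trans (cong (λ z → z * (dp k (lam n) * ω n) * χ (_≟U_ Q (un Q n) b)) (Λ-sum n 1≤suc)) (trans (id121 _ _ _ _) (trans (cong (λ z → z * (ω n * χ (_≟U_ Q (un Q n) b))) (sym (dp-suc k (lam n)))) (id122 _ _ _ _)))
   e : S FF b ≡ ι (suc k) * R (suc k) b
   e = trans (Σ-cong (range X) term) (Σ-*ˡ (range X) (ι (suc k)) _)

  -- μ * 1 is the indicator of 1, whose class sum is δ; X ≥ 2 puts the integer 1 inside the range.
  U-convolution : 2 N.≤ X → Sup (λ b → (U ⋆ R 0) b - δ b) τU
  U-convolution X2 b = subst (λ z → ∣ z ∣ ≤ τU) (id126 _ _) (abs-neg (subst₂ (λ y z → ∣ y - z ∣ ≤ τU) e (+-identityʳ _) (convolution b)))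
   where
   open Convolution μ 1ℚ 0≤1 (λ d _ _ → μ≤1 d) 0
   c : ℕ → ℚ
   c n = χ (_≟U_ Q (un Q n) b)
   term : ∀ n → FF n * c n ≡ χ (n N.≟ 1) * (ω n * c n)
   term zero = trans (cong (λ z → divisorSum μ 0 * (1ℚ * z) * c 0) ω-0) (id123 _ _ _)
   term n@(suc _) = trans (cong (λ z → z * (1ℚ * ω n) * c n) (μ-sum n 1≤suc)) (id124 (χ (n N.≟ 1)) (ω n) (c n))
   un1 : un Q 1 ≡ 1U Q
   un1 = un-mk Q 1 (λ {i} → coprime-1 Q {i})
   e : S FF b ≡ δ b
   e = trans (Σ-cong (range X) term) (trans (Σ-pick (range X) N._≟_ 1 (λ n → ω n * c n) (Σ-range-χ X2))
    (trans (cong (_* c 1) ω-1) (trans (*-identityˡ _) (χ-⇔ (_≟U_ Q (un Q 1) b) (_≟U_ Q b (1U Q)) (λ h → trans (sym h) un1) (λ h → trans un1 (sym h))))))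

  ∥U∥ : ∥ U ∥₁ ≤ ∑ (R 0)
  ∥U∥ = Σ-mono els (λ t → Σ-abs≤ (range X) (λ n _ → abs-* (subst₂ _≤_ (cong ∣_∣ (sym (*-identityˡ _))) refl
    (subst (∣ μ n * ω n ∣ ≤_) refl (abs-* (μ≤1 n) (≤-reflexive (∣∣-nonneg (ω≥0 n)))))) (≤-reflexive (∣∣-nonneg (χ≥0 (_≟U_ Q (un Q n) t))))))

-- Moments of the exponential weight.

module Moments where

 open Q
 open Kit
 open DividedPower
 open Blocks

 -- Sums of dp k (j/H) T^j over j < J, compared with m^{k+1} by summation by parts.
 module _ (K m P : ℕ) (K≥1 : 1 N.≤ K) (m≥1 : 1 N.≤ m) (P≥1 : 1 N.≤ P) where
  open Weights K m P K≥1 m≥1 P≥1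

  s : ℕ → ℕ → ℚ
  s k j = Σ (range j) (g k)

  suc-point : ∀ j → ι (suc j) * rec H ≡ ι j * rec H + rec H
  suc-point j = trans (cong (_* rec H) (ι-suc j)) (id129 (ι j) (rec H))

  parts-lower : ∀ k j → rec H * T * s k j ≤ θ * s (suc k) j + dp (suc k) (ι j * rec H) * T ^ j
  parts-lower k zero = ≡≤ (*-zeroʳ _) (0≤+ (≤-reflexive (sym (*-zeroʳ θ))) (0≤* (dp≥0 (suc k) (jH≥0 zero)) 0≤1))
  parts-lower k (suc j) = id130 (rec H) θ (s k j) (s (suc k) j) (dp k a) (dp (suc k) a) (dp (suc k) (ι (suc j) * rec H)) (T ^ j)
    via 0≤+ (≤⇒0≤ (parts-lower k j)) (0≤* (0≤* T≥0 (^≥0 j T≥0)) (≤⇒0≤ (subst (λ z → dp (suc k) a + dp k a * rec H ≤ dp (suc k) z) (sym (suc-point j)) (dp-+-lower k (jH≥0 j) (rec≥0 H)))))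
   where
   a : ℚ
   a = ι j * rec H

  parts-upper : ∀ k j → θ * s (suc k) j + dp (suc k) (ι j * rec H) * T ^ j ≤ rec H * (s k j + g k j)
  parts-upper k zero = ≡≤ (trans (cong (λ z → θ * 0ℚ + z * 1ℚ) d0) (id131 θ)) (0≤* (rec≥0 H) (0≤+ ≤-refl (g≥0 k zero)))
   where
   d0 : dp (suc k) (ι 0 * rec H) ≡ 0ℚ
   d0 = trans (cong (λ z → rec (suc k) * (z * dp k (ι 0 * rec H))) (trans (cong (_* rec H) ι-0) (*-zeroˡ _))) (trans (cong (rec (suc k) *_) (*-zeroˡ _)) (*-zeroʳ _))
  parts-upper k (suc j) = id132 (rec H) θ (s k j) (s (suc k) j) (dp k a) (dp (suc k) a) (dp k a') (dp (suc k) a') (T ^ j)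
    via 0≤+ (≤⇒0≤ (parts-upper k j)) (0≤* (0≤* T≥0 (^≥0 j T≥0)) (≤⇒0≤ (subst (λ z → dp (suc k) z ≤ dp (suc k) a + rec H * dp k z) (sym (suc-point j)) (dp-lipschitz k (jH≥0 j) (rec≥0 H)))))
   where
   a a' : ℚ
   a = ι j * rec H
   a' = ι (suc j) * rec H

  geometric : ∀ j → θ * s 0 j ≡ 1ℚ - T ^ j
  geometric zero = id133 θ
  geometric (suc j) = trans (*-distribˡ-+ θ _ _) (trans (cong (θ * (1ℚ * T ^ j) +_) (geometric j)) (id134 θ (T ^ j)))

  -- A Riemann sum of step 1/H for the integral of x^k/k! · exp(-x/m) over [0, P m]; over the whole
  -- half-line that integral is m^(k+1).
  I : ℕ → ℚ
  I k = rec H * s k J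

  M : ℚ
  M = ι m

  M≥0 : 0ℚ ≤ M
  M≥0 = ι≥0 m

  J'θ : ι J' * θ ≡ 1ℚ
  J'θ = ι*rec J'≥1

  J'H : ι J' * rec H ≡ M
  J'H = trans (cong (_* rec H) (ι-* H m)) (trans (id72 (ι H) M (rec H)) (trans (cong (M *_) (ι*rec H≥1)) (*-identityʳ _)))

  θ-solve : ∀ y → ι J' * (θ * y) ≡ y
  θ-solve y = trans (sym (*-assoc _ _ _)) (trans (cong (_* y) J'θ) (*-identityˡ y))

  Mθ : M * θ ≡ rec H
  Mθ = trans (cong (_* θ) (sym J'H)) (trans (id72 (ι J') (rec H) θ) (trans (cong (rec H *_) J'θ) (*-identityʳ _)))

  I0 : I 0 ≡ M * (1ℚ - T ^ J)
  I0 = trans (cong (rec H *_) (trans (sym (θ-solve (s 0 J))) (cong (ι J' *_) (geometric J)))) (trans (id135 (rec H) (ι J') (1ℚ - T ^ J)) (cong (_* (1ℚ - T ^ J)) J'H))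

  I-step-upper : ∀ k → suc k N.≤ J → I (suc k) ≤ M * I k
  I-step-upper k h = subst₂ _≤_ (cong (rec H *_) (θ-solve (s (suc k) J))) (trans (id136 (rec H) (ι J') (s k J)) (cong (_* I k) J'H))
   (*-monoˡ (rec H) (rec≥0 H) (*-monoˡ (ι J') (ι≥0 J') (l2 _ _ _ _ via 0≤+ (≤⇒0≤ (parts-upper k J)) (≤⇒0≤ last))))
   where
   l2 : ∀ t1 r s0 d → r * s0 - t1 ≡ (r * (s0 + d) - (t1 + dp (suc k) (ι J * rec H) * T ^ J)) + (dp (suc k) (ι J * rec H) * T ^ J - r * d)
   l2 = λ t1 r s0 d → id127 t1 r s0 d (dp (suc k) (ι J * rec H) * T ^ J)
   -- Since dp (k+1) at J/H is J/(H (k+1)) times dp k, the boundary term dominates exactly because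
   -- k+1 ≤ J.
   last : rec H * g k J ≤ dp (suc k) (ι J * rec H) * T ^ J
   last = *-cancelˡ (ι (suc k)) (ι-pos 1≤suc) (subst₂ _≤_ (id128 (ι (suc k)) (rec H) (dp k (ι J * rec H)) (T ^ J)) (trans (cong (_* T ^ J) (sym (dp-suc k (ι J * rec H)))) (*-assoc _ _ _))
    (*-monoʳ (T ^ J) (^≥0 J T≥0) (*-monoʳ (dp k (ι J * rec H)) (dp≥0 k (jH≥0 J)) (*-monoʳ (rec H) (rec≥0 H) (ι-mono h)))))

  I≤ : ∀ k → k N.≤ J → I k ≤ M ^ suc k
  I≤ zero _ = ≡≤ I0 (*-monoˡ M M≥0 (id55 (T ^ J) via ^≥0 J T≥0))
  I≤ (suc k) h = ≤-trans (I-step-upper k h) (*-monoˡ M M≥0 (I≤ k (NP.<⇒≤ h)))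

  I-step-lower : ∀ k → M * I k - rec H * I k ≤ I (suc k) + M * (Gm (suc k) * T ^ J)
  I-step-lower k = ≡≤ (sym e1) (≤-trans (*-monoˡ (ι J' * rec H) (0≤* (ι≥0 J') (rec≥0 H)) (parts-lower k J)) (≡≤ e2
    (+-monoʳ (I (suc k)) (*-monoˡ M M≥0 (*-monoʳ (T ^ J) (^≥0 J T≥0) (dp≤Gm (suc k) (jH≥0 J) (jH≤ NP.≤-refl)))))))
   where
   e1 : ι J' * rec H * (rec H * T * s k J) ≡ M * I k - rec H * I k
   e1 = trans (id137 (ι J') (rec H) θ (s k J)) (trans (cong (λ z → z * I k - (z * θ) * I k) J'H) (cong (λ z → M * I k - z * I k) Mθ))
   e2 : ι J' * rec H * (θ * s (suc k) J + dp (suc k) (ι J * rec H) * T ^ J) ≡ I (suc k) + M * (dp (suc k) (ι J * rec H) * T ^ J)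
   e2 = trans (id138 (ι J') (rec H) θ (s (suc k) J) _) (cong₂ (λ y z → rec H * y + z * (dp (suc k) (ι J * rec H) * T ^ J)) (θ-solve (s (suc k) J)) J'H)

  -- Every step of the recursion adds one discretisation error 1/H and one truncation error T^J,
  -- scaled by the crude bound for the moments; hence the linear factor k+1.
  defect : ℕ → ℚ
  defect k = ι (suc k) * (Gm (suc k) * (rec H + T ^ J))

  I≥ : ∀ k → k N.≤ J → M ^ suc k ≤ I k + defect k
  I≥ zero _ = subst (λ z → M * 1ℚ ≤ z + defect 0) (sym I0) (id139 M (T ^ J) (ι 1) (ι (P N.* m)) (rec H) via 0≤+ (0≤* (≤⇒0≤ big) (^≥0 J T≥0)) (0≤* (0≤* (ι≥0 1) (0≤* (ι≥0 _) 0≤1)) (rec≥0 H)))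
   where
   big : M ≤ ι 1 * (ι (P N.* m) * 1ℚ)
   big = subst (M ≤_) (trans (sym (*-identityʳ _)) (trans (sym (*-identityˡ _)) (cong (_* (ι (P N.* m) * 1ℚ)) (sym ι-1)))) (ι-mono (NP.m≤n*m m P {{N.>-nonZero P≥1}}))
  I≥ (suc k) h = ≤-trans (*-monoˡ M M≥0 (I≥ k k≤)) (subst (λ z → M * (I k + defect k) ≤ I (suc k) + z * (Gm (suc (suc k)) * (rec H + T ^ J))) (sym (ι-suc (suc k)))
    (id140 M (I k) (I (suc k)) (ι (suc k)) (Gm (suc k)) (rec H) (T ^ J) (ι (P N.* m)) via
     0≤+ (0≤+ (≤⇒0≤ (I-step-lower k)) (0≤* (0≤* (ι≥0 (suc k)) (0≤* (Gm≥0 (suc k)) rt)) (≤⇒0≤ M≤Pm))) (0≤+ (0≤* (0≤* (≤⇒0≤ M≤Pm) (Gm≥0 (suc k))) (^≥0 J T≥0)) (0≤* (rec≥0 H) (≤⇒0≤ IG)))))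
   where
   k≤ : k N.≤ J
   k≤ = NP.<⇒≤ h
   rt : 0ℚ ≤ rec H + T ^ J
   rt = 0≤+ (rec≥0 H) (^≥0 J T≥0)
   M≤Pm : M ≤ ι (P N.* m)
   M≤Pm = ι-mono (NP.m≤n*m m P {{N.>-nonZero P≥1}})
   1≤Pm : 1ℚ ≤ ι (P N.* m)
   1≤Pm = subst (_≤ ι (P N.* m)) ι-1 (ι-mono Pm≥1)
   IG : I k ≤ ι (P N.* m) * Gm (suc k)
   IG = ≤-trans (I≤ k k≤) (≤-trans (^-mono (suc k) M≥0 M≤Pm) (subst (_≤ ι (P N.* m) * Gm (suc k)) (*-identityˡ _) (*-monoʳ (Gm (suc k)) (Gm≥0 (suc k)) 1≤Pm)))

  -- T^{J'} ≤ 1/2, so T^J decays exponentially in P.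
  2T^J'≤1 : ι 2 * T ^ J' ≤ 1ℚ
  2T^J'≤1 = ≤-trans (*-monoʳ (T ^ J') (^≥0 J' T≥0) two) (≡≤ (sym (^-* (1ℚ + θ) T J')) (^≤1 J' (0≤* (0≤+ 0≤1 θ≥0) T≥0) (id74 θ via sq≥0 θ)))
   where
   two : ι 2 ≤ (1ℚ + θ) ^ J'
   two = ≡≤ (trans ι-2 (cong (1ℚ +_) (sym J'θ))) (bernoulli θ J' θ≥0)

  T^-decay : ∀ i → ι (2 N.^ i) * T ^ (i N.* J') ≤ 1ℚ
  T^-decay zero = ≤-reflexive (trans (*-identityʳ _) ι-1)
  T^-decay (suc i) = subst (_≤ 1ℚ) (trans (id71 (ι 2) (T ^ J') (ι (2 N.^ i)) (T ^ (i N.* J'))) (cong₂ _*_ (sym (ι-* 2 (2 N.^ i))) (sym (^-+ T J' (i N.* J')))))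
   (subst (ι 2 * T ^ J' * (ι (2 N.^ i) * T ^ (i N.* J')) ≤_) (*-identityˡ 1ℚ)
    (*-mono (0≤* (ι≥0 2) (^≥0 J' T≥0)) (0≤* (ι≥0 (2 N.^ i)) (^≥0 (i N.* J') T≥0)) 2T^J'≤1 (T^-decay i)))

-- An explicit lower bound for L(1, c), c a real character.

module LOne where

 open Q
 open Kit
 open Arith using (divisorSum; divisorSum-p*; divisorSum-1; divisorSum-cong; divisorSum-bound; χ-∣≡Σ; fs; fs-prime; ∈fs⇒∣; fs≡[]⇒1; prime≥1; prime≥2)

 abel : ∀ (c f : ℕ → ℚ) q → (∀ i → 0ℚ ≤ f i) → (∀ i → f (suc i) ≤ f i) → (∀ t → ∣ Σ (range t) c ∣ ≤ q) → 0ℚ ≤ q →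
  ∀ t → ∣ Σ (range t) (λ i → c i * f i) ∣ ≤ q * f 0
 abel c f q f≥0 dec bnd q≥0 t = ≤≡ (subst (λ z → ∣ z ∣ ≤ q * (f 0 - f t) + q * f t) (id162 _ _) (abs-+ (go t) (abs-* (bnd t) (≤-reflexive (∣∣-nonneg (f≥0 t))))))
   (id163 q (f 0) (f t))
  where
  go : ∀ t → ∣ Σ (range t) (λ i → c i * f i) - Σ (range t) c * f t ∣ ≤ q * (f 0 - f t)
  go zero = ≤-reflexive (trans (cong ∣_∣ (id164 (f 0))) (trans (∣∣-nonneg ≤-refl) (sym (id165 q (f 0)))))
  go (suc t) = subst₂ _≤_ (cong ∣_∣ (id166 (c t) (f t) _ (Σ (range t) c) (f (suc t)))) (id167 q (f 0) (f t) (f (suc t)))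
   (abs-+ (go t) (abs-* (bnd (suc t)) (≤-reflexive (∣∣-nonneg (≤⇒0≤ (dec t))))))

 -- The final clause makes the cofactor n' admissible for recursion on n.
 prime-power-split : ∀ {p} → Prime p → ∀ n → 1 N.≤ n → ∃[ k ] ∃[ n' ] (n ≡ p N.^ k N.* n' × ¬ (p ∣ n') × 1 N.≤ n' × (p ∣ n → n' N.< n))
 prime-power-split {p} pp = <-rec _ go
  where
  go : ∀ n → (∀ {n₁} → n₁ N.< n → 1 N.≤ n₁ → ∃[ k ] ∃[ n' ] (n₁ ≡ p N.^ k N.* n' × ¬ (p ∣ n') × 1 N.≤ n' × (p ∣ n₁ → n' N.< n₁))) → 1 N.≤ n →
   ∃[ k ] ∃[ n' ] (n ≡ p N.^ k N.* n' × ¬ (p ∣ n') × 1 N.≤ n' × (p ∣ n → n' N.< n))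
  go n rec h with p ∣? n
  ... | no nd = 0 , n , sym (NP.+-identityʳ n) , nd , h , (λ d → ⊥-elim (nd d))
  ... | yes (divides q e) with rec {q} lt q1
   where
   q1 : 1 N.≤ q
   q1 = NP.n≢0⇒n>0 (λ z → NP.<⇒≢ h (sym (trans e (cong (N._* p) z))))
   lt : q N.< n
   lt = NP.<-≤-trans (NP.m<m*n q p {{N.>-nonZero q1}} (prime≥2 pp)) (NP.≤-reflexive (sym e))
  ... | k , n' , e' , nd , n1 , _ = suc k , n' , trans e (trans (NP.*-comm q p) (trans (cong (p N.*_) e') (sym (NP.*-assoc p (p N.^ k) n')))) , nd , n1 ,
    (λ _ → NP.<-≤-trans (NP.≤-<-trans (ℕ≤≡ (NP.m≤n*m n' (p N.^ k) {{NP.m^n≢0 p k {{prime⇒nonZero pp}}}}) (sym e'))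
     (NP.m<m*n q p {{N.>-nonZero (NP.n≢0⇒n>0 (λ z → NP.<⇒≢ h (sym (trans e (cong (N._* p) z)))))}} (prime≥2 pp))) (NP.≤-reflexive (sym e)))

 module RealCharacter (c : ℕ → ℚ)
  (c-* : ∀ a b → 1 N.≤ a → 1 N.≤ b → c (a N.* b) ≡ c a * c b)
  (c-1 : c 1 ≡ 1ℚ)
  (c-values : ∀ n → (c n ≡ 0ℚ) ⊎ ((c n ≡ 1ℚ) ⊎ (c n ≡ - 1ℚ)))
  (q : ℕ) (q≥1 : 1 N.≤ q)
  (c-sums : ∀ a t → ∣ Σ (range t) (λ i → c (i N.+ a)) ∣ ≤ ι q)
  where

  r : ℕ → ℚ
  r = divisorSum c

  ∣c∣≤1 : ∀ n → ∣ c n ∣ ≤ 1ℚ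
  ∣c∣≤1 n with c-values n
  ... | inj₁ e = ≡≤ (trans (cong ∣_∣ e) (∣∣-nonneg ≤-refl)) 0≤1
  ... | inj₂ (inj₁ e) = ≤-reflexive (trans (cong ∣_∣ e) (∣∣-nonneg 0≤1))
  ... | inj₂ (inj₂ e) = ≤-reflexive (trans (cong ∣_∣ e) (trans (∣-∣ 1ℚ) (∣∣-nonneg 0≤1)))

  geo : ℚ → ℕ → ℚ
  geo x zero = 1ℚ
  geo x (suc k) = 1ℚ + x * geo x k

  r-away : ℕ → ℕ → ℚ
  r-away p = divisorSum (λ d → χ (¬? (p ∣? d)) * c d)

  -- Multiplicativity of r = 1 * c at p: a factor p^k contributes 1 + c(p) + ... + c(p)^k. The first
  -- component is carried to split off the divisors prime to p in the next step.
  r-split : ∀ {p} → Prime p → ∀ n' → 1 N.≤ n' → ¬ (p ∣ n') → ∀ k → (r-away p (p N.^ k N.* n') ≡ r n') × (r (p N.^ k N.* n') ≡ geo (c p) k * r n')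
  r-split {p} pp n' n1 nd zero = trans (cong (r-away p) (NP.+-identityʳ n')) away , trans (cong r (NP.+-identityʳ n')) (sym (*-identityˡ _))
   where
   away : r-away p n' ≡ r n'
   away = divisorSum-cong n1 (λ d _ dv → trans (cong (_* c d) (χ-yes (¬? (p ∣? d)) (λ pd → nd (∣-trans pd dv)))) (*-identityˡ _))
  r-split {p} pp n' n1 nd (suc k) with r-split pp n' n1 nd k
  ... | ih1 , ih2 = trans (cong (r-away p) (NP.*-assoc p (p N.^ k) n')) (trans (divisorSum-p* _ pp N1) (trans (cong₂ _+_ s1 s2) (trans (+-identityʳ _) ih1)))
    , trans (cong r (NP.*-assoc p (p N.^ k) n')) (trans (divisorSum-p* c pp N1) (trans (cong₂ _+_ ih1 (trans (divisorSum-cong N1 (λ d d1 _ → c-* p d (prime≥1 pp) d1)) (trans (Σ-cong (range (suc N)) (λ d → id8 _ _ _)) (trans (Σ-*ˡ (range (suc N)) (c p) _) (cong (c p *_) ih2))))) (id161 (r n') (c p) (geo (c p) k))))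
   where
   N = p N.^ k N.* n'
   N1 : 1 N.≤ N
   N1 = NP.*-mono-≤ (NP.m^n>0 p {{prime⇒nonZero pp}} k) n1
   s1 : divisorSum (λ d → χ (¬? (p ∣? d)) * (χ (¬? (p ∣? d)) * c d)) N ≡ r-away p N
   s1 = divisorSum-cong N1 (λ d _ _ → idem d)
    where
    idem : ∀ d → χ (¬? (p ∣? d)) * (χ (¬? (p ∣? d)) * c d) ≡ χ (¬? (p ∣? d)) * c d
    idem d with p ∣? d
    ... | yes _ = id145 (c d)
    ... | no _ = *-identityˡ _
   s2 : divisorSum (λ e → χ (¬? (p ∣? p N.* e)) * c (p N.* e)) N ≡ 0ℚ
   s2 = Σ-0∈ (range (suc N)) (λ d _ → trans (cong (λ z → χ (d ∣? N) * (z * c (p N.* d))) (χ-no (¬? (p ∣? p N.* d)) (λ h → h (m∣m*n d)))) (trans (cong (χ (d ∣? N) *_) (*-zeroˡ _)) (*-zeroʳ _)))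

  geo-values : ∀ x → (x ≡ 0ℚ) ⊎ ((x ≡ 1ℚ) ⊎ (x ≡ - 1ℚ)) → ∀ k → (0ℚ ≤ geo x k) × (1ℚ ≤ geo x (2 N.* k))
  geo-values x v k = go k v , go2 k v
   where
   go : ∀ k → (x ≡ 0ℚ) ⊎ ((x ≡ 1ℚ) ⊎ (x ≡ - 1ℚ)) → 0ℚ ≤ geo x k
   alt : ∀ k → x ≡ - 1ℚ → (geo x k ≡ 1ℚ) ⊎ (geo x k ≡ 0ℚ)
   alt zero e = inj₁ refl
   alt (suc k) refl with alt k refl
   ... | inj₁ h = inj₂ (trans (cong (λ z → 1ℚ + - 1ℚ * z) h) l)
    where
    l : 1ℚ + - 1ℚ * 1ℚ ≡ 0ℚ
    l = id155 1ℚ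
   ... | inj₂ h = inj₁ (trans (cong (λ z → 1ℚ + - 1ℚ * z) h) (id156 1ℚ))
   go zero _ = 0≤1
   go (suc k) (inj₁ refl) = 0≤+ 0≤1 (≤-reflexive (sym (*-zeroˡ _)))
   go (suc k) (inj₂ (inj₁ refl)) = 0≤+ 0≤1 (0≤* 0≤1 (go k (inj₂ (inj₁ refl))))
   go (suc k) (inj₂ (inj₂ e)) with alt (suc k) e
   ... | inj₁ h = ≤≡ 0≤1 (sym h)
   ... | inj₂ h = ≤-reflexive (sym h)
   ss : ∀ y → 0ℚ ≤ y → 1ℚ ≤ y → (x ≡ 0ℚ) ⊎ ((x ≡ 1ℚ) ⊎ (x ≡ - 1ℚ)) → 1ℚ ≤ 1ℚ + x * (1ℚ + x * y)
   ss y y0 y1 (inj₁ refl) = ≤+ʳ (≤-reflexive (sym (*-zeroˡ _)))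
   ss y y0 y1 (inj₂ (inj₁ refl)) = ≤+ʳ (0≤* 0≤1 (0≤+ 0≤1 (0≤* 0≤1 y0)))
   ss y y0 y1 (inj₂ (inj₂ refl)) = ≤≡ y1 (id157 y)
   go2 : ∀ k → (x ≡ 0ℚ) ⊎ ((x ≡ 1ℚ) ⊎ (x ≡ - 1ℚ)) → 1ℚ ≤ geo x (2 N.* k)
   go2 zero _ = ≤-refl
   go2 (suc k) v = subst (λ z → 1ℚ ≤ geo x z) (cong suc (sym (NP.+-suc k (k N.+ 0)))) (ss (geo x (2 N.* k)) (≤-trans 0≤1 (go2 k v)) (go2 k v) v)

  private
   prime-factor : ∀ n → 2 N.≤ n → ∃[ p ] (Prime p × p ∣ n)
   prime-factor n h = go (fs n) refl (fs-prime n)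
    where
    go : ∀ l → fs n ≡ l → All Prime l → ∃[ p ] (Prime p × p ∣ n)
    go [] e _ = ⊥-elim (NP.<⇒≢ h (sym (fs≡[]⇒1 (NP.<⇒≤ h) e)))
    go (p ∷ l) e (pp ∷ _) = p , pp , ∈fs⇒∣ (NP.<⇒≤ h) (subst (λ z → p Data.List.Membership.Propositional.∈ z) (sym e) (here refl))
     where import Data.List.Membership.Propositional

  r≥0 : ∀ n → 1 N.≤ n → 0ℚ ≤ r n
  r≥0 = <-rec _ go
   where
   go : ∀ n → (∀ {k} → k N.< n → 1 N.≤ k → 0ℚ ≤ r k) → 1 N.≤ n → 0ℚ ≤ r n
   go n rec h with n N.≟ 1
   ... | yes refl = subst (0ℚ ≤_) (sym (trans (divisorSum-1 c) c-1)) 0≤1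
   ... | no ne with prime-factor n (NP.≤∧≢⇒< h (λ e → ne (sym e)))
   ... | p , pp , pn with prime-power-split pp n h
   ... | k , n' , e , nd , n1 , lt = subst (0ℚ ≤_) (sym (trans (cong r e) (proj₂ (r-split pp n' n1 nd k)))) (0≤* (proj₁ (geo-values (c p) (c-values p) k)) (rec (lt pn) n1))

  -- In a square all exponents are even, and 1 + x + ... + x^(2k) ≥ 1 for x among 0, 1, -1.
  r-square : ∀ n → 1 N.≤ n → 1ℚ ≤ r (n N.* n)
  r-square = <-rec _ go
   where
   go : ∀ n → (∀ {k} → k N.< n → 1 N.≤ k → 1ℚ ≤ r (k N.* k)) → 1 N.≤ n → 1ℚ ≤ r (n N.* n)
   go n rec h with n N.≟ 1
   ... | yes refl = ≤-reflexive (sym (trans (divisorSum-1 c) c-1))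
   ... | no ne with prime-factor n (NP.≤∧≢⇒< h (λ e → ne (sym e)))
   ... | p , pp , pn with prime-power-split pp n h
   ... | k , n' , e , nd , n1 , lt = subst (1ℚ ≤_) (sym (trans (cong r e2) (proj₂ (r-split pp (n' N.* n') (NP.*-mono-≤ n1 n1) nd2 (2 N.* k)))))
      (subst (_≤ geo (c p) (2 N.* k) * r (n' N.* n')) (*-identityˡ 1ℚ) (*-mono 0≤1 0≤1 (proj₂ (geo-values (c p) (c-values p) k)) (rec (lt pn) n1)))
    where
    nd2 : ¬ (p ∣ n' N.* n')
    nd2 d with euclidsLemma n' n' pp d
    ... | inj₁ x = nd x
    ... | inj₂ x = nd x
    open import Data.Nat.Tactic.RingSolver using () renaming (solve-∀ to solveℕ)
    re : ∀ a b → a N.* b N.* (a N.* b) ≡ a N.* a N.* (b N.* b)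
    re = solveℕ
    e2 : n N.* n ≡ p N.^ (2 N.* k) N.* (n' N.* n')
    e2 = trans (cong₂ N._*_ e e) (trans (re (p N.^ k) n') (cong (N._* (n' N.* n')) (trans (sym (NP.^-distribˡ-+-* p k k)) (cong (p N.^_) (cong (k N.+_) (sym (NP.+-identityʳ k)))))))

  -- f d = Σ_{m ≥ 1} max(0, N - d m)
  module Weighted (N : ℕ) where

   f : ℕ → ℚ
   f d = Σ (range N) (λ i → ι (N N.∸ d N.* suc i))

   f≥0 : ∀ d → 0ℚ ≤ f d
   f≥0 d = Σ≥0 (range N) (λ i → ι≥0 _)

   f-dec : ∀ d → f (suc d) ≤ f d
   f-dec d = Σ-mono (range N) (λ i → ι-mono (NP.∸-monoʳ-≤ N (NP.*-monoˡ-≤ (suc i) (NP.n≤1+n d))))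

   -- Both sides are the sum of c(d) (N - d e) over all pairs with d e < N.
   total : Σ (range N) (λ i → r (suc i) * ι (N N.∸ suc i)) ≡ Σ (range N) (λ i → c (suc i) * f (suc i))
   total = begin
    Σ (range N) (λ i → r (suc i) * ι (N N.∸ suc i))
     ≡⟨ Σ-cong∈ (range N) (λ i i∈ → trans (cong (_* ι (N N.∸ suc i)) (expand i (∈range i∈))) (trans (sym (Σ-*ʳ (range N) _ _)) (Σ-cong (range N) (λ d → trans (sym (Σ-*ʳ (range N) _ _))
        (Σ-cong (range N) (λ e → trans (*-assoc _ _ _) (χ-subst (suc d N.* suc e N.≟ suc i) {c (suc d) * ι (N N.∸ suc i)} {c (suc d) * ι (N N.∸ suc d N.* suc e)} (λ eq → cong (λ z → c (suc d) * ι (N N.∸ z)) (sym eq)))))))) ) ⟩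
    Σ (range N) (λ i → Σ (range N) (λ d → Σ (range N) (λ e → χ (suc d N.* suc e N.≟ suc i) * (c (suc d) * ι (N N.∸ suc d N.* suc e)))))
     ≡⟨ trans (Σ-swap (range N) (range N) _) (Σ-cong (range N) (λ d → Σ-swap (range N) (range N) _)) ⟩
    Σ (range N) (λ d → Σ (range N) (λ e → Σ (range N) (λ i → χ (suc d N.* suc e N.≟ suc i) * (c (suc d) * ι (N N.∸ suc d N.* suc e)))))
     ≡⟨ Σ-cong (range N) (λ d → trans (Σ-cong (range N) (λ e → trans (Σ-*ʳ (range N) _ _) (collapse d e))) (Σ-*ˡ (range N) (c (suc d)) _)) ⟩
    Σ (range N) (λ i → c (suc i) * f (suc i)) ∎
    where
    open ≡-Reasoning
    Σ-shift : ∀ n (h : ℕ → ℚ) → Σ (range (suc n)) h ≡ Σ (range n) (λ i → h (suc i)) + h 0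
    Σ-shift zero h = trans (+-identityʳ _) (sym (+-identityˡ _))
    Σ-shift (suc n) h = trans (cong (h (suc n) +_) (Σ-shift n h)) (sym (+-assoc _ _ _))
    expand : ∀ i → i N.< N → r (suc i) ≡ Σ (range N) (λ d → Σ (range N) (λ e → χ (suc d N.* suc e N.≟ suc i) * c (suc d)))
    expand i l = trans (sym (divisorSum-bound c (suc N) 1≤suc (N.s≤s l))) (trans (Σ-shift N _) (trans (cong (Σ (range N) (λ d → χ (suc d ∣? suc i) * c (suc d)) +_) z0) (trans (+-identityʳ _)
      (Σ-cong (range N) (λ d → trans (cong (_* c (suc d)) (trans (χ-∣≡Σ (suc d) (suc N) 1≤suc (N.s≤s l)) (trans (Σ-shift N _) (trans (cong (Σ (range N) (λ e → χ (suc d N.* suc e N.≟ suc i)) +_) (zz d)) (+-identityʳ _)))))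
       (sym (Σ-*ʳ (range N) (c (suc d)) _)))))))
     where
     z0 : χ (0 ∣? suc i) * c 0 ≡ 0ℚ
     z0 = trans (cong (_* c 0) (χ-no (0 ∣? suc i) (λ { (divides k e) → NP.1+n≢0 (trans e (NP.*-zeroʳ k)) }))) (*-zeroˡ _)
     zz : ∀ d → χ (suc d N.* 0 N.≟ suc i) ≡ 0ℚ
     zz d = χ-no (suc d N.* 0 N.≟ suc i) (λ e → NP.1+n≢0 (sym (trans (sym (NP.*-zeroʳ d)) e)))
    collapse : ∀ d e → Σ (range N) (λ i → χ (suc d N.* suc e N.≟ suc i)) * (c (suc d) * ι (N N.∸ suc d N.* suc e)) ≡ c (suc d) * ι (N N.∸ suc d N.* suc e)
    collapse d e with e N.+ d N.* suc e N.<? N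
    ... | yes l = trans (cong (_* (c (suc d) * ι (N N.∸ suc d N.* suc e))) (trans (Σ-cong (range N) (λ i → χ-⇔ (suc d N.* suc e N.≟ suc i) (i N.≟ e N.+ d N.* suc e) (λ h → sym (NP.suc-injective h)) (λ h → cong suc (sym h)))) (Σ-range-χ l))) (*-identityˡ _)
    ... | no nl = trans (cong (λ z → S * (c (suc d) * z)) ι0) (trans (id146 S (c (suc d))) (cong (c (suc d) *_) (sym ι0)))
     where
     S = Σ (range N) (λ i → χ (suc d N.* suc e N.≟ suc i))
     ι0 : ι (N N.∸ suc d N.* suc e) ≡ 0ℚ
     ι0 = trans (cong ι (NP.m≤n⇒m∸n≡0 (NP.≤-trans (NP.≮⇒≥ nl) (NP.n≤1+n _)))) ι-0

   -- 2 d f(d) = N² - N d + ρ (d - ρ) with ρ = N mod d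
   f-formula : ∀ d .{{_ : NonZero d}} → 2ℚ * (ι d * f d) ≡ (ι N * ι N - ι N * ι d) + ι (N % d) * (ι d - ι (N % d))
   f-formula d = begin
    2ℚ * (ι d * f d) ≡⟨ cong (λ z → 2ℚ * (ι d * z)) (trans f≡ (arith k (NP.≤-refl))) ⟩
    2ℚ * (ι d * G) ≡⟨ sym (id158 (ι d) G) ⟩
    ι d * (2ℚ * G) ≡⟨ cong (ι d *_) (gauss k) ⟩
    ι d * (ι k * (2ℚ * ι N - ι d * (1ℚ + ι k))) ≡⟨ cong (λ z → ι d * (ι k * (2ℚ * z - ι d * (1ℚ + ι k)))) Ne ⟩
    ι d * (ι k * (2ℚ * (ρ + ι k * ι d) - ι d * (1ℚ + ι k))) ≡⟨ id159 (ι d) (ι k) ρ ⟩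
    ((ρ + ι k * ι d) * (ρ + ι k * ι d) - (ρ + ι k * ι d) * ι d) + ρ * (ι d - ρ) ≡⟨ cong (λ z → (z * z - z * ι d) + ρ * (ι d - ρ)) (sym Ne) ⟩
    (ι N * ι N - ι N * ι d) + ρ * (ι d - ρ) ∎
    where
    open ≡-Reasoning
    k : ℕ
    k = N / d
    ρ : ℚ
    ρ = ι (N % d)
    Ne : ι N ≡ ρ + ι k * ι d
    Ne = trans (cong ι (m≡m%n+[m/n]*n N d)) (trans (ι-+ (N % d) (k N.* d)) (cong (ρ +_) (ι-* k d)))
    kd≤N : k N.* d N.≤ N
    kd≤N = ℕ≤≡ (NP.m≤n+m (k N.* d) (N % d)) (sym (m≡m%n+[m/n]*n N d))
    k≤N : k N.≤ N
    k≤N = NP.≤-trans (NP.m≤m*n k d) kd≤N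
    h : ℕ → ℚ
    h i = ι (N N.∸ d N.* suc i)
    f≡ : f d ≡ Σ (range k) h
    f≡ = trans (cong (λ z → Σ (range z) h) (sym (NP.m∸n+n≡m k≤N))) (trans (Σ-range-+ (N N.∸ k) k h) (trans (cong (_+ Σ (range k) h) (Σ-0∈ (range (N N.∸ k)) (λ i _ →
      trans (cong ι (NP.m≤n⇒m∸n≡0 (big i))) ι-0))) (+-identityˡ _)))
     where
     big : ∀ i → N N.≤ d N.* suc (i N.+ k)
     big i = NP.≤-trans (NP.<⇒≤ (NP.≤-<-trans (NP.≤-reflexive (m≡m%n+[m/n]*n N d)) (NP.+-monoˡ-< (k N.* d) (m%n<n N d)))) (ℕ≡≤ (NP.*-comm (suc k) d) (NP.*-monoʳ-≤ d (N.s≤s (NP.m≤n+m k i))))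
    G : ℚ
    G = Σ (range k) (λ i → ι N - ι d * (1ℚ + ι i))
    arith : ∀ j → j N.≤ k → Σ (range j) h ≡ Σ (range j) (λ i → ι N - ι d * (1ℚ + ι i))
    arith j le = Σ-cong∈ (range j) (λ i i∈ → sub i (NP.≤-trans (∈range i∈) le))
     where
     sub : ∀ i → suc i N.≤ k → h i ≡ ι N - ι d * (1ℚ + ι i)
     sub i hi = trans (id98 (ι (N N.∸ d N.* suc i)) (ι (d N.* suc i))) (cong₂ (λ a b → a - b) (trans (sym (ι-+ _ _)) (cong ι (NP.m∸n+n≡m (ℕ≡≤ (NP.*-comm d (suc i)) (NP.≤-trans (NP.*-monoˡ-≤ d hi) kd≤N)))))
       (trans (ι-* d (suc i)) (cong (ι d *_) (ι-suc i))))
    gauss : ∀ j → 2ℚ * Σ (range j) (λ i → ι N - ι d * (1ℚ + ι i)) ≡ ι j * (2ℚ * ι N - ι d * (1ℚ + ι j))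
    gauss zero = trans (*-zeroʳ 2ℚ) (sym (trans (cong (_* (2ℚ * ι N - ι d * (1ℚ + ι 0))) ι-0) (*-zeroˡ _)))
    gauss (suc j) = trans (*-distribˡ-+ 2ℚ _ _) (trans (cong (2ℚ * (ι N - ι d * (1ℚ + ι j)) +_) (gauss j)) (trans (id147 (ι N) (ι d) (ι j)) (cong (λ z → z * (2ℚ * ι N - ι d * (1ℚ + z))) (sym (ι-suc j)))))

  -- Comparing Σ r(n) (N - n) over squares with its expansion over divisors bounds L(1, c) from below.
  module LowerBound where

   -- N = (2M)² leaves at least 3M² of weight N - k² on each of the M squares k² ≤ M². D = 16 q M
   -- makes the divisors beyond D cost q N²/D = M³. The errors below D are N q + D² = (4q + 256q²)
   -- M², and 260 = 4 + 256 makes this at most M³.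
   M D N : ℕ
   M = 260 N.* (q N.* q)
   D = 16 N.* (q N.* M)
   N = 2 N.* M N.* (2 N.* M)

   open Weighted N

   private
    open import Data.Nat.Tactic.RingSolver using () renaming (solve-∀ to solveℕ)

    M≥1 : 1 N.≤ M
    M≥1 = NP.*-mono-≤ {1} {260} 1≤suc (NP.*-mono-≤ q≥1 q≥1)

    D≥1 : 1 N.≤ D
    D≥1 = NP.*-mono-≤ {1} {16} 1≤suc (NP.*-mono-≤ q≥1 M≥1)

    16q≤M : 16 N.* q N.≤ M
    16q≤M = NP.*-mono-≤ {16} {260} (NP.m≤m+n 16 244) (NP.m≤m*n q q {{N.>-nonZero q≥1}})

    D≤N : D N.≤ N
    D≤N = ℕ≡≤ (sym (NP.*-assoc 16 q M)) (NP.*-mono-≤ (NP.≤-trans 16q≤M (NP.m≤m+n M _)) (NP.m≤m+n M _))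

    m q' : ℚ
    m = ι M
    q' = ι q

    m≥0 : 0ℚ ≤ m
    m≥0 = ι≥0 M

    ιN : ι N ≡ (2ℚ * m) * (2ℚ * m)
    ιN = trans (ι-* (2 N.* M) (2 N.* M)) (cong (λ z → z * z) (trans (ι-* 2 M) (cong (_* m) (trans (ι-suc 1) (cong (1ℚ +_) ι-1)))))

    3ℚ : ℚ
    3ℚ = 2ℚ + 1ℚ

    -- M distinct squares with r ≥ 1, each of weight at least N - M² = 3M²; nonnegativity of r
    -- allows all other integers to be dropped.
    squares-lower : m * (3ℚ * (m * m)) ≤ Σ (range N) (λ i → r (suc i) * ι (N N.∸ suc i))
    squares-lower = ≡≤ (sym (trans (Σ-const (range M) _) (cong (λ z → ι z * (3ℚ * (m * m))) (range-length M)))) (≤-trans (Σ-mono∈ (range M) (λ k k∈ → big k (∈range k∈)))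
      (≡≤ (trans (Σ-cong∈ (range M) (λ k k∈ → spread k (∈range k∈))) (Σ-swap (range M) (range N) _)) (Σ-mono∈ (range N) (λ i i∈ → at i))))
     where
     k²≤ : ∀ k → k N.< M → suc k N.* suc k N.≤ M N.* M
     k²≤ k h = NP.*-mono-≤ h h
     4M² : N ≡ M N.* M N.+ 3 N.* (M N.* M)
     4M² = re M
      where
      re : ∀ M → 2 N.* M N.* (2 N.* M) ≡ M N.* M N.+ 3 N.* (M N.* M)
      re = solveℕ
     k²≤N : ∀ k → k N.< M → suc k N.* suc k N.≤ N
     k²≤N k h = NP.≤-trans (k²≤ k h) (ℕ≤≡ (NP.m≤m+n _ _) (sym 4M²))
     big : ∀ k → k N.< M → 3ℚ * (m * m) ≤ ι (N N.∸ suc k N.* suc k)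
     big k h = ≡≤ (trans (cong (_* (m * m)) (sym ι3)) (trans (cong (ι 3 *_) (sym (ι-* M M))) (sym (ι-* 3 (M N.* M))))) (ι-mono (NP.m+n≤o⇒m≤o∸n (3 N.* (M N.* M)) (ℕ≡≤ (NP.+-comm (3 N.* (M N.* M)) _) (ℕ≤≡ (NP.+-monoˡ-≤ (3 N.* (M N.* M)) (k²≤ k h)) (sym 4M²)))))
      where
      ι3 : ι 3 ≡ 3ℚ
      ι3 = trans (ι-suc 2) (trans (cong (1ℚ +_) (trans (ι-suc 1) (cong (1ℚ +_) ι-1))) (+-comm 1ℚ 2ℚ))
     spread : ∀ k → k N.< M → ι (N N.∸ suc k N.* suc k) ≡ Σ (range N) (λ i → χ (suc i N.≟ suc k N.* suc k) * ι (N N.∸ suc i))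
     spread k h = sym (trans (Σ-cong (range N) (λ i → χ-subst (suc i N.≟ suc k N.* suc k) {ι (N N.∸ suc i)} {ι (N N.∸ suc k N.* suc k)} (λ e → cong (λ z → ι (N N.∸ z)) e)))
      (trans (Σ-*ʳ (range N) _ _) (trans (cong (_* ι (N N.∸ suc k N.* suc k)) (trans (Σ-cong (range N) (λ i → χ-⇔ (suc i N.≟ suc k N.* suc k) (i N.≟ k N.+ k N.* suc k) NP.suc-injective (cong suc))) (Σ-range-χ (k²≤N k h)))) (*-identityˡ _))))
     uniq : ∀ i → Σ (range M) (λ k → χ (suc i N.≟ suc k N.* suc k)) ≤ r (suc i)
     uniq i = go M
      where
      sq-inj : ∀ a b → suc a N.* suc a ≡ suc b N.* suc b → a ≡ b
      sq-inj a b e with NP.<-cmp a b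
      ... | tri≈ _ p _ = p
      ... | tri< l _ _ = ⊥-elim (NP.<⇒≢ (NP.*-mono-< (N.s≤s l) (N.s≤s l)) e)
      ... | tri> _ _ l = ⊥-elim (NP.<⇒≢ (NP.*-mono-< (N.s≤s l) (N.s≤s l)) (sym e))
      go : ∀ j → Σ (range j) (λ k → χ (suc i N.≟ suc k N.* suc k)) ≤ r (suc i)
      go zero = r≥0 (suc i) 1≤suc
      go (suc j) with suc i N.≟ suc j N.* suc j
      ... | no _ = ≡≤ (+-identityˡ _) (go j)
      ... | yes e = ≡≤ (trans (cong (1ℚ +_) (Σ-0∈ (range j) (λ k k∈ → χ-no (suc i N.≟ suc k N.* suc k) (λ e' → NP.<⇒≢ (∈range k∈) (sq-inj k j (trans (sym e') e)))))) (+-identityʳ 1ℚ))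
          (subst (λ z → 1ℚ ≤ r z) (sym e) (r-square (suc j) 1≤suc))
     at : ∀ i → Σ (range M) (λ k → χ (suc i N.≟ suc k N.* suc k) * ι (N N.∸ suc i)) ≤ r (suc i) * ι (N N.∸ suc i)
     at i = ≡≤ (Σ-*ʳ (range M) _ _) (*-monoʳ (ι (N N.∸ suc i)) (ι≥0 _) (uniq i))

    S : ℕ → ℚ
    S Y = Σ (range Y) (λ i → c (suc i) * rec (suc i))

    far : ∣ Σ (range (N N.∸ D)) (λ i → c (suc (i N.+ D)) * f (suc (i N.+ D))) ∣ ≤ q' * f (suc D)
    far = abel (λ i → c (suc (i N.+ D))) (λ i → f (suc (i N.+ D))) q' (λ i → f≥0 (suc (i N.+ D))) (λ i → f-dec (suc (i N.+ D))) (λ t → subst (λ z → ∣ z ∣ ≤ q') (Σ-cong (range t) (λ i → cong c (NP.+-suc i D))) (c-sums (suc D) t)) (ι≥0 q) (N N.∸ D)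

    f-far : 2ℚ * (ι D * f (suc D)) ≤ ι N * ι N
    f-far = ≤-trans (*-monoˡ 2ℚ (0≤+ 0≤1 0≤1) (*-monoʳ (f (suc D)) (f≥0 (suc D)) (ι-mono (NP.n≤1+n D)))) (≡≤ (f-formula (suc D))
      (id148 (ι N) (ι (suc D)) (ι (N % suc D)) via 0≤+ (0≤* (≤⇒0≤ (ι-mono ρN)) (ι≥0 (suc D))) (sq≥0 (ι (N % suc D)))))
     where
     ρN : N % suc D N.≤ N
     ρN = ℕ≤≡ (NP.m≤m+n _ _) (sym (m≡m%n+[m/n]*n N (suc D)))

    -- Dividing `f-formula` by d gives 2 f(d) = N²/d - N + ρ(d - ρ)/d. The first term yields L(1,
    -- c), the second a character sum bounded by q, and the third is at most D for each of D
    -- divisors.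
    near : 2ℚ * Σ (range D) (λ i → c (suc i) * f (suc i)) ≤ ι N * ι N * S D + ι N * q' + ι D * ι D
    near = ≡≤ (trans (sym (Σ-*ˡ (range D) 2ℚ _)) (Σ-cong (range D) (λ i → split i))) (≡≤ (trans (Σ-+ (range D) _ _) (cong₂ _+_ (trans (Σ-- (range D) _ _) (cong₂ (λ a b → a - b) (Σ-*ˡ (range D) (ι N * ι N) _) (Σ-*ˡ (range D) (ι N) _))) refl))
      (+-mono (id149 _ (ι N) _ q' via 0≤* (ι≥0 N) (≤⇒0≤ (≤-trans (-≤abs _) (subst (λ z → ∣ z ∣ ≤ q') (Σ-cong (range D) (λ i → cong c (NP.+-comm i 1))) (c-sums 1 D)))))
       (≤-trans (≤abs _) (≤≡ (Σ-abs≤ (range D) (λ i i∈ → small i (∈range i∈))) (trans (Σ-const (range D) (ι D)) (cong (λ z → ι z * ι D) (range-length D)))))))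
     where
     e : ℕ → ℚ
     e i = (ι (N % suc i) * (ι (suc i) - ι (N % suc i))) * rec (suc i)
     split : ∀ i → 2ℚ * (c (suc i) * f (suc i)) ≡ (ι N * ι N * (c (suc i) * rec (suc i)) - ι N * c (suc i)) + c (suc i) * e i
     split i = trans (trans (cong (λ z → 2ℚ * (c (suc i) * z)) fe) (id141 (c (suc i)) (ι (suc i)) (f (suc i)) (rec (suc i)))) (trans (cong (λ z → c (suc i) * (z * rec (suc i))) (f-formula (suc i)))
       (l2 (c (suc i)) (ι N) (ι (suc i)) (rec (suc i)) _ (ι*rec {suc i} 1≤suc)))
      where
      fe : f (suc i) ≡ (ι (suc i) * rec (suc i)) * f (suc i)
      fe = sym (trans (cong (_* f (suc i)) (ι*rec {suc i} 1≤suc)) (*-identityˡ _))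
      l2 : ∀ c n d r p → d * r ≡ 1ℚ → c * (((n * n - n * d) + p) * r) ≡ (n * n * (c * r) - n * c) + c * (p * r)
      l2 c n d r p h = trans (id142 c n d r p) (cong (λ z → (n * n * (c * r) - z) + c * (p * r)) (trans (cong (n * c *_) h) (*-identityʳ _)))
     small : ∀ i → i N.< D → ∣ c (suc i) * e i ∣ ≤ ι D
     small i h = ≤-trans (subst (∣ c (suc i) * e i ∣ ≤_) (*-identityˡ _) (abs-* (∣c∣≤1 (suc i)) (≤-reflexive (∣∣-nonneg e≥0)))) (≤-trans e≤ (ι-mono h))
      where
      ρ d : ℚ
      ρ = ι (N % suc i)
      d = ι (suc i)
      ρ≤d : ρ ≤ d
      ρ≤d = ι-mono (NP.<⇒≤ (m%n<n N (suc i)))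
      e≥0 : 0ℚ ≤ e i
      e≥0 = 0≤* (0≤* (ι≥0 _) (≤⇒0≤ ρ≤d)) (rec≥0 (suc i))
      e≤ : e i ≤ d
      e≤ = ≤≡ (*-monoʳ (rec (suc i)) (rec≥0 (suc i)) (id143 d ρ via 0≤+ (0≤* (ι≥0 (suc i)) (≤⇒0≤ ρ≤d)) (sq≥0 ρ))) (trans (*-assoc _ _ _) (trans (cong (d *_) (ι*rec {suc i} 1≤suc)) (*-identityʳ d)))

    D≡ : ι D ≡ ι 16 * (q' * m)
    D≡ = trans (ι-* 16 (q N.* M)) (cong (ι 16 *_) (ι-* q M))

    16≡ : ι 16 ≡ (2ℚ * 2ℚ) * (2ℚ * 2ℚ)
    16≡ = trans (ι-* 4 4) (cong (λ z → z * z) (trans (ι-* 2 2) (cong (λ z → z * z) (trans (ι-suc 1) (cong (1ℚ +_) ι-1)))))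

    -- q N² / D = m³
    qf : 2ℚ * (q' * f (suc D)) ≤ m * (m * m)
    qf = *-cancelˡ (ι 16 * m) (0<* (ι-pos {16} 1≤suc) (ι-pos M≥1)) (subst₂ _≤_ (trans (cong (λ z → 2ℚ * (z * f (suc D))) D≡) (id150 (ι 16) q' m (f (suc D)))) (trans (cong (λ z → z * z) ιN) (trans (id151 m) (cong (λ z → z * m * (m * (m * m))) (sym 16≡)))) f-far)

    slop : ι N * q' + ι D * ι D ≤ m * (m * m)
    slop = subst₂ _≤_ e1 e2 (ι-mono nat)
     where
     nat : N N.* q N.+ D N.* D N.≤ M N.* (M N.* M)
     nat = ℕ≡≤ (re q M) (ℕ≤≡ (NP.*-monoˡ-≤ (M N.* M) (NP.+-monoˡ-≤ (256 N.* (q N.* q)) (NP.*-monoʳ-≤ 4 (NP.m≤m*n q q {{N.>-nonZero q≥1}}))))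
       (cong (N._* (M N.* M)) (sym (NP.*-distribʳ-+ (q N.* q) 4 256))))
      where
      re : ∀ q M → 2 N.* M N.* (2 N.* M) N.* q N.+ 16 N.* (q N.* M) N.* (16 N.* (q N.* M)) ≡ (4 N.* q N.+ 256 N.* (q N.* q)) N.* (M N.* M)
      re = solveℕ
     e1 : ι (N N.* q N.+ D N.* D) ≡ ι N * q' + ι D * ι D
     e1 = trans (ι-+ (N N.* q) (D N.* D)) (cong₂ _+_ (ι-* N q) (ι-* D D))
     e2 : ι (M N.* (M N.* M)) ≡ m * (m * m)
     e2 = trans (ι-* M (M N.* M)) (cong (m *_) (ι-* M M))

    -- Twice the weighted sum of r is at least 6M³; the far divisors and the errors of the near ones
    -- take M³ each.
    key : 2ℚ * 2ℚ * (m * (m * m)) ≤ ι N * ι N * S D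
    key = l (m) (ι N * ι N * S D) (ι N * q') (ι D * ι D) (Σ (range D) (λ i → c (suc i) * f (suc i))) _ (q' * f (suc D)) _ total'
      via 0≤+ (0≤+ (≤⇒0≤ near) (≤⇒0≤ slop)) (0≤+ (≤⇒0≤ qf) (0≤+ (0≤* (0≤+ 0≤1 0≤1) (≤⇒0≤ (≤-trans (≤abs _) far))) (0≤* (0≤+ 0≤1 0≤1) (≤⇒0≤ squares-lower))))
     where
     total' : Σ (range N) (λ i → r (suc i) * ι (N N.∸ suc i)) ≡ Σ (range (N N.∸ D)) (λ i → c (suc (i N.+ D)) * f (suc (i N.+ D))) + Σ (range D) (λ i → c (suc i) * f (suc i))
     total' = trans total (trans (cong (λ z → Σ (range z) (λ i → c (suc i) * f (suc i))) (sym (NP.m∸n+n≡m D≤N))) (Σ-range-+ (N N.∸ D) D _))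
     l : ∀ m A B C n F q t → t ≡ F + n → A - 2ℚ * 2ℚ * (m * (m * m)) ≡
      (((A + B + C) - 2ℚ * n) + (m * (m * m) - (B + C))) + ((m * (m * m) - 2ℚ * q) + (2ℚ * (q - F) + 2ℚ * (t - m * ((2ℚ + 1ℚ) * (m * m)))))
     l m A B C n F q _ refl = id152 m A B C n F q

    S-D : 1ℚ ≤ ι 4 * m * S D
    S-D = *-cancelˡ (2ℚ * 2ℚ * (m * (m * m))) (0<* (0<* (0<+ 0<1 0≤1) (0<+ 0<1 0≤1)) (0<* mp (0<* mp mp))) (subst₂ _≤_ (sym (*-identityʳ _)) (trans (cong (λ z → z * z * S D) ιN) (trans (id153 m (S D)) (cong (λ z → 2ℚ * 2ℚ * (m * (m * m)) * (z * m * S D)) (sym ι4)))) key)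
     where
     mp : 0ℚ < m
     mp = ι-pos M≥1
     ι4 : ι 4 ≡ 2ℚ * 2ℚ
     ι4 = trans (ι-* 2 2) (cong (λ z → z * z) (trans (ι-suc 1) (cong (1ℚ +_) ι-1)))

   -- The sum up to D is at least 1/(4M), and by Abel summation the rest changes it by at most q/D =
   -- 1/(16M).
   L-one-lower : ∀ Y → D N.≤ Y → 1ℚ ≤ ι (8 N.* M) * Σ (range Y) (λ i → c (suc i) * rec (suc i))
   L-one-lower Y h = subst (λ z → 1ℚ ≤ z * S Y) (sym ι8) (l (ι 4) m (S Y) (S D) tail eqS via 0≤+ (≤⇒0≤ S-D) (≤⇒0≤ bound))
    where
    tail : ℚ
    tail = Σ (range (Y N.∸ D)) (λ i → c (suc (i N.+ D)) * rec (suc (i N.+ D)))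
    eqS : S Y ≡ tail + S D
    eqS = trans (cong S (sym (NP.m∸n+n≡m h))) (Σ-range-+ (Y N.∸ D) D _)
    ι8 : ι (8 N.* M) ≡ 2ℚ * ι 4 * m
    ι8 = trans (ι-* 8 M) (cong (_* m) (trans (ι-* 2 4) (cong (_* ι 4) (trans (ι-suc 1) (cong (1ℚ +_) ι-1)))))
    small : ∣ tail ∣ ≤ q' * rec (suc D)
    small = abel (λ i → c (suc (i N.+ D))) (λ i → rec (suc (i N.+ D))) q' (λ i → rec≥0 (suc (i N.+ D))) (λ i → rec-mono {suc (i N.+ D)} 1≤suc (NP.n≤1+n _)) (λ t → subst (λ z → ∣ z ∣ ≤ q') (Σ-cong (range t) (λ i → cong c (NP.+-suc i D))) (c-sums (suc D) t)) (ι≥0 q) (Y N.∸ D)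
    -- 8 m q / D ≤ 1 with D = 16 q m
    bound : - (2ℚ * ι 4 * m * tail) ≤ ι 4 * m * S D
    bound = ≤-trans (≡≤ (id154 _ _) (*-monoˡ (2ℚ * ι 4 * m) (0≤* (0≤* (0≤+ 0≤1 0≤1) (ι≥0 4)) m≥0) (≤-trans (-≤abs tail) small))) (≤-trans final S-D)
     where
     final : 2ℚ * ι 4 * m * (q' * rec (suc D)) ≤ 1ℚ
     final = ≤-trans (*-monoˡ (2ℚ * ι 4 * m) (0≤* (0≤* (0≤+ 0≤1 0≤1) (ι≥0 4)) m≥0) (*-monoˡ q' (ι≥0 q) (rec-mono D≥1 (NP.n≤1+n D))))
       (≤≡ (≤+ʳ {b = 2ℚ * ι 4 * m * (q' * rec D)} (0≤* (0≤* (0≤* (0≤+ 0≤1 0≤1) (ι≥0 4)) m≥0) (0≤* (ι≥0 q) (rec≥0 D))))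
        (trans (id144 (ι 4) m q' (rec D)) (trans (cong (λ z → z * (q' * m) * rec D) e16) (trans (cong (_* rec D) (sym D≡)) (ι*rec D≥1)))))
      where
      e16 : 2ℚ * 2ℚ * ι 4 ≡ ι 16
      e16 = trans (cong (2ℚ * 2ℚ *_) ι4) (sym 16≡)
       where
       ι4 : ι 4 ≡ 2ℚ * 2ℚ
       ι4 = trans (ι-* 2 2) (cong (λ z → z * z) (trans (ι-suc 1) (cong (1ℚ +_) ι-1)))
    l : ∀ f m s d t → s ≡ t + d → 2ℚ * f * m * s - 1ℚ ≡ (f * m * d - 1ℚ) + (f * m * d - - (2ℚ * f * m * t))
    l f m _ d t refl = id160 f m d t

-- Cosets of the squares and real characters.

module Spectral where

 open Q
 open Kit
 open Group

 cancel-nonzero : ∀ {a b} c → c ≢ 0ℚ → a * c ≡ b * c → a ≡ b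
 cancel-nonzero {a} {b} c h e = ≤-antisym (*-cancelˡ (c * c) pos (≤-reflexive (eq a b e))) (*-cancelˡ (c * c) pos (≤-reflexive (eq b a (sym e))))
  where
  eq : ∀ a b → a * c ≡ b * c → c * c * a ≡ c * c * b
  eq a b e = trans (id176 c a) (trans (cong (c *_) e) (sym (id176 c b)))
  pos : 0ℚ < c * c
  pos with <-cmp 0ℚ c
  ... | tri< p _ _ = 0<* p p
  ... | tri≈ _ p _ = ⊥-elim (h (sym p))
  ... | tri> _ _ p = subst (0ℚ <_) (id170 c) (0<* n n)
   where
   n : 0ℚ < - c
   n = subst₂ _<_ (+-inverseʳ c) (+-identityˡ _) (+-mono-<-≤ p ≤-refl)

 sign-abs : ∀ {s} → s * s ≡ 1ℚ → ∣ s ∣ ≡ 1ℚ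
 sign-abs {s} e with <-cmp ∣ s ∣ 1ℚ
 ... | tri≈ _ p _ = p
 ... | tri< p _ _ = ⊥-elim (<-irrefl e' (≤-<-trans (*-monoˡ ∣ s ∣ (0≤∣∣ s) (<⇒≤ p)) (subst (_< 1ℚ) (sym (*-identityʳ _)) p)))
  where
  e' : ∣ s ∣ * ∣ s ∣ ≡ 1ℚ
  e' = trans (sym (∣*∣ s s)) (trans (cong ∣_∣ e) (∣∣-nonneg 0≤1))
 ... | tri> _ _ p = ⊥-elim (<-irrefl (sym e') (<-≤-trans (subst (1ℚ <_) (sym (*-identityʳ _)) p) (*-monoˡ ∣ s ∣ (0≤∣∣ s) (<⇒≤ p))))
  where
  e' : ∣ s ∣ * ∣ s ∣ ≡ 1ℚ
  e' = trans (sym (∣*∣ s s)) (trans (cong ∣_∣ e) (∣∣-nonneg 0≤1))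

 module _ (𝔾 : FiniteAbelianGroup) where
  open FiniteAbelianGroup 𝔾
  open Analysis 𝔾

  record RealChar (ε : G → ℚ) : Set where
   field
    mult : ∀ a b → ε (a ∙ b) ≡ ε a * ε b
    sign : ∀ a → ε a * ε a ≡ 1ℚ
  open RealChar

  Nontrivial : (G → ℚ) → Set
  Nontrivial ε = ∃[ t ] (ε t ≢ 1ℚ)

  ε-e : ∀ {ε} → RealChar ε → ε e ≡ 1ℚ
  ε-e {ε} c = trans (sym (*-identityʳ _)) (trans (cong (ε e *_) (sym (sign c e))) (trans (sym (*-assoc _ _ _)) (trans (cong (_* ε e) (sym (mult c e e))) (trans (cong (λ z → ε z * ε e) (∙-idˡ e)) (sign c e)))))

  ε-square : ∀ {ε} → RealChar ε → ∀ u → ε (u ∙ u) ≡ 1ℚ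
  ε-square c u = trans (mult c u u) (sign c u)

  ∑ε≡0 : ∀ {ε} → RealChar ε → Nontrivial ε → ∑ ε ≡ 0ℚ
  ∑ε≡0 {ε} c (t , ne) = trans (sym (id177 (∑ ε))) (trans (cong (_- ∑ ε * 0ℚ) refl) (trans (cong (λ z → z - ∑ ε * 0ℚ) zero') (id178 (∑ ε))))
   where
   shift : ε t * ∑ ε ≡ ∑ ε
   shift = trans (sym (Σ-*ˡ els (ε t) ε)) (trans (Σ-cong els (λ s → sym (mult c t s))) (∑-mul t ε))
   l4 : ∀ b → b - 1ℚ ≡ 0ℚ → b ≡ 1ℚ
   l4 b h = trans (sym (id173 b)) (trans (cong (_+ 1ℚ) h) (+-identityˡ 1ℚ))
   zero' : ∑ ε ≡ 0ℚ
   zero' = cancel-nonzero (ε t - 1ℚ) (λ h → ne (l4 (ε t) h)) (trans (id179 (∑ ε) (ε t)) (trans (cong (λ z → z - ∑ ε) shift) (trans (+-inverseʳ (∑ ε)) (sym (*-zeroˡ _)))))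

  module Decomposition (φ⁻ : ℚ) (φφ⁻ : φ * φ⁻ ≡ 1ℚ) (φ≥0 : 0ℚ ≤ φ) (reps : List G)
   (cover : ∀ t → ∃[ x ] (x ∈ reps × ∃[ u ] (t ≡ x ∙ (u ∙ u)))) where

   SquareInvariant : (G → ℚ) → Set
   SquareInvariant f = ∀ t u → f (t ∙ (u ∙ u)) ≡ f t

   Eigen : (G → ℚ) → G → Set
   Eigen f x = ∃[ σ ] (σ * σ ≡ 1ℚ × (∀ t → f (x ∙ t) ≡ σ * f t))

   Bounded : (G → ℚ) → ℚ → Set
   Bounded f β = ∀ {ε} → RealChar ε → Nontrivial ε → ∣ ∑ (λ t → ε t * f t) ∣ ≤ β

   -- The signs with f(x t) = ± f(t) form a real character ε as soon as f(e) ≠ 0, and f = ε f(e). If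
   -- ε were trivial, ∑ f = 0 would give f(e) = 0; so ε is nontrivial, and the bound applies to ∑ ε
   -- f = φ f(e).
   leaf : ∀ f β → 0ℚ ≤ β → SquareInvariant f → ∑ f ≡ 0ℚ → Bounded f β → (∀ x → x ∈ reps → Eigen f x) → ∀ t → φ * ∣ f t ∣ ≤ β
   leaf f β β≥0 si s0 bnd eig t = by (f e ≟ 0ℚ)
    where
    eigen : ∀ t → Eigen f t
    eigen t with cover t
    ... | x , x∈ , u , refl = σ , proj₁ (proj₂ (eig x x∈)) , λ s → trans (cong f (∙-assoc x (u ∙ u) s)) (trans (proj₂ (proj₂ (eig x x∈)) ((u ∙ u) ∙ s))
       (cong (σ *_) (trans (cong f (∙-comm (u ∙ u) s)) (si s u))))
     where σ = proj₁ (eig x x∈)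
    ε : G → ℚ
    ε t = proj₁ (eigen t)
    at : ∀ t → f t ≡ ε t * f e
    at t = trans (cong f (sym (∙-idʳ t))) (proj₂ (proj₂ (eigen t)) e)
    by : Dec (f e ≡ 0ℚ) → φ * ∣ f t ∣ ≤ β
    by (yes z) = ≡≤ (trans (cong (λ y → φ * ∣ y ∣) (trans (at t) (trans (cong (ε t *_) z) (*-zeroʳ _)))) (trans (cong (φ *_) (∣∣-nonneg ≤-refl)) (*-zeroʳ φ))) β≥0
    by (no nz) = ≤-trans (*-monoˡ φ φ≥0 (≤-reflexive (trans (cong ∣_∣ (at t)) (trans (∣*∣ _ _) (trans (cong (_* ∣ f e ∣) (sign-abs (proj₁ (proj₂ (eigen t))))) (*-identityˡ _))))))
      (≡≤ (sym (trans (cong ∣_∣ sumε) (trans (∣*∣ _ _) (cong (_* ∣ f e ∣) (∣∣-nonneg φ≥0))))) (bnd char nontriv))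
     where
     char : RealChar ε
     char = record { mult = λ a b → cancel-nonzero (f e) nz (trans (sym (at (a ∙ b))) (trans (proj₂ (proj₂ (eigen a)) b) (trans (cong (ε a *_) (at b)) (sym (*-assoc _ _ _)))))
            ; sign = λ a → proj₁ (proj₂ (eigen a)) }
     sumε : ∑ (λ t → ε t * f t) ≡ φ * f e
     sumε = trans (Σ-cong els (λ t → trans (cong (ε t *_) (at t)) (trans (sym (*-assoc _ _ _)) (cong (_* f e) (proj₁ (proj₂ (eigen t))))))) (Σ-*ʳ els (f e) _)
     nontriv : Nontrivial ε
     nontriv with any? (λ t → ¬? (ε t ≟ 1ℚ)) els
     ... | yes a = Any.satisfied a
     ... | no na = ⊥-elim (nz (trans (sym (*-identityʳ _)) (trans (cong (f e *_) (sym φφ⁻)) (trans (id135 (f e) φ φ⁻) (trans (cong (_* φ⁻) φf) (*-zeroˡ _))))))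
      where
      all1 : ∀ t → t ∈ els → ε t ≡ 1ℚ
      all1 t m with ε t ≟ 1ℚ
      ... | yes p = p
      ... | no n = ⊥-elim (na (Data.List.Membership.Propositional.lose m n))
       where import Data.List.Membership.Propositional
      φf : φ * f e ≡ 0ℚ
      φf = trans (sym (trans (Σ-cong∈ els (λ t m → trans (at t) (cong (_* f e) (all1 t m)))) (Σ-*ʳ els (f e) _))) s0

   -- A Fourier expansion without the dual group. As f is invariant under squares, translation by a
   -- representative x is an involution on f, so f splits into eigenfunctions f(t) ± f(x t). Each
   -- splitting doubles the bound `β`, is undone by averaging the two parts, and preserves the
   -- earlier eigenvalue relations; after all representatives only leaves remain.
   spectral : ∀ xs f β → 0ℚ ≤ β → SquareInvariant f → ∑ f ≡ 0ℚ → Bounded f β → (∀ x → x ∈ reps → (x ∈ xs) ⊎ Eigen f x) →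
    ∀ t → φ * ∣ f t ∣ ≤ ι (2 N.^ length xs) * β
   spectral [] f β β≥0 si s0 bnd h t = ≤≡ (leaf f β β≥0 si s0 bnd (λ x m → [ (λ ()) , (λ z → z) ]′ (h x m)) t) (sym (trans (cong (_* β) ι-1) (*-identityˡ β)))
    where open import Data.Sum using ([_,_]′)
   spectral (x ∷ xs) f β β≥0 si s0 bnd h t = *-cancelˡ 2ℚ (0<+ 0<1 0≤1) (≤-trans (≡≤ (id174 φ ∣ f t ∣) (*-monoˡ φ φ≥0 two))
     (≡≤ (*-distribˡ-+ φ _ _) (≤≡ (+-mono (half f₊ si₊ s₊ b₊ (λ y m → eig₊ y (h y m)) t) (half f₋ si₋ s₋ b₋ (λ y m → eig₋ y (h y m)) t))
      (trans (id175 (ι (2 N.^ length xs)) β) (cong (λ z → 2ℚ * (z * β)) (sym (trans (ι-* 2 (2 N.^ length xs)) (cong (_* ι (2 N.^ length xs)) (trans (ι-suc 1) (cong (1ℚ +_) ι-1))))))))))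
    where
    f₊ f₋ : G → ℚ
    f₊ t = f t + f (x ∙ t)
    f₋ t = f t - f (x ∙ t)
    two : ∣ f t ∣ + ∣ f t ∣ ≤ ∣ f₊ t ∣ + ∣ f₋ t ∣
    two = ≡≤ dbl (≡≤ (cong ∣_∣ (id168 (f t) (f (x ∙ t)))) (∣+∣≤ (f₊ t) (f₋ t)))
     where
     dbl : ∣ f t ∣ + ∣ f t ∣ ≡ ∣ f t + f t ∣
     dbl = sym (trans (cong ∣_∣ (sym (id169 (f t)))) (trans (∣*∣ 2ℚ (f t)) (trans (cong (_* ∣ f t ∣) (∣∣-nonneg (0≤+ 0≤1 0≤1))) (id169 ∣ f t ∣))))
    half : ∀ f' → SquareInvariant f' → ∑ f' ≡ 0ℚ → Bounded f' (β + β) → (∀ y → y ∈ reps → (y ∈ xs) ⊎ Eigen f' y) → ∀ t → φ * ∣ f' t ∣ ≤ ι (2 N.^ length xs) * (β + β)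
    half f' a b c d = spectral xs f' (β + β) (0≤+ β≥0 β≥0) a b c d
    shift-si : ∀ t u → f (x ∙ (t ∙ (u ∙ u))) ≡ f (x ∙ t)
    shift-si t u = trans (cong f (sym (∙-assoc x t (u ∙ u)))) (si (x ∙ t) u)
    si₊ : SquareInvariant f₊
    si₊ t u = cong₂ _+_ (si t u) (shift-si t u)
    si₋ : SquareInvariant f₋
    si₋ t u = cong₂ (λ a b → a - b) (si t u) (shift-si t u)
    s₊ : ∑ f₊ ≡ 0ℚ
    s₊ = trans (Σ-+ els _ _) (trans (cong₂ _+_ s0 (trans (∑-mul x f) s0)) (+-identityˡ 0ℚ))
    s₋ : ∑ f₋ ≡ 0ℚ
    s₋ = trans (Σ-- els _ _) (trans (cong₂ (λ a b → a - b) s0 (trans (∑-mul x f) s0)) (+-inverseʳ 0ℚ))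
    shifted : ∀ {ε} → RealChar ε → Nontrivial ε → ∣ ∑ (λ t → ε t * f (x ∙ t)) ∣ ≤ β
    shifted {ε} c n = subst (λ z → ∣ z ∣ ≤ β) (sym eq) (subst (∣ ε (inv x) * ∑ (λ t → ε t * f t) ∣ ≤_) (*-identityˡ β) (abs-* (≤-reflexive (sign-abs (sign c (inv x)))) (bnd c n)))
     where
     eq : ∑ (λ t → ε t * f (x ∙ t)) ≡ ε (inv x) * ∑ (λ t → ε t * f t)
     eq = trans (Σ-cong els (λ t → trans (cong (λ z → ε z * f (x ∙ t)) (sym (cancelˡ x t))) (trans (cong (_* f (x ∙ t)) (mult c (inv x) (x ∙ t))) (*-assoc _ _ _))))
      (trans (Σ-*ˡ els (ε (inv x)) _) (cong (ε (inv x) *_) (∑-mul x (λ t → ε t * f t))))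
    b₊ : Bounded f₊ (β + β)
    b₊ {ε} c n = subst (λ z → ∣ z ∣ ≤ β + β) (sym (trans (Σ-cong els (λ t → *-distribˡ-+ (ε t) _ _)) (Σ-+ els _ _))) (abs-+ (bnd c n) (shifted c n))
    b₋ : Bounded f₋ (β + β)
    b₋ {ε} c n = subst (λ z → ∣ z ∣ ≤ β + β) (sym (trans (Σ-cong els (λ t → id31 (ε t) _ _)) (Σ-- els _ _))) (abs-- (bnd c n) (shifted c n))
    swapx : ∀ y t → x ∙ (y ∙ t) ≡ y ∙ (x ∙ t)
    swapx y t = trans (sym (∙-assoc x y t)) (trans (cong (_∙ t) (∙-comm x y)) (∙-assoc y x t))
    back : ∀ t → f (x ∙ (x ∙ t)) ≡ f t
    back t = trans (cong f (trans (sym (∙-assoc x x t)) (∙-comm (x ∙ x) t))) (si t x)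
    eig₊ : ∀ y → (y ∈ x ∷ xs) ⊎ Eigen f y → (y ∈ xs) ⊎ Eigen f₊ y
    eig₊ y (inj₁ (here refl)) = inj₂ (1ℚ , *-identityˡ 1ℚ , λ t → trans (cong (f (x ∙ t) +_) (back t)) (trans (+-comm _ _) (sym (*-identityˡ _))))
    eig₊ y (inj₁ (there m)) = inj₁ m
    eig₊ y (inj₂ (σ , s , h)) = inj₂ (σ , s , λ t → trans (cong₂ _+_ (h t) (trans (cong f (swapx y t)) (h (x ∙ t)))) (sym (*-distribˡ-+ σ _ _)))
    eig₋ : ∀ y → (y ∈ x ∷ xs) ⊎ Eigen f y → (y ∈ xs) ⊎ Eigen f₋ y
    eig₋ y (inj₁ (here refl)) = inj₂ (- 1ℚ , m1 , λ t → trans (cong (λ z → f (x ∙ t) - z) (back t)) (id171 (f (x ∙ t)) (f t)))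
     where
     m1 : - 1ℚ * - 1ℚ ≡ 1ℚ
     m1 = trans (id170 1ℚ) (*-identityˡ 1ℚ)
    eig₋ y (inj₁ (there m)) = inj₁ m
    eig₋ y (inj₂ (σ , s , h)) = inj₂ (σ , s , λ t → trans (cong₂ (λ a b → a - b) (h t) (trans (cong f (swapx y t)) (h (x ∙ t)))) (id172 σ _ _))

   -- The coset sum of L minus its mean is invariant under squares and sums to zero, and twisting it
   -- by a nontrivial real character gives φ times the twisted sum of L.
   coset-equidistribution : ∀ L β → 0ℚ ≤ β → (∀ {ε} → RealChar ε → Nontrivial ε → ∣ ∑ (λ t → ε t * L t) ∣ ≤ β) →
    ∀ t → ∣ ∑ (λ s → L (t ∙ (s ∙ s))) - ∑ L ∣ ≤ ι (2 N.^ length reps) * β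
   coset-equidistribution L β β≥0 bnd t = *-cancelˡ φ φ>0 (≤≡ (spectral reps f (φ * β) (0≤* φ≥0 β≥0) si s0 fb (λ x m → inj₁ m) t) (id8 (ι (2 N.^ length reps)) φ β))
    where
    φ>0 : 0ℚ < φ
    φ>0 with <-cmp 0ℚ φ
    ... | tri< p _ _ = p
    ... | tri≈ _ p _ = ⊥-elim (<-irrefl (trans (sym (*-zeroˡ φ⁻)) (trans (cong (_* φ⁻) p) φφ⁻)) 0<1)
    ... | tri> _ _ p = ⊥-elim (<-irrefl refl (<-≤-trans p φ≥0))
    A : G → ℚ
    A t = ∑ (λ s → L (t ∙ (s ∙ s)))
    f : G → ℚ
    f t = A t - ∑ L
    sq : ∀ t u s → t ∙ (u ∙ u) ∙ (s ∙ s) ≡ t ∙ ((u ∙ s) ∙ (u ∙ s))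
    sq t u s = trans (∙-assoc t (u ∙ u) (s ∙ s)) (cong (t ∙_) (trans (∙-assoc u u (s ∙ s)) (trans (cong (u ∙_) (trans (sym (∙-assoc u s s)) (trans (cong (_∙ s) (∙-comm u s)) (∙-assoc s u s)))) (sym (∙-assoc u s (u ∙ s))))))
    si : SquareInvariant f
    si t u = cong (λ z → z - ∑ L) (trans (Σ-cong els (λ s → cong L (sq t u s))) (∑-mul u (λ s → L (t ∙ (s ∙ s)))))
    ∑A : ∀ (w : G → ℚ) → (∀ t s → w (t ∙ (s ∙ s)) ≡ w t) → ∑ (λ t → w t * A t) ≡ φ * ∑ (λ t → w t * L t)
    ∑A w wi = trans (Σ-cong els (λ t → sym (Σ-*ˡ els (w t) _))) (trans (Σ-swap els els _) (trans (Σ-cong els (λ s → trans (Σ-cong els (λ t → cong₂ _*_ (sym (wi t s)) refl))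
      (trans (Σ-cong els (λ t → cong (λ z → w z * L z) (∙-comm t (s ∙ s)))) (∑-mul (s ∙ s) (λ t → w t * L t))))) (trans (Σ-cong els (λ _ → sym (*-identityˡ _))) (Σ-*ʳ els _ _))))
    ∑const : ∀ c → ∑ (λ _ → c) ≡ φ * c
    ∑const c = trans (Σ-cong els (λ _ → sym (*-identityˡ c))) (Σ-*ʳ els c _)
    s0 : ∑ f ≡ 0ℚ
    s0 = trans (Σ-- els A _) (trans (cong₂ (λ a b → a - b) (trans (Σ-cong els (λ t → sym (*-identityˡ _))) (trans (∑A (λ _ → 1ℚ) (λ _ _ → refl)) (cong (φ *_) (Σ-cong els (λ t → *-identityˡ _))))) (∑const (∑ L))) (+-inverseʳ _))
    fb : Bounded f (φ * β)
    fb {ε} c n = subst (λ z → ∣ z ∣ ≤ φ * β) (sym eq) (abs-* (≤-reflexive (∣∣-nonneg φ≥0)) (bnd c n))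
     where
     eq : ∑ (λ t → ε t * f t) ≡ φ * ∑ (λ t → ε t * L t)
     eq = trans (Σ-cong els (λ t → id31 (ε t) _ _)) (trans (Σ-- els _ _) (trans (cong₂ (λ a b → a - b) (∑A ε (λ t s → trans (mult c t (s ∙ s)) (trans (cong (ε t *_) (ε-square c s)) (*-identityʳ _))))
       (trans (Σ-*ʳ els (∑ L) ε) (trans (cong (_* ∑ L) (∑ε≡0 c n)) (*-zeroˡ _)))) (id23 _)))

-- Square roots of integers congruent to 1 modulo g³.

module Hensel where

 open import Data.Integer as ℤ using (ℤ; +_; -[1+_]; 0ℤ; 1ℤ)
 import Data.Integer.Properties as ℤP
 open import Data.Integer.DivMod using (_%ℕ_; _/ℕ_; a≡a%ℕn+[a/ℕn]*n)
 open import Data.Integer.Tactic.RingSolver using () renaming (solve-∀ to solveℤ)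

 -- Since √(1+4v) = 1 + 2 v C(-v) with the integral Catalan series C, the fixed point c = 1 - v c² gives the root.
 catalan : ∀ (g w : ℤ) n → ∃[ c ] ∃[ k ] (c ℤ.+ g ℤ.* w ℤ.* (c ℤ.* c) ≡ 1ℤ ℤ.+ k ℤ.* g ℤ.^ n)
 catalan g w zero = 0ℤ , ℤ.- 1ℤ , l g w
  where
  l : ∀ g w → 0ℤ ℤ.+ g ℤ.* w ℤ.* (0ℤ ℤ.* 0ℤ) ≡ 1ℤ ℤ.+ (ℤ.- 1ℤ) ℤ.* 1ℤ
  l = solveℤ
 catalan g w (suc n) with catalan g w n
 ... | c , k , e = c' , k' , trans l1 (trans (cong (λ z → z ℤ.+ g ℤ.* w ℤ.* (z ℤ.* z)) c'≡) (trans (l2 c k G g w) (trans (cong (λ z → z ℤ.- k ℤ.* G ℤ.+ k' ℤ.* (g ℤ.* G)) e) (l3 k G (k' ℤ.* (g ℤ.* G))))))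
  where
  G c' k' : ℤ
  G = g ℤ.^ n
  c' = 1ℤ ℤ.- g ℤ.* w ℤ.* (c ℤ.* c)
  -- The new approximation is c - kG; the change of g w c² is g w (k²G² - 2 c k G), divisible by g
  -- G, which gains one power of g.
  k' = w ℤ.* (k ℤ.* k ℤ.* G ℤ.- (+ 2) ℤ.* (c ℤ.* k))
  l1 : c' ℤ.+ g ℤ.* w ℤ.* (c' ℤ.* c') ≡ c' ℤ.+ g ℤ.* w ℤ.* (c' ℤ.* c')
  l1 = refl
  l0 : ∀ a b x → (a ℤ.+ b) ℤ.- b ℤ.- x ≡ a ℤ.- x
  l0 = solveℤ
  l00 : ∀ x b → (1ℤ ℤ.+ x) ℤ.- b ℤ.- x ≡ 1ℤ ℤ.- b
  l00 = solveℤ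
  c'≡ : c' ≡ c ℤ.- k ℤ.* G
  c'≡ = trans (sym (l00 (k ℤ.* G) (g ℤ.* w ℤ.* (c ℤ.* c)))) (trans (cong (λ z → z ℤ.- g ℤ.* w ℤ.* (c ℤ.* c) ℤ.- k ℤ.* G) (sym e)) (l0 c (g ℤ.* w ℤ.* (c ℤ.* c)) (k ℤ.* G)))
  l2 : ∀ c k G g w → (c ℤ.- k ℤ.* G) ℤ.+ g ℤ.* w ℤ.* ((c ℤ.- k ℤ.* G) ℤ.* (c ℤ.- k ℤ.* G)) ≡
   (c ℤ.+ g ℤ.* w ℤ.* (c ℤ.* c)) ℤ.- k ℤ.* G ℤ.+ w ℤ.* (k ℤ.* k ℤ.* G ℤ.- (+ 2) ℤ.* (c ℤ.* k)) ℤ.* (g ℤ.* G)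
  l2 = solveℤ
  l3 : ∀ k G x → (1ℤ ℤ.+ k ℤ.* G) ℤ.- k ℤ.* G ℤ.+ x ≡ 1ℤ ℤ.+ x
  l3 = solveℤ

 +-^ : ∀ g n → (+ g) ℤ.^ n ≡ + (g N.^ n)
 +-^ g zero = refl
 +-^ g (suc n) = trans (cong (λ y → (+ g) ℤ.* y) (+-^ g n)) (sym (ℤP.pos-* g (g N.^ n)))

 module _ (Q : ℕ) {{_ : NonZero Q}} where

  ℤ-congruent : ∀ a b z → + a ≡ + b ℤ.+ z ℤ.* + Q → a % Q ≡ b % Q
  ℤ-congruent a b (+ k) e = trans (cong (_% Q) (ℤP.+-injective (trans e (trans (cong (λ y → (+ b) ℤ.+ y) (sym (ℤP.pos-* k Q))) (sym (ℤP.pos-+ b (k N.* Q))))))) ([m+kn]%n≡m%n b k Q)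
  ℤ-congruent a b -[1+ k ] e = sym (trans (cong (_% Q) (ℤP.+-injective (trans (l (+ b) (+ suc k) (+ Q)) (trans (cong (λ y → y ℤ.+ + suc k ℤ.* + Q) (sym e)) (trans (cong (λ y → (+ a) ℤ.+ y) (sym (ℤP.pos-* (suc k) Q))) (sym (ℤP.pos-+ a (suc k N.* Q)))))))) ([m+kn]%n≡m%n a (suc k) Q))
   where
   l : ∀ b k q → b ≡ b ℤ.+ (ℤ.- k) ℤ.* q ℤ.+ k ℤ.* q
   l = solveℤ

 -- With v = g w and c + v c² ≡ 1, the number 1 + 2 v c has square 1 + 4v (c + v c²) ≡ 1 + 4v.
 -- Reduction modulo g^n makes the root a natural number.
 sqrt-1+4gw : ∀ g w n {{_ : NonZero (g N.^ n)}} → ∃[ u ] ((u N.* u) % (g N.^ n) ≡ (1 N.+ 4 N.* (g N.* w)) % (g N.^ n))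
 sqrt-1+4gw g w n with catalan (+ g) (+ w) n
 ... | c , k , e = u , ℤ-congruent Q (u N.* u) (1 N.+ 4 N.* (g N.* w)) z eq
  where
  Q = g N.^ n
  v s q z : ℤ
  v = + g ℤ.* + w
  s = 1ℤ ℤ.+ (+ 2) ℤ.* (v ℤ.* c)
  q = s /ℕ Q
  u : ℕ
  u = s %ℕ Q
  z = (+ 4) ℤ.* v ℤ.* k ℤ.- (+ 2) ℤ.* (s ℤ.* q) ℤ.+ q ℤ.* q ℤ.* + Q
  ue : + u ≡ s ℤ.- q ℤ.* + Q
  ue = trans (l (+ u) (q ℤ.* + Q)) (cong (λ y → y ℤ.- q ℤ.* + Q) (sym (a≡a%ℕn+[a/ℕn]*n s Q)))
   where
   l : ∀ a b → a ≡ (a ℤ.+ b) ℤ.- b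
   l = solveℤ
  e' : c ℤ.+ v ℤ.* (c ℤ.* c) ≡ 1ℤ ℤ.+ k ℤ.* + Q
  e' = trans e (cong (λ y → 1ℤ ℤ.+ k ℤ.* y) (+-^ g n))
  l1 : ∀ v c q Q → (1ℤ ℤ.+ (+ 2) ℤ.* (v ℤ.* c) ℤ.- q ℤ.* Q) ℤ.* (1ℤ ℤ.+ (+ 2) ℤ.* (v ℤ.* c) ℤ.- q ℤ.* Q) ≡
   1ℤ ℤ.+ (+ 4) ℤ.* v ℤ.* (c ℤ.+ v ℤ.* (c ℤ.* c)) ℤ.+ (q ℤ.* q ℤ.* Q ℤ.- (+ 2) ℤ.* ((1ℤ ℤ.+ (+ 2) ℤ.* (v ℤ.* c)) ℤ.* q)) ℤ.* Q
  l1 = solveℤ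
  l2 : ∀ v s q Q k → 1ℤ ℤ.+ (+ 4) ℤ.* v ℤ.* (1ℤ ℤ.+ k ℤ.* Q) ℤ.+ (q ℤ.* q ℤ.* Q ℤ.- (+ 2) ℤ.* (s ℤ.* q)) ℤ.* Q ≡
   (1ℤ ℤ.+ (+ 4) ℤ.* v) ℤ.+ ((+ 4) ℤ.* v ℤ.* k ℤ.- (+ 2) ℤ.* (s ℤ.* q) ℤ.+ q ℤ.* q ℤ.* Q) ℤ.* Q
  l2 = solveℤ
  te : 1ℤ ℤ.+ (+ 4) ℤ.* v ≡ + (1 N.+ 4 N.* (g N.* w))
  te = sym (trans (ℤP.pos-+ 1 (4 N.* (g N.* w))) (cong (λ y → (1ℤ) ℤ.+ y) (trans (ℤP.pos-* 4 (g N.* w)) (cong (λ y → (+ 4) ℤ.* y) (ℤP.pos-* g w)))))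
  eq : + (u N.* u) ≡ + (1 N.+ 4 N.* (g N.* w)) ℤ.+ z ℤ.* + Q
  eq = trans (ℤP.pos-* u u) (trans (cong₂ ℤ._*_ ue ue) (trans (l1 v c q (+ Q)) (trans (cong (λ y → 1ℤ ℤ.+ (+ 4) ℤ.* v ℤ.* y ℤ.+ (q ℤ.* q ℤ.* + Q ℤ.- (+ 2) ℤ.* (s ℤ.* q)) ℤ.* + Q) e')
   (trans (l2 v s q (+ Q) k) (cong (λ y → y ℤ.+ z ℤ.* + Q) te)))))

 parity : ∀ g → ∃[ h ] ((g ≡ 2 N.* h) ⊎ (g ≡ 1 N.+ 2 N.* h))
 parity zero = 0 , inj₁ refl
 parity (suc g) with parity g
 ... | h , inj₁ e = h , inj₂ (cong suc e)
 ... | h , inj₂ e = suc h , inj₁ (trans (cong suc e) (sym (NP.*-suc 2 h)))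

 odd-^ : ∀ h n → ∃[ e ] ((1 N.+ 2 N.* h) N.^ n ≡ 1 N.+ 2 N.* e)
 odd-^ h zero = 0 , refl
 odd-^ h (suc n) with odd-^ h n
 ... | e , p = h N.+ e N.+ 2 N.* (h N.* e) , trans (cong ((1 N.+ 2 N.* h) N.*_) p) (re h e)
  where
  re : ∀ h e → (1 N.+ 2 N.* h) N.* (1 N.+ 2 N.* e) ≡ 1 N.+ 2 N.* (h N.+ e N.+ 2 N.* (h N.* e))
  re = solveℕ

 private
  -- For g = 2h the factor 4 is absorbed: 4 g h² = g³. This is why three powers of g are taken; for
  -- g = 2 the condition is the familiar one modulo 8.
  even-case : ∀ g h j → g ≡ 2 N.* h → 1 N.+ 4 N.* (g N.* (j N.* (h N.* h))) ≡ 1 N.+ j N.* (g N.* (g N.* (g N.* 1)))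
  even-case g h j refl = re h j
   where
   re : ∀ h j → 1 N.+ 4 N.* (2 N.* h N.* (j N.* (h N.* h))) ≡ 1 N.+ j N.* (2 N.* h N.* (2 N.* h N.* (2 N.* h N.* 1)))
   re = solveℕ

  -- For odd Q = 1 + 2e the number 1 + 3(e + e²) is an inverse of 4, because 4 (1 + 3(e + e²)) = 1 +
  -- 3Q².
  odd-case : ∀ g j e Q → Q ≡ 1 N.+ 2 N.* e → 1 N.+ 4 N.* (g N.* (g N.* g N.* (j N.* (1 N.+ 3 N.* (e N.+ e N.* e))))) ≡
   1 N.+ j N.* (g N.* (g N.* (g N.* 1))) N.+ 3 N.* (g N.* (g N.* (g N.* 1))) N.* j N.* Q N.* Q
  odd-case g j e Q refl = re g j e
   where
   re : ∀ g j e → 1 N.+ 4 N.* (g N.* (g N.* g N.* (j N.* (1 N.+ 3 N.* (e N.+ e N.* e))))) ≡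
    1 N.+ j N.* (g N.* (g N.* (g N.* 1))) N.+ 3 N.* (g N.* (g N.* (g N.* 1))) N.* j N.* (1 N.+ 2 N.* e) N.* (1 N.+ 2 N.* e)
   re = solveℕ

 square-root : ∀ g n {{_ : NonZero (g N.^ n)}} j → ∃[ u ] ((u N.* u) % (g N.^ n) ≡ (1 N.+ j N.* (g N.* (g N.* (g N.* 1)))) % (g N.^ n))
 square-root g n j with parity g
 ... | h , inj₁ p = proj₁ r , trans (proj₂ r) (cong (λ y → y % (g N.^ n)) (even-case g h j p))
  where r = sqrt-1+4gw g (j N.* (h N.* h)) n
 ... | h , inj₂ p = proj₁ r , trans (proj₂ r) (trans (cong (λ y → y % (g N.^ n)) (odd-case g j e (g N.^ n) Q≡)) ([m+kn]%n≡m%n (1 N.+ j N.* G3) (3 N.* G3 N.* j N.* (g N.^ n)) (g N.^ n)))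
  where
  G3 = g N.* (g N.* (g N.* 1))
  e = proj₁ (odd-^ h n)
  Q≡ : g N.^ n ≡ 1 N.+ 2 N.* e
  Q≡ = trans (cong (N._^ n) p) (proj₂ (odd-^ h n))
  r = sqrt-1+4gw g (g N.* g N.* (j N.* (1 N.+ 3 N.* (e N.+ e N.* e)))) n

-- Class sums beyond an initial segment.

module Local where

 open Q
 open Kit
 open DividedPower
 open Arith
 open Sieve
 open Group
 open Units
 open Blocks
 open Series
 open Equidistribution
 open Chebyshev using (harmonic)

 module _ (K m P : ℕ) (K≥1 : 1 N.≤ K) (m≥1 : 1 N.≤ m) (P≥1 : 1 N.≤ P) (Q : ℕ) {{nzQ : NonZero Q}} where
  open Weights K m P K≥1 m≥1 P≥1
  open Congruence Q
  open FiniteAbelianGroup (units Q) using (els; once)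
  open Analysis (units Q)
  open ClassSums Q X
  open InClass K m P K≥1 m≥1 P≥1 Q

  coprime-class : ∀ n (t : Unit Q) → 1 N.* n ≈ val t → Coprime n Q
  coprime-class n t e {i} = coprime-≈ Q {val t} {n} (trans (sym e) (cong (λ z → z Data.Nat.DivMod.% Q) (NP.*-identityˡ n))) (λ {j} → cop! Q t {j}) {i}
   where import Data.Nat.DivMod

  module _ {ps : List ℕ} (sv : Sieving ps) (ps-prime : All Prime ps) (r : ℕ) where
   open Sums K m P K≥1 m≥1 P≥1 Q ps ps-prime

   R≡D : ∀ k t → R k t ≡ D sv r (val t) k J
   R≡D k t = trans (S-≈ (rF k) (rF-supported k) t) (Σ-cong (range X) term)
    where
    term : ∀ n → rF k n * χ (n ≈? val t) ≡ a sv r (val t) n * (v k n * rec n)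
    term n = by (n ≈? val t)
     where
     e1 : χ (1 N.* n ≈? val t) ≡ χ (n ≈? val t)
     e1 = cong (λ z → χ (z ≈? val t)) (NP.*-identityˡ n)
     by : Dec (n ≈ val t) → rF k n * χ (n ≈? val t) ≡ a sv r (val t) n * (v k n * rec n)
     by (yes h) = trans (cong₂ (λ x y → dp k (lam n) * (x * (w n * rec n)) * y) al (χ-yes (n ≈? val t) h)) (trans (id180 (dp k (lam n)) (w n) (rec n) (χ (sifted? ps n)))
       (cong (λ z → (z * χ (sifted? ps n)) * (v k n * rec n)) (sym (trans e1 (χ-yes (n ≈? val t) h)))))
      where
      al : χ (allowed? n) ≡ χ (sifted? ps n)
      al = χ-⇔ (allowed? n) (sifted? ps n) proj₂ (λ s → (λ {i} → coprime-class n t (trans (cong (λ z → z Data.Nat.DivMod.% Q) (NP.*-identityˡ n)) h) {i}) , s)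
       where import Data.Nat.DivMod
     by (no h) = trans (cong (dp k (lam n) * ω n *_) (χ-no (n ≈? val t) h)) (trans (id182 (dp k (lam n)) (ω n) (χ (sifted? ps n)) (v k n * rec n)) (cong (λ z → (z * χ (sifted? ps n)) * (v k n * rec n)) (sym (trans e1 (χ-no (n ≈? val t) h)))))

   Vq : ℚ
   Vq = V ps * rec Q

   -- The sieve is informative only once ρ^(yH) exceeds its rounding errors, so an initial segment
   -- is split off and kept as it is. As `errb` does not depend on the class, it is taken at class
   -- 0.
   R-tail : ∀ k y {e} → y N.* H N.≤ J → ι J * errb sv r 0 k (y N.* H) ≤ e →
    ∀ t → ∣ (R k t - D sv r (val t) k (y N.* H)) - Σ (range (J N.∸ y N.* H)) (λ s → g k (s N.+ y N.* H)) * (Vq * rec H) ∣ ≤ e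
   R-tail k y {e} h he t = subst (λ z → ∣ (z - D sv r (val t) k (y N.* H)) - Σ (range (J N.∸ y N.* H)) (λ s → g k (s N.+ y N.* H)) * (Vq * rec H) ∣ ≤ e) (trans (cong (D sv r (val t) k) (NP.m∸n+n≡m h)) (sym (R≡D k t)))
    (≤-trans (equidistribution sv r (val t) k (J N.∸ y N.* H) (y N.* H) (NP.≤-reflexive (NP.m∸n+n≡m h)))
     (≤-trans (*-monoʳ (errb sv r 0 k (y N.* H)) errb≥0 (ι-mono (NP.m∸n≤m J (y N.* H)))) he))
    where
    errb≥0 : 0ℚ ≤ errb sv r 0 k (y N.* H)
    errb≥0 = 0≤+ (0≤* (slack≥0 sv r 0 k) (0≤+ (rec≥0 H) (i≥0 sv r 0 (y N.* H)))) (0≤* (Gm≥0 k) (0≤+ (0≤* (i≥0 sv r 0 (y N.* H)) (0≤+ 0≤1 (0≤+ (A₀≥0 sv r 0) (A₀≥0 sv r 0)))) (0≤* (ι≥0 6) (B≥0 sv r 0))))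

   x≤2^ : ∀ y → x (y N.* H) N.≤ 2 N.^ (suc (2 N.* y))
   x≤2^ y = ι-cancel (≤-trans (x-upper (y N.* H)) (≤≡ (+-mono (subst (_≤ ι (2 N.^ (2 N.* y))) ι-1 (ι-mono (NP.m^n>0 2 (2 N.* y)))) (ρ^≤2^ y))
    (trans (sym (ι-+ _ _)) (cong (λ z → ι (2 N.^ (2 N.* y) N.+ z)) (sym (NP.+-identityʳ _))))))

   hs-initial : ∀ y → Σ (range (x (y N.* H))) rec ≤ ι (suc (2 N.* y))
   hs-initial y = ≤-trans (Σ-extend rec rec≥0 _ _ (x≤2^ y)) (harmonic (suc (2 N.* y)))

   lg-initial : ∀ y {n} → 1 N.≤ n → n N.< x (y N.* H) → lg n N.< y N.* H
   lg-initial y {n} h l = ^-strict (≤-<-trans (lg-lower h) (<x {n} {y N.* H} l))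

   lam-initial : ∀ y {n} → 1 N.≤ n → n N.< x (y N.* H) → lam n ≤ ι y
   lam-initial y {n} h l = ≤-trans (lam≤lgQ h) (≤≡ (*-monoʳ (rec H) (rec≥0 H) (ι-mono (NP.<⇒≤ (lg-initial y h l))))
    (trans (cong (_* rec H) (ι-* y H)) (trans (*-assoc _ _ _) (trans (cong (ι y *_) (ι*rec H≥1)) (*-identityʳ _)))))

-- Real characters modulo gⁿ as characters modulo g³.

module CharacterModulus where

 open Q
 open Kit
 open Group
 open Units
 open Sieve
 open Spectral
 open Hensel
 open import Data.List using (map)

 -- Every real character modulo gⁿ has modulus g³, because integers ≡ 1 (mod g³) are squares.
 module RealCharacters (g n : ℕ) (g≥2 : 2 N.≤ g) (n≥3 : 3 N.≤ n) where

  instance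
   nzg : NonZero g
   nzg = N.>-nonZero (NP.<⇒≤ g≥2)
   nzQ : NonZero (g N.^ n)
   nzQ = NP.m^n≢0 g n

  q₀ : ℕ
  q₀ = g N.* (g N.* (g N.* 1))

  instance
   nzq₀ : NonZero q₀
   nzq₀ = NP.m^n≢0 g 3

  Q : ℕ
  Q = g N.^ n

  q₀≥1 : 1 N.≤ q₀
  q₀≥1 = N.>-nonZero⁻¹ q₀

  q₀>1 : 1 N.< q₀
  q₀>1 = NP.<-≤-trans g≥2 (NP.m≤m*n g (g N.* (g N.* 1)) {{NP.m^n≢0 g 2}})

  q₀∣Q : q₀ ∣ Q
  q₀∣Q = divides (g N.^ (n N.∸ 3)) (trans (cong (g N.^_) (sym (NP.m∸n+n≡m n≥3))) (NP.^-distribˡ-+-* g (n N.∸ 3) 3))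

  open Congruence Q renaming (_≈_ to _≈Q_; *-≈ to *-≈Q; %-≈ to %-≈Q)
  open Congruence q₀ using () renaming (_≈_ to _≈₀_; _≈?_ to _≈₀?_; *-≈ to *-≈₀; %-≈ to %-≈₀; +kQ-≈ to +kQ-≈₀; block to block₀; F[]-eq to F[]-eq₀; F to F₀; cancel-≈ to cancel-≈₀)
  open FiniteAbelianGroup (units Q) using (els; inv)
  open Analysis (units Q)

  Q⇒q₀ : ∀ {a b} → a ≈Q b → a ≈₀ b
  Q⇒q₀ {a} {b} h = trans (red a) (trans (cong (_% q₀) h) (sym (red b)))
   where
   red : ∀ a → a ≈₀ a % Q
   red a = trans (cong (_% q₀) (trans (m≡m%n+[m/n]*n a Q) (cong (λ z → a % Q N.+ a / Q N.* z) (_∣_.equality q₀∣Q)))) (trans (cong (λ z → (a % Q N.+ z) % q₀) (sym (NP.*-assoc (a / Q) _ q₀))) (+kQ-≈₀ (a % Q) (a / Q N.* _∣_.quotient q₀∣Q)))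

  coprime-^ : ∀ a k → Coprime a g → Coprime a (g N.^ k)
  coprime-^ a zero c (_ , d) = ∣1⇒≡1 d
  coprime-^ a (suc k) c {i} (ia , id) = coprime-^ a k c (ia , Cop.coprime-divisor {i} {g} (λ {j} (ji , jg) → c (∣-trans ji ia , jg)) id)

  coprime-q₀⇒ : ∀ a → Coprime a q₀ → Coprime a Q
  coprime-q₀⇒ a c {i} = coprime-^ a n (λ {j} (ja , jg) → c (ja , ∣-trans jg (m∣m*n _))) {i}

  coprime-Q⇒ : ∀ a → Coprime a Q → Coprime a q₀
  coprime-Q⇒ a c (ia , iq) = c (ia , ∣-trans iq q₀∣Q)

  coprime-≈₀ : ∀ {a b} → a ≈₀ b → Coprime a Q → Coprime b Q
  coprime-≈₀ {a} {b} e c {i} = coprime-q₀⇒ b (λ {j} → Units.coprime-≈ q₀ {a} {b} e (λ {k} → coprime-Q⇒ a (λ {l} → c {l}) {k}) {j}) {i}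

  square-class : ∀ (t : Unit Q) → val t ≈₀ 1 → ∃[ u ] (t ≡ _*U_ Q u u)
  square-class t h = u , sym (trans (sym (un-* Q (λ {i} → cu {i}) (λ {i} → cu {i}))) (≈-un Q t uu))
   where
   j = val t / q₀
   te : val t ≡ 1 N.+ j N.* q₀
   te = trans (m≡m%n+[m/n]*n (val t) q₀) (cong (N._+ j N.* q₀) (trans h (m<n⇒m%n≡m q₀>1)))
   root = square-root g n j
   uu : (proj₁ root N.* proj₁ root) ≈Q val t
   uu = trans (proj₂ root) (cong (_% Q) (sym te))
   cuu : Coprime (proj₁ root N.* proj₁ root) Q
   cuu {i} = Units.coprime-≈ Q {val t} {proj₁ root N.* proj₁ root} (sym uu) (λ {k} → cop! Q t {k}) {i}
   cu : Coprime (proj₁ root) Q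
   cu (d , dq) = cuu (∣-trans d (m∣m*n (proj₁ root)) , dq)
   u : Unit Q
   u = un Q (proj₁ root)

  val-*U : ∀ a b → val (_*U_ Q a b) ≈Q val a N.* val b
  val-*U a b = trans (cong (_% Q) (*U-val Q a b)) (%-≈Q _)

  ratio-square : ∀ (a b : Unit Q) → val a ≈₀ val b → ∃[ u ] (a ≡ _*U_ Q b (_*U_ Q u u))
  ratio-square a b h = proj₁ sq , trans (sym (cancelʳ b a)) (cong (_*U_ Q b) (proj₂ sq))
   where
   c : Unit Q
   c = _*U_ Q (inv b) a
   bc : val b N.* val c ≈₀ val b N.* 1
   bc = trans (sym (Q⇒q₀ {val (_*U_ Q b c)} {val b N.* val c} (val-*U b c))) (trans (cong (λ z → val z % q₀) (cancelʳ b a)) (trans h (cong (_% q₀) (sym (NP.*-identityʳ (val b))))))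
   sq = square-class c (cancel-≈₀ {val b} {val c} {1} (λ {i} → coprime-Q⇒ (val b) (λ {j} → cop! Q b {j}) {i}) bc)

  reps : List (Unit Q)
  reps = map (un Q) (range q₀)

  reps-length : length reps ≡ q₀
  reps-length = trans (length-map (un Q) (range q₀)) (range-length q₀)

  range∋ : ∀ {i k} → i N.< k → i ∈ range k
  range∋ {i} {suc k} h with i N.≟ k
  ... | yes refl = here refl
  ... | no ne = there (range∋ (NP.≤∧≢⇒< (NP.≤-pred h) ne))

  cover : ∀ t → ∃[ x ] (x ∈ reps × ∃[ u ] (t ≡ _*U_ Q x (_*U_ Q u u)))
  cover t = un Q r , ∈-map⁺ (un Q) (range∋ (m%n<n (val t) q₀)) , ratio-square t (un Q r) (trans (sym (%-≈₀ (val t))) (Q⇒q₀ {r} {val (un Q r)} (un-≈ Q (un Q r) (λ {i} → cr {i}) refl)))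
   where
   r = val t % q₀
   cr : Coprime r Q
   cr {i} = coprime-≈₀ {val t} {r} (sym (%-≈₀ (val t))) (λ {j} → cop! Q t {j}) {i}

  module _ {ε : Unit Q → ℚ} (ch : RealChar (units Q) ε) (nt : Nontrivial (units Q) ε) where
   open RealChar ch

   c : ℕ → ℚ
   c a = χ (coprime? a Q) * ε (un Q a)

   c-coprime : ∀ {a} → Coprime a Q → c a ≡ ε (un Q a)
   c-coprime {a} h = trans (cong (_* ε (un Q a)) (χ-yes (coprime? a Q) (λ {i} → h {i}))) (*-identityˡ _)

   c-¬coprime : ∀ {a} → ¬ Coprime a Q → c a ≡ 0ℚ
   c-¬coprime {a} h = trans (cong (_* ε (un Q a)) (χ-no (coprime? a Q) (λ k → h (λ {i} → k {i})))) (*-zeroˡ _)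

   c-* : ∀ a b → 1 N.≤ a → 1 N.≤ b → c (a N.* b) ≡ c a * c b
   c-* a b _ _ = by (coprime? a Q) (coprime? b Q)
    where
    by : Dec (Coprime a Q) → Dec (Coprime b Q) → c (a N.* b) ≡ c a * c b
    by (yes h) (yes k) = trans (c-coprime (λ {i} → coprime-* h k {i})) (trans (cong ε (un-* Q (λ {i} → h {i}) (λ {i} → k {i}))) (trans (mult _ _) (sym (cong₂ _*_ (c-coprime (λ {i} → h {i})) (c-coprime (λ {i} → k {i}))))))
    by (no h) _ = trans (c-¬coprime (λ k → h (λ {i} (p , q) → k (∣-trans p (m∣m*n b) , q)))) (sym (trans (cong (_* c b) (c-¬coprime (λ k → h (λ {i} → k {i})))) (*-zeroˡ _)))
    by _ (no h) = trans (c-¬coprime (λ k → h (λ {i} (p , q) → k (∣-trans p (n∣m*n a) , q)))) (sym (trans (cong (c a *_) (c-¬coprime (λ k → h (λ {i} → k {i})))) (*-zeroʳ _)))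

   c-1 : c 1 ≡ 1ℚ
   c-1 = trans (c-coprime (λ {i} → coprime-1 Q {i})) (trans (cong ε (un-mk Q 1 (λ {i} → coprime-1 Q {i}))) (ε-e (units Q) ch))

   c-values : ∀ a → (c a ≡ 0ℚ) ⊎ ((c a ≡ 1ℚ) ⊎ (c a ≡ - 1ℚ))
   c-values a = by (coprime? a Q)
    where
    s1 : ∣ ε (un Q a) ∣ ≡ 1ℚ
    s1 = sign-abs (sign (un Q a))
    signs : (∣ ε (un Q a) ∣ ≡ ε (un Q a)) ⊎ (∣ ε (un Q a) ∣ ≡ - ε (un Q a)) → (ε (un Q a) ≡ 1ℚ) ⊎ (ε (un Q a) ≡ - 1ℚ)
    signs (inj₁ e) = inj₁ (trans (sym e) s1)
    signs (inj₂ e) = inj₂ (trans (sym (id21 (ε (un Q a)))) (cong -_ (trans (sym e) s1)))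
    by : Dec (Coprime a Q) → (c a ≡ 0ℚ) ⊎ ((c a ≡ 1ℚ) ⊎ (c a ≡ - 1ℚ))
    by (no h) = inj₁ (c-¬coprime (λ k → h (λ {i} → k {i})))
    by (yes h) with signs (∣∣≡ (ε (un Q a)))
    ... | inj₁ e = inj₂ (inj₁ (trans (c-coprime (λ {i} → h {i})) e))
    ... | inj₂ e = inj₂ (inj₂ (trans (c-coprime (λ {i} → h {i})) e))

   -- Units congruent modulo g³ differ by a square factor, on which a real character is 1; being a
   -- unit is itself a condition modulo g³.
   c-periodic : ∀ {a b} → a ≈₀ b → c a ≡ c b
   c-periodic {a} {b} h = by (coprime? a Q)
    where
    by : Dec (Coprime a Q) → c a ≡ c b
    by (no na) = trans (c-¬coprime (λ k → na (λ {i} → k {i}))) (sym (c-¬coprime (λ k → na (λ {i} → coprime-≈₀ {b} {a} (sym h) (λ {j} → k {j}) {i}))))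
    by (yes ca) = trans (c-coprime (λ {i} → ca {i})) (trans (trans (cong ε (proj₂ rs)) (trans (mult (un Q b) _) (trans (cong (ε (un Q b) *_) (ε-square (units Q) ch (proj₁ rs))) (*-identityʳ _)))) (sym (c-coprime (λ {i} → cb {i}))))
     where
     cb : Coprime b Q
     cb {i} = coprime-≈₀ {a} {b} h (λ {j} → ca {j}) {i}
     rs = ratio-square (un Q a) (un Q b) (trans (sym (Q⇒q₀ {a} {val (un Q a)} (un-≈ Q (un Q a) (λ {i} → ca {i}) refl))) (trans h (Q⇒q₀ {b} {val (un Q b)} (un-≈ Q (un Q b) (λ {i} → cb {i}) refl))))

   spread : ∀ (f : ℕ → ℕ) → (∀ k → Σ (range q₀) (λ i → χ (f i ≈₀? k)) ≡ 1ℚ) → Σ (range q₀) (λ i → c (f i)) ≡ Σ (range q₀) c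
   spread f h = trans (Σ-cong∈ (range q₀) (λ i i∈ → sym (trans (Σ-cong∈ (range q₀) (λ k k∈ → trans (χ-subst (f i ≈₀? k) {c k} {c (f i)} (λ e → c-periodic (sym e))) (cong (_* c (f i)) (χ-⇔ (f i ≈₀? k) (k N.≟ f i % q₀) (λ e → trans (sym (m<n⇒m%n≡m (∈range k∈))) (sym e)) (λ e → trans (sym (m%n%n≡m%n (f i) q₀)) (cong (_% q₀) (sym e)))))))
      (trans (Σ-*ʳ (range q₀) _ _) (trans (cong (_* c (f i)) (Σ-range-χ (m%n<n (f i) q₀))) (*-identityˡ _)))))) (trans (Σ-swap (range q₀) (range q₀) (λ i k → χ (f i ≈₀? k) * c k)) (Σ-cong (range q₀) (λ k → trans (Σ-*ʳ (range q₀) _ _) (trans (cong (_* c k) (h k)) (*-identityˡ _)))))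

   full-period : Σ (range q₀) c ≡ 0ℚ
   full-period = cancel-nonzero (ε t - 1ℚ) ne (trans (id179 _ (ε t)) (trans (cong (λ z → z - S) twisted) (trans (+-inverseʳ S) (sym (*-zeroˡ _)))))
    where
    t = proj₁ nt
    S = Σ (range q₀) c
    ne : ε t - 1ℚ ≢ 0ℚ
    ne h = proj₂ nt (trans (sym (id173 (ε t))) (trans (cong (_+ 1ℚ) h) (+-identityˡ 1ℚ)))
    τ = val t
    cτ : c τ ≡ ε t
    cτ = trans (c-coprime (λ {i} → cop! Q t {i})) (cong ε (≈-un Q t refl))
    one : ∀ k → Σ (range q₀) (λ i → χ (τ N.* i ≈₀? k)) ≡ 1ℚ
    one k = trans (Σ-cong (range q₀) (λ i → sym (*-identityʳ _))) (trans (proj₂ fe q₀) (trans (Σ-cong (range q₀) (λ i → cong (λ z → χ (z ≈₀? proj₁ fe)) (sym (NP.+-identityʳ i)))) (block₀ 0 (proj₁ fe))))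
     where fe = F[]-eq₀ τ k (λ {i} → coprime-Q⇒ τ (λ {j} → cop! Q t {j}) {i})
    mul : ∀ i → c (τ N.* i) ≡ ε t * c i
    mul zero = trans (trans (cong c (NP.*-zeroʳ τ)) c0) (sym (trans (cong (ε t *_) c0) (*-zeroʳ _)))
     where
     c0 : c 0 ≡ 0ℚ
     c0 = c-¬coprime (λ k → NP.<⇒≢ q₀>1 (sym (k (Data.Nat.Divisibility._∣0 q₀ , q₀∣Q))))
      where import Data.Nat.Divisibility
    mul (suc i) = trans (c-* τ (suc i) τ1 1≤suc) (cong (_* c (suc i)) cτ)
     where
     τ1 : 1 N.≤ τ
     τ1 = NP.n≢0⇒n>0 (λ z → NP.<⇒≢ q₀>1 (sym (cop! Q t (subst (q₀ ∣_) (sym z) (Data.Nat.Divisibility._∣0 q₀) , q₀∣Q))))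
      where import Data.Nat.Divisibility
    twisted : ε t * S ≡ S
    twisted = trans (sym (Σ-*ˡ (range q₀) (ε t) c)) (trans (Σ-cong (range q₀) (λ i → sym (mul i))) (spread (λ i → τ N.* i) one))

   c-sums : ∀ a k → ∣ Σ (range k) (λ i → c (i N.+ a)) ∣ ≤ ι q₀
   c-sums a k = subst (λ z → ∣ z ∣ ≤ ι q₀) (sym (trans (cong (λ z → Σ (range z) (λ i → c (i N.+ a))) (trans (m≡m%n+[m/n]*n k q₀) (NP.+-comm (k % q₀) _))) (blocks (k / q₀) (k % q₀))))
    (≤-trans (Σ-abs≤ (range (k % q₀)) {g = λ _ → 1ℚ} (λ i _ → c≤1 (i N.+ a))) (≡≤ (trans (Σ-const (range (k % q₀)) 1ℚ) (trans (*-identityʳ _) (cong ι (range-length (k % q₀))))) (ι-mono (NP.<⇒≤ (m%n<n k q₀)))))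
    where
    c≤1 : ∀ n → ∣ c n ∣ ≤ 1ℚ
    c≤1 n with c-values n
    ... | inj₁ e = ≡≤ (trans (cong ∣_∣ e) (∣∣-nonneg ≤-refl)) 0≤1
    ... | inj₂ (inj₁ e) = ≤-reflexive (trans (cong ∣_∣ e) (∣∣-nonneg 0≤1))
    ... | inj₂ (inj₂ e) = ≤-reflexive (trans (cong ∣_∣ e) (trans (∣-∣ 1ℚ) (∣∣-nonneg 0≤1)))
    blocks : ∀ s r → Σ (range (s N.* q₀ N.+ r)) (λ i → c (i N.+ a)) ≡ Σ (range r) (λ i → c (i N.+ a))
    blocks zero r = refl
    blocks (suc s) r = trans (cong (λ z → Σ (range z) (λ i → c (i N.+ a))) (NP.+-assoc q₀ (s N.* q₀) r)) (trans (Σ-range-+ q₀ (s N.* q₀ N.+ r) _)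
     (trans (cong₂ _+_ (trans (Σ-cong (range q₀) (λ i → cong c (NP.+-assoc i (s N.* q₀ N.+ r) a))) (trans (spread (λ i → i N.+ (s N.* q₀ N.+ r N.+ a)) (block₀ (s N.* q₀ N.+ r N.+ a))) full-period)) (blocks s r)) (+-identityˡ _)))

-- Prime sums twisted by real characters.

module RealSums where

 open Q
 open Kit
 open DividedPower
 open Arith
 open Sieve
 open Group
 open Units
 open Blocks
 open Series
 open Local
 open Spectral
 open LOne
 open Equidistribution
 open import Data.List.Relation.Binary.Permutation.Propositional using (↭-sym)

 module PrimePowers where

  -- The indicator of the powers of p, including 1; it is also 1 at 0, which is harmless since the
  -- weight `rec 0` vanishes.
  pw : ℕ → ℕ → ℚ
  pw p d = χ (all? (p N.≟_) (fs d))

  pw≥0 : ∀ p d → 0ℚ ≤ pw p d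
  pw≥0 p d = χ≥0 (all? (p N.≟_) (fs d))

  pw-p* : ∀ {p d} → Prime p → 1 N.≤ d → pw p (p N.* d) ≡ pw p d
  pw-p* {p} {d} pp h = χ-⇔ (all? (p N.≟_) (fs (p N.* d))) (all? (p N.≟_) (fs d)) (λ a → All.tail (PermP.All-resp-↭ (fs-p* pp h) a)) (λ a → PermP.All-resp-↭ (↭-sym (fs-p* pp h)) (refl ∷ a))

  module _ {p : ℕ} (pp : Prime p) (X : ℕ) where

   Sp Sall : ℚ
   Sp = Σ (range X) (λ d → χ (p ∣? d) * (pw p d * rec d))
   Sall = Σ (range X) (λ d → pw p d * rec d)

   term≥0 : ∀ d → 0ℚ ≤ pw p d * rec d
   term≥0 d = 0≤* (pw≥0 p d) (rec≥0 d)

   Sp≤ : Sp ≤ rec p * Sall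
   Sp≤ with Congruence.ceil 1 X p {{prime⇒nonZero pp}}
   ... | y , lo , _ , be = ≡≤ (Congruence.Σ-multiples 1 p X y {{prime⇒nonZero pp}} lo be (λ d → pw p d * rec d))
     (≡≤ (trans (Σ-cong (range y) step) (Σ-*ˡ (range y) (rec p) _)) (*-monoˡ (rec p) (rec≥0 p) (Σ-extend _ term≥0 y X y≤X)))
    where
    p≥1 : 1 N.≤ p
    p≥1 = prime≥1 pp
    step : ∀ d → pw p (p N.* d) * rec (p N.* d) ≡ rec p * (pw p d * rec d)
    step zero = trans (cong (λ z → pw p (p N.* 0) * rec z) (NP.*-zeroʳ p)) (trans (*-zeroʳ _) (sym (trans (cong (rec p *_) (*-zeroʳ _)) (*-zeroʳ _))))
    step d@(suc _) = trans (cong₂ _*_ (pw-p* pp 1≤suc) (rec-* p d)) (id8 (pw p d) (rec p) (rec d))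
    y≤X : y N.≤ X
    y≤X = go y be
     where
     go : ∀ y → (∀ m → m N.< y → p N.* m N.< X) → y N.≤ X
     go zero _ = N.z≤n
     go (suc y) f = NP.≤-<-trans (NP.m≤n*m y p {{prime⇒nonZero pp}}) (f y NP.≤-refl)

   Sall≤ : Sall ≤ 1ℚ + Sp
   Sall≤ = ≤-trans (Σ-mono (range X) term) (≡≤ (Σ-+ (range X) _ _) (+-monoˡ Sp (one X)))
    where
    one : ∀ X → Σ (range X) (λ d → χ (d N.≟ 1)) ≤ 1ℚ
    one X with 1 N.<? X
    ... | yes h = ≤-reflexive (Σ-range-χ h)
    ... | no h = ≡≤ (Σ-0∈ (range X) (λ d d∈ → χ-no (d N.≟ 1) (λ e → h (subst (N._< X) e (∈range d∈))))) 0≤1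
    r1 : rec 1 ≡ 1ℚ
    r1 = trans (sym (*-identityˡ _)) (trans (cong (_* rec 1) (sym ι-1)) (ι*rec 1≤suc))
    term : ∀ d → pw p d * rec d ≤ χ (d N.≟ 1) + χ (p ∣? d) * (pw p d * rec d)
    term zero = ≡≤ (*-zeroʳ _) (0≤+ (χ≥0 (0 N.≟ 1)) (0≤* (χ≥0 (p ∣? 0)) (term≥0 0)))
    term d@(suc _) = by (d N.≟ 1) (p ∣? d)
     where
     d1 : 1 N.≤ d
     d1 = N.s≤s N.z≤n
     by : (e1 : Dec (d ≡ 1)) (e2 : Dec (p ∣ d)) → pw p d * rec d ≤ χ e1 + χ e2 * (pw p d * rec d)
     by (yes e) dd = ≤-trans (subst (λ z → pw p d * rec d ≤ z) (*-identityˡ 1ℚ) (*-mono (pw≥0 p d) (rec≥0 d) (χ≤1 (all? (p N.≟_) (fs d))) (≤-reflexive (trans (cong rec e) r1)))) (≤+ʳ (0≤* (χ≥0 dd) (term≥0 d)))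
     by (no ne) (yes _) = ≡≤ (sym (*-identityˡ _)) (≤+ˡ ≤-refl)
     by (no ne) (no nd) = ≡≤ (trans (cong (_* rec d) (χ-no (all? (p N.≟_) (fs d)) (λ a → bad (fs d) refl a))) (*-zeroˡ _)) (0≤+ ≤-refl (0≤* ≤-refl (term≥0 d)))
      where
      bad : ∀ l → fs d ≡ l → All (p ≡_) l → _
      bad [] e _ = ne (fs≡[]⇒1 d1 e)
      bad (x ∷ l) e (refl ∷ _) = nd (∈fs⇒∣ d1 (subst (p ∈_) (sym e) (here refl)))
       where open import Data.List.Relation.Unary.Any using (here)

   -- The geometric series by self-similarity: the powers divisible by p sum to at most 1/p times
   -- all powers, and all powers to at most 1 plus those. As p ≥ 2, the whole sum is at most 2.
   Sp-bound : Sp ≤ 2ℚ * rec p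
   Sp-bound = ≤-trans Sp≤ (≡≤ (*-comm _ _) (*-monoʳ (rec p) (rec≥0 p) Sall≤2))
    where
    half : 2ℚ * rec p ≤ 1ℚ
    half = ≡≤ (cong (_* rec p) (sym ι-2)) (≤≡ (*-monoʳ (rec p) (rec≥0 p) (ι-mono (prime≥2 pp))) (ι*rec (prime≥1 pp)))
    S≥0 : 0ℚ ≤ Sall
    S≥0 = Σ≥0 (range X) term≥0
    Sall≤2 : Sall ≤ 2ℚ
    Sall≤2 = id193 Sall (rec p) Sp via 0≤+ (0≤+ (≤⇒0≤ Sall≤) (≤⇒0≤ Sall≤)) (0≤+ (0≤+ (≤⇒0≤ Sp≤) (≤⇒0≤ Sp≤)) (0≤* S≥0 (≤⇒0≤ half)))

 module _ (K m P : ℕ) (K≥1 : 1 N.≤ K) (m≥1 : 1 N.≤ m) (P≥1 : 1 N.≤ P) (g n : ℕ) (g≥2 : 2 N.≤ g) (n≥3 : 3 N.≤ n) where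
  open Weights K m P K≥1 m≥1 P≥1 hiding (g)
  module CM = CharacterModulus.RealCharacters g n g≥2 n≥3
  open CM using (Q; q₀; nzQ; q₀≥1)
  open Congruence Q
  open FiniteAbelianGroup (units Q) using (els; _∙_; inv)
  open Analysis (units Q)
  open ClassSums Q X
  open InClass K m P K≥1 m≥1 P≥1 Q
  open Sums K m P K≥1 m≥1 P≥1 Q [] [] using () renaming (allowed? to allowed°?; R to R°; L to L°; rF to rF°; ω to ω°; τL to τL°; R-convolution to R°-convolution; Λ≤Pm to Λ≤Pm°)

  -- The constant 8M of `L-one-lower` for the period q₀, so that L(1, c) ≥ 1/C₀.
  C₀ : ℕ
  C₀ = 8 N.* (260 N.* (q₀ N.* q₀))

  module Twisted {ε : Unit Q → ℚ} (ch : RealChar (units Q) ε) (nt : Nontrivial (units Q) ε) where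
   open RealChar ch

   c : ℕ → ℚ
   c = CM.c ch nt

   ⟨_⟩ : (Unit Q → ℚ) → ℚ
   ⟨ F ⟩ = ∑ (λ t → ε t * F t)

   ε≤1 : ∀ t → ∣ ε t ∣ ≤ 1ℚ
   ε≤1 t = ≤-reflexive (sign-abs (sign t))

   ⟨⟩-⋆ : ∀ F H → ⟨ F ⋆ H ⟩ ≡ ⟨ F ⟩ * ⟨ H ⟩
   ⟨⟩-⋆ F H = trans (Σ-cong els (λ b → sym (Σ-*ˡ els (ε b) _))) (trans (Σ-swap els els _) (trans (Σ-cong els (λ t → trans (sym (∑-mul t _)) (trans (Σ-cong els (λ b → trans (cong₂ (λ x y → x * (F t * H y)) (mult t b) (cancelˡ t b)) (id71 (ε t) (ε b) (F t) (H b)))) (Σ-*ˡ els (ε t * F t) _)))) (Σ-*ʳ els ⟨ H ⟩ _)))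

   ⟨⟩-Sup : ∀ {F s} → Sup F s → ∣ ⟨ F ⟩ ∣ ≤ φ * s
   ⟨⟩-Sup {F} {s} h = ≤≡ (Σ-abs≤ els {g = λ _ → 1ℚ * s} (λ t _ → abs-* (ε≤1 t) (h t))) (Σ-*ʳ els s _)

   ⟨⟩-- : ∀ F H → ⟨ (λ t → F t - H t) ⟩ ≡ ⟨ F ⟩ - ⟨ H ⟩
   ⟨⟩-- F H = trans (Σ-cong els (λ t → id31 (ε t) (F t) (H t))) (Σ-- els _ _)

   ⟨⟩-const : ∀ x → ⟨ (λ _ → x) ⟩ ≡ 0ℚ
   ⟨⟩-const x = trans (Σ-*ʳ els x ε) (trans (cong (_* x) (∑ε≡0 (units Q) ch nt)) (*-zeroˡ x))

   class-sum : ∀ k → ∑ (λ t → ε t * χ (1 N.* k ≈? val t)) ≡ c k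
   class-sum k = by (coprime? k Q)
    where
    e1 : ∀ t → χ (1 N.* k ≈? val t) ≡ χ (k ≈? val t)
    e1 t = cong (λ z → χ (z ≈? val t)) (NP.*-identityˡ k)
    by : Dec (Coprime k Q) → ∑ (λ t → ε t * χ (1 N.* k ≈? val t)) ≡ c k
    by (yes h) = trans (Σ-cong els (λ t → trans (*-comm _ _) (cong (_* ε t) (trans (e1 t) (χ-⇔ (k ≈? val t) (_≟U_ Q t (un Q k)) (λ e → sym (≈-un Q t e)) (λ e → un-≈ Q t (λ {i} → h {i}) (sym e)))))))
      (trans (∑-pick (un Q k) ε) (sym (CM.c-coprime ch nt (λ {i} → h {i}))))
    by (no h) = trans (Σ-0∈ els (λ t _ → trans (cong (ε t *_) (χ-no (1 N.* k ≈? val t) (λ e → h (λ {i} → coprime-class K m P K≥1 m≥1 P≥1 Q k t e {i})))) (*-zeroʳ _))) (sym (CM.c-¬coprime ch nt (λ k → h (λ {i} → k {i}))))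

   -- Twisting by ε turns convolutions into products, so the twist of R_1 is nearly that of L_0
   -- times that of R_0. The twist of R_0 is close to L(1, c), and that of R_1 is bounded by its
   -- initial segment because the rest is equidistributed. Nothing is sifted here, as the argument
   -- needs the periodic sums of c.
   module Shapiro (y : ℕ) (yJ : y N.* H N.≤ J) (e : ℚ)
    (he : ∀ k → k N.≤ 1 → ι J * errb [] 1 0 k (y N.* H) ≤ e) where

    Y : ℕ
    Y = x (y N.* H)

    ⟨D⟩ : ∀ k → ⟨ (λ t → D [] 1 (val t) k (y N.* H)) ⟩ ≡ Σ (range Y) (λ j → c j * (v k j * rec j))
    ⟨D⟩ k = trans (Σ-cong els (λ t → sym (Σ-*ˡ (range Y) (ε t) _))) (trans (Σ-swap els (range Y) _) (Σ-cong (range Y) (λ j → trans (Σ-cong els (λ t → id194 (ε t) (χ (1 N.* j ≈? val t)) (v k j * rec j)))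
      (trans (Σ-*ʳ els (v k j * rec j) _) (cong (_* (v k j * rec j)) (class-sum j))))))

    R°-initial : ∀ k → k N.≤ 1 → ∣ ⟨ R° k ⟩ - Σ (range Y) (λ j → c j * (v k j * rec j)) ∣ ≤ φ * e
    R°-initial k hk = subst (λ z → ∣ z ∣ ≤ φ * e) eq (⟨⟩-Sup (R-tail K m P K≥1 m≥1 P≥1 Q [] [] 1 k y yJ (he k hk)))
     where
     cst : ℚ
     cst = Σ (range (J N.∸ y N.* H)) (λ s → Weights.g K m P K≥1 m≥1 P≥1 k (s N.+ y N.* H)) * (Vq K m P K≥1 m≥1 P≥1 Q [] [] 1 * rec H)
     eq : ⟨ (λ t → (R° k t - D [] 1 (val t) k (y N.* H)) - cst) ⟩ ≡ ⟨ R° k ⟩ - Σ (range Y) (λ j → c j * (v k j * rec j))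
     eq = trans (⟨⟩-- (λ t → R° k t - D [] 1 (val t) k (y N.* H)) (λ _ → cst)) (trans (cong₂ (λ a b → a - b) (trans (⟨⟩-- (R° k) _) (cong (λ z → ⟨ R° k ⟩ - z) (⟨D⟩ k))) (⟨⟩-const cst)) (id195 _ _))

    c≤1 : ∀ j → ∣ c j ∣ ≤ 1ℚ
    c≤1 = RealCharacter.∣c∣≤1 c (CM.c-* ch nt) (CM.c-1 ch nt) (CM.c-values ch nt) q₀ q₀≥1 (CM.c-sums ch nt)

    initial-1 : ∣ Σ (range Y) (λ j → c j * (v 1 j * rec j)) ∣ ≤ ι y * ι (suc (2 N.* y))
    initial-1 = ≤-trans (Σ-abs≤ (range Y) (λ j j∈ → term j (∈range j∈))) (≡≤ (Σ-*ˡ (range Y) (ι y) rec) (*-monoˡ (ι y) (ι≥0 y) (hs-initial K m P K≥1 m≥1 P≥1 Q [] [] 1 y)))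
     where
     term : ∀ j → j N.< Y → ∣ c j * (v 1 j * rec j) ∣ ≤ ι y * rec j
     term zero _ = ≡≤ (trans (cong ∣_∣ (trans (cong (c 0 *_) (*-zeroʳ _)) (*-zeroʳ _))) (∣∣-nonneg ≤-refl)) (0≤* (ι≥0 y) (rec≥0 0))
     term j@(suc _) l = subst (∣ c j * (v 1 j * rec j) ∣ ≤_) (*-identityˡ _) (abs-* (c≤1 j) (≡≤ (∣∣-nonneg (0≤* (v≥0 1 j) (rec≥0 j))) (*-monoʳ (rec j) (rec≥0 j)
       (subst (v 1 j ≤_) (*-identityʳ _) (*-mono (dp≥0 1 (lam≥0 j)) (w≥0 j) (≡≤ (dp1 (lam j)) (lam-initial K m P K≥1 m≥1 P≥1 Q [] [] 1 y 1≤suc l)) (w≤1 j))))))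
      where
      dp1 : ∀ y → dp 1 y ≡ y
      dp1 y = trans (sym (*-identityˡ _)) (trans (cong (_* dp 1 y) (sym ι-1)) (trans (dp-suc 0 y) (*-identityʳ y)))

    S₁ : ℚ
    S₁ = Σ (range Y) (λ j → c j * rec j)

    initial-0 : ∣ S₁ - Σ (range Y) (λ j → c j * (v 0 j * rec j)) ∣ ≤ ι y * rec m * ι (suc (2 N.* y))
    initial-0 = subst (λ z → ∣ z ∣ ≤ ι y * rec m * ι (suc (2 N.* y))) (Σ-- (range Y) _ _) (≤-trans (Σ-abs≤ (range Y) (λ j j∈ → term j (∈range j∈)))
      (≡≤ (Σ-*ˡ (range Y) (ι y * rec m) rec) (*-monoˡ (ι y * rec m) (0≤* (ι≥0 y) (rec≥0 m)) (hs-initial K m P K≥1 m≥1 P≥1 Q [] [] 1 y))))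
     where
     term : ∀ j → j N.< Y → ∣ c j * rec j - c j * (v 0 j * rec j) ∣ ≤ ι y * rec m * rec j
     term zero _ = ≡≤ (trans (cong ∣_∣ (id188 (c 0) (v 0 0))) (∣∣-nonneg ≤-refl)) (0≤* (0≤* (ι≥0 y) (rec≥0 m)) (rec≥0 0))
     term j@(suc _) l = subst₂ _≤_ (cong ∣_∣ (id196 (c j) (rec j) (w j))) (*-identityˡ _) (abs-* (c≤1 j) (≡≤ (∣∣-nonneg (0≤* (≤⇒0≤ (w≤1 j)) (rec≥0 j))) (*-monoʳ (rec j) (rec≥0 j) gap)))
      where
      gap : 1ℚ - w j ≤ ι y * rec m
      gap = ≤-trans (id78 (ι (lamℕ j)) θ (w j) via ≤⇒0≤ (bernoulli- θ (lamℕ j) θ≥0 θ≤1)) (≤≡ (*-monoʳ θ θ≥0 (ι-mono (NP.≤-trans (lamℕ≤lg 1≤suc) (NP.<⇒≤ (lg-initial K m P K≥1 m≥1 P≥1 Q [] [] 1 y 1≤suc l)))))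
        (trans (cong₂ _*_ (ι-* y H) (rec-* H m)) (trans (id183 (ι y) (ι H) (rec H) (rec m)) (trans (cong (λ z → ι y * z * rec m) (ι*rec H≥1)) (cong (_* rec m) (*-identityʳ _))))))

    module _ (D≤ : suc (RealCharacter.LowerBound.D c (CM.c-* ch nt) (CM.c-1 ch nt) (CM.c-values ch nt) q₀ q₀≥1 (CM.c-sums ch nt)) N.≤ Y)
         (small : ι y * rec m * ι (suc (2 N.* y)) + φ * e ≤ rec (2 N.* C₀)) where

     open RealCharacter c (CM.c-* ch nt) (CM.c-1 ch nt) (CM.c-values ch nt) q₀ q₀≥1 (CM.c-sums ch nt)

     C₀≥1 : 1 N.≤ C₀
     C₀≥1 = NP.*-mono-≤ {1} {8} 1≤suc (NP.*-mono-≤ {1} {260} 1≤suc (NP.*-mono-≤ q₀≥1 q₀≥1))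

     S₁-lower : rec C₀ ≤ S₁
     S₁-lower = go Y D≤
      where
      shift : ∀ Y → Σ (range (suc Y)) (λ j → c j * rec j) ≡ Σ (range Y) (λ i → c (suc i) * rec (suc i))
      shift zero = trans (+-identityʳ _) (*-zeroʳ _)
      shift (suc Y) = cong (c (suc Y) * rec (suc Y) +_) (shift Y)
      go : ∀ Y → suc (LowerBound.D) N.≤ Y → rec C₀ ≤ Σ (range Y) (λ j → c j * rec j)
      go (suc Y) h = subst (rec C₀ ≤_) (sym (shift Y)) (subst₂ _≤_ (*-identityʳ _) (trans (sym (*-assoc _ _ _)) (trans (cong (_* Σ (range Y) (λ i → c (suc i) * rec (suc i))) (trans (*-comm _ _) (ι*rec C₀≥1))) (*-identityˡ _)))
         (*-monoˡ (rec C₀) (rec≥0 C₀) (LowerBound.L-one-lower Y (NP.≤-pred h))))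

     R°0-lower : rec (2 N.* C₀) ≤ ⟨ R° 0 ⟩
     R°0-lower = l (rec (2 N.* C₀)) ⟨ R° 0 ⟩ S₁ _ (φ * e) (ι y * rec m * ι (suc (2 N.* y))) (rec C₀) two
       via 0≤+ (0≤+ (≤⇒0≤ (≤-trans (-≤abs _) (R°-initial 0 N.z≤n))) (≤⇒0≤ (≤-trans (≤abs _) initial-0))) (0≤+ (≤⇒0≤ small) (≤⇒0≤ S₁-lower))
      where
      two : rec C₀ ≡ rec (2 N.* C₀) + rec (2 N.* C₀)
      two = sym (trans (cong (λ z → z + z) (rec-* 2 C₀)) (trans (id184 (rec 2) (rec C₀)) (trans (cong (_* rec C₀) (trans (cong (_* rec 2) (sym ι-2)) (ι*rec {2} 1≤suc))) (*-identityˡ _))))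
      l : ∀ h R S s f z c → c ≡ h + h → R - h ≡ ((f - - (R - s)) + (z - (S - s))) + ((h - (z + f)) + (S - c))
      l h R S s f z _ refl = id189 h R S s f z

     -- The bound for the product of the twists of L_0 and R_0 is divided by the lower bound 1/(2C₀)
     -- for the latter.
     L°0-bound : ∣ ⟨ L° 0 ⟩ ∣ ≤ ι (2 N.* C₀) * ((ι y * ι (suc (2 N.* y)) + φ * e) + φ * τL° 0)
     L°0-bound = *-cancelˡ (rec (2 N.* C₀)) (rec>0 c2) (≤-trans (*-monoʳ ∣ ⟨ L° 0 ⟩ ∣ (0≤∣∣ _) (≤-trans R°0-lower (≤abs _)))
       (≡≤ (trans (sym (∣*∣ ⟨ R° 0 ⟩ ⟨ L° 0 ⟩)) (cong ∣_∣ (*-comm _ _))) (≤≡ prod (sym (trans (sym (*-assoc _ _ _)) (trans (cong (_* Bd) (trans (*-comm _ _) (ι*rec c2))) (*-identityˡ Bd)))))))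
      where
      Bd : ℚ
      Bd = (ι y * ι (suc (2 N.* y)) + φ * e) + φ * τL° 0
      c2 : 1 N.≤ 2 N.* C₀
      c2 = NP.*-mono-≤ {1} {2} 1≤suc C₀≥1
      conv : ∣ ⟨ R° 1 ⟩ - ⟨ L° 0 ⟩ * ⟨ R° 0 ⟩ ∣ ≤ φ * τL° 0
      conv = subst (λ z → ∣ z ∣ ≤ φ * τL° 0) (trans (⟨⟩-- (λ t → ι 1 * R° 1 t) (λ b → Σ (range 1) (λ i → (L° i ⋆ R° (0 N.∸ i)) b))) (cong₂ (λ a b → a - b) (Σ-cong els (λ t → cong (ε t *_) (trans (cong (_* R° 1 t) ι-1) (*-identityˡ _))))
        (trans (Σ-cong els (λ t → cong (ε t *_) (+-identityʳ _))) (⟨⟩-⋆ (L° 0) (R° 0))))) (⟨⟩-Sup (R°-convolution 0))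
      prod : ∣ ⟨ L° 0 ⟩ * ⟨ R° 0 ⟩ ∣ ≤ Bd
      prod = subst (λ z → ∣ z ∣ ≤ Bd) (id185 ⟨ R° 1 ⟩ (⟨ L° 0 ⟩ * ⟨ R° 0 ⟩) (Σ (range Y) (λ j → c j * (v 1 j * rec j)))) (≤-trans (abs-- (abs-+ initial-1 (R°-initial 1 NP.≤-refl)) conv) ≤-refl)

   module SmallPrimes (ps : List ℕ) (ps-prime : All Prime ps) (Lm : ℚ) (Lm≥0 : 0ℚ ≤ Lm) (lg≤ : All (λ p → lgQ p ≤ Lm) ps) where
    open Sums K m P K≥1 m≥1 P≥1 Q ps ps-prime using (L; ω; ω≥0; ω≤rec; qF; allowed?; wr≥0)
    open PrimePowers

    small-part : ∀ d → 1 N.≤ d → Λ d * χ (¬? (sifted? ps d)) ≤ Σ ps (λ p → Lm * (χ (p ∣? d) * pw p d))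
    small-part d h with Λ-support d h
    ... | inj₁ z = ≡≤ (trans (cong (_* χ (¬? (sifted? ps d))) z) (*-zeroˡ _)) (Σ≥0 ps (λ p → 0≤* Lm≥0 (0≤* (χ≥0 (p ∣? d)) (pw≥0 p d))))
    ... | inj₂ (p₀ , pp₀ , p₀∈ , all₀ , e) = go ps ps-prime lg≤
     where
     go : ∀ l → All Prime l → All (λ p → lgQ p ≤ Lm) l → Λ d * χ (¬? (sifted? l d)) ≤ Σ l (λ p → Lm * (χ (p ∣? d) * pw p d))
     go [] _ _ = ≤-reflexive (*-zeroʳ _)
     go (p ∷ l) (pp ∷ pr) (lp ∷ lr) = by (p ∣? d)
      where
      rest≥0 : 0ℚ ≤ Σ l (λ p → Lm * (χ (p ∣? d) * pw p d))
      rest≥0 = Σ≥0 l (λ p → 0≤* Lm≥0 (0≤* (χ≥0 (p ∣? d)) (pw≥0 p d)))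
      by : (dd : Dec (p ∣ d)) → Λ d * χ (¬? (sifted? (p ∷ l) d)) ≤ Lm * (χ dd * pw p d) + Σ l (λ p → Lm * (χ (p ∣? d) * pw p d))
      by (no nd) = ≡≤ (cong (Λ d *_) (χ-⇔ (¬? (sifted? (p ∷ l) d)) (¬? (sifted? l d)) (λ f s → f (nd ∷ s)) (λ { f (_ ∷ s) → f s }))) (≤-trans (go l pr lr) (≤+ˡ (0≤* Lm≥0 (0≤* ≤-refl (pw≥0 p d)))))
      by (yes dv) = ≤-trans (subst (Λ d * χ (¬? (sifted? (p ∷ l) d)) ≤_) (*-identityʳ _) (*-monoˡ (Λ d) (Λ≥0 d) (χ≤1 (¬? (sifted? (p ∷ l) d)))))
        (≤-trans (subst (λ z → Λ d ≤ z) (sym (trans (cong (λ z → Lm * (1ℚ * z)) (χ-yes (all? (p N.≟_) (fs d)) (subst (λ z → All (z ≡_) (fs d)) same all₀))) (id186 Lm))) (≡≤ (trans e (cong lgQ same)) lp)) (≤+ʳ rest≥0))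
       where
       same : p₀ ≡ p
       same = All.lookup all₀ (∣⇒∈fs pp h dv)

    -- Sifting removes from Λ only the powers of the sieving primes, and the reciprocals of the
    -- powers of p divisible by p sum to at most 2/p.
    L-difference : ∣ ⟨ L° 0 ⟩ - ⟨ L 0 ⟩ ∣ ≤ Lm * (2ℚ * Σ ps rec)
    L-difference = subst (λ z → ∣ z ∣ ≤ Lm * (2ℚ * Σ ps rec)) (trans (Σ-- (range X) _ _) (cong₂ (λ a b → a - b) (sym (expand (λ j → qF° j))) (sym (expand (λ j → qF Λ 0 j)))))
      (≤-trans (Σ-abs≤ (range X) (λ j _ → term j)) (≡≤ (trans (Σ-swap (range X) ps _) (Σ-cong ps (λ p → trans (Σ-cong (range X) (λ j → id197 Lm (χ (p ∣? j)) (pw p j) (rec j))) (Σ-*ˡ (range X) Lm _))))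
       (≤≡ (bound ps ps-prime) (trans (Σ-cong ps (λ p → sym (*-assoc Lm 2ℚ (rec p)))) (trans (Σ-*ˡ ps (Lm * 2ℚ) rec) (*-assoc Lm 2ℚ _))))))
     where
     qF° : ℕ → ℚ
     qF° j = dp 0 (lam j) * (Λ j * ω° j)
     expand : ∀ f → ⟨ S f ⟩ ≡ Σ (range X) (λ j → f j * ε (un Q j))
     expand f = trans (Σ-cong els (λ t → sym (Σ-*ˡ (range X) (ε t) _))) (trans (Σ-swap els (range X) _) (Σ-cong (range X) (λ j → trans (Σ-cong els (λ t → id190 (ε t) (f j) (χ (_≟U_ Q (un Q j) t))))
       (trans (Σ-*ˡ els (f j) _) (cong (f j *_) (trans (Σ-cong els (λ t → cong (_* ε t) (χ-⇔ (_≟U_ Q (un Q j) t) (_≟U_ Q t (un Q j)) sym sym))) (∑-pick (un Q j) ε)))))))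
     bound : ∀ l → All Prime l → Σ l (λ p → Lm * Σ (range X) (λ j → χ (p ∣? j) * (pw p j * rec j))) ≤ Σ l (λ p → Lm * (2ℚ * rec p))
     bound [] _ = ≤-refl
     bound (p ∷ l) (pp ∷ pr) = +-mono (*-monoˡ Lm Lm≥0 (Sp-bound pp X)) (bound l pr)
     ω-diff : ∀ j → ω° j - ω j ≤ χ (¬? (sifted? ps j)) * rec j
     ω-diff j = by (sifted? ps j) (coprime? j Q)
      where
      by : Dec (All (λ p → ¬ (p ∣ j)) ps) → Dec (Coprime j Q) → ω° j - ω j ≤ χ (¬? (sifted? ps j)) * rec j
      by (yes s) _ = ≡≤ (trans (cong (λ z → z * (w j * rec j) - ω j) (χ-⇔ (allowed°? j) (allowed? j) (λ { (c , _) → (λ {i} → c {i}) , s }) (λ { (c , _) → (λ {i} → c {i}) , [] }))) (+-inverseʳ _)) (0≤* (χ≥0 (¬? (sifted? ps j))) (rec≥0 j))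
      by (no s) _ = ≤-trans (id187 (ω° j) (ω j) via ω≥0 j) (≤≡ (Sums.ω≤rec K m P K≥1 m≥1 P≥1 Q [] [] j) (trans (sym (*-identityˡ _)) (cong (_* rec j) (sym (χ-yes (¬? (sifted? ps j)) s)))))
     ω-diff≥0 : ∀ j → 0ℚ ≤ ω° j - ω j
     ω-diff≥0 j = subst (0ℚ ≤_) (id191 (χ (allowed°? j)) (χ (allowed? j)) (w j * rec j)) (0≤* (≤⇒0≤ (χ-mono (allowed? j) (allowed°? j) (λ { (c , _) → (λ {i} → c {i}) , [] }))) (wr≥0 j))
     term : ∀ j → ∣ qF° j * ε (un Q j) - qF Λ 0 j * ε (un Q j) ∣ ≤ Σ ps (λ p → Lm * (χ (p ∣? j) * pw p j) * rec j)
     term j = subst (λ z → ∣ z ∣ ≤ Σ ps (λ p → Lm * (χ (p ∣? j) * pw p j) * rec j)) (id192 (Λ j) (ω° j) (ω j) (ε (un Q j)))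
       (≤-trans (subst (∣ (Λ j * (ω° j - ω j)) * ε (un Q j) ∣ ≤_) (*-identityʳ _) (abs-* (≤-reflexive (∣∣-nonneg (0≤* (Λ≥0 j) (ω-diff≥0 j)))) (ε≤1 (un Q j)))) (fin j))
      where
      fin : ∀ j → Λ j * (ω° j - ω j) ≤ Σ ps (λ p → Lm * (χ (p ∣? j) * pw p j) * rec j)
      fin zero = ≡≤ (trans (*-zeroˡ _) refl) (Σ≥0 ps (λ p → 0≤* (0≤* Lm≥0 (0≤* (χ≥0 (p ∣? 0)) (pw≥0 p 0))) (rec≥0 0)))
      fin j@(suc _) = ≤-trans (*-monoˡ (Λ j) (Λ≥0 j) (ω-diff j)) (≡≤ (sym (*-assoc _ _ _)) (≤≡ (*-monoʳ (rec j) (rec≥0 j) (small-part j 1≤suc)) (sym (Σ-*ʳ ps (rec j) _))))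

-- Near constancy of R_k, and classes without primes.

module Rough where

 open Q
 open Kit
 open DividedPower
 open Arith
 open Sieve
 open Group
 open Units
 open Blocks
 open Series
 open Local
 open Equidistribution
 open Moments using () renaming (I to moment)

 module _ (Q : ℕ) {{nzQ : NonZero Q}} where
  open Congruence Q

  -- Each block [sQ, (s+1)Q) contains one member of the class and contributes at most 1/(sQ); the
  -- condition n ≥ Q removes the block s = 0.
  class-harmonic : ∀ b N → Σ (range N) (λ n → χ (Q N.≤? n) * (χ (n ≈? b) * rec n)) ≤ rec Q * Σ (range N) rec
  class-harmonic b N = ≤-trans (Σ-extend _ f≥0 N (N N.* Q) (NP.m≤m*n N Q)) (go N)
   where
   f : ℕ → ℚ
   f n = χ (Q N.≤? n) * (χ (n ≈? b) * rec n)
   f≥0 : ∀ n → 0ℚ ≤ f n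
   f≥0 n = 0≤* (χ≥0 (Q N.≤? n)) (0≤* (χ≥0 (n ≈? b)) (rec≥0 n))
   go : ∀ s → Σ (range (s N.* Q)) f ≤ rec Q * Σ (range s) rec
   go zero = ≤-reflexive (sym (*-zeroʳ _))
   go (suc s) = ≡≤ (Σ-range-+ Q (s N.* Q) f) (≤≡ (+-mono (blk s) (go s)) (sym (*-distribˡ-+ (rec Q) _ _)))
    where
    blk : ∀ s → Σ (range Q) (λ i → f (i N.+ s N.* Q)) ≤ rec Q * rec s
    blk zero = ≡≤ (Σ-0∈ (range Q) (λ i i∈ → trans (cong (_* (χ (i N.+ 0 ≈? b) * rec (i N.+ 0))) (χ-no (Q N.≤? i N.+ 0) (λ h → NP.<⇒≱ (∈range i∈) (ℕ≤≡ h (NP.+-identityʳ i))))) (*-zeroˡ _))) (0≤* (rec≥0 Q) (rec≥0 0))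
    blk s@(suc s') = ≤≡ (Σ-mono (range Q) (λ i → ≤-trans (χ*≤ (Q N.≤? i N.+ s N.* Q) (0≤* (χ≥0 (i N.+ s N.* Q ≈? b)) (rec≥0 (i N.+ s N.* Q)))) (*-monoˡ _ (χ≥0 (i N.+ s N.* Q ≈? b)) (rec-mono (NP.*-mono-≤ {1} {s} 1≤suc (N.>-nonZero⁻¹ Q)) (NP.m≤n+m (s N.* Q) i)))))
      (trans (Σ-*ʳ (range Q) (rec (s N.* Q)) _) (trans (cong (_* rec (s N.* Q)) (block (s N.* Q) b)) (trans (*-identityˡ _) (trans (rec-* s Q) (*-comm _ _)))))

 module RoughSums (K m P : ℕ) (K≥1 : 1 N.≤ K) (m≥1 : 1 N.≤ m) (P≥1 : 1 N.≤ P) (Q : ℕ) {{nzQ : NonZero Q}}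
      {ps : List ℕ} (sv : Congruence.Sieving Q ps) (ps-prime : All Prime ps) (r z : ℕ) (Q≤z : Q N.≤ z)
      (complete : ∀ p → Prime p → Coprime p Q → p N.< z → p ∈ ps) where
  open Weights K m P K≥1 m≥1 P≥1
  open Congruence Q
  open FiniteAbelianGroup (units Q) using (els; once)
  open Analysis (units Q)
  open ClassSums Q X
  open InClass K m P K≥1 m≥1 P≥1 Q
  open Sums K m P K≥1 m≥1 P≥1 Q ps ps-prime

  rough-factor : ∀ {n p} → 1 N.≤ n → Coprime n Q → All (λ p → ¬ (p ∣ n)) ps → Prime p → p ∣ n → z N.≤ p
  rough-factor {n} {p} h c s pp d = NP.≮⇒≥ λ lt → All.lookup s (complete p pp (λ {i} (ip , iq) → c (∣-trans ip d , iq)) lt) d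

  rough≥z : ∀ {n} → 2 N.≤ n → Coprime n Q → All (λ p → ¬ (p ∣ n)) ps → z N.≤ n
  rough≥z {n} h c s = go (fs n) refl (fs-prime n)
   where
   n1 : 1 N.≤ n
   n1 = NP.<⇒≤ h
   go : ∀ l → fs n ≡ l → All Prime l → z N.≤ n
   go [] e _ = ⊥-elim (NP.<⇒≢ h (sym (fs≡[]⇒1 n1 e)))
   go (p ∷ l) e (pp ∷ _) = NP.≤-trans (rough-factor n1 (λ {i} → c {i}) s pp pn) (∣⇒≤ {{N.>-nonZero n1}} pn)
    where
    pn : p ∣ n
    pn = ∈fs⇒∣ n1 (subst (p ∈_) (sym e) (here refl))

  module _ (y : ℕ) (y≥1 : 1 N.≤ y) (t : Unit Q) where

   N : ℕ
   N = x (y N.* H)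

   aa : ℕ → ℚ
   aa = a sv r (val t)

   aa≤ : ∀ n → aa n ≤ χ (n ≈? val t)
   aa≤ n = ≤≡ (subst (aa n ≤_) (*-identityʳ _) (*-monoˡ _ (χ≥0 (1 N.* n ≈? val t)) (χ≤1 (sifted? ps n)))) (cong (λ z → χ (z ≈? val t)) (NP.*-identityˡ n))

   -- A sifted integer n ≥ 2 prime to Q has a prime factor of at least z, hence exceeds Q. Otherwise
   -- one small representative of the class could dominate its harmonic sum.
   aa-large : ∀ n → 2 N.≤ n → aa n ≤ χ (Q N.≤? n) * χ (n ≈? val t)
   aa-large n h = by (Q N.≤? n)
    where
    by : (d : Dec (Q N.≤ n)) → aa n ≤ χ d * χ (n ≈? val t)
    by (yes _) = ≤≡ (aa≤ n) (sym (*-identityˡ _))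
    by (no nq) = ≤-reflexive (trans (trans (sym (χ-× (1 N.* n ≈? val t) (sifted? ps n))) (χ-no (1 N.* n ≈? val t ×-dec sifted? ps n) (λ { (e , s) → nq (NP.≤-trans Q≤z (rough≥z h (λ {i} → coprime-class K m P K≥1 m≥1 P≥1 Q n t e {i}) s)) }))) (sym (*-zeroˡ _)))

   initial : ℕ → ℚ
   initial k = D sv r (val t) k (y N.* H)

   yk≥0 : ∀ k → 0ℚ ≤ ι y ^ k
   yk≥0 k = ^≥0 k (ι≥0 y)

   v≤yk : ∀ k {n} → 1 N.≤ n → n N.< N → v k n ≤ ι y ^ k
   v≤yk k {n} h l = subst (v k n ≤_) (*-identityʳ _) (*-mono (dp≥0 k (lam≥0 n)) (w≥0 n) (≤-trans (dp≤^ k (lam≥0 n)) (^-mono k (lam≥0 n) (lam-initial K m P K≥1 m≥1 P≥1 Q sv ps-prime r y h l))) (w≤1 n))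

   tail-term : ∀ k n → 2 N.≤ n → n N.< N → aa n * (v k n * rec n) ≤ ι y ^ k * (χ (Q N.≤? n) * (χ (n ≈? val t) * rec n))
   tail-term k n h l = ≤≡ (*-mono (a≥0 sv r (val t) n) (0≤* (v≥0 k n) (rec≥0 n)) (aa-large n h) (*-monoʳ (rec n) (rec≥0 n) (v≤yk k (NP.<⇒≤ h) l))) (id218 _ _ _ _)

   class-bound : Σ (range N) (λ n → χ (Q N.≤? n) * (χ (n ≈? val t) * rec n)) ≤ rec Q * ι (suc (2 N.* y))
   class-bound = ≤-trans (class-harmonic Q (val t) N) (*-monoˡ (rec Q) (rec≥0 Q) (hs-initial K m P K≥1 m≥1 P≥1 Q sv ps-prime r y))

   initial≥0 : ∀ k → 0ℚ ≤ initial k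
   initial≥0 k = Σ≥0 (range N) (λ n → 0≤* (a≥0 sv r (val t) n) (0≤* (v≥0 k n) (rec≥0 n)))

   initial-suc : ∀ k → initial (suc k) ≤ ι y ^ suc k * (rec Q * ι (suc (2 N.* y)))
   initial-suc k = ≤-trans (Σ-mono∈ (range N) (λ n n∈ → term n (∈range n∈))) (≡≤ (Σ-*ˡ (range N) (ι y ^ suc k) _) (*-monoˡ (ι y ^ suc k) (yk≥0 (suc k)) class-bound))
    where
    rhs≥0 : ∀ n → 0ℚ ≤ ι y ^ suc k * (χ (Q N.≤? n) * (χ (n ≈? val t) * rec n))
    rhs≥0 n = 0≤* (yk≥0 (suc k)) (0≤* (χ≥0 (Q N.≤? n)) (0≤* (χ≥0 (n ≈? val t)) (rec≥0 n)))
    term : ∀ n → n N.< N → aa n * (v (suc k) n * rec n) ≤ ι y ^ suc k * (χ (Q N.≤? n) * (χ (n ≈? val t) * rec n))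
    term 0 _ = ≡≤ (id113 (aa 0) (v (suc k) 0)) (rhs≥0 0)
    term 1 _ = ≡≤ (id206 (aa 1) (rec (suc k)) (dp k 0ℚ) (w 1) (rec 1)) (rhs≥0 1)
    term n@(suc (suc _)) l = tail-term (suc k) n (N.s≤s 1≤suc) l

   -- The integer 1 survives every sieve and produces δ; its logarithm is 0, so it is visible only
   -- for k = 0.
   initial-0 : 2 N.≤ N → ∣ initial 0 - δ t ∣ ≤ rec Q * ι (suc (2 N.* y))
   initial-0 N2 = ≡≤ (trans (cong ∣_∣ (cong (λ z → initial 0 - z) δ≡)) (trans (cong ∣_∣ (sym (Σ-- (range N) _ _))) refl))
     (≤-trans (Σ-abs≤ (range N) (λ n n∈ → term n (∈range n∈))) class-bound)
    where
    δ≡ : δ t ≡ Σ (range N) (λ n → χ (n N.≟ 1) * δ t)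
    δ≡ = sym (trans (Σ-*ʳ (range N) (δ t) _) (trans (cong (_* δ t) (Σ-range-χ N2)) (*-identityˡ _)))
    rhs≥0 : ∀ n → 0ℚ ≤ χ (Q N.≤? n) * (χ (n ≈? val t) * rec n)
    rhs≥0 n = 0≤* (χ≥0 (Q N.≤? n)) (0≤* (χ≥0 (n ≈? val t)) (rec≥0 n))
    term : ∀ n → n N.< N → ∣ aa n * (v 0 n * rec n) - χ (n N.≟ 1) * δ t ∣ ≤ χ (Q N.≤? n) * (χ (n ≈? val t) * rec n)
    term 0 _ = ≡≤ (trans (cong ∣_∣ (id207 (aa 0) (v 0 0) (δ t))) (∣∣-nonneg ≤-refl)) (rhs≥0 0)
    term 1 _ = ≡≤ (trans (cong ∣_∣ (trans (cong₂ (λ a b → a - 1ℚ * b) a1 (sym dt)) (id208 (χ (1 ≈? val t))))) (∣∣-nonneg ≤-refl)) (rhs≥0 1)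
     where
     un1 : un Q 1 ≡ 1U Q
     un1 = un-mk Q 1 (λ {i} → coprime-1 Q {i})
     dt : χ (1 ≈? val t) ≡ δ t
     dt = χ-⇔ (1 ≈? val t) (_≟U_ Q t (1U Q)) (λ h → trans (sym (≈-un Q t h)) un1) (λ h → un-≈ Q t (λ {i} → coprime-1 Q {i}) (trans un1 (sym h)))
     r1 : rec 1 ≡ 1ℚ
     r1 = trans (sym (*-identityˡ _)) (trans (cong (_* rec 1) (sym ι-1)) (ι*rec 1≤suc))
     open import Data.Nat.Divisibility using (∣1⇒≡1)
     open import Data.Nat.Primality using (¬prime[1])
     a1 : aa 1 * (v 0 1 * rec 1) ≡ χ (1 ≈? val t)
     a1 = trans (cong₂ (λ b c → χ (1 ≈? val t) * b * (1ℚ * 1ℚ * c)) (χ-yes (sifted? ps 1) (All.map (λ pp d → ¬prime[1] (subst Prime (∣1⇒≡1 d) pp)) ps-prime)) r1) (id203 _)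
    term n@(suc (suc _)) l = ≡≤ (cong ∣_∣ (id209 _ (δ t))) (≡≤ (∣∣-nonneg (0≤* (a≥0 sv r (val t) n) (0≤* (v≥0 0 n) (rec≥0 n)))) (≤≡ (tail-term 0 n (N.s≤s 1≤suc) l) (*-identityˡ _)))

   module _ (yJ : y N.* H N.≤ J) (N2 : 2 N.≤ N) (err : ∀ k → k N.≤ 6 → ι J * errb sv r 0 k (y N.* H) ≤ rec Q) where

    Vr : ℚ
    Vr = V ps * rec Q

    Vr≥0 : 0ℚ ≤ Vr
    Vr≥0 = 0≤* (V≥0 sv) (rec≥0 Q)

    Vr≤ : Vr ≤ rec Q
    Vr≤ = subst (Vr ≤_) (*-identityˡ _) (*-monoʳ (rec Q) (rec≥0 Q) (V≤1 sv))

    I : ℕ → ℚ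
    I = moment K m P K≥1 m≥1 P≥1

    bulk : ℕ → ℚ
    bulk k = Σ (range (J N.∸ y N.* H)) (λ s → g k (s N.+ y N.* H)) * (Vr * rec H)

    -- The tail estimate starts at j = yH, the moment at j = 0; the gap has yH terms of weight 1/H,
    -- each at most y^k.
    missing : ∀ k → ∣ bulk k - Vr * I k ∣ ≤ rec Q * (ι y * ι y ^ k)
    missing k = subst (λ z → ∣ z ∣ ≤ rec Q * (ι y * ι y ^ k)) (sym eq) (abs-neg (≡≤ (∣∣-nonneg (0≤* (0≤* Vr≥0 (rec≥0 H)) G≥0)) (≡≤ (*-assoc Vr (rec H) _) (*-mono Vr≥0 (0≤* (rec≥0 H) G≥0) Vr≤ G≤))))
     where
     G₀ : ℚ
     G₀ = Σ (range (y N.* H)) (g k)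
     G≥0 : 0ℚ ≤ G₀
     G≥0 = Σ≥0 (range (y N.* H)) (λ j → g≥0 k j)
     split : Σ (range J) (g k) ≡ Σ (range (J N.∸ y N.* H)) (λ s → g k (s N.+ y N.* H)) + G₀
     split = trans (cong (λ z → Σ (range z) (g k)) (sym (NP.m∸n+n≡m yJ))) (Σ-range-+ (J N.∸ y N.* H) (y N.* H) (g k))
     eq : bulk k - Vr * I k ≡ - (Vr * rec H * G₀)
     eq = trans (cong (λ z → bulk k - Vr * (rec H * z)) split) (id210 _ Vr (rec H) G₀)
     gy : ∀ j → j ∈ range (y N.* H) → g k j ≤ ι y ^ k
     gy j j∈ = subst (g k j ≤_) (*-identityʳ _) (*-mono (dp≥0 k (jH≥0 j)) (^≥0 j T≥0) (≤-trans (dp≤^ k (jH≥0 j)) (^-mono k (jH≥0 j) (≤≡ (*-monoʳ (rec H) (rec≥0 H) (ι-mono (NP.<⇒≤ (∈range j∈)))) yH))) (^≤1 j T≥0 T≤1))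
      where
      yH : ι (y N.* H) * rec H ≡ ι y
      yH = trans (cong (_* rec H) (ι-* y H)) (trans (*-assoc _ _ _) (trans (cong (ι y *_) (ι*rec H≥1)) (*-identityʳ _)))
     G≤ : rec H * G₀ ≤ ι y * ι y ^ k
     G≤ = ≤≡ (*-monoˡ (rec H) (rec≥0 H) (Σ-mono∈ (range (y N.* H)) gy)) (trans (cong (rec H *_) (trans (Σ-const (range (y N.* H)) _) (cong (λ z → ι z * ι y ^ k) (range-length (y N.* H))))) (trans (cong (λ z → rec H * (z * ι y ^ k)) (ι-* y H)) (trans (id204 (rec H) (ι y) (ι H) (ι y ^ k)) (trans (cong (λ z → z * (ι y * ι y ^ k)) (ι*rec H≥1)) (*-identityˡ _)))))

    -- Three errors of size 1/Q times a polynomial in y: the initial segment, the part of the moment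
    -- before it ends, and the sieve error on the rest.
    R≈-suc : ∀ k → suc k N.≤ 6 → ∣ R (suc k) t - Vr * I (suc k) ∣ ≤ rec Q * (ι y ^ suc k * ι (suc (2 N.* y)) + ι y * ι y ^ suc k + 1ℚ)
    R≈-suc k h = subst₂ _≤_ (cong ∣_∣ (id211 (R (suc k) t) (initial (suc k)) (bulk (suc k)) (Vr * I (suc k)))) (id212 (ι y ^ suc k) (rec Q) (ι (suc (2 N.* y))) (ι y * ι y ^ suc k))
      (abs-+ (abs-+ (≡≤ (∣∣-nonneg (initial≥0 (suc k))) (initial-suc k)) (missing (suc k))) (R-tail K m P K≥1 m≥1 P≥1 Q sv ps-prime r (suc k) y yJ (err (suc k) h) t))

    R≈-0 : ∣ R 0 t - δ t - Vr * I 0 ∣ ≤ rec Q * (ι (suc (2 N.* y)) + ι y * 1ℚ + 1ℚ)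
    R≈-0 = subst₂ _≤_ (cong ∣_∣ (id213 (R 0 t) (initial 0) (bulk 0) (Vr * I 0) (δ t))) (id214 (rec Q) (ι (suc (2 N.* y))) (ι y * 1ℚ))
      (abs-+ (abs-+ (initial-0 N2) (missing 0)) (R-tail K m P K≥1 m≥1 P≥1 Q sv ps-prime r 0 y yJ (err 0 N.z≤n) t))

  -- If the class of t contains no prime in [z, X), only higher prime powers contribute to L k t.
  L-without-primes : ∀ k (t : Unit Q) → (∀ p → z N.≤ p → p N.< X → Prime p → ¬ (p ≈ val t)) → 1 N.≤ z →
   L k t * ι z ≤ Gm k * ι (P N.* m) * (ι 2 * ι W)
  L-without-primes k t none z≥1 = ≤-trans (*-monoʳ (ι z) (ι≥0 z) (≤-trans (Σ-mono∈ (range X) (λ d d∈ → term d (∈range d∈))) (≡≤ (Σ-*ˡ (range X) cst _) (*-monoˡ cst cst≥0 squares))))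
    (≡≤ (l0 cst (rec z) (ι W) (ι z)) (≡≤ (cong (cst *_) (trans (cong (λ u → ι 2 * u * ι W) (ι*rec z≥1)) (cong (_* ι W) (*-identityʳ _)))) ≤-refl))
   where
   cst : ℚ
   cst = Gm k * ι (P N.* m)
   cst≥0 : 0ℚ ≤ cst
   cst≥0 = 0≤* (Gm≥0 k) (ι≥0 _)
   l0 : ∀ c r w z → c * (ι 2 * r * w) * z ≡ c * (ι 2 * (z * r) * w)
   l0 = λ c r w z → id219 c r w z (ι 2)
   sq : ℕ → ℚ
   sq d = Σ (range X) (λ p → χ (z N.≤? p) * (χ (p N.* p ∣? d) * rec d))
   sqt≥0 : ∀ p d → 0ℚ ≤ χ (z N.≤? p) * (χ (p N.* p ∣? d) * rec d)
   sqt≥0 p d = 0≤* (χ≥0 (z N.≤? p)) (0≤* (χ≥0 (p N.* p ∣? d)) (rec≥0 d))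
   sq≥0' : ∀ d → 0ℚ ≤ sq d
   sq≥0' d = Σ≥0 (range X) (λ p → sqt≥0 p d)
   sq-one : ∀ d p → p N.< X → z N.≤ p → p N.* p ∣ d → rec d ≤ sq d
   sq-one d p pX zp pd = ≡≤ (sym (trans (cong₂ (λ a b → a * (b * rec d)) (χ-yes (z N.≤? p) zp) (χ-yes (p N.* p ∣? d) pd)) (trans (*-identityˡ _) (*-identityˡ _))))
     (≡≤ (sym (Σ-pick (range X) N._≟_ p (λ p → χ (z N.≤? p) * (χ (p N.* p ∣? d) * rec d)) (Σ-range-χ pX))) (Σ-mono (range X) (λ q → χ*≤ (q N.≟ p) (sqt≥0 q d))))
   term : ∀ d → d N.< X → qF Λ k d * χ (_≟U_ Q (un Q d) t) ≤ cst * sq d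
   term zero _ = ≡≤ (trans (cong (λ z → dp k (lam 0) * (Λ 0 * z) * χ (_≟U_ Q (un Q 0) t)) ω-0) (id220 _ _ _)) (0≤* cst≥0 (sq≥0' 0))
   term d@(suc _) dX with Λ-support d 1≤suc
   ... | inj₁ e = ≡≤ (trans (cong (λ z → dp k (lam d) * (z * ω d) * χ (_≟U_ Q (un Q d) t)) e) (id221 _ _ _)) (0≤* cst≥0 (sq≥0' d))
   ... | inj₂ (p , pp , p∈ , all , _) = by (allowed? d) (_≟U_ Q (un Q d) t)
    where
    d1 : 1 N.≤ d
    d1 = N.s≤s N.z≤n
    by : (da : Dec (Allowed d)) (dt : Dec (un Q d ≡ t)) → dp k (lam d) * (Λ d * (χ da * (w d * rec d))) * χ dt ≤ cst * sq d
    by (no _) dt = ≡≤ (id215 _ _ _ _) (0≤* cst≥0 (sq≥0' d))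
    by (yes _) (no _) = ≡≤ (*-zeroʳ _) (0≤* cst≥0 (sq≥0' d))
    by (yes (c , s)) (yes e) = ≡≤ (id216 (dp k (lam d)) (Λ d) (w d) (rec d)) (≤-trans (*-mono (0≤* (0≤* (dp≥0 k (lam≥0 d)) (w≥0 d)) (Λ≥0 d)) (rec≥0 d) (*-mono (0≤* (dp≥0 k (lam≥0 d)) (w≥0 d)) (Λ≥0 d) (v≤Gm k d1 dX) (≡≤ (sym (∣∣-nonneg (Λ≥0 d))) (Λ≤Pm d d1 dX))) (≤-refl {rec d})) (*-monoˡ cst cst≥0 (sq-one d p pX zp p²)))
     where
     pd : p ∣ d
     pd = ∈fs⇒∣ d1 p∈
     zp : z N.≤ p
     zp = rough-factor d1 (λ {i} → c {i}) s pp pd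
     pX : p N.< X
     pX = NP.≤-<-trans (∣⇒≤ pd) dX
     p² : p N.* p ∣ d
     p² = go (fs d) refl all
      where
      import Data.Nat.ListAction as LA
      none1 : ∀ {A : Set} → p ∈ [] → A
      none1 ()
      go : ∀ id216 → fs d ≡ id216 → All (p ≡_) id216 → p N.* p ∣ d
      go [] eqfs _ = none1 (subst (p ∈_) eqfs (∣⇒∈fs pp d1 pd))
      go (q ∷ []) eqfs (qp ∷ []) = ⊥-elim (none d (NP.≤-trans zp (∣⇒≤ pd)) dX (subst Prime (sym dp') pp) (un-≈ Q t (λ {i} → c {i}) e))
       where
       dp' : d ≡ p
       dp' = trans (fs-product d1) (trans (cong LA.product eqfs) (trans (NP.*-identityʳ q) (sym qp)))
      go (q ∷ q' ∷ id216) eqfs (qp ∷ qp' ∷ _) = divides (LA.product id216) (trans (fs-product d1) (trans (cong LA.product eqfs) (trans (cong₂ (λ u u' → u N.* (u' N.* LA.product id216)) (sym qp) (sym qp')) (trans (sym (NP.*-assoc p p _)) (NP.*-comm (p N.* p) _)))))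
   -- The multiples of p² have harmonic sum at most W/p², and the sum of 1/p² over p ≥ z is at most
   -- 2/z.
   squares : Σ (range X) sq ≤ ι 2 * rec z * ι W
   squares = ≡≤ (Σ-swap (range X) (range X) _) (≤-trans (Σ-mono (range X) inner) (≡≤ (Σ-*ʳ (range X) (ι W) _) (*-monoʳ (ι W) (ι≥0 W) (recsq X))))
    where
    inner : ∀ p → Σ (range X) (λ d → χ (z N.≤? p) * (χ (p N.* p ∣? d) * rec d)) ≤ χ (z N.≤? p) * rec (p N.* p) * ι W
    inner zero = ≤-reflexive (trans (Σ-0∈ (range X) (λ d _ → trans (cong (_* (χ (0 ∣? d) * rec d)) z0) (*-zeroˡ _))) (sym (trans (cong (λ u → u * rec 0 * ι W) z0) (trans (cong (_* ι W) (*-zeroˡ _)) (*-zeroˡ _)))))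
     where
     z0 : χ (z N.≤? 0) ≡ 0ℚ
     z0 = χ-no (z N.≤? 0) (λ h → NP.<⇒≱ z≥1 h)
    inner p@(suc _) with ceil X (p N.* p)
    ... | y , lo , _ , be = ≡≤ (trans (Σ-*ˡ (range X) _ _) (trans (cong (χ (z N.≤? p) *_) (trans (Σ-multiples (p N.* p) X y lo be rec) (trans (Σ-cong (range y) (λ d → rec-* (p N.* p) d)) (Σ-*ˡ (range y) _ _)))) (sym (*-assoc _ _ _))))
       (*-monoˡ _ (0≤* (χ≥0 (z N.≤? p)) (rec≥0 (p N.* p))) (≤-trans (Σ-extend rec rec≥0 y X y≤X) hs≤W))
     where
     y≤X : y N.≤ X
     y≤X = go y be
      where
      go : ∀ y → (∀ m → m N.< y → p N.* p N.* m N.< X) → y N.≤ X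
      go zero _ = N.z≤n
      go (suc y) f = NP.≤-<-trans (NP.m≤n*m y (p N.* p)) (f y NP.≤-refl)
    -- 1/p² ≤ 2 (1/p - 1/(p+1))
    recsq : ∀ n → Σ (range n) (λ p → χ (z N.≤? p) * rec (p N.* p)) ≤ ι 2 * rec z
    recsq n = ≤-trans (tele n) (id217 (ι 2) (rec z) (rec (z N.⊔ n)) via 0≤* (ι≥0 2) (rec≥0 (z N.⊔ n)))
     where
     tele : ∀ n → Σ (range n) (λ p → χ (z N.≤? p) * rec (p N.* p)) ≤ ι 2 * (rec z - rec (z N.⊔ n))
     tele zero = ≤-reflexive (sym (trans (cong (λ u → ι 2 * (rec z - rec u)) (NP.⊔-identityʳ z)) (trans (cong (ι 2 *_) (+-inverseʳ _)) (*-zeroʳ _))))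
     tele (suc n) with z N.≤? n
     ... | no nz = ≡≤ (trans (cong (_+ Σ (range n) (λ p → χ (z N.≤? p) * rec (p N.* p))) (*-zeroˡ _)) (+-identityˡ _)) (≤≡ (tele n) (cong (λ u → ι 2 * (rec z - rec u)) (trans (NP.m≥n⇒m⊔n≡m (NP.<⇒≤ (NP.≰⇒> nz))) (sym (NP.m≥n⇒m⊔n≡m (NP.≰⇒> nz))))))
     ... | yes zn = ≤-trans (+-monoˡ _ (≡≤ (*-identityˡ _) (step n n1))) (≤≡ (+-monoʳ (ι 2 * (rec n - rec (suc n))) (tele n)) (trans (cong (λ u → ι 2 * (rec n - rec (suc n)) + ι 2 * (rec z - rec u)) (NP.m≤n⇒m⊔n≡n zn)) (trans (id205 (ι 2) (rec n) (rec (suc n)) (rec z)) (cong (λ u → ι 2 * (rec z - rec u)) (sym (NP.m≤n⇒m⊔n≡n (NP.m≤n⇒m≤1+n zn)))))))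
      where
      n1 : 1 N.≤ n
      n1 = NP.≤-trans z≥1 zn
      step : ∀ n → 1 N.≤ n → rec (n N.* n) ≤ ι 2 * (rec n - rec (suc n))
      step n h = ≡≤ (rec-* n n) (subst (λ u → rec n * rec n ≤ u * (rec n - rec (suc n))) (sym ι-2) (l4 (rec n) (rec (suc n)) diff via 0≤* (rec≥0 n) (≤⇒0≤ half)))
       where
       ra : ℚ
       ra = rec n
       rb : ℚ
       rb = rec (suc n)
       diff : ra - rb ≡ ra * rb
       diff = trans (cong₂ (λ u v → u - v) (sym (trans (cong (ra *_) (ι*rec {suc n} 1≤suc)) (*-identityʳ ra))) (sym (trans (cong (_* rb) (trans (*-comm _ _) (ι*rec h))) (*-identityˡ rb)))) (trans (cong (λ u → ra * (u * rb) - ra * ι n * rb) (ι-suc n)) (id199 ra rb (ι n)))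
       half : ra ≤ 2ℚ * rb
       half = subst₂ _≤_ (trans (id200 (ι (suc n)) ra rb) (trans (cong (_* ra) (ι*rec {suc n} 1≤suc)) (*-identityˡ ra))) (trans (id201 (ι n) ra rb) (trans (cong {A = ℚ} (λ u → 2ℚ * (u * rb)) {ι n * rec n} {1ℚ} (ι*rec h)) (cong (λ u → 2ℚ * u) (*-identityˡ rb)))) (*-monoʳ (ra * rb) (0≤* (rec≥0 n) (rec≥0 (suc n))) sn)
        where
        sn : ι (suc n) ≤ 2ℚ * ι n
        sn = subst (_≤ 2ℚ * ι n) (sym (ι-suc n)) (id198 (ι n) via ≤⇒0≤ (subst (_≤ ι n) ι-1 (ι-mono h)))
       l4 : ∀ a b → a - b ≡ a * b → 2ℚ * (a - b) - a * a ≡ a * (2ℚ * b - a)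
       l4 a b e = trans (cong (λ u → 2ℚ * u - a * a) e) (id202 a b)

-- Total masses from the convolution identities.

module MassSolve where

 open Q
 open Kit

 -- If (k+1) y_{k+1} ≈ Σ_{i≤k} x_i y_{k-i} and all y_j ≈ 1, then all x_k ≈ 1 as well.
 module _ (x y : ℕ → ℚ) (δ : ℚ) (δ≥0 : 0ℚ ≤ δ) (K : ℕ)
      (y≈1 : ∀ j → j N.≤ suc K → ∣ y j - 1ℚ ∣ ≤ δ) (half : 1ℚ ≤ 2ℚ * y 0)
      (conv : ∀ k → k N.≤ K → ∣ ι (suc k) * y (suc k) - Σ (range (suc k)) (λ i → x i * y (k N.∸ i)) ∣ ≤ δ)
      (δ≤1 : δ ≤ 1ℚ) where

  mutual
   -- Natural numbers that depend on k alone, so that finitely many of them can be evaluated. In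
   -- `errorᶜ` the outer 2 is the cost of dividing by y_0 ≥ 1/2; in `total` the factor 2 is the
   -- bound for the y_j.
   errorᶜ : ℕ → ℕ
   errorᶜ k = 2 N.* (suc k N.+ (total k N.+ 2))

   total : ℕ → ℕ
   total zero = 0
   total (suc k) = 2 N.* errorᶜ k N.+ 1 N.+ total k

  2≥0 : 0ℚ ≤ 2ℚ
  2≥0 = 0≤+ 0≤1 0≤1

  total-suc : ∀ k → ι (total (suc k)) ≡ 2ℚ * ι (errorᶜ k) + 1ℚ + ι (total k)
  total-suc k = trans (ι-+ (2 N.* errorᶜ k N.+ 1) (total k)) (cong (_+ ι (total k)) (trans (ι-+ (2 N.* errorᶜ k) 1) (cong₂ _+_ (trans (ι-* 2 (errorᶜ k)) (cong (_* ι (errorᶜ k)) ι-2)) ι-1)))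

  errorᶜ≡ : ∀ k → ι (errorᶜ k) ≡ 2ℚ * (ι (suc k) + (ι (total k) + 2ℚ))
  errorᶜ≡ k = trans (ι-* 2 (suc k N.+ (total k N.+ 2))) (cong₂ _*_ ι-2 (trans (ι-+ (suc k) (total k N.+ 2)) (cong (ι (suc k) +_) (trans (ι-+ (total k) 2) (cong (ι (total k) +_) ι-2)))))

  x≈1-upto : ∀ n → n N.≤ suc K → ∀ k → k N.< n → ∣ x k - 1ℚ ∣ ≤ ι (errorᶜ k) * δ
  x≈1-upto (suc n) h k k<n = by (NP.m≤n⇒m<n∨m≡n (NP.≤-pred k<n))
   where
   open import Data.Sum using (_⊎_; inj₁; inj₂)
   ih : ∀ k → k N.< n → ∣ x k - 1ℚ ∣ ≤ ι (errorᶜ k) * δ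
   ih = x≈1-upto n (NP.<⇒≤ h)
   n≤K : n N.≤ K
   n≤K = NP.≤-pred h
   term : ∀ i → i N.< n → ∣ x i * y (n N.∸ i) - 1ℚ ∣ ≤ (2ℚ * ι (errorᶜ i) + 1ℚ) * δ
   term i i<n = subst₂ _≤_ (cong ∣_∣ (id224 (x i) (y (n N.∸ i)))) (id225 (ι (errorᶜ i)) δ)
     (abs-+ (≡≤ (∣*∣ _ _) (*-mono (0≤∣∣ _) (0≤∣∣ _) (ih i i<n) yb)) (y≈1 _ n∸i))
    where
    n∸i : n N.∸ i N.≤ suc K
    n∸i = NP.≤-trans (NP.m∸n≤m n i) (NP.m≤n⇒m≤1+n n≤K)
    yb : ∣ y (n N.∸ i) ∣ ≤ 2ℚ
    yb = subst (λ u → ∣ u ∣ ≤ 2ℚ) (id222 (y (n N.∸ i))) (abs-+ (≤-trans (y≈1 _ n∸i) δ≤1) (≤-reflexive (∣∣-nonneg 0≤1)))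
   sums : ∀ j → j N.≤ n → ∣ Σ (range j) (λ i → x i * y (n N.∸ i)) - ι j ∣ ≤ ι (total j) * δ
   sums zero _ = ≡≤ (trans (cong (λ u → ∣ 0ℚ - u ∣) ι-0) (trans (cong ∣_∣ (+-inverseʳ 0ℚ)) (∣∣-nonneg ≤-refl))) (≤-reflexive (sym (trans (cong (_* δ) ι-0) (*-zeroˡ δ))))
   sums (suc j) h = subst₂ _≤_ (cong ∣_∣ (trans (id226 _ _ (ι j)) (cong (λ u → x j * y (n N.∸ j) + Σ (range j) (λ i → x i * y (n N.∸ i)) - u) (sym (ι-suc j))))) (trans (sym (*-distribʳ-+ δ _ _)) (cong (_* δ) (sym (total-suc j)))) (abs-+ (term j h) (sums j (NP.<⇒≤ h)))
   step : ∣ x n - 1ℚ ∣ ≤ ι (errorᶜ n) * δ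
   step = ≤-trans (subst₂ _≤_ (*-identityˡ _) (id227 ∣ x n - 1ℚ ∣ (y 0)) (*-monoʳ ∣ x n - 1ℚ ∣ (0≤∣∣ _) half))
     (≤≡ (*-monoˡ 2ℚ 2≥0 main) (trans (id228 (ι (suc n)) (ι (total n)) δ) (cong (_* δ) (sym (errorᶜ≡ n)))))
    where
    S : ℚ
    S = Σ (range n) (λ i → x i * y (n N.∸ i))
    y0≥0 : 0ℚ ≤ y 0
    y0≥0 = *-cancelˡ 2ℚ (0<+ 0<1 0≤1) half'
     where
     half' : 2ℚ * 0ℚ ≤ 2ℚ * y 0
     half' = ≡≤ (*-zeroʳ 2ℚ) (≤-trans 0≤1 half)
    T : ℚ
    T = ι (suc n) * y (suc n) - Σ (range (suc n)) (λ i → x i * y (n N.∸ i))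
    eq : ι (suc n) * (y (suc n) - 1ℚ) - ((S - ι n) + ((y 0 - 1ℚ) + T)) ≡ (x n - 1ℚ) * y 0
    eq = trans (cong₂ (λ u u' → u * (y (suc n) - 1ℚ) - ((S - ι n) + ((y 0 - 1ℚ) + (u * y (suc n) - (x n * y u' + S))))) (ι-suc n) (NP.n∸n≡0 n)) (id223 (ι n) (y (suc n)) S (y 0) (x n))
    main : ∣ x n - 1ℚ ∣ * y 0 ≤ ι (suc n) * δ + (ι (total n) * δ + (δ + δ))
    main = ≡≤ (trans (cong (∣ x n - 1ℚ ∣ *_) (sym (∣∣-nonneg y0≥0))) (trans (sym (∣*∣ _ _)) (cong ∣_∣ (sym eq))))
     (abs-- (≡≤ (trans (∣*∣ _ _) (cong (_* ∣ y (suc n) - 1ℚ ∣) (∣∣-nonneg (ι≥0 (suc n))))) (*-monoˡ (ι (suc n)) (ι≥0 (suc n)) (y≈1 (suc n) h)))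
         (abs-+ (sums n NP.≤-refl) (abs-+ (y≈1 0 N.z≤n) (conv n n≤K))))
   open import Data.Sum using (_⊎_; inj₁; inj₂)
   by : (k N.< n) ⊎ (k ≡ n) → ∣ x k - 1ℚ ∣ ≤ ι (errorᶜ k) * δ
   by (inj₁ l) = ih k l
   by (inj₂ refl) = step

  x≈1 : ∀ k → k N.≤ K → ∣ x k - 1ℚ ∣ ≤ ι (errorᶜ k) * δ
  x≈1 k h = x≈1-upto (suc K) NP.≤-refl k (N.s≤s h)

-- The extremal contradiction in a class without primes.

module Endgame where

 open Q
 open Kit
 open Group

 -- The common relative precision of all masses and errors.
 o : ℚ
 o = rec 1000

 o≥0 : 0ℚ ≤ o
 o≥0 = rec≥0 1000

 to1 : ι 1000 * o ≡ 1ℚ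
 to1 = ι*rec {1000} 1≤suc

 -- 2 · 0.997² > 1.003⁶ + 1.003⁵ · 2 · 1.001 · 0.001
 constants : ∀ ν → 0ℚ < ν → let b = ι 1003 * o ; c = ι 997 * o ; d = 2ℚ * (ι 1001 * o) * o in
  2ℚ * ((c * (ν * ν * ν)) * (c * (ν * ν * ν))) ≤
   (b * ν) * (b * ν) * ((b * ν) * (b * ν)) * ((b * ν) * (b * ν)) + (b * ν) * (b * ν) * ((b * ν) * (b * ν)) * ((b * ν) * (d * ν)) → ⊥
 constants ν ν>0 h = NP.<⇒≱ (NP.<ᵇ⇒< (1003 N.* 1003 N.* (1003 N.* 1003) N.* (1003 N.* 1003) N.* 1000 N.+ 1003 N.* 1003 N.* (1003 N.* 1003) N.* 1003 N.* (2 N.* 1001))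
                    (2 N.* (997 N.* 997) N.* (1000 N.* 1000 N.* (1000 N.* 1000) N.* 1000)) tt)
   (ι-cancel (subst₂ _≤_ lhs rhs (*-cancelˡ ω ω>0 (subst₂ _≤_ e1 e2 h))))
  where
  sq : ℚ → ℚ
  sq x = x * x
  t : ℚ
  t = ι 1000
  ω : ℚ
  ω = sq ν * sq ν * sq ν * (sq o * sq o * sq o * o)
  o>0 : 0ℚ < o
  o>0 = rec>0 {1000} 1≤suc
  ω>0 : 0ℚ < ω
  ω>0 = 0<* (0<* (0<* νν νν) νν) (0<* (0<* (0<* oo oo) oo) o>0)
   where
   νν : 0ℚ < sq ν
   νν = 0<* ν>0 ν>0
   oo : 0ℚ < sq o
   oo = 0<* o>0 o>0
  e1 : 2ℚ * ((ι 997 * o * (ν * ν * ν)) * (ι 997 * o * (ν * ν * ν))) ≡ ω * (2ℚ * (ι 997 * ι 997) * (t * t * (t * t) * t))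
  e1 = trans (id257 (ι 997) o ν) (trans (cong (λ u → sq ν * sq ν * sq ν * (2ℚ * (ι 997 * ι 997)) * sq o * (u * u * (u * u) * u)) (sym to1)) (id258 (ι 997) o ν t))
  e2 : _ ≡ ω * (ι 1003 * ι 1003 * (ι 1003 * ι 1003) * (ι 1003 * ι 1003) * t + ι 1003 * ι 1003 * (ι 1003 * ι 1003) * ι 1003 * (2ℚ * ι 1001))
  e2 = trans (id259 (ι 1003) (ι 1001) o ν) (trans (cong (λ u → sq ν * sq ν * sq ν * (((ι 1003 * o) * (ι 1003 * o)) * ((ι 1003 * o) * (ι 1003 * o)) * ((ι 1003 * o) * (ι 1003 * o)) * u + ((ι 1003 * o) * (ι 1003 * o)) * ((ι 1003 * o) * (ι 1003 * o)) * (ι 1003 * o) * (2ℚ * (ι 1001 * o) * o))) (sym to1)) (id260 (ι 1003) (ι 1001) o ν t))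
  lhs : 2ℚ * (ι 997 * ι 997) * (t * t * (t * t) * t) ≡ ι (2 N.* (997 N.* 997) N.* (1000 N.* 1000 N.* (1000 N.* 1000) N.* 1000))
  lhs = sym (i* (2 N.* (997 N.* 997)) (1000 N.* 1000 N.* (1000 N.* 1000) N.* 1000) (i* 2 (997 N.* 997) ι-2 (ι-* 997 997)) (i* (1000 N.* 1000 N.* (1000 N.* 1000)) 1000 (i* (1000 N.* 1000) (1000 N.* 1000) (ι-* 1000 1000) (ι-* 1000 1000)) refl))
   where
   i* : ∀ a b {x y} → ι a ≡ x → ι b ≡ y → ι (a N.* b) ≡ x * y
   i* a b p q = trans (ι-* a b) (cong₂ _*_ p q)
  rhs : _ ≡ ι (1003 N.* 1003 N.* (1003 N.* 1003) N.* (1003 N.* 1003) N.* 1000 N.+ 1003 N.* 1003 N.* (1003 N.* 1003) N.* 1003 N.* (2 N.* 1001))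
  rhs = sym (trans (ι-+ (1003 N.* 1003 N.* (1003 N.* 1003) N.* (1003 N.* 1003) N.* 1000) (1003 N.* 1003 N.* (1003 N.* 1003) N.* 1003 N.* (2 N.* 1001)))
   (cong₂ _+_ (i* (1003 N.* 1003 N.* (1003 N.* 1003) N.* (1003 N.* 1003)) 1000 (i* (1003 N.* 1003 N.* (1003 N.* 1003)) (1003 N.* 1003) q4 q2) refl)
         (i* (1003 N.* 1003 N.* (1003 N.* 1003) N.* 1003) (2 N.* 1001) (i* (1003 N.* 1003 N.* (1003 N.* 1003)) 1003 q4 refl) (i* 2 1001 ι-2 refl))))
   where
   i* : ∀ a b {x y} → ι a ≡ x → ι b ≡ y → ι (a N.* b) ≡ x * y
   i* a b p q = trans (ι-* a b) (cong₂ _*_ p q)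
   q2 : ι (1003 N.* 1003) ≡ ι 1003 * ι 1003
   q2 = ι-* 1003 1003
   q4 : ι (1003 N.* 1003 N.* (1003 N.* 1003)) ≡ ι 1003 * ι 1003 * (ι 1003 * ι 1003)
   q4 = i* (1003 N.* 1003) (1003 N.* 1003) q2 q2

 module _ (𝔾 : FiniteAbelianGroup) where
  open FiniteAbelianGroup 𝔾
  open Analysis 𝔾

  module NoObstruction (φ⁻ : ℚ) (φφ⁻ : φ * φ⁻ ≡ 1ℚ) (φ⁻≥0 : 0ℚ ≤ φ⁻) (φ≥0 : 0ℚ ≤ φ)
    (L R : ℕ → G → ℚ) (U : G → ℚ) (τ ε μ : ℚ) (r̄ : ℕ → ℚ)
    (L≥0 : ∀ k b → 0ℚ ≤ L k b)
    (τ≥0 : 0ℚ ≤ τ) (ε≥0 : 0ℚ ≤ ε) (μ≥1 : 1ℚ ≤ μ)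
    (conv-R : ∀ k → k N.≤ 5 → Sup (λ b → ι (suc k) * R (suc k) b - Σ (range (suc k)) (λ i → (L i ⋆ R (k N.∸ i)) b)) τ)
    (conv-U : Sup (λ b → (U ⋆ R 0) b - δ b) τ)
    (R-osc : ∀ k → 2 N.≤ k → k N.≤ 6 → ∀ b → ∣ R k b - r̄ k ∣ ≤ ε)
    (U₁ : ∥ U ∥₁ ≤ 2ℚ * μ)
    (mass : ∀ k → k N.≤ 5 → ∣ ∑ (L k) - μ ^ suc k ∣ ≤ o * μ ^ suc k)
    (errors : φ * (ι 34100 * (ε + μ * τ)) ≤ o * μ)
    (a : G) (empty : φ * L 5 a ≤ o * μ ^ 6)
    (κ : ℚ) (κ≥0 : 0ℚ ≤ κ) (κ≤ : κ ≤ o * μ)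
    (cosets : ∀ t → ∣ ∑ (λ s → L 0 (t ∙ (s ∙ s))) - ∑ (L 0) ∣ ≤ κ)
    where

   open Mean φ⁻ φφ⁻ φ⁻≥0

   μ≥0 : 0ℚ ≤ μ
   μ≥0 = ≤-trans 0≤1 μ≥1
   2≥0 : 0ℚ ≤ 2ℚ
   2≥0 = 0≤+ 0≤1 0≤1

   open Recurrence L R U 5 τ ε (2ℚ * μ) r̄ L≥0 τ≥0 ε≥0 conv-R conv-U R-osc U₁ (0≤* 2≥0 μ≥0)

   Z : ℚ
   Z = ε + μ * τ
   Z≥0 : 0ℚ ≤ Z
   Z≥0 = 0≤+ ε≥0 (0≤* μ≥0 τ≥0)

   1+o : 1ℚ + o ≡ ι 1001 * o
   1+o = trans (cong (_+ o) (sym to1)) (trans (id237 (ι 1000) o) (cong (_* o) (trans (cong (ι 1000 +_) (sym ι-1)) (sym (ι-+ 1000 1)))))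

   o≤1 : o ≤ 1ℚ
   o≤1 = subst (o ≤_) (trans (sym (*-identityˡ _)) (trans (cong (_* rec 1) (sym ι-1)) (ι*rec {1} 1≤suc))) (rec-mono {1} {1000} 1≤suc 1≤suc)

   m≥0 : ∀ k → 0ℚ ≤ m k
   m≥0 k = Σ≥0 els (L≥0 k)

   m≤ : ∀ k → k N.≤ 5 → m k ≤ (1ℚ + o) * μ ^ suc k
   m≤ k h = id238 (m k) (μ ^ suc k) o via ≤⇒0≤ (≤-trans (≤abs _) (mass k h))
   m≥ : ∀ k → k N.≤ 5 → (1ℚ - o) * μ ^ suc k ≤ m k
   m≥ k h = id239 (m k) (μ ^ suc k) o via ≤⇒0≤ (≤-trans (-≤abs _) (mass k h))
   m≤2 : ∀ k → k N.≤ 5 → m k ≤ 2ℚ * μ ^ suc k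
   m≤2 k h = ≤-trans (m≤ k h) (*-monoʳ (μ ^ suc k) (^≥0 (suc k) μ≥0) (+-mono (≤-refl {1ℚ}) o≤1))

   -- With the masses at most 2μ^(i+1) and j ≤ 4, the terms in ε have total coefficient at most 88
   -- and those in μτ total 60; 100 covers both.
   η≤ : ∀ j → suc j N.≤ 5 → η (suc j) ≤ ι 100 * (μ ^ suc j * Z)
   η≤ j h = ≤-trans (+-mono (+-mono t1 t2) (+-mono t3 (+-mono t4 t5))) fin
    where
    p : ℚ
    p = μ ^ suc j
    p≥0 : 0ℚ ≤ p
    p≥0 = ^≥0 (suc j) μ≥0
    μ≤p : μ ≤ p
    μ≤p = subst (_≤ p) (*-identityʳ μ) (*-monoˡ μ μ≥0 (1≤^ j μ≥1))
    q≤ : ∀ i → i N.≤ j → m i + m i ≤ 2ℚ * (2ℚ * p)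
    q≤ i hi = subst (m i + m i ≤_) (id233 _) (+-mono mi mi)
     where
     mi : m i ≤ 2ℚ * p
     mi = ≤-trans (m≤2 i (NP.≤-trans hi (NP.<⇒≤ h))) (*-monoˡ 2ℚ 2≥0 (^-monoʳ μ≥1 (N.s≤s hi)))
    εε : 0ℚ ≤ ε + ε
    εε = 0≤+ ε≥0 ε≥0
    ττ : 0ℚ ≤ τ + τ
    ττ = 0≤+ τ≥0 τ≥0
    t1 : ι (suc (suc j)) * (2ℚ * μ * (ε + ε)) ≤ ι 6 * (2ℚ * p * (ε + ε))
    t1 = *-mono (ι≥0 _) (0≤* (0≤* 2≥0 μ≥0) εε) (ι-mono (N.s≤s h)) (*-monoʳ (ε + ε) εε (*-monoˡ 2ℚ 2≥0 μ≤p))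
    t2 : 2ℚ * μ * (τ + τ) ≤ 2ℚ * (p * μ) * (τ + τ)
    t2 = *-monoʳ (τ + τ) ττ (*-monoˡ 2ℚ 2≥0 (subst (_≤ p * μ) (*-identityˡ μ) (*-monoʳ μ μ≥0 (1≤^ (suc j) μ≥1))))
    t3 : (m (suc j) + m (suc j)) * (τ + τ) ≤ 2ℚ * (2ℚ * (p * μ)) * (τ + τ)
    t3 = *-monoʳ (τ + τ) ττ (subst (m (suc j) + m (suc j) ≤_) (id231 (p * μ)) (+-mono ms ms))
     where
     ms : m (suc j) ≤ 2ℚ * (p * μ)
     ms = subst (λ u → m (suc j) ≤ 2ℚ * u) (*-comm μ p) (m≤2 (suc j) h)
    t4 : (m j + m j) * ((m 0 + m 0) * (τ + τ) + 2ℚ * μ * (τ + τ)) ≤ 2ℚ * (2ℚ * p) * (2ℚ * (2ℚ * μ) * (τ + τ) + 2ℚ * μ * (τ + τ))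
    t4 = *-mono (0≤+ (m≥0 j) (m≥0 j)) (0≤+ (0≤* (0≤+ (m≥0 0) (m≥0 0)) ττ) (0≤* (0≤* 2≥0 μ≥0) ττ)) (q≤ j NP.≤-refl)
        (+-mono (*-monoʳ (τ + τ) ττ (≤≡ (+-mono (m≤2 0 N.z≤n) (m≤2 0 N.z≤n)) (id234 μ))) (≤-refl))
    t5 : Σ (range j) (λ i → (m i + m i) * (2ℚ * μ * (ε + ε))) ≤ ι 4 * (2ℚ * (2ℚ * p) * (2ℚ * (ε + ε)))
    t5 = go j (NP.≤-pred h) refl
     where
     c : ℚ
     c = 2ℚ * (2ℚ * p) * (2ℚ * (ε + ε))
     c≥0 : 0ℚ ≤ c
     c≥0 = 0≤* (0≤* 2≥0 (0≤* 2≥0 p≥0)) (0≤* 2≥0 εε)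
     go : ∀ j' → j' N.≤ 4 → j' ≡ j → Σ (range j') (λ i → (m i + m i) * (2ℚ * μ * (ε + ε))) ≤ ι 4 * c
     go j' h4 refl = ≤-trans (Σ-mono∈ (range j) (λ i i∈ → term i (∈range i∈))) (≡≤ (trans (Σ-const (range j) c) (cong (λ z → ι z * c) (range-length j))) (*-monoʳ c c≥0 (ι-mono h4)))
      where
      term : ∀ i → i N.< j → (m i + m i) * (2ℚ * μ * (ε + ε)) ≤ c
      term i hi = subst₂ _≤_ (id232 (m i + m i) μ (ε + ε)) refl (*-monoʳ (2ℚ * (ε + ε)) (0≤* 2≥0 εε) mm)
       where
       mi : m i * μ ≤ 2ℚ * p
       mi = ≤-trans (*-monoʳ μ μ≥0 (m≤2 i (NP.≤-trans (NP.<⇒≤ hi) (NP.<⇒≤ h)))) (≡≤ (id229 (μ ^ suc i) μ) (*-monoˡ 2ℚ 2≥0 (^-monoʳ μ≥1 (N.s≤s hi))))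
       mm : (m i + m i) * μ ≤ 2ℚ * (2ℚ * p)
       mm = subst₂ _≤_ (id230 (m i) μ) (id231 p) (+-mono mi mi)
    fin : (ι 6 * (2ℚ * p * (ε + ε)) + 2ℚ * (p * μ) * (τ + τ)) + (2ℚ * (2ℚ * (p * μ)) * (τ + τ) + (2ℚ * (2ℚ * p) * (2ℚ * (2ℚ * μ) * (τ + τ) + 2ℚ * μ * (τ + τ)) + ι 4 * (2ℚ * (2ℚ * p) * (2ℚ * (ε + ε))))) ≤ ι 100 * (p * Z)
    fin = subst₂ _≤_ (id235 p μ τ ε (ι 6) (ι 4)) (id236 (ι 100) p ε (μ * τ))
      (+-mono (*-monoʳ (p * ε) (0≤* p≥0 ε≥0) (subst (_≤ ι 100) eqε (ι-mono {88} {100} (NP.≤ᵇ⇒≤ 88 100 tt)))) (*-monoʳ (p * (μ * τ)) (0≤* p≥0 (0≤* μ≥0 τ≥0)) (subst (_≤ ι 100) eqτ (ι-mono {60} {100} (NP.≤ᵇ⇒≤ 60 100 tt)))))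
     where
     sixty : ℚ
     sixty = 2ℚ * 2ℚ + 2ℚ * 2ℚ * 2ℚ + 2ℚ * 2ℚ * (2ℚ * 2ℚ * 2ℚ + 2ℚ * 2ℚ)
     eqε : ι 88 ≡ 2ℚ * ι 6 * 2ℚ + 2ℚ * 2ℚ * 2ℚ * 2ℚ * ι 4
     eqε = trans (ι-+ 24 64) (cong₂ _+_ (trans (ι-* 12 2) (cong₂ _*_ (trans (ι-* 2 6) (cong (_* ι 6) ι-2)) ι-2)) (trans (ι-* 16 4) (cong (_* ι 4) (trans (ι-* 8 2) (cong₂ _*_ (trans (ι-* 4 2) (cong₂ _*_ (trans (ι-* 2 2) (cong₂ _*_ ι-2 ι-2)) ι-2)) ι-2)))))
     i4 : ι 4 ≡ 2ℚ * 2ℚ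
     i4 = trans (ι-* 2 2) (cong₂ _*_ ι-2 ι-2)
     i8 : ι 8 ≡ 2ℚ * 2ℚ * 2ℚ
     i8 = trans (ι-* 4 2) (cong₂ _*_ i4 ι-2)
     eqτ : ι 60 ≡ sixty
     eqτ = trans (ι-+ 12 48) (cong₂ _+_ (trans (ι-+ 4 8) (cong₂ _+_ i4 i8)) (trans (ι-* 4 12) (cong₂ _*_ i4 (trans (ι-+ 8 4) (cong₂ _+_ i8 i4)))))

   -- Each step multiplies the error by 2m_0 ≤ 4μ and adds 100; the fifth value is the 34100 of the
   -- hypothesis `errors`.
   errᶜ : ℕ → ℕ
   errᶜ zero = 0
   errᶜ (suc k) = 100 N.+ 4 N.* errᶜ k

   err≤ : ∀ k → k N.≤ 5 → err k ≤ ι (errᶜ k) * (μ ^ k * Z)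
   err≤ zero _ = ≤-reflexive (sym (trans (cong (_* (1ℚ * Z)) ι-0) (*-zeroˡ _)))
   err≤ (suc k) h = ≤≡ (+-mono (η≤ k h) (*-mono (0≤+ (m≥0 0) (m≥0 0)) (err≥0 k (NP.<⇒≤ h)) (+-mono (m≤2 0 N.z≤n) (m≤2 0 N.z≤n)) (err≤ k (NP.<⇒≤ h))))
     (trans (id240 (ι 100) μ (μ ^ k) Z (ι (errᶜ k))) (cong (_* (μ * μ ^ k * Z)) (sym (trans (ι-+ 100 (4 N.* errᶜ k)) (cong (ι 100 +_) (trans (ι-* 4 (errᶜ k)) (cong (_* ι (errᶜ k)) (trans (ι-* 2 2) (cong₂ _*_ ι-2 ι-2)))))))))

   φerr : ∀ c k → c N.≤ 34100 → φ * (ι c * (μ ^ k * Z)) ≤ o * μ ^ suc k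
   φerr c k h = ≤-trans (*-monoˡ φ φ≥0 (*-monoʳ (μ ^ k * Z) (0≤* (^≥0 k μ≥0) Z≥0) (ι-mono h)))
     (subst₂ _≤_ (id241 φ (ι 34100) Z (μ ^ k)) (id242 o μ (μ ^ k)) (*-monoʳ (μ ^ k) (^≥0 k μ≥0) errors))

   G² : G → ℚ
   G² = square

   -- 1 + 3o and 1 - 3o: every estimate of the main terms loses at most three times the precision.
   b c : ℚ
   b = ι 1003 * o
   c = ι 997 * o
   b≡ : 1ℚ + o + o + o ≡ b
   b≡ = trans (cong (λ u → u + o + o) 1+o) (trans (id243 (ι 1001) o) (cong (_* o) (trans (cong (λ u → ι 1001 + u) (sym ι-2)) (sym (ι-+ 1001 2)))))
   c≡ : 1ℚ - o - o - o ≡ c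
   c≡ = trans (cong (λ u → u - o - o - o) (sym to1)) (trans (cong (λ u → u * o - o - o - o) t≡) (id244 (ι 997) o))
    where
    t≡ : ι 1000 ≡ ι 997 + (1ℚ + 2ℚ)
    t≡ = trans (ι-+ 997 3) (cong (ι 997 +_) (trans (ι-+ 1 2) (cong₂ _+_ ι-1 ι-2)))

   ν : ℚ
   ν = μ * μ
   ν≥0 : 0ℚ ≤ ν
   ν≥0 = 0≤* μ≥0 μ≥0

   -- The recurrence gives G ≈ -l_1, and since L_1 ≥ 0, -l_1 is at most the mean of L_1.
   φG≤ : ∀ t → φ * G² t ≤ b * ν
   φG≤ t = ≤-trans (*-monoˡ φ φ≥0 g1) (≡≤ (trans (*-distribˡ-+ φ _ _) (cong₂ _+_ (φ-cancel (m 1)) refl))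
     (≤-trans (+-mono (m≤ 1 1≤suc) (≤-trans (*-monoˡ φ φ≥0 (η≤ 0 1≤suc)) (φerr 100 1 (NP.≤ᵇ⇒≤ 100 34100 tt))))
     (subst (λ u → (1ℚ + o) * μ ^ 2 + o * μ ^ 2 ≤ u * ν) b≡ (id245 o μ via 0≤* o≥0 ν≥0))))
    where
    g1 : G² t ≤ φ⁻ * m 1 + η 1
    g1 = id246 (L 1 t) (φ⁻ * m 1) (G² t) (η 1) via 0≤+ (≤⇒0≤ (≤-trans (≤abs _) (recurrence 0 1≤suc t))) (L≥0 1 t)

   -- G is L_0 ⋆ L_0 minus its mean, and L_0 ⋆ L_0 is nonnegative. That the constant μ² is the same
   -- as in the upper bound makes the extremal argument possible.
   -φG≤ : ∀ t → - (φ * G² t) ≤ b * ν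
   -φG≤ t = ≤-trans g1 (≤-trans (*-mono (m≥0 0) (m≥0 0) (m≤ 0 N.z≤n) (m≤ 0 N.z≤n)) (subst (λ u → (1ℚ + o) * μ ^ 1 * ((1ℚ + o) * μ ^ 1) ≤ u * ν) b≡ (id247 o μ via 0≤* (0≤* o≥0 (≤⇒0≤ o≤1)) ν≥0)))
    where
    sq≡ : G² t ≡ (L 0 ⋆ L 0) t - φ⁻ * (m 0 * m 0)
    sq≡ = trans (π⋆π (L 0) (L 0) t) (cong (λ u → (L 0 ⋆ L 0) t - φ⁻ * u) (∑-⋆ (L 0) (L 0)))
    LL≥0 : 0ℚ ≤ (L 0 ⋆ L 0) t
    LL≥0 = Σ≥0 els (λ s → 0≤* (L≥0 0 s) (L≥0 0 _))
    g1 : - (φ * G² t) ≤ m 0 * m 0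
    g1 = subst (λ u → - (φ * u) ≤ m 0 * m 0) (sym sq≡) (trans (id248 φ ((L 0 ⋆ L 0) t) (m 0 * m 0) (φ⁻ * (m 0 * m 0))) (trans (cong (λ u → φ * (L 0 ⋆ L 0) t + (m 0 * m 0 - u)) (φ-cancel _)) (trans (cong (φ * (L 0 ⋆ L 0) t +_) (+-inverseʳ _)) (+-identityʳ _))) via 0≤* φ≥0 LL≥0)

   β : ℚ
   β = b * ν
   β≥0 : 0ℚ ≤ β
   β≥0 = 0≤* (0≤* (ι≥0 1003) o≥0) ν≥0

   G-sup : Sup G² (φ⁻ * β)
   G-sup t = abs≤ (subst (_≤ φ⁻ * β) (c⁻ (G² t)) (*-monoˡ φ⁻ φ⁻≥0 (φG≤ t))) (subst (_≤ φ⁻ * β) (trans (id249 φ⁻ φ (G² t)) (cong -_ (c⁻ (G² t)))) (*-monoˡ φ⁻ φ⁻≥0 (-φG≤ t)))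
    where
    c⁻ : ∀ x → φ⁻ * (φ * x) ≡ x
    c⁻ x = trans (sym (*-assoc φ⁻ φ x)) (trans (cong (_* x) (trans (*-comm φ⁻ φ) φφ⁻)) (*-identityˡ x))

   open Squares G²

   G₁ : ∥ G² ∥₁ ≤ β
   G₁ = ≤≡ (Σ-mono els G-sup) (trans (∑-const (φ⁻ * β)) (φ-cancel β))

   φN : φ * N ≤ β * β
   φN = ≤≡ (*-monoˡ φ φ≥0 (N≤ (0≤* φ⁻≥0 β≥0) G-sup)) (trans (id250 φ φ⁻ β) (trans (cong (λ u → u * u * (β * β)) φφ⁻) (trans (cong (_* (β * β)) (*-identityˡ 1ℚ)) (*-identityˡ _))))

   N≥0 : 0ℚ ≤ N
   N≥0 = Σ≥0 els (λ t → sq≥0 (G² t))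

   κG : ∀ t → ∣ ∑ (λ s → G² (t ∙ (s ∙ s))) ∣ ≤ (m 0 + m 0) * κ
   κG = ⋆-coset (l 0) (l 0) (∥π∥₁ (L≥0 0)) κ≥0 (λ t → subst (λ u → ∣ u ∣ ≤ κ) (sym (trans (Σ-- els _ _) (cong (λ u → ∑ (λ s → L 0 (t ∙ (s ∙ s))) - u) (trans (∑-const (φ⁻ * m 0)) (φ-cancel (m 0)))))) (cosets t))

   d : ℚ
   d = 2ℚ * (ι 1001 * o) * o

   κC : ∑ (λ s → C (s ∙ s)) ≤ β * (d * ν)
   κC = ≤-trans (∑C-squares G₁ (0≤* (0≤+ (m≥0 0) (m≥0 0)) κ≥0) κG) (*-monoˡ β β≥0 (≤≡ (*-mono (0≤+ (m≥0 0) (m≥0 0)) κ≥0 (+-mono (m≤ 0 N.z≤n) (m≤ 0 N.z≤n)) κ≤)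
     (trans (cong (λ u → (u * μ ^ 1 + u * μ ^ 1) * (o * μ)) 1+o) (id251 (ι 1001 * o) o μ))))

   Y : ℚ
   Y = (G² ⋆ (G² ⋆ G²)) a

   -- At the class a the value of L_5 is negligible, so l_5 is minus the mean μ⁶/φ there, and l_5 ≈
   -- -G ⋆ G ⋆ G. This equals the maximum that |φG| ≤ μ² allows, up to the precision.
   φY : c * (ν * ν * ν) ≤ φ * Y
   φY = ≤-trans (subst (λ u → u * (ν * ν * ν) ≤ m 5 - φ * L 5 a - φ * err 5) c≡ (id252 o μ (m 5) (φ * L 5 a) (φ * err 5) via 0≤+ (0≤+ (≤⇒0≤ (m≥ 5 NP.≤-refl)) (≤⇒0≤ empty)) (≤⇒0≤ (≤-trans (*-monoˡ φ φ≥0 (err≤ 5 NP.≤-refl)) (φerr (errᶜ 5) 5 NP.≤-refl)))))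
     (subst (_≤ φ * Y) (trans (id253 φ (φ⁻ * m 5) (L 5 a) (err 5)) (cong (λ u → u - φ * L 5 a - φ * err 5) (φ-cancel (m 5)))) (*-monoˡ φ φ≥0 g1))
    where
    g1 : φ⁻ * m 5 - L 5 a - err 5 ≤ Y
    g1 = id254 (L 5 a) (φ⁻ * m 5) Y (err 5) via ≤⇒0≤ (≤-trans (-≤abs _) (subst (λ u → ∣ l 5 a - u ∣ ≤ err 5) (power5 a) (l≈power 5 NP.≤-refl a)))

   -- `triple-bound` times φ² gives 2(φY)² ≤ (φN)³ plus a small term. Here φN is at most about ν²
   -- and φY at least about ν³, so 2 ≤ 1 up to the errors.
   contradiction : ⊥
   contradiction = constants ν (0<* μ>0 μ>0) (≤-trans (*-monoˡ 2ℚ 2≥0 (*-mono cν cν φY φY)) (≡≤ (id255 φ Y) (≤-trans (*-monoˡ (φ * φ) (0≤* φ≥0 φ≥0) (triple-bound a κC)) (≡≤ (id256 φ N (β * (d * ν)))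
     (+-mono (*-mono (0≤* φN≥0 φN≥0) φN≥0 (*-mono φN≥0 φN≥0 φN φN) φN) (*-monoʳ (β * (d * ν)) (0≤* β≥0 (0≤* (0≤* (0≤* 2≥0 (0≤* (ι≥0 1001) o≥0)) o≥0) ν≥0)) (*-mono φN≥0 φN≥0 φN φN)))))))
    where
    μ>0 : 0ℚ < μ
    μ>0 = <-≤-trans 0<1 μ≥1
    cν : 0ℚ ≤ c * (ν * ν * ν)
    cν = 0≤* (0≤* (ι≥0 997) o≥0) (0≤* (0≤* ν≥0 ν≥0) ν≥0)
    φN≥0 : 0ℚ ≤ φ * N
    φN≥0 = 0≤* φ≥0 N≥0

-- Orders of magnitude and elementary size estimates.

module Bounds where

 open Q
 open Kit
 open DividedPower
 open Arith
 open Sieve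
 open Group
 open Units
 open Blocks
 open Chebyshev

 -- Orders of magnitude in the base 2^e: v ◁ i means 0 ≤ v ≤ 2^(ei), and v ▷ i means 0 ≤ v ≤ 2^(-ei).
 module Scale (e : ℕ) (e≥1 : 1 N.≤ e) where
  S s : ℚ
  S = ι (2 N.^ e)
  s = rec (2 N.^ e)

  infix 4 _◁_ _▷_
  record _◁_ (v : ℚ) (i : ℕ) : Set where
   constructor _,_
   field
    nonneg : 0ℚ ≤ v
    bound : v ≤ S ^ i

  record _▷_ (v : ℚ) (i : ℕ) : Set where
   constructor _,_
   field
    nonneg : 0ℚ ≤ v
    bound : v ≤ s ^ i

  Ss : S * s ≡ 1ℚ
  Ss = ι*rec (NP.m^n>0 2 e)

  S≥2 : 2ℚ ≤ S
  S≥2 = subst (_≤ S) ι-2 (ι-mono (NP.^-monoʳ-≤ 2 e≥1))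

  S≥1 : 1ℚ ≤ S
  S≥1 = ≤-trans (≤+ʳ 0≤1) S≥2

  S≥0 : 0ℚ ≤ S
  S≥0 = ≤-trans 0≤1 S≥1

  s≥0 : 0ℚ ≤ s
  s≥0 = rec≥0 (2 N.^ e)

  s≤1 : s ≤ 1ℚ
  s≤1 = subst₂ _≤_ (*-identityˡ s) Ss (*-monoʳ s s≥0 S≥1)

  up : ∀ {v i j} → i N.≤ j → v ◁ i → v ◁ j
  up h (p , q) = p , ≤-trans q (^-monoʳ S≥1 h)

  down : ∀ {v i j} → j N.≤ i → v ▷ i → v ▷ j
  down h (p , q) = p , ≤-trans q (^-antiʳ s≥0 s≤1 h)

  infixl 7 _·_ _·▷_ _▷·▷_
  infixl 6 _⊕_ _⊕▷_

  _·_ : ∀ {v w i j} → v ◁ i → w ◁ j → v * w ◁ i N.+ j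
  _·_ {i = i} {j} (p , q) (p' , q') = 0≤* p p' , ≤≡ (*-mono p p' q q') (sym (^-+ S i j))

  _▷·▷_ : ∀ {v w i j} → v ▷ i → w ▷ j → v * w ▷ i N.+ j
  _▷·▷_ {i = i} {j} (p , q) (p' , q') = 0≤* p p' , ≤≡ (*-mono p p' q q') (sym (^-+ s i j))

  S^s^ : ∀ i → S ^ i * s ^ i ≡ 1ℚ
  S^s^ i = trans (sym (^-* S s i)) (trans (cong (_^ i) Ss) (1^ i))

  _·▷_ : ∀ {v w i j} → v ◁ i → w ▷ i N.+ j → v * w ▷ j
  _·▷_ {i = i} {j} (p , q) (p' , q') = 0≤* p p' , ≤≡ (*-mono p p' q q') (trans (cong (S ^ i *_) (^-+ s i j)) (trans (sym (*-assoc _ _ _)) (trans (cong (_* s ^ j) (S^s^ i)) (*-identityˡ _))))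

  _⊕_ : ∀ {v w i} → v ◁ i → w ◁ i → v + w ◁ suc i
  _⊕_ {i = i} (p , q) (p' , q') = 0≤+ p p' , ≤-trans (+-mono q q') (≡≤ (id233 (S ^ i)) (*-monoʳ (S ^ i) (^≥0 i S≥0) S≥2))

  _⊕▷_ : ∀ {v w i} → v ▷ suc i → w ▷ suc i → v + w ▷ i
  _⊕▷_ {i = i} (p , q) (p' , q') = 0≤+ p p' , ≤-trans (+-mono q q') (≡≤ (id184 s (s ^ i)) (≤≡ (*-monoʳ (s ^ i) (^≥0 i s≥0) (≤≡ (*-monoʳ s s≥0 S≥2) Ss)) (*-identityˡ _)))

  pow : ∀ {v i} k → v ◁ i → v ^ k ◁ k N.* i
  pow zero _ = 0≤1 , ≤-refl
  pow (suc k) b = b · pow k b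

  const : ∀ {c} → c N.≤ 2 N.^ e → ι c ◁ 1
  const {c} h = ι≥0 c , ≤≡ (ι-mono h) (sym (*-identityʳ S))

  one : 1ℚ ◁ 0
  one = 0≤1 , ≤-refl

  below : ∀ {v w i} → 0ℚ ≤ v → v ≤ w → w ◁ i → v ◁ i
  below p h (_ , q) = p , ≤-trans h q

  below▷ : ∀ {v w i} → 0ℚ ≤ v → v ≤ w → w ▷ i → v ▷ i
  below▷ p h (_ , q) = p , ≤-trans h q

  S^≡ : ∀ i → S ^ i ≡ ι (2 N.^ (i N.* e))
  S^≡ i = trans (sym (ι-^ (2 N.^ e) i)) (cong ι (trans (NP.^-*-assoc 2 e i) (cong (2 N.^_) (NP.*-comm e i))))

  s^≡ : ∀ i → s ^ i ≡ rec (2 N.^ (i N.* e))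
  s^≡ i = rec-unique (NP.m^n>0 2 (i N.* e)) (trans (cong (_* s ^ i) (sym (S^≡ i))) (S^s^ i))

  ι◁ : ∀ {c} i → c N.≤ 2 N.^ (i N.* e) → ι c ◁ i
  ι◁ {c} i h = ι≥0 c , ≤≡ (ι-mono h) (sym (S^≡ i))

  rec▷ : ∀ {c} i → 2 N.^ (i N.* e) N.≤ c → rec c ▷ i
  rec▷ {c} i h = rec≥0 c , ≤≡ (rec-mono (NP.m^n>0 2 (i N.* e)) h) (sym (s^≡ i))

 -- Beyond k₀ ≥ 2x the ratio x/(k+1) of consecutive divided powers is at most 1/2.
 dp-halving : ∀ k₀ s {x} → 0ℚ ≤ x → 2ℚ * x ≤ ι k₀ → dp (s N.+ k₀) x ≤ rec (2 N.^ s) * dp k₀ x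
 dp-halving k₀ zero {x} x≥0 _ = ≤-reflexive (sym (trans (cong (_* dp k₀ x) (trans (sym (*-identityˡ _)) (trans (cong (_* rec 1) (sym ι-1)) (ι*rec {1} 1≤suc)))) (*-identityˡ _)))
 dp-halving k₀ (suc s) {x} x≥0 h = *-cancelˡ 2ℚ (0<+ 0<1 0≤1) (≤-trans half (≤≡ (dp-halving k₀ s x≥0 h) (sym e)))
  where
  k : ℕ
  k = s N.+ k₀
  half : 2ℚ * dp (suc k) x ≤ dp k x
  half = *-cancelˡ (ι (suc k)) (ι-pos 1≤suc) (subst₂ _≤_ (trans (id261 x (dp k x)) (trans (cong (2ℚ *_) (sym (dp-suc k x))) (id262 (ι (suc k)) (dp (suc k) x)))) refl
    (*-monoʳ (dp k x) (dp≥0 k x≥0) (≤-trans h (ι-mono (NP.≤-trans (NP.m≤n+m k₀ s) (NP.n≤1+n k))))))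
  e : 2ℚ * (rec (2 N.^ suc s) * dp k₀ x) ≡ rec (2 N.^ s) * dp k₀ x
  e = trans (cong (λ u → 2ℚ * (u * dp k₀ x)) (rec-* 2 (2 N.^ s))) (trans (id263 2ℚ (rec 2) (rec (2 N.^ s)) (dp k₀ x)) (trans (cong (_* (rec (2 N.^ s) * dp k₀ x)) (trans (cong (_* rec 2) (sym ι-2)) (ι*rec {2} 1≤suc))) (*-identityˡ _)))

 -- At index 2h₀ the value is at most h₀^(2h₀) ≤ 2^(2h₀²). The first 2h₀² halvings cancel this, the
 -- remaining s give the bound.
 dp-small : ∀ h₀ s {x} → 0ℚ ≤ x → x ≤ ι h₀ → dp (h₀ N.* (2 N.* h₀) N.+ s N.+ 2 N.* h₀) x ≤ rec (2 N.^ s)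
 dp-small h₀ s {x} x≥0 h = ≤-trans (dp-halving (2 N.* h₀) (h₀ N.* (2 N.* h₀) N.+ s) x≥0 (≤≡ (*-monoˡ 2ℚ (0≤+ 0≤1 0≤1) h) (trans (cong (_* ι h₀) (sym ι-2)) (sym (ι-* 2 h₀)))))
  (≤≡ (*-monoˡ (rec (2 N.^ (a N.+ s))) (rec≥0 (2 N.^ (a N.+ s))) (≤-trans (dp≤^ (2 N.* h₀) x≥0) (≤-trans (^-mono (2 N.* h₀) x≥0 h) (≡≤ (sym (ι-^ h₀ (2 N.* h₀))) (ι-mono pw)))))
   (trans (cong (_* ι (2 N.^ a)) (trans (cong rec (NP.^-distribˡ-+-* 2 a s)) (rec-* (2 N.^ a) (2 N.^ s)))) (trans (id264 _ _ _) (trans (cong (_* rec (2 N.^ s)) (ι*rec (NP.m^n>0 2 a))) (*-identityˡ _)))))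
  where
  a : ℕ
  a = h₀ N.* (2 N.* h₀)
  pw : h₀ N.^ (2 N.* h₀) N.≤ 2 N.^ a
  pw = ℕ≤≡ (NP.^-monoˡ-≤ (2 N.* h₀) (n≤2^n h₀)) (NP.^-*-assoc 2 h₀ (2 N.* h₀))

 module _ (Q : ℕ) {{nzQ : NonZero Q}} where
  open Congruence Q
  open FiniteAbelianGroup (units Q) using (els)
  open Analysis (units Q) using (φ)

  ok? : ∀ p → Dec (Coprime p Q)
  ok? p = coprime? p Q

  sieving : ∀ n → Sieving (primes ok? n)
  sieving zero = []
  sieving (suc n) with prime? n ×-dec ok? n
  ... | yes (pp , c) = (pp , (λ {i} → c {i}) , All.map (λ { (qp , _ , lt) → qp , NP.<⇒≢ lt }) (primes-below ok? n)) ∷ sieving n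
  ... | no _ = sieving n

  V≡density : ∀ n → V (primes ok? n) ≡ density ok? n
  V≡density zero = refl
  V≡density (suc n) with prime? n ×-dec ok? n
  ... | yes _ = cong ((1ℚ - rec n) *_) (V≡density n)
  ... | no _ = V≡density n

  count-units : ∀ n .(h : n N.≤ Q) → Σ (elements Q n h) (λ _ → 1ℚ) ≡ Σ (range n) (λ i → χ (coprime? i Q))
  count-units zero h = refl
  count-units (suc n) h with coprime? n Q
  ... | yes _ = cong (1ℚ +_) (count-units n (NP.<⇒≤ h))
  ... | no _ = trans (count-units n (NP.<⇒≤ h)) (sym (+-identityˡ _))

  φ≡ : φ ≡ Σ (range Q) (λ i → χ (coprime? i Q))
  φ≡ = count-units Q NP.≤-refl

  φ≤Q : φ ≤ ι Q
  φ≤Q = ≡≤ φ≡ (≤≡ (Σ-mono (range Q) (λ i → χ≤1 (coprime? i Q))) (trans (Σ-const (range Q) 1ℚ) (trans (*-identityʳ _) (cong ι (range-length Q)))))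

  -- The q residues congruent to 1 modulo g are units, since coprimality to g implies coprimality to
  -- Q.
  φ≥ : ∀ g {{_ : NonZero g}} q → q N.* g ≡ Q → (∀ a → Coprime a g → Coprime a Q) → ι q ≤ φ
  φ≥ g q eq lift = ≡≤ (sym (trans (cong (λ z → Cg.count z 1) (trans (sym eq) (sym (NP.+-identityʳ _)))) (trans (Cg.count-blocks q 0 1) (+-identityʳ _))))
    (≤≡ (Σ-mono (range Q) (λ i → χ-mono (i Cg.≈? 1) (coprime? i Q) (λ h → λ {j} → lift i (λ {k} → coprime-≈ g {1} {i} (sym h) (λ {l} → coprime-1 g {l}) {k}) {j}))) (sym φ≡))
   where module Cg = Congruence g

 module _ (K m P : ℕ) (K≥1 : 1 N.≤ K) (m≥1 : 1 N.≤ m) (P≥1 : 1 N.≤ P) where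
  open Weights K m P K≥1 m≥1 P≥1

  2^≤ρ^ : ∀ y → ι (2 N.^ y) ≤ ρ ^ (y N.* H)
  2^≤ρ^ y = ≡≤ (trans (ι-^ 2 y) (cong (_^ y) ι-2)) (≤≡ (^-mono y (0≤+ 0≤1 0≤1) two) (sym (^-^ ρ y H)))
   where
   two : 2ℚ ≤ ρ ^ H
   two = ≡≤ (cong (1ℚ +_) (sym (ι*rec H≥1))) (bernoulli (rec H) H (rec≥0 H))

  2^≤x : ∀ y → 2 N.^ y N.≤ x (y N.* H)
  2^≤x y = ι-cancel (≤-trans (2^≤ρ^ y) (x-lower (y N.* H)))

  ρ⁻≤ : ∀ y → ρ⁻ ^ (y N.* H) ≤ rec (2 N.^ y)
  ρ⁻≤ y = *-cancelˡ (ι (2 N.^ y)) (ι-pos (NP.m^n>0 2 y)) (≤≡ (*-monoʳ (ρ⁻ ^ (y N.* H)) (^≥0 (y N.* H) (0≤* (ι≥0 H) (rec≥0 (suc H)))) (2^≤ρ^ y)) (trans (ρ^ρ⁻^ (y N.* H)) (sym (ι*rec (NP.m^n>0 2 y)))))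

-- Sizes of the error terms.

module Sizes where

 open Q
 open Kit
 open DividedPower
 open Arith
 open Sieve
 open Group
 open Units
 open Blocks
 open Chebyshev
 open Equidistribution
 open Series
 open Bounds

 module Orders (N K m P : ℕ) (N≥2 : 2 N.≤ N) (K≥1 : 1 N.≤ K) (m≥1 : 1 N.≤ m) (P≥1 : 1 N.≤ P) (H≡ : 2 N.* K ≡ 2 N.^ (20 N.* N)) where

  N≥1 : 1 N.≤ N
  N≥1 = NP.<⇒≤ N≥2

  open Weights K m P K≥1 m≥1 P≥1 hiding (g)
  open Scale N N≥1

  module _ (W≤ : W N.≤ 2 N.^ N) where

   Pm≤ : P N.* m N.≤ 2 N.^ N
   Pm≤ = NP.≤-trans (NP.≤-trans (NP.m≤n*m (P N.* m) 2) (NP.n≤1+n _)) W≤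

   two◁ : ι 2 ◁ 1
   two◁ = const (NP.^-monoʳ-≤ 2 {1} {N} N≥1)
   Pm◁ : ι (P N.* m) ◁ 1
   Pm◁ = const Pm≤
   W◁ : ι W ◁ 1
   W◁ = const W≤
   Gm◁ : ∀ k → Gm k ◁ k
   Gm◁ k = subst (Gm k ◁_) (NP.*-identityʳ k) (pow k Pm◁)
   H▷ : rec H ▷ 20
   H▷ = rec▷ 20 (NP.≤-reflexive (sym H≡))
   H◁ : ι H ◁ 20
   H◁ = ι◁ 20 (NP.≤-reflexive H≡)
   J◁ : ι J ◁ 21
   J◁ = subst (_◁ 21) (sym (trans (cong ι (trans (cong (P N.*_) (NP.*-comm H m)) (sym (NP.*-assoc P m H)))) (ι-* (P N.* m) H))) (Pm◁ · H◁)

   6◁ : ∀ {k} i → k N.≤ i → Gm k ◁ i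
   6◁ i h = up h (Gm◁ _)

   ≥8 : ι 8 ◁ 2
   ≥8 = ι◁ 2 (NP.≤-trans {8} {2 N.^ 4} (NP.≤ᵇ⇒≤ 8 16 tt) (NP.^-monoʳ-≤ 2 (NP.*-monoʳ-≤ 2 N≥2)))

   module _ (Q : ℕ) {{nzQ : NonZero Q}} where
    open Congruence Q using (Sieving)

    slack▷ : ∀ {ps} (sv : Sieving ps) r k → k N.≤ 6 → InClass.slack K m P K≥1 m≥1 P≥1 Q sv r 0 k ▷ 11
    slack▷ sv r k h = E▷ ⊕▷ down (NP.≤ᵇ⇒≤ 12 14 tt) (6◁ 6 h ·▷ H▷)
     where
     e▷ : Gm k * (ι W * rec H) ▷ 13
     e▷ = 6◁ 6 h ·▷ (W◁ ·▷ H▷)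
     E▷ : E k ▷ 12
     E▷ = e▷ ⊕▷ e▷

    errb▷ : ∀ {ps} (sv : Sieving ps) r y k → k N.≤ 6 → ρ⁻ ^ (y N.* H) ▷ 40 → ρ⁻ ^ (y N.* H) * (1ℚ + (InClass.A₀ K m P K≥1 m≥1 P≥1 Q sv r 0 + InClass.A₀ K m P K≥1 m≥1 P≥1 Q sv r 0)) ▷ 40 → InClass.B K m P K≥1 m≥1 P≥1 Q sv r 0 ▷ 40 →
     ι J * InClass.errb K m P K≥1 m≥1 P≥1 Q sv r 0 k (y N.* H) ▷ 8
    errb▷ sv r y k h i▷ A▷ B▷ = J◁ ·▷ (down (NP.≤ᵇ⇒≤ 30 30 tt) (slack▷ sv r k h ▷·▷ (H▷ ⊕▷ down (NP.≤ᵇ⇒≤ 20 40 tt) i▷)) ⊕▷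
      down (NP.≤ᵇ⇒≤ 30 31 tt) (6◁ 6 h ·▷ (down (NP.≤ᵇ⇒≤ 38 40 tt) A▷ ⊕▷ (below (ι≥0 6) (ι-mono {6} {8} (NP.≤ᵇ⇒≤ 6 8 tt)) ≥8 ·▷ B▷))))

    module _ (big : 20 N.* N N.< P) {ps : List ℕ} (ps-prime : All Prime ps) where
     open Sums K m P K≥1 m≥1 P≥1 Q ps ps-prime using (ε∞; ε∞≥0; hs; hs≥0; hs≤W; τL; τU)

     2W≤J' : W N.+ W N.≤ J'
     2W≤J' = NP.≤-trans (NP.+-mono-≤ W≤ W≤) (ℕ≡≤ (cong (2 N.^ N N.+_) (sym (NP.+-identityʳ _))) (NP.≤-trans (NP.^-monoʳ-≤ 2 {suc N} {20 N.* N} (ℕ≤≡ (NP.+-monoˡ-≤ N (NP.*-mono-≤ {1} {19} {1} {N} 1≤suc N≥1)) (NP.+-comm (19 N.* N) N))) (ℕ≡≤ (sym H≡) (NP.m≤m*n H m {{N.>-nonZero m≥1}}))))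

     -- T^(J') ≤ 1/2, so 20N stretches of length J' give 2^(-20N). This is why P must exceed 20N.
     T^▷ : ∀ j → 20 N.* N N.* J' N.≤ j → T ^ j ▷ 20
     T^▷ j h = ^≥0 j T≥0 , ≤-trans (^-antiʳ T≥0 T≤1 h) (≤≡ (*-cancelˡ (ι (2 N.^ (20 N.* N))) (ι-pos (NP.m^n>0 2 (20 N.* N)))
       (≤≡ (Moments.T^-decay K m P K≥1 m≥1 P≥1 (20 N.* N)) (sym (ι*rec (NP.m^n>0 2 (20 N.* N)))))) (sym (s^≡ 20)))

     J-large : 20 N.* N N.* J' N.≤ J N.∸ (W N.+ W)
     J-large = ℕ≡≤ (sym (NP.m+n∸m≡n J' (20 N.* N N.* J'))) (NP.∸-mono (NP.*-monoˡ-≤ J' big) 2W≤J')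

     ε∞▷ : ε∞ ▷ 20
     ε∞▷ = T^▷ (J N.∸ (W N.+ W)) J-large

     hs◁ : hs ◁ 1
     hs◁ = below hs≥0 hs≤W W◁

     tail▷ : ∀ {c} k → k N.≤ 5 → c ◁ 1 → (c * (ι (P N.* m) + ι (P N.* m)) ^ k) * ε∞ * (hs * hs) ▷ 7
     tail▷ {c} k h cb = subst (_▷ 7) (id265 (c * (ι (P N.* m) + ι (P N.* m)) ^ k) ε∞ (hs * hs)) (up (NP.+-monoʳ-≤ 2 (NP.+-monoʳ-≤ 1 (NP.*-monoˡ-≤ 2 h))) ((hs◁ · hs◁) · (cb · pow k (Pm◁ ⊕ Pm◁))) ·▷ ε∞▷)

     τL▷ : ∀ k → k N.≤ 5 → τL k ▷ 7
     τL▷ k h = tail▷ k h Pm◁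

     τU▷ : τU ▷ 7
     τU▷ = tail▷ 0 N.z≤n (up N.z≤n one)

    defect▷ : 20 N.* N N.< P → ∀ k → k N.≤ 6 → Moments.defect K m P K≥1 m≥1 P≥1 k ▷ 10
    defect▷ big k h = below (ι≥0 (suc k)) (ι-mono {suc k} {8} (NP.≤-trans (N.s≤s h) (NP.n≤1+n 7))) ≥8 ·▷ (6◁ 7 (N.s≤s h) ·▷ (H▷ ⊕▷ T^▷ big {[]} [] J (NP.≤-trans (J-large big {[]} []) (NP.m∸n≤m J (W N.+ W)))))

-- A prime in every reduced class, for given parameters.

module Core where

 open Q
 open Kit
 open DividedPower
 open Arith
 open Sieve
 open Group
 open Units
 open Blocks
 open Chebyshev
 open Equidistribution
 open Series
 open Spectral
 open Rough
 open Bounds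
 open Endgame

 -- Two scales are used. Quantities comparable to Q or log X are measured in powers of 2^N, while y,
 -- P, the inverse sieve density and the constants of g are powers of 2^π, which is far smaller. The
 -- mass m is at least 126 orders of the small scale, so it dominates all main-term errors.
 module Setting (g n N π K m P : ℕ) (g≥2 : 2 N.≤ g) (n≥3 : 3 N.≤ n) (N≥2 : 2 N.≤ N) (π≥25 : 25 N.≤ π) (K≥1 : 1 N.≤ K) (m≥1 : 1 N.≤ m) (P≥1 : 1 N.≤ P)
  (P≡ : P ≡ 2 N.^ π) (H≡ : 2 N.* K ≡ 2 N.^ (20 N.* N)) (π≤N : π N.≤ N) (W≤ : suc (2 N.* (P N.* m)) N.≤ 2 N.^ N) (big : 20 N.* N N.< P)
  (Q≤ : g N.^ n N.≤ 2 N.^ N) (m≥ : 2 N.^ (126 N.* π) N.≤ m) (y : ℕ) (y≤P : y N.≤ P) (y≥ : 40 N.* N N.≤ y) (g≤P : g N.≤ P)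
  (C≤P : 2 N.* RealSums.C₀ K m P K≥1 m≥1 P≥1 g n g≥2 n≥3 N.≤ P) (q≤P : 2 N.^ (g N.* (g N.* (g N.* 1))) N.≤ P)
  where

  Q q₀ : ℕ
  Q = g N.^ n
  q₀ = g N.* (g N.* (g N.* 1))

  instance
   nzg : NonZero g
   nzg = CharacterModulus.RealCharacters.nzg g n g≥2 n≥3
   nzQ : NonZero Q
   nzQ = CharacterModulus.RealCharacters.nzQ g n g≥2 n≥3

  open Weights K m P K≥1 m≥1 P≥1 hiding (g)
  open Congruence Q using (Sieving; []; V; h; h≥0; V≥0; V≤1; _≈_)
  open FiniteAbelianGroup (units Q) using (els; e; _∙_; inv)
  open Analysis (units Q)
  private
   module Sz = Sizes.Orders N K m P N≥2 K≥1 m≥1 P≥1 H≡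
   module B = Scale N (NP.<⇒≤ N≥2)
  open Scale π (NP.≤-trans 1≤suc π≥25)

  b : ℚ
  b = B.s

  b≤s : b ≤ s
  b≤s = rec-mono (NP.m^n>0 2 π) (NP.^-monoʳ-≤ 2 π≤N)

  toS : ∀ {v i} → v B.▷ i → v ▷ i
  toS {v} {i} (p B., q) = p , ≤-trans q (^-mono i B.s≥0 b≤s)

  small : ∀ {c} → c N.≤ P → ι c ◁ 1
  small h = const (subst (_ N.≤_) P≡ h)

  2^25≤P : 2 N.^ 25 N.≤ 2 N.^ π
  2^25≤P = NP.^-monoʳ-≤ 2 π≥25

  literal : ∀ c → c N.≤ 2 N.^ 25 → ι c ◁ 1
  literal c h = const (NP.≤-trans h 2^25≤P)

  2≥0 : 0ℚ ≤ 2ℚ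
  2≥0 = 0≤+ 0≤1 0≤1

  φ≥0 : 0ℚ ≤ φ
  φ≥0 = Σ≥0 els (λ _ → 0≤1)

  φ◁ : φ B.◁ 1
  φ◁ = B.below φ≥0 (φ≤Q Q) (B.const Q≤)

  Q≥1 : 1 N.≤ Q
  Q≥1 = N.>-nonZero⁻¹ Q

  φ/Q≤1 : φ * rec Q ≤ 1ℚ
  φ/Q≤1 = ≤≡ (*-monoʳ (rec Q) (rec≥0 Q) (φ≤Q Q)) (ι*rec Q≥1)

  b^≤recQ : ∀ {v} i → v B.▷ suc i → v ≤ rec Q
  b^≤recQ i (_ B., q) = ≤-trans q (≤-trans (^-antiʳ {m = 1} {n = suc i} B.s≥0 B.s≤1 1≤suc) (≡≤ (*-identityʳ b) (rec-mono Q≥1 Q≤)))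

  q' : ℕ
  q' = g N.^ (n N.∸ 1)

  q'g : q' N.* g ≡ Q
  q'g = trans (NP.*-comm q' g) (cong (g N.^_) (NP.m+[n∸m]≡n {1} {n} (NP.≤-trans 1≤suc n≥3)))

  q'≤φ : ι q' ≤ φ
  q'≤φ = φ≥ Q g q' q'g (λ a c → λ {i} → CharacterModulus.RealCharacters.coprime-^ g n g≥2 n≥3 a n (λ {j} → c {j}) {i})

  rg≤φ/Q : rec g ≤ φ * rec Q
  rg≤φ/Q = ≡≤ (sym (trans (cong (λ u → ι q' * rec u) (sym q'g)) (trans (cong (ι q' *_) (rec-* q' g)) (trans (sym (*-assoc _ _ _)) (trans (cong (_* rec g) (ι*rec q'≥1)) (*-identityˡ _)))))) (*-monoʳ (rec Q) (rec≥0 Q) q'≤φ)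
   where
   q'≥1 : 1 N.≤ q'
   q'≥1 = N.>-nonZero⁻¹ q' {{NP.m^n≢0 g (n N.∸ 1)}}

  φ>0 : 0ℚ < φ
  φ>0 = <-≤-trans (ι-pos (N.>-nonZero⁻¹ q' {{NP.m^n≢0 g (n N.∸ 1)}})) q'≤φ

  inverse≥0 : ∀ {x y} → 0ℚ < x → x * y ≡ 1ℚ → 0ℚ ≤ y
  inverse≥0 {x} {y} p e = *-cancelˡ x p (≡≤ (*-zeroʳ x) (≤≡ 0≤1 (sym e)))

  φ⁻ : ℚ
  φ⁻ = reciprocal φ>0
  φφ⁻ : φ * φ⁻ ≡ 1ℚ
  φφ⁻ = reciprocal-inverse φ>0
  φ⁻≥0 : 0ℚ ≤ φ⁻
  φ⁻≥0 = inverse≥0 φ>0 φφ⁻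

  y≥1 : 1 N.≤ y
  y≥1 = NP.≤-trans (NP.*-mono-≤ {1} {40} {1} {N} 1≤suc (NP.<⇒≤ N≥2)) y≥

  yJ : y N.* H N.≤ J
  yJ = NP.*-mono-≤ y≤P (NP.m≤m*n H m {{N.>-nonZero m≥1}})

  2≤x : 2 N.≤ x (y N.* H)
  2≤x = NP.≤-trans (NP.^-monoʳ-≤ 2 y≥1) (2^≤x K m P K≥1 m≥1 P≥1 y)

  2≤X : 2 N.≤ X
  2≤X = NP.≤-trans 2≤x (ℕ≤≡ (mono (J N.∸ y N.* H) (y N.* H)) (cong x (NP.m∸n+n≡m yJ)))
   where
   mono : ∀ k j → x j N.≤ x (k N.+ j)
   mono zero j = NP.≤-refl
   mono (suc k) j = NP.≤-trans (mono k j) (x-mono (k N.+ j))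

  y◁ : ι y ◁ 1
  y◁ = small y≤P

  2y◁ : ι (suc (2 N.* y)) ◁ 3
  2y◁ = subst (_◁ 3) (sym (trans (ι-suc (2 N.* y)) (cong (1ℚ +_) (trans (ι-* 2 y) (trans (cong (_* ι y) ι-2) (id169 (ι y))))))) (up N.z≤n one ⊕ (y◁ ⊕ y◁))

  ℳ : ℚ
  ℳ = ι m

  ℳ≥1 : 1ℚ ≤ ℳ
  ℳ≥1 = subst (_≤ ℳ) ι-1 (ι-mono m≥1)

  ℳ≥0 : 0ℚ ≤ ℳ
  ℳ≥0 = ι≥0 m

  S^≤ℳ : ∀ i → i N.≤ 126 → S ^ i ≤ ℳ
  S^≤ℳ i h = ≤-trans (^-monoʳ S≥1 h) (≡≤ (S^≡ 126) (ι-mono m≥))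

  rm▷ : rec m ▷ 126
  rm▷ = rec▷ 126 m≥

  rec▷1 : ∀ c → 1 N.≤ c → c N.≤ 2 N.^ 25 → s ≤ rec c
  rec▷1 c h l = rec-mono h (NP.≤-trans l 2^25≤P)

  2s≤o : s + s ≤ o
  2s≤o = ≤≡ (+-mono s≤r s≤r) (trans (id233 (rec 2000)) (trans (cong (λ u → u * rec 2000) (sym ι-2)) (trans (cong (ι 2 *_) (rec-* 2 1000)) (trans (sym (*-assoc _ _ _)) (trans (cong (_* rec 1000) (ι*rec {2} 1≤suc)) (*-identityˡ _))))))
   where
   s≤r : s ≤ rec 2000
   s≤r = rec▷1 2000 1≤suc (NP.≤ᵇ⇒≤ 2000 (2 N.^ 25) tt)

  s≤o : s ≤ o
  s≤o = ≤-trans (≤+ʳ s≥0) 2s≤o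

  S^s : ∀ i → S ^ i ≡ S ^ suc i * s
  S^s i = sym (trans (id279 S (S ^ i) s) (trans (cong (_* S ^ i) Ss) (*-identityˡ _)))

  ◁⇒≤sℳ : ∀ {v} i → i N.≤ 125 → v ◁ i → v ≤ s * ℳ
  ◁⇒≤sℳ i h (_ , q) = ≤-trans q (≡≤ (trans (S^s i) (*-comm _ s)) (*-monoˡ s s≥0 (S^≤ℳ (suc i) (N.s≤s h))))

  module _ {ps : List ℕ} (sv : Sieving ps) (ps-prime : All Prime ps) (r z : ℕ) (Q≤z : Q N.≤ z)
   (complete : ∀ p → Prime p → Coprime p Q → p N.< z → p ∈ ps)
   (errS : ∀ k → k N.≤ 6 → ι J * InClass.errb K m P K≥1 m≥1 P≥1 Q sv r 0 k (y N.* H) B.▷ 8)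
   (err0 : ∀ k → k N.≤ 1 → ι J * InClass.errb K m P K≥1 m≥1 P≥1 Q [] 1 0 k (y N.* H) B.▷ 8)
   (V≥ : s ≤ V ps) (z≥ : 2 N.^ (16 N.* N) N.≤ z) (lg≤ : All (λ p → lgQ p ≤ S) ps) (h≤ : h ps ≤ S)
   where

   open Sums K m P K≥1 m≥1 P≥1 Q ps ps-prime using (R; L; U; L≥0; R≥0; τL; τU; R-convolution; U-convolution; ∥U∥)

   Vr : ℚ
   Vr = V ps * rec Q

   Vr≥0 : 0ℚ ≤ Vr
   Vr≥0 = 0≤* (V≥0 sv) (rec≥0 Q)

   I : ℕ → ℚ
   I = Moments.I K m P K≥1 m≥1 P≥1

   -- The density of sifted integers among all integers, summed over the reduced classes; the total
   -- mass of R_k is about c m^(k+1).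
   c : ℚ
   c = φ * Vr

   c≥0 : 0ℚ ≤ c
   c≥0 = 0≤* φ≥0 Vr≥0

   c≤1 : c ≤ 1ℚ
   c≤1 = ≤-trans (*-monoˡ φ φ≥0 (≤≡ (*-monoʳ (rec Q) (rec≥0 Q) (V≤1 sv)) (*-identityˡ _))) φ/Q≤1

   s²≤c : s * s ≤ c
   s²≤c = ≤≡ (*-mono s≥0 s≥0 V≥ (≤-trans (rec-mono (NP.<⇒≤ g≥2) (subst (g N.≤_) P≡ g≤P)) rg≤φ/Q)) (id8 (V ps) φ (rec Q))

   c>0 : 0ℚ < c
   c>0 = <-≤-trans (0<* s>0 s>0) s²≤c
    where
    s>0 : 0ℚ < s
    s>0 = rec>0 (NP.m^n>0 2 π)

   c⁻ : ℚ
   c⁻ = reciprocal c>0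
   cc⁻ : c * c⁻ ≡ 1ℚ
   cc⁻ = reciprocal-inverse c>0
   c⁻≥0 : 0ℚ ≤ c⁻
   c⁻≥0 = inverse≥0 c>0 cc⁻

   c⁻◁ : c⁻ ◁ 2
   c⁻◁ = c⁻≥0 , ≡≤ (sym (trans (cong (_* c⁻) (S^s^ 2)) (*-identityˡ _))) (≡≤ (*-assoc _ _ _) (≤≡ (*-monoˡ (S ^ 2) (^≥0 2 S≥0) (≤≡ (*-monoʳ c⁻ c⁻≥0 (≡≤ (cong (s *_) (*-identityʳ s)) s²≤c)) cc⁻)) (*-identityʳ _)))

   ε τ : ℚ
   ε = rec Q * S ^ 11
   τ = B.s ^ 7

   ε≥0 : 0ℚ ≤ ε
   ε≥0 = 0≤* (rec≥0 Q) (^≥0 11 S≥0)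
   τ≥0 : 0ℚ ≤ τ
   τ≥0 = ^≥0 7 B.s≥0

   errQ : ∀ k → k N.≤ 6 → ι J * InClass.errb K m P K≥1 m≥1 P≥1 Q sv r 0 k (y N.* H) ≤ rec Q
   errQ k hk = b^≤recQ 7 (errS k hk)

   poly≤ : ∀ k → k N.≤ 6 → ι y ^ k * ι (suc (2 N.* y)) + ι y * ι y ^ k + 1ℚ ≤ S ^ 11
   poly≤ k hk = _◁_.bound ((up (NP.+-monoˡ-≤ 3 k6) (yk · 2y◁) ⊕ up (NP.≤-trans (NP.+-monoʳ-≤ 1 k6) (NP.≤ᵇ⇒≤ 7 9 tt)) (y◁ · yk)) ⊕ up N.z≤n one)
    where
    k6 : k N.* 1 N.≤ 6
    k6 = ℕ≡≤ (NP.*-identityʳ k) hk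
    yk : ι y ^ k ◁ k N.* 1
    yk = pow k y◁

   R-osc-suc : ∀ k → suc k N.≤ 6 → ∀ t → ∣ R (suc k) t - Vr * I (suc k) ∣ ≤ ε
   R-osc-suc k hk t = ≤-trans (RoughSums.R≈-suc K m P K≥1 m≥1 P≥1 Q sv ps-prime r z Q≤z complete y y≥1 t yJ 2≤x errQ k hk) (*-monoˡ (rec Q) (rec≥0 Q) (poly≤ (suc k) hk))

   R-osc-0 : ∀ t → ∣ R 0 t - δ t - Vr * I 0 ∣ ≤ ε
   R-osc-0 t = ≤-trans (RoughSums.R≈-0 K m P K≥1 m≥1 P≥1 Q sv ps-prime r z Q≤z complete y y≥1 t yJ 2≤x errQ) (*-monoˡ (rec Q) (rec≥0 Q) (subst (_≤ S ^ 11) (cong (λ u → u + ι y * 1ℚ + 1ℚ) (*-identityˡ _)) (poly≤ 0 N.z≤n)))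

   open Mean φ⁻ φφ⁻ φ⁻≥0 hiding (π)

   M : ℕ → ℚ
   M k = ∑ (R k)

   φε≤ : φ * ε ≤ S ^ 11
   φε≤ = ≡≤ (sym (*-assoc _ _ _)) (≤≡ (*-monoʳ (S ^ 11) (^≥0 11 S≥0) φ/Q≤1) (*-identityˡ _))

   ∑-bound : ∀ {f} → (∀ t → ∣ f t ∣ ≤ ε) → ∣ ∑ f ∣ ≤ S ^ 11
   ∑-bound h = ≤-trans (Σ-abs≤ els (λ t _ → h t)) (≡≤ (∑-const ε) φε≤)

   mass≈cI : ∀ k → k N.≤ 6 → ∣ M k - c * I k ∣ ≤ S ^ 12
   mass≈cI zero _ = ≤-trans (subst (λ u → ∣ u ∣ ≤ S ^ 11 + 1ℚ) eq (abs-+ (∑-bound R-osc-0) (≤-reflexive (∣∣-nonneg 0≤1)))) (_◁_.bound (_⊕_ {i = 11} (^≥0 11 S≥0 , ≤-refl) (up N.z≤n one)))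
    where
    eq : ∑ (λ t → R 0 t - δ t - Vr * I 0) + 1ℚ ≡ M 0 - c * I 0
    eq = trans (cong (_+ 1ℚ) (trans (Σ-- els _ _) (cong₂ (λ u v → u - v) (trans (Σ-- els _ _) (cong (λ u → M 0 - u) ∑-δ)) (∑-const (Vr * I 0))))) (id268 (M 0) φ Vr (I 0))
   mass≈cI (suc k) hk = ≤-trans (subst (λ u → ∣ u ∣ ≤ S ^ 11) (trans (Σ-- els _ _) (cong (λ u → M (suc k) - u) (trans (∑-const (Vr * I (suc k))) (sym (*-assoc φ Vr _))))) (∑-bound (R-osc-suc k hk)))
     (^-monoʳ S≥1 (NP.n≤1+n 11))

   J≥6 : 6 N.≤ J
   J≥6 = NP.≤-trans (NP.≤-trans (NP.≤-trans (NP.≤ᵇ⇒≤ 6 40 tt) (NP.≤-trans (NP.*-monoʳ-≤ 20 N≥2) (NP.<⇒≤ big))) (NP.m≤m*n P J' {{N.>-nonZero J'≥1}})) NP.≤-refl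

   I≈ℳ : ∀ k → k N.≤ 6 → ∣ I k - ℳ ^ suc k ∣ ≤ 1ℚ
   I≈ℳ k hk = abs≤ (≤-trans (id269 (I k) (ℳ ^ suc k) via ≤⇒0≤ (Moments.I≤ K m P K≥1 m≥1 P≥1 k kJ)) 0≤1) (≤-trans (id270 (I k) (ℳ ^ suc k) df via ≤⇒0≤ (Moments.I≥ K m P K≥1 m≥1 P≥1 k kJ)) df≤1)
    where
    kJ : k N.≤ J
    kJ = NP.≤-trans hk J≥6
    df : ℚ
    df = Moments.defect K m P K≥1 m≥1 P≥1 k
    df≤1 : df ≤ 1ℚ
    df≤1 = _▷_.bound (down N.z≤n (toS (Sz.defect▷ W≤ Q big k hk)))

   mass≈ : ∀ k → k N.≤ 6 → ∣ M k - c * ℳ ^ suc k ∣ ≤ S ^ 13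
   mass≈ k hk = subst₂ _≤_ (cong ∣_∣ (id271 (M k) c (I k) (ℳ ^ suc k))) refl (≤-trans (abs-+ (mass≈cI k hk) (≤≡ (abs-* (≡≤ (∣∣-nonneg c≥0) c≤1) (I≈ℳ k hk)) (*-identityˡ 1ℚ)))
     (_◁_.bound (_⊕_ {i = 12} (^≥0 12 S≥0 , ≤-refl) (up N.z≤n one))))

   scale : ℕ → ℚ
   scale k = c⁻ * rec m ^ suc k

   rm^≤ : ∀ k → rec m ^ suc k ≤ rec m
   rm^≤ k = ≤≡ (^-antiʳ {m = 1} {n = suc k} (rec≥0 m) (≤-trans (_▷_.bound (down N.z≤n rm▷)) ≤-refl) 1≤suc) (*-identityʳ _)

   scale≥0 : ∀ k → 0ℚ ≤ scale k
   scale≥0 k = 0≤* c⁻≥0 (^≥0 (suc k) (rec≥0 m))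

   scale▷ : ∀ k → scale k ▷ 120
   scale▷ k = c⁻◁ ·▷ down (NP.≤ᵇ⇒≤ 122 126 tt) (below▷ (^≥0 (suc k) (rec≥0 m)) (rm^≤ k) rm▷)

   ℳrm : ∀ k → ℳ ^ k * rec m ^ k ≡ 1ℚ
   ℳrm k = trans (sym (^-* ℳ (rec m) k)) (trans (cong (_^ k) (ι*rec m≥1)) (1^ k))

   -- Normalised masses. The factor 1/c occurs once on each side of the convolution identity, so
   -- only the R_k carry it, and `MassSolve` shows that the L_k have mass about m^(k+1) without it.
   yy xx : ℕ → ℚ
   yy k = M k * scale k
   xx k = ∑ (L k) * rec m ^ suc k

   yy≈1 : ∀ k → k N.≤ 6 → ∣ yy k - 1ℚ ∣ ≤ s
   yy≈1 k hk = ≡≤ (trans (cong ∣_∣ eq) (trans (∣*∣ _ _) (cong (∣ M k - c * ℳ ^ suc k ∣ *_) (∣∣-nonneg (scale≥0 k))))) (≤-trans (*-monoʳ (scale k) (scale≥0 k) (mass≈ k hk)) (≤≡ (_▷_.bound (down {j = 1} (NP.≤ᵇ⇒≤ 1 107 tt) (_·▷_ {i = 13} {j = 107} (^≥0 13 S≥0 , ≤-refl) (scale▷ k)))) (*-identityʳ s)))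
    where
    eq : yy k - 1ℚ ≡ (M k - c * ℳ ^ suc k) * scale k
    eq = trans (cong (λ u → yy k - u) (sym (trans (cong₂ _*_ cc⁻ (ℳrm (suc k))) (*-identityˡ 1ℚ)))) (id272 (M k) c (ℳ ^ suc k) c⁻ (rec m ^ suc k))

   s≤rec2 : s ≤ rec 2
   s≤rec2 = rec▷1 2 1≤suc (NP.≤ᵇ⇒≤ 2 (2 N.^ 25) tt)

   half : 1ℚ ≤ 2ℚ * yy 0
   half = l (yy 0) s (rec 2) (trans (cong (_* rec 2) (sym ι-2)) (ι*rec {2} 1≤suc)) via 0≤* 2≥0 (0≤+ (≤⇒0≤ (≤-trans (-≤abs _) (yy≈1 0 N.z≤n))) (≤⇒0≤ s≤rec2))
    where
    l'' : 2ℚ - 1ℚ ≡ 1ℚ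
    l'' = trans (+-assoc 1ℚ 1ℚ (- 1ℚ)) (trans (cong (1ℚ +_) (+-inverseʳ 1ℚ)) (+-identityʳ 1ℚ))
    l : ∀ y s r → 2ℚ * r ≡ 1ℚ → 2ℚ * y - 1ℚ ≡ 2ℚ * ((s - - (y - 1ℚ)) + (r - s))
    l y s r e = trans (cong (λ u → 2ℚ * y - u) (sym (trans (cong (λ u → 2ℚ - u) e) l''))) (id273 y s r)

   φτ▷ : φ * τ B.▷ 6
   φτ▷ = φ◁ B.·▷ (τ≥0 B., ≤-refl)

   conv-R : ∀ k → k N.≤ 5 → Sup (λ b → ι (suc k) * R (suc k) b - Σ (range (suc k)) (λ i → (L i ⋆ R (k N.∸ i)) b)) τ
   conv-R k hk t = ≤-trans (R-convolution k t) (B._▷_.bound (Sz.τL▷ W≤ Q big ps-prime k hk))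

   conv-U : Sup (λ b → (U ⋆ R 0) b - δ b) τ
   conv-U t = ≤-trans (U-convolution 2≤X t) (B._▷_.bound (Sz.τU▷ W≤ Q big ps-prime))

   conv-yy : ∀ k → k N.≤ 5 → ∣ ι (suc k) * yy (suc k) - Σ (range (suc k)) (λ i → xx i * yy (k N.∸ i)) ∣ ≤ s
   conv-yy k hk = ≡≤ (trans (cong ∣_∣ eq) (trans (∣*∣ _ _) (cong (∣ D ∣ *_) (∣∣-nonneg (scale≥0 (suc k)))))) (≤-trans (*-monoʳ (scale (suc k)) (scale≥0 (suc k)) D≤)
     (≡≤ (*-comm _ _) (≤≡ (*-mono (scale≥0 (suc k)) (0≤* φ≥0 τ≥0) (_▷_.bound (down N.z≤n (scale▷ (suc k)))) (_▷_.bound (down {j = 1} 1≤suc (toS φτ▷)))) (trans (*-identityˡ _) (*-identityʳ s)))))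
    where
    D : ℚ
    D = ι (suc k) * M (suc k) - Σ (range (suc k)) (λ i → ∑ (L i) * M (k N.∸ i))
    D≡ : ∑ (λ b → ι (suc k) * R (suc k) b - Σ (range (suc k)) (λ i → (L i ⋆ R (k N.∸ i)) b)) ≡ D
    D≡ = trans (Σ-- els _ _) (cong₂ (λ u v → u - v) (Σ-*ˡ els (ι (suc k)) _) (trans (Σ-swap els (range (suc k)) _) (Σ-cong (range (suc k)) (λ i → ∑-⋆ (L i) (R (k N.∸ i))))))
    D≤ : ∣ D ∣ ≤ φ * τ
    D≤ = subst (λ u → ∣ u ∣ ≤ φ * τ) D≡ (≤≡ (Σ-abs≤ els (λ t _ → conv-R k hk t)) (∑-const τ))
    expo : ∀ i → i N.< suc k → rec m ^ suc i * rec m ^ suc (k N.∸ i) ≡ rec m ^ suc (suc k)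
    expo i hi = trans (sym (^-+ (rec m) (suc i) (suc (k N.∸ i)))) (cong (rec m ^_) (cong suc (trans (NP.+-suc i (k N.∸ i)) (cong suc (NP.m+[n∸m]≡n (NP.≤-pred hi))))))
    eq : ι (suc k) * yy (suc k) - Σ (range (suc k)) (λ i → xx i * yy (k N.∸ i)) ≡ D * scale (suc k)
    eq = trans (cong₂ (λ u v → u - v) (id89 (ι (suc k)) (M (suc k)) (scale (suc k)))
       (trans (Σ-cong∈ (range (suc k)) (λ i i∈ → trans (id274 (∑ (L i)) (M (k N.∸ i)) c⁻ (rec m ^ suc i) (rec m ^ suc (k N.∸ i))) (cong (λ u → ∑ (L i) * M (k N.∸ i) * (c⁻ * u)) (expo i (∈range i∈))))) (Σ-*ʳ (range (suc k)) (scale (suc k)) _))) (id275 _ _ (scale (suc k)))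

   -- 21874 is the value at k = 5. For errors below 1/1000 the scale 2^π must exceed 21874000,
   -- whence π ≥ 25.
   errorᶜ≤ : ∀ k → k N.≤ 5 → MassSolve.errorᶜ xx yy s s≥0 5 yy≈1 half conv-yy s≤1 k N.≤ 21874
   errorᶜ≤ 0 _ = NP.≤ᵇ⇒≤ _ 21874 tt
   errorᶜ≤ 1 _ = NP.≤ᵇ⇒≤ _ 21874 tt
   errorᶜ≤ 2 _ = NP.≤ᵇ⇒≤ _ 21874 tt
   errorᶜ≤ 3 _ = NP.≤ᵇ⇒≤ _ 21874 tt
   errorᶜ≤ 4 _ = NP.≤ᵇ⇒≤ _ 21874 tt
   errorᶜ≤ 5 _ = NP.≤ᵇ⇒≤ _ 21874 tt
   errorᶜ≤ (suc (suc (suc (suc (suc (suc k)))))) (N.s≤s (N.s≤s (N.s≤s (N.s≤s (N.s≤s ())))))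

   21874s≤o : ι 21874 * s ≤ o
   21874s≤o = ≤≡ (*-monoˡ (ι 21874) (ι≥0 21874) (rec▷1 (21874 N.* 1000) (NP.≤ᵇ⇒≤ 1 (21874 N.* 1000) tt) (NP.≤ᵇ⇒≤ (21874 N.* 1000) (2 N.^ 25) tt)))
     (trans (cong (ι 21874 *_) (rec-* 21874 1000)) (trans (sym (*-assoc _ _ _)) (trans (cong (_* o) (ι*rec {21874} (NP.≤ᵇ⇒≤ 1 21874 tt))) (*-identityˡ o))))

   mass : ∀ k → k N.≤ 5 → ∣ ∑ (L k) - ℳ ^ suc k ∣ ≤ o * ℳ ^ suc k
   mass k hk = ≡≤ (trans (cong ∣_∣ eq) (trans (∣*∣ _ _) (cong (∣ xx k - 1ℚ ∣ *_) (∣∣-nonneg ℳk≥0)))) (*-monoʳ (ℳ ^ suc k) ℳk≥0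
     (≤-trans (MassSolve.x≈1 xx yy s s≥0 5 yy≈1 half conv-yy s≤1 k hk) (≤-trans (*-monoʳ s s≥0 (ι-mono (errorᶜ≤ k hk))) 21874s≤o)))
    where
    ℳk≥0 : 0ℚ ≤ ℳ ^ suc k
    ℳk≥0 = ^≥0 (suc k) ℳ≥0
    eq : ∑ (L k) - ℳ ^ suc k ≡ (xx k - 1ℚ) * ℳ ^ suc k
    eq = trans (cong (λ u → u - ℳ ^ suc k) (sym (trans (cong (∑ (L k) *_) (ℳrm (suc k))) (*-identityʳ _)))) (id276 (∑ (L k)) (rec m ^ suc k) (ℳ ^ suc k))

   U₁ : ∥ U ∥₁ ≤ 2ℚ * ℳ
   U₁ = ≤-trans ∥U∥ (≤-trans (id277 (M 0) c ℳ (S ^ 13) via 0≤+ (≤⇒0≤ (≤-trans (≤abs _) (mass≈ 0 N.z≤n))) (0≤+ (≤⇒0≤ (S^≤ℳ 13 (NP.≤ᵇ⇒≤ 13 126 tt))) (0≤* (≤⇒0≤ c≤1) ℳ≥0))) ≤-refl)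

   errors : φ * (ι 34100 * (ε + ℳ * τ)) ≤ o * ℳ
   errors = ≡≤ (id278 φ (ι 34100) ε ℳ τ) (≤-trans (+-mono (◁⇒≤sℳ 12 (NP.≤ᵇ⇒≤ 12 125 tt) (k◁ · (0≤* φ≥0 ε≥0 , φε≤)))
     (*-monoʳ ℳ ℳ≥0 (≤≡ (_▷_.bound (down {j = 1} 1≤suc (_·▷_ {j = 5} k◁ (toS φτ▷)))) (*-identityʳ s))))
     (≡≤ (sym (*-distribʳ-+ ℳ s s)) (*-monoʳ ℳ ℳ≥0 2s≤o)))
    where
    k◁ : ι 34100 ◁ 1
    k◁ = literal 34100 (NP.≤ᵇ⇒≤ 34100 (2 N.^ 25) tt)

   z≥1 : 1 N.≤ z
   z≥1 = NP.≤-trans (NP.m^n>0 2 (16 N.* N)) z≥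

   empty : ∀ t → (∀ p → z N.≤ p → p N.< X → Prime p → ¬ (p ≈ val t)) → φ * L 5 t ≤ o * ℳ ^ 6
   empty t none = ≡≤ (sym eq) (≤-trans (_▷_.bound (down {j = 1} 1≤suc (toS small▷))) (≡≤ (*-identityʳ s) (≤-trans s≤o (subst (_≤ o * ℳ ^ 6) (*-identityʳ o) (*-monoˡ o o≥0 (1≤^ 6 ℳ≥1))))))
    where
    eq : φ * (L 5 t * ι z) * rec z ≡ φ * L 5 t
    eq = trans (id266 φ (L 5 t) (ι z) (rec z)) (trans (cong (φ * L 5 t *_) (ι*rec z≥1)) (*-identityʳ _))
    Lz : L 5 t * ι z B.◁ 8
    Lz = B.below (0≤* (L≥0 5 t) (ι≥0 z)) (RoughSums.L-without-primes K m P K≥1 m≥1 P≥1 Q sv ps-prime r z Q≤z complete 5 t none z≥1) (Sz.Gm◁ W≤ 5 B.· Sz.Pm◁ W≤ B.· (Sz.two◁ W≤ B.· Sz.W◁ W≤))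
    small▷ : φ * (L 5 t * ι z) * rec z B.▷ 7
    small▷ = B._·▷_ {i = 9} {j = 7} (φ◁ B.· Lz) (B.rec▷ 16 z≥)

   -- The first summand bounds the twisted sum over all prime powers, the second the contribution
   -- removed by sifting with the small primes.
   β : ℚ
   β = ι (2 N.* RealSums.C₀ K m P K≥1 m≥1 P≥1 g n g≥2 n≥3) * ((ι y * ι (suc (2 N.* y)) + φ * B.s ^ 8) + φ * τ) + S * (2ℚ * h ps)

   φe▷ : φ * B.s ^ 8 B.▷ 7
   φe▷ = φ◁ B.·▷ (^≥0 8 B.s≥0 B., ≤-refl)

   ▷⇒◁ : ∀ {v} i → v B.▷ i → v ◁ 0
   ▷⇒◁ i h' = down' (toS h')
    where
    down' : ∀ {v} → v ▷ i → v ◁ 0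
    down' (p , q) = p , ≤-trans q (^-antiʳ s≥0 s≤1 (N.z≤n {i}))

   h◁ : h ps ◁ 1
   h◁ = h≥0 ps , ≤≡ h≤ (sym (*-identityʳ S))

   S◁ : S ◁ 1
   S◁ = S≥0 , ≤-reflexive (sym (*-identityʳ S))

   2◁ : 2ℚ ◁ 1
   2◁ = 2≥0 , ≤≡ S≥2 (sym (*-identityʳ S))

   β◁ : β ◁ 8
   β◁ = (small C≤P · (((y◁ · 2y◁) ⊕ up N.z≤n (▷⇒◁ 7 φe▷)) ⊕ up N.z≤n (▷⇒◁ 6 φτ▷))) ⊕ up (NP.≤ᵇ⇒≤ 3 7 tt) (S◁ · (2◁ · h◁))

   twisted : ∀ {ε} → RealChar (units Q) ε → Nontrivial (units Q) ε → ∣ ∑ (λ t → ε t * L 0 t) ∣ ≤ β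
   twisted {ε'} ch nt = subst (λ u → ∣ u ∣ ≤ β) (id187 (∑ (λ t → ε' t * L° 0 t)) (∑ (λ t → ε' t * L 0 t))) (abs-- (≤-trans bound (*-monoˡ (ι (2 N.* C₀)) (ι≥0 (2 N.* C₀)) (+-monoʳ (ι y * ι (suc (2 N.* y)) + φ * B.s ^ 8) (*-monoˡ φ φ≥0 (B._▷_.bound (Sz.τL▷ W≤ Q big {[]} [] 0 N.z≤n))))))
     (RealSums.Twisted.SmallPrimes.L-difference K m P K≥1 m≥1 P≥1 g n g≥2 n≥3 ch nt ps ps-prime S S≥0 lg≤))
    where
    L° : ℕ → Unit Q → ℚ
    L° = Sums.L K m P K≥1 m≥1 P≥1 Q [] []
    τL° : ℕ → ℚ
    τL° = Sums.τL K m P K≥1 m≥1 P≥1 Q [] []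
    C₀ : ℕ
    C₀ = RealSums.C₀ K m P K≥1 m≥1 P≥1 g n g≥2 n≥3
    D≤ : suc (16 N.* (q₀ N.* (260 N.* (q₀ N.* q₀)))) N.≤ x (y N.* H)
    D≤ = NP.≤-trans (N.s≤s (ℕ≡≤ (l2 q₀ (260 N.* (q₀ N.* q₀))) (NP.*-mono-≤ {q₀} {2 N.^ π} (NP.≤-trans (n≤2^n q₀) (ℕ≤≡ q≤P P≡)) (ℕ≤≡ C≤P P≡))))
      (NP.≤-trans (ℕ≡≤ (cong suc (sym (NP.^-distribˡ-+-* 2 π π))) (NP.^-monoʳ-< 2 (N.s≤s 1≤suc) (NP.n<1+n (π N.+ π)))) (NP.≤-trans (NP.^-monoʳ-≤ 2 (NP.≤-trans 2π+1≤ y≥)) (2^≤x K m P K≥1 m≥1 P≥1 y)))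
     where
     l2 : ∀ q c → 16 N.* (q N.* c) ≡ q N.* (2 N.* (8 N.* c))
     l2 = solveℕ
     2π+1≤ : suc (π N.+ π) N.≤ 40 N.* N
     2π+1≤ = NP.≤-trans (NP.+-mono-≤ {1} {N} (NP.<⇒≤ N≥2) (NP.+-mono-≤ π≤N π≤N)) (ℕ≡≤ (l3 N) (NP.*-monoˡ-≤ N (NP.≤ᵇ⇒≤ 3 40 tt)))
      where
      l3 : ∀ N → N N.+ (N N.+ N) ≡ 3 N.* N
      l3 = solveℕ
    bound : ∣ ∑ (λ t → ε' t * L° 0 t) ∣ ≤ ι (2 N.* C₀) * ((ι y * ι (suc (2 N.* y)) + φ * B.s ^ 8) + φ * τL° 0)
    bound = RealSums.Twisted.Shapiro.L°0-bound K m P K≥1 m≥1 P≥1 g n g≥2 n≥3 ch nt y yJ (B.s ^ 8) (λ k hk → B._▷_.bound (err0 k hk)) D≤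
      (≤-trans (_▷_.bound (((subst (_▷ 2) (id267 (ι y) (ι (suc (2 N.* y))) (rec m)) (_·▷_ {i = 4} {j = 2} (y◁ · 2y◁) (down (NP.≤ᵇ⇒≤ 6 126 tt) rm▷))) ⊕▷ down (NP.≤ᵇ⇒≤ 2 7 tt) (toS φe▷)))) (≡≤ (*-identityʳ s) (rec-mono C≥1 (ℕ≤≡ C≤P P≡))))
     where
     C≥1 : 1 N.≤ 2 N.* C₀
     C≥1 = NP.*-mono-≤ {1} {2} 1≤suc (NP.*-mono-≤ {1} {8} 1≤suc (NP.*-mono-≤ {1} {260} 1≤suc (NP.*-mono-≤ (CharacterModulus.RealCharacters.q₀≥1 g n g≥2 n≥3) (CharacterModulus.RealCharacters.q₀≥1 g n g≥2 n≥3))))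

   κ : ℚ
   κ = ι (2 N.^ length (CharacterModulus.RealCharacters.reps g n g≥2 n≥3)) * β

   κ◁ : κ ◁ 9
   κ◁ = small (ℕ≡≤ (cong (2 N.^_) (CharacterModulus.RealCharacters.reps-length g n g≥2 n≥3)) q≤P) · β◁

   prime-in-class : ∀ t → ¬ (∀ p → z N.≤ p → p N.< X → Prime p → ¬ (p ≈ val t))
   prime-in-class t none = NoObstruction.contradiction (units Q) φ⁻ φφ⁻ φ⁻≥0 φ≥0 L R U τ ε ℳ (λ k → Vr * I k) L≥0 τ≥0 ε≥0 ℳ≥1 conv-R conv-U
    (λ { (suc k) _ hk b → R-osc-suc k hk b }) U₁ mass errors t (empty t none) κ (_◁_.nonneg κ◁) (≤-trans (◁⇒≤sℳ 9 (NP.≤ᵇ⇒≤ 9 125 tt) κ◁) (*-monoʳ ℳ ℳ≥0 s≤o))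
    (Decomposition.coset-equidistribution (units Q) φ⁻ φφ⁻ φ≥0 (CharacterModulus.RealCharacters.reps g n g≥2 n≥3) (CharacterModulus.RealCharacters.cover g n g≥2 n≥3) (L 0) β (_◁_.nonneg β◁) twisted)

-- Choice of parameters and primes in residue classes modulo gⁿ.

module Dirichlet where

 open Q
 open Kit
 open DividedPower
 open Arith
 open Sieve
 open Units
 open Blocks
 open Chebyshev
 open Equidistribution
 open Bounds

 module ℕScale (j : ℕ) (j≥1 : 1 N.≤ j) where
  infix 4 _⊴_
  record _⊴_ (c i : ℕ) : Set where
   constructor bd
   field bound : c N.≤ 2 N.^ (i N.* j)
  open _⊴_ public

  infixl 7 _⊗_
  infixl 6 _⊞_
  _⊗_ : ∀ {a b i k} → a ⊴ i → b ⊴ k → a N.* b ⊴ i N.+ k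
  _⊗_ {i = i} {k} (bd p) (bd q) = bd (ℕ≤≡ (NP.*-mono-≤ p q) (trans (sym (NP.^-distribˡ-+-* 2 (i N.* j) (k N.* j))) (cong (2 N.^_) (sym (NP.*-distribʳ-+ j i k)))))

  raise : ∀ {a i k} → i N.≤ k → a ⊴ i → a ⊴ k
  raise h (bd p) = bd (NP.≤-trans p (NP.^-monoʳ-≤ 2 (NP.*-monoˡ-≤ j h)))

  _⊞_ : ∀ {a b i} → a ⊴ i → b ⊴ i → a N.+ b ⊴ suc i
  _⊞_ {i = i} (bd p) (bd q) = bd (NP.≤-trans (NP.+-mono-≤ p q) (ℕ≡≤ (cong (2 N.^ (i N.* j) N.+_) (sym (NP.+-identityʳ _))) (NP.^-monoʳ-≤ 2 (NP.+-monoˡ-≤ (i N.* j) j≥1))))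

 -- The largest parameter, `y`, is of order 2^(19j) and must stay below P = 2^(2^j); the inequality
 -- holds from j = 11 on, which is the shift in `j`.
 19j≤2^j : ∀ k → 19 N.* (k N.+ 11) N.≤ 2 N.^ (k N.+ 11)
 19j≤2^j zero = NP.≤ᵇ⇒≤ 209 2048 tt
 19j≤2^j (suc k) = ℕ≡≤ (NP.*-suc 19 (k N.+ 11)) (ℕ≤≡ (NP.+-mono-≤ 19≤ (19j≤2^j k)) (cong (2 N.^ (k N.+ 11) N.+_) (sym (NP.+-identityʳ _))))
  where
  19≤ : 19 N.≤ 2 N.^ (k N.+ 11)
  19≤ = NP.≤-trans (NP.≤ᵇ⇒≤ 19 2048 tt) (NP.^-monoʳ-≤ 2 (NP.m≤n+m 11 k))

 -- n = 128π leaves room for log X ≈ 2Pm = 2^(127π + 1). N makes Q ≤ 2^N. H = 2K = 2^(20N) beats the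
 -- rounding errors, and z > 2^(16N) beats the contribution of higher prime powers. h₀ bounds the
 -- sum of 1/p over the sieving primes, r is the depth at which `dp-small` gives 2^(-40N), and y is
 -- so large that 2^(-y) times the sieve's rounding errors, about 2^((4+I) r), is still 2^(-40N).
 module Parameters (g : ℕ) (g≥2 : 2 N.≤ g) (b₀ : ℕ) where
  q₀ k₀ j π n N m P K I z h₀ r y : ℕ
  q₀ = g N.* (g N.* (g N.* 1))
  k₀ = q₀ N.+ b₀
  j = k₀ N.+ 11
  π = 2 N.^ j
  n = 128 N.* π
  N = g N.* n
  m = 2 N.^ (126 N.* π)
  P = 2 N.^ π
  K = 2 N.^ (20 N.* N N.∸ 1)
  I = 16 N.* N
  z = suc (2 N.^ I)
  h₀ = suc I
  r = h₀ N.* (2 N.* h₀) N.+ 40 N.* N N.+ 2 N.* h₀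
  y = (5 N.+ I) N.* r N.+ 40 N.* N

 -- The parameters enter through their defining equations, so that their numerals never unfold.
 module _ (g : ℕ) (g≥2 : 2 N.≤ g) (b₀ q₀ j π n N m P K I z h₀ r y : ℕ) (q₀≡ : q₀ ≡ g N.* (g N.* (g N.* 1))) (j≡ : j ≡ q₀ N.+ b₀ N.+ 11) (π≡ : π ≡ 2 N.^ j) (n≡ : n ≡ 128 N.* π) (N≡ : N ≡ g N.* n)
  (m≡ : m ≡ 2 N.^ (126 N.* π)) (P≡ : P ≡ 2 N.^ π) (K≡ : K ≡ 2 N.^ (20 N.* N N.∸ 1)) (I≡ : I ≡ 16 N.* N) (z≡ : z ≡ suc (2 N.^ I)) (h₀≡ : h₀ ≡ suc I)
  (r≡ : r ≡ h₀ N.* (2 N.* h₀) N.+ 40 N.* N N.+ 2 N.* h₀) (y≡ : y ≡ (5 N.+ I) N.* r N.+ 40 N.* N) where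

  j≥11 : 11 N.≤ j
  j≥11 = subst (11 N.≤_) (sym j≡) (NP.m≤n+m 11 (q₀ N.+ b₀))

  open ℕScale j (NP.≤-trans 1≤suc j≥11)

  lit : ∀ c → c N.≤ 2 N.^ 11 → c ⊴ 1
  lit c h = bd (NP.≤-trans h (NP.^-monoʳ-≤ 2 (ℕ≤≡ j≥11 (sym (NP.*-identityˡ j)))))

  π⊴ : π ⊴ 1
  π⊴ = bd (NP.≤-reflexive (trans π≡ (cong (2 N.^_) (sym (NP.*-identityˡ j)))))

  q₀≤j : q₀ N.≤ j
  q₀≤j = ℕ≤≡ (NP.≤-trans (NP.m≤m+n q₀ b₀) (NP.m≤m+n _ 11)) (sym j≡)

  q₀≤π : q₀ N.≤ π
  q₀≤π = NP.≤-trans q₀≤j (ℕ≤≡ (n≤2^n j) (sym π≡))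

  g≥1 : 1 N.≤ g
  g≥1 = NP.<⇒≤ g≥2

  g≤q₀ : g N.≤ q₀
  g≤q₀ = ℕ≤≡ (NP.m≤m*n g (g N.* (g N.* 1)) {{N.>-nonZero (NP.*-mono-≤ g≥1 (NP.*-mono-≤ g≥1 (NP.≤-refl {1})))}}) (sym q₀≡)

  q₀⊴ : q₀ ⊴ 1
  q₀⊴ = bd (NP.≤-trans q₀≤π (bound π⊴))

  g⊴ : g ⊴ 1
  g⊴ = bd (NP.≤-trans g≤q₀ (bound q₀⊴))

  n⊴ : n ⊴ 2
  n⊴ = subst (_⊴ 2) (sym n≡) (lit 128 (NP.≤ᵇ⇒≤ 128 2048 tt) ⊗ π⊴)

  N⊴ : N ⊴ 3
  N⊴ = subst (_⊴ 3) (sym N≡) (g⊴ ⊗ n⊴)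

  I⊴ : I ⊴ 4
  I⊴ = subst (_⊴ 4) (sym I≡) (lit 16 (NP.≤ᵇ⇒≤ 16 2048 tt) ⊗ N⊴)

  1⊴ : 1 ⊴ 1
  1⊴ = lit 1 (NP.≤ᵇ⇒≤ 1 2048 tt)
  2⊴ : 2 ⊴ 1
  2⊴ = lit 2 (NP.≤ᵇ⇒≤ 2 2048 tt)

  r↑ : ∀ {a i} k → a ⊴ i → i N.≤ k → a ⊴ k
  r↑ k h l = raise l h

  h₀⊴ : h₀ ⊴ 5
  h₀⊴ = subst (_⊴ 5) (sym h₀≡) (r↑ 4 1⊴ (NP.≤ᵇ⇒≤ 1 4 tt) ⊞ I⊴)

  40N⊴ : 40 N.* N ⊴ 4
  40N⊴ = lit 40 (NP.≤ᵇ⇒≤ 40 2048 tt) ⊗ N⊴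

  r⊴ : r ⊴ 13
  r⊴ = subst (_⊴ 13) (sym r≡) ((h₀⊴ ⊗ (2⊴ ⊗ h₀⊴) ⊞ r↑ 11 40N⊴ (NP.≤ᵇ⇒≤ 4 11 tt)) ⊞ r↑ 12 (2⊴ ⊗ h₀⊴) (NP.≤ᵇ⇒≤ 6 12 tt))

  y⊴ : y ⊴ 19
  y⊴ = subst (_⊴ 19) (sym y≡) ((r↑ 4 (lit 5 (NP.≤ᵇ⇒≤ 5 2048 tt)) (NP.≤ᵇ⇒≤ 1 4 tt) ⊞ I⊴) ⊗ r⊴ ⊞ r↑ 18 40N⊴ (NP.≤ᵇ⇒≤ 4 18 tt))

  ⊴⇒≤P : ∀ {c} i → i N.≤ 19 → c ⊴ i → c N.≤ P
  ⊴⇒≤P i h c = NP.≤-trans (bound (raise h c)) (ℕ≤≡ (NP.^-monoʳ-≤ 2 (ℕ≤≡ (subst (λ u → 19 N.* u N.≤ 2 N.^ u) (sym j≡) (19j≤2^j (q₀ N.+ b₀))) (sym π≡))) (sym P≡))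

  y≤P : y N.≤ P
  y≤P = ⊴⇒≤P 19 NP.≤-refl y⊴

  y≥ : 40 N.* N N.≤ y
  y≥ = ℕ≤≡ (NP.m≤n+m (40 N.* N) ((5 N.+ I) N.* r)) (sym y≡)

  π≥ : 2048 N.≤ π
  π≥ = ℕ≤≡ (NP.^-monoʳ-≤ 2 {11} j≥11) (sym π≡)

  π≤n : π N.≤ n
  π≤n = ℕ≤≡ (NP.m≤n*m π 128) (sym n≡)

  n≤N : n N.≤ N
  n≤N = ℕ≤≡ (NP.m≤n*m n g {{N.>-nonZero g≥1}}) (sym N≡)

  n≥3 : 3 N.≤ n
  n≥3 = NP.≤-trans (NP.≤-trans (NP.≤ᵇ⇒≤ 3 2048 tt) π≥) π≤n

  N≥2048 : 2048 N.≤ N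
  N≥2048 = NP.≤-trans π≥ (NP.≤-trans π≤n n≤N)

  N≥2 : 2 N.≤ N
  N≥2 = NP.≤-trans (NP.≤ᵇ⇒≤ 2 2048 tt) N≥2048

  N≥1 : 1 N.≤ N
  N≥1 = NP.<⇒≤ N≥2

  b₀≤n : b₀ N.≤ n
  b₀≤n = NP.≤-trans (ℕ≤≡ (NP.≤-trans (NP.m≤n+m b₀ q₀) (NP.m≤m+n _ 11)) (sym j≡)) (NP.≤-trans (n≤2^n j) (ℕ≡≤ (sym π≡) π≤n))

  K≥1 : 1 N.≤ K
  K≥1 = subst (1 N.≤_) (sym K≡) (NP.m^n>0 2 (20 N.* N N.∸ 1))

  H≡ : 2 N.* K ≡ 2 N.^ (20 N.* N)
  H≡ = trans (cong (2 N.*_) K≡) (cong (2 N.^_) (NP.m+[n∸m]≡n {1} {20 N.* N} (NP.*-mono-≤ {1} {20} 1≤suc N≥1)))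

  m≥1 : 1 N.≤ m
  m≥1 = subst (1 N.≤_) (sym m≡) (NP.m^n>0 2 (126 N.* π))

  P≥1 : 1 N.≤ P
  P≥1 = subst (1 N.≤_) (sym P≡) (NP.m^n>0 2 π)

  -- Here P m = 2^(127π), and 2^n = 2^(128π). This inequality is the source of the bound 2^(2^n) for
  -- the primes.
  Wd≤ : suc (2 N.* (P N.* m)) N.≤ 2 N.^ n
  Wd≤ = NP.≤-trans (NP.+-mono-≤ (NP.m^n>0 2 (suc (127 N.* π))) (NP.≤-reflexive (cong (2 N.*_) (trans (cong₂ N._*_ P≡ m≡) (sym (NP.^-distribˡ-+-* 2 π (126 N.* π)))))))
   (ℕ≡≤ (cong (2 N.^ suc (127 N.* π) N.+_) (sym (NP.+-identityʳ _))) (NP.^-monoʳ-≤ 2 (ℕ≤≡ (NP.+-monoˡ-≤ (127 N.* π) (NP.≤-trans (NP.≤ᵇ⇒≤ 2 2048 tt) π≥)) (sym n≡))))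

  W≤ : suc (2 N.* (P N.* m)) N.≤ 2 N.^ N
  W≤ = NP.≤-trans Wd≤ (NP.^-monoʳ-≤ 2 n≤N)

  big : 20 N.* N N.< P
  big = ⊴⇒≤P 5 (NP.≤ᵇ⇒≤ 5 19 tt) (r↑ 4 1⊴ (NP.≤ᵇ⇒≤ 1 4 tt) ⊞ (lit 20 (NP.≤ᵇ⇒≤ 20 2048 tt) ⊗ N⊴))

  Q≤ : g N.^ n N.≤ 2 N.^ N
  Q≤ = ℕ≤≡ (NP.^-monoˡ-≤ n (n≤2^n g)) (trans (NP.^-*-assoc 2 g n) (cong (2 N.^_) (sym N≡)))

  g≤P : g N.≤ P
  g≤P = ⊴⇒≤P 1 (NP.≤ᵇ⇒≤ 1 19 tt) g⊴

  C≤P : 2 N.* (8 N.* (260 N.* (g N.* (g N.* (g N.* 1)) N.* (g N.* (g N.* (g N.* 1)))))) N.≤ P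
  C≤P = subst (λ u → 2 N.* (8 N.* (260 N.* (u N.* u))) N.≤ P) q₀≡ (⊴⇒≤P 5 (NP.≤ᵇ⇒≤ 5 19 tt) (2⊴ ⊗ (lit 8 (NP.≤ᵇ⇒≤ 8 2048 tt) ⊗ (lit 260 (NP.≤ᵇ⇒≤ 260 2048 tt) ⊗ (q₀⊴ ⊗ q₀⊴)))))

  q≤P : 2 N.^ (g N.* (g N.* (g N.* 1))) N.≤ P
  q≤P = subst (λ u → 2 N.^ u N.≤ P) q₀≡ (ℕ≤≡ (NP.^-monoʳ-≤ 2 q₀≤π) (sym P≡))

  Q : ℕ
  Q = g N.^ n

  instance
   nzQ : NonZero Q
   nzQ = CharacterModulus.RealCharacters.nzQ g n g≥2 n≥3

  open Congruence Q using (Sieving; []; _≈_; h; h≥0; A)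
  open Weights K m P K≥1 m≥1 P≥1 hiding (g)
  open Scale N N≥1

  Q≤z : Q N.≤ z
  Q≤z = NP.≤-trans Q≤ (NP.≤-trans (NP.^-monoʳ-≤ 2 (ℕ≤≡ (NP.m≤n*m N 16) (sym I≡))) (ℕ≤≡ (NP.n≤1+n _) (sym z≡)))

  ps : List ℕ
  ps = primes (ok? Q) z

  sv : Sieving ps
  sv = sieving Q z

  ps-prime : All Prime ps
  ps-prime = All.map proj₁ (primes-below (ok? Q) z)

  h≤ : h ps ≤ ι h₀
  h≤ = ≤-trans (recsum≤ (ok? Q) z) (≡≤ (cong (λ u → Σ (range u) rec) z≡) (≤≡ (+-mono (rec≤one (2 N.^ I) (NP.m^n>0 2 I)) (harmonic I)) (sym (trans (cong ι h₀≡) (ι-suc I)))))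
   where
   rec≤one : ∀ n → 1 N.≤ n → rec n ≤ 1ℚ
   rec≤one (suc n) _ = rec≤1 n

  initial▷ : ρ⁻ ^ (y N.* H) ▷ 40
  initial▷ = below▷ (^≥0 (y N.* H) (0≤* (ι≥0 H) (rec≥0 (suc H)))) (ρ⁻≤ K m P K≥1 m≥1 P≥1 y) (rec▷ 40 (NP.^-monoʳ-≤ 2 y≥))

  weighted▷ : ∀ a {A₀} → 0ℚ ≤ A₀ → A₀ ≤ ι (2 N.^ a) → suc (suc a) N.+ 40 N.* N N.≤ y → ρ⁻ ^ (y N.* H) * (1ℚ + (A₀ + A₀)) ▷ 40
  weighted▷ a {A₀} A≥0 A≤ hy = below▷ (0≤* i≥0 a≥0) (*-mono i≥0 a≥0 (ρ⁻≤ K m P K≥1 m≥1 P≥1 y) A≤') (0≤* (rec≥0 (2 N.^ y)) (ι≥0 (2 N.^ suc (suc a))) , ≤≡ (*-monoʳ (ι (2 N.^ suc (suc a))) (ι≥0 (2 N.^ suc (suc a))) (rec-mono (NP.m^n>0 2 (suc (suc a) N.+ 40 N.* N)) (NP.^-monoʳ-≤ 2 hy))) eq)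
   where
   i≥0 : 0ℚ ≤ ρ⁻ ^ (y N.* H)
   i≥0 = ^≥0 (y N.* H) (0≤* (ι≥0 H) (rec≥0 (suc H)))
   a≥0 : 0ℚ ≤ 1ℚ + (A₀ + A₀)
   a≥0 = 0≤+ 0≤1 (0≤+ A≥0 A≥0)
   A≤' : 1ℚ + (A₀ + A₀) ≤ ι (2 N.^ suc (suc a))
   A≤' = ≤-trans (+-mono (subst (_≤ ι (2 N.^ a)) ι-1 (ι-mono (NP.m^n>0 2 a))) (+-mono A≤ A≤)) (≤≡ (≤≡ (≤+ʳ (ι≥0 (2 N.^ a))) (id280 (ι (2 N.^ a)))) (sym (trans (ι-* 2 (2 N.^ suc a)) (cong₂ _*_ ι-2 (trans (ι-* 2 (2 N.^ a)) (cong (_* ι (2 N.^ a)) ι-2))))))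
   eq : rec (2 N.^ (suc (suc a) N.+ 40 N.* N)) * ι (2 N.^ suc (suc a)) ≡ s ^ 40
   eq = trans (cong (λ u → u * ι (2 N.^ suc (suc a))) (trans (cong rec (NP.^-distribˡ-+-* 2 (suc (suc a)) (40 N.* N))) (rec-* (2 N.^ suc (suc a)) (2 N.^ (40 N.* N))))) (trans (id264 _ _ _) (trans (cong (_* rec (2 N.^ (40 N.* N))) (ι*rec (NP.m^n>0 2 (suc (suc a))))) (trans (*-identityˡ _) (sym (s^≡ 40)))))

  r≥2 : 2 N.≤ r
  r≥2 = NP.≤-trans (NP.≤-trans N≥2 (NP.m≤n*m N 40)) (ℕ≤≡ (NP.≤-trans (NP.m≤n+m (40 N.* N) (h₀ N.* (2 N.* h₀))) (NP.m≤m+n _ (2 N.* h₀))) (sym r≡))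

  A≤ : A (length ps) r ≤ ι (2 N.^ ((4 N.+ I) N.* r))
  A≤ = ≤≡ (^-mono r (0≤* (ι≥0 3) (ι≥0 _)) (≡≤ (sym (ι-* 3 (suc (length ps)))) (ι-mono (NP.≤-trans (NP.*-monoʳ-≤ 3 (N.s≤s (length-primes (ok? Q) z))) (ℕ≡≤ (cong (λ u → 3 N.* suc u) z≡) 3z)))))
   (trans (sym (ι-^ (2 N.^ (4 N.+ I)) r)) (cong ι (NP.^-*-assoc 2 (4 N.+ I) r)))
   where
   3z : 3 N.* suc (suc (2 N.^ I)) N.≤ 2 N.^ (4 N.+ I)
   3z = go (2 N.^ I) (NP.m^n>0 2 I)
    where
    go : ∀ t → 1 N.≤ t → 3 N.* suc (suc t) N.≤ 2 N.* (2 N.* (2 N.* (2 N.* t)))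
    go t h = NP.≤-trans (NP.*-monoʳ-≤ 3 (NP.+-mono-≤ h (NP.+-monoˡ-≤ t h))) (ℕ≡≤ (l t) (ℕ≤≡ (NP.*-monoˡ-≤ t (NP.≤ᵇ⇒≤ 9 16 tt)) (l' t)))
     where
     l : ∀ t → 3 N.* (t N.+ (t N.+ t)) ≡ 9 N.* t
     l = solveℕ
     l' : ∀ t → 16 N.* t ≡ 2 N.* (2 N.* (2 N.* (2 N.* t)))
     l' = solveℕ

  rec-Q≤1 : rec Q ≤ 1ℚ
  rec-Q≤1 = go Q (N.>-nonZero⁻¹ Q)
   where
   go : ∀ n → 1 N.≤ n → rec n ≤ 1ℚ
   go (suc n) _ = rec≤1 n

  errS : ∀ k → k N.≤ 6 → ι J * InClass.errb K m P K≥1 m≥1 P≥1 Q sv r 0 k (y N.* H) ▷ 8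
  errS k hk = Sizes.Orders.errb▷ N K m P N≥2 K≥1 m≥1 P≥1 H≡ W≤ Q sv r y k hk initial▷ (weighted▷ ((4 N.+ I) N.* r) (^≥0 r (0≤* (ι≥0 3) (ι≥0 _))) A≤ enough)
    (0≤* (dp≥0 r (h≥0 ps)) (rec≥0 Q) , ≤≡ (*-mono (dp≥0 r (h≥0 ps)) (rec≥0 Q) (≡≤ (cong (λ u → dp u (h ps)) r≡) (dp-small h₀ (40 N.* N) (h≥0 ps) h≤)) rec-Q≤1) (trans (*-identityʳ _) (sym (s^≡ 40))))
   where
   enough : suc (suc ((4 N.+ I) N.* r)) N.+ 40 N.* N N.≤ y
   enough = ℕ≤≡ (NP.+-monoˡ-≤ (40 N.* N) (NP.+-monoˡ-≤ ((4 N.+ I) N.* r) r≥2)) (sym y≡)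

  err0 : ∀ k → k N.≤ 1 → ι J * InClass.errb K m P K≥1 m≥1 P≥1 Q [] 1 0 k (y N.* H) ▷ 8
  err0 k hk = Sizes.Orders.errb▷ N K m P N≥2 K≥1 m≥1 P≥1 H≡ W≤ Q [] 1 y k (NP.≤-trans hk (NP.≤ᵇ⇒≤ 1 6 tt)) initial▷ (weighted▷ 2 (^≥0 1 (0≤* (ι≥0 3) (ι≥0 1))) (≡≤ (trans (*-identityʳ _) (sym (ι-* 3 1))) (ι-mono (NP.≤ᵇ⇒≤ 3 4 tt))) enough)
    (0≤* (dp≥0 1 ≤-refl) (rec≥0 Q) , ≤-trans (*-monoʳ (rec Q) (rec≥0 Q) (≤≡ (dp≤^ 1 (≤-refl {0ℚ})) (*-zeroˡ 1ℚ))) (≡≤ (*-zeroˡ (rec Q)) (^≥0 40 s≥0)))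
   where
   enough : 4 N.+ 40 N.* N N.≤ y
   enough = ℕ≤≡ (NP.+-monoˡ-≤ (40 N.* N) (NP.≤-trans (NP.≤ᵇ⇒≤ 4 10 tt) (NP.*-mono-≤ {5} {5 N.+ I} (NP.m≤m+n 5 I) r≥2))) (sym y≡)

  V≥ : rec (2 N.^ π) ≤ Congruence.V Q ps
  V≥ = ≤-trans (rec-mono (NP.*-mono-≤ {1} {4} 1≤suc 1≤suc) size) (≤≡ (density-lower (ok? Q) j') (sym (trans (V≡density Q z) (cong (density (ok? Q)) (trans z≡ (cong (λ u → suc (2 N.^ u)) (sym I3)))))))
   where
   I≥3 : 3 N.≤ I
   I≥3 = NP.≤-trans (NP.≤-trans (NP.≤ᵇ⇒≤ 3 2048 tt) N≥2048) (ℕ≤≡ (NP.m≤n*m N 16) (sym I≡))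
   j' : ℕ
   j' = I N.∸ 3
   I3 : 3 N.+ j' ≡ I
   I3 = NP.m+[n∸m]≡n I≥3
   size : 4 N.* (suc (suc j') N.* suc j') N.≤ 2 N.^ π
   size = NP.≤-trans (NP.*-monoʳ-≤ 4 (NP.*-mono-≤ (ℕ≤≡ (NP.n≤1+n _) I3) (ℕ≤≡ (NP.≤-trans (NP.n≤1+n _) (NP.n≤1+n _)) I3)))
    (ℕ≤≡ (⊴⇒≤P 9 (NP.≤ᵇ⇒≤ 9 19 tt) (lit 4 (NP.≤ᵇ⇒≤ 4 2048 tt) ⊗ (I⊴ ⊗ I⊴))) P≡)

  h₀≤P : h₀ N.≤ 2 N.^ π
  h₀≤P = ℕ≤≡ (⊴⇒≤P 5 (NP.≤ᵇ⇒≤ 5 19 tt) h₀⊴) P≡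

  lg≤ : All (λ p → lgQ p ≤ ι (2 N.^ π)) ps
  lg≤ = All.map (λ { {p} (pp , _ , lt) → bound' p (NP.<⇒≤ (prime>1 pp)) lt }) (primes-below (ok? Q) z)
   where
   open import Data.Nat.Primality using (prime⇒nonTrivial)
   prime>1 : ∀ {p} → Prime p → 1 N.< p
   prime>1 {p} pp = N.nonTrivial⇒n>1 p {{prime⇒nonTrivial pp}}
   bound' : ∀ p → 1 N.≤ p → p N.< z → lgQ p ≤ ι (2 N.^ π)
   bound' p p1 lt = ≤-trans (*-monoʳ (rec H) (rec≥0 H) (ι-mono (NP.<⇒≤ (Local.lg-initial K m P K≥1 m≥1 P≥1 Q sv ps-prime r h₀ p1 px))))
    (≡≤ (trans (cong (_* rec H) (ι-* h₀ H)) (trans (*-assoc _ _ _) (trans (cong (ι h₀ *_) (ι*rec H≥1)) (*-identityʳ _)))) (ι-mono h₀≤P))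
    where
    px : p N.< x (h₀ N.* H)
    px = NP.<-≤-trans lt (NP.≤-trans (ℕ≡≤ z≡ (ℕ≤≡ (NP.+-monoˡ-≤ (2 N.^ I) (NP.m^n>0 2 I)) (trans (cong (2 N.^ I N.+_) (sym (NP.+-identityʳ _))) (cong (2 N.^_) (sym h₀≡))))) (2^≤x K m P K≥1 m≥1 P≥1 h₀))

  z≥ : 2 N.^ (16 N.* N) N.≤ z
  z≥ = ℕ≡≤ (cong (2 N.^_) (sym I≡)) (ℕ≤≡ (NP.n≤1+n _) (sym z≡))

  -- The search below X is finite and decidable, so refuting the absence of primes is enough to
  -- obtain one.
  prime-in-class : ∀ a → Coprime a g → ∃[ p ] (Prime p × Q N.≤ p × p N.< 2 N.^ (2 N.^ n) × p ≈ a)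
  prime-in-class a cg = by (NP.anyUpTo? (λ p → (z N.≤? p) ×-dec (prime? p ×-dec (p % Q N.≟ a % Q))) X)
   where
   by : Dec (∃[ p ] (p N.< X × (z N.≤ p × (Prime p × p % Q ≡ a % Q)))) → ∃[ p ] (Prime p × Q N.≤ p × p N.< 2 N.^ (2 N.^ n) × p ≈ a)
   by (yes (p , lt , zp , pp , e)) = p , pp , NP.≤-trans Q≤z zp , NP.<-≤-trans lt (NP.≤-trans X≤ (NP.^-monoʳ-≤ 2 Wd≤)) , e
   by (no none) = ⊥-elim (Core.Setting.prime-in-class g n N π K m P g≥2 n≥3 N≥2 (NP.≤-trans (NP.≤ᵇ⇒≤ 25 2048 tt) π≥) K≥1 m≥1 P≥1 P≡ H≡ (NP.≤-trans π≤n n≤N) W≤ big Q≤ (NP.≤-reflexive (sym m≡)) y y≤P y≥ g≤P C≤P q≤P sv ps-prime r z Q≤z (λ p pp c lt → primes-complete (ok? Q) z pp (λ {i} → c {i}) lt) errS err0 V≥ z≥ lg≤ (≤-trans h≤ (ι-mono h₀≤P)) (un Q a)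
    (λ p zp pX pp e → none (p , pX , zp , pp , trans e (sym (un-≈ Q (un Q a) (λ {i} → CharacterModulus.RealCharacters.coprime-^ g n g≥2 n≥3 a n (λ {j} → cg {j}) {i}) refl)))))

  conclusion : ∃[ n ] (b₀ N.≤ n × (∀ a → Coprime a g → ∃[ p ] (Prime p × g N.^ n N.≤ p × p N.< 2 N.^ (2 N.^ n) × (∀ {{_ : NonZero (g N.^ n)}} → p % (g N.^ n) ≡ a % (g N.^ n)))))
  conclusion = n , b₀≤n , λ a c → let (p , pp , lo , hi , e) = prime-in-class a (λ {i} → c {i}) in p , pp , lo , hi , e

 primes-modulo-powers : ∀ g → 2 N.≤ g → ∀ b → ∃[ n ] (b N.≤ n × (∀ a → Coprime a g → ∃[ p ] (Prime p × g N.^ n N.≤ p × p N.< 2 N.^ (2 N.^ n) × (∀ {{_ : NonZero (g N.^ n)}} → p % (g N.^ n) ≡ a % (g N.^ n)))))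
 primes-modulo-powers g g≥2 b = conclusion g g≥2 b q₀ j π n N m P K I z h₀ r y refl refl refl refl refl refl refl refl refl refl refl refl refl
  where open Parameters g g≥2 b

-- The digit sequence from a chain of primes, and the counting.

module Chain where

 open import Defs
 open Units using (coprime-≈; coprime-1)
 open import Data.Nat as N using (ℕ; zero; suc; _+_; _*_; _^_; _∸_; _≤_; _<_; NonZero; z≤n; s≤s)
 open import Data.Nat.Properties as NP using (≤-trans; ≤-refl; ≤-reflexive)
 open import Data.Nat.DivMod hiding (_mod_)
 open import Data.Nat.Divisibility using (_∣_; divides; n∣m*n)
 open import Data.Nat.Coprimality using (Coprime)
 open import Data.Nat.Primality using (Prime; prime?)
 open import Data.Nat.Tactic.RingSolver using () renaming (solve-∀ to solveℕ)
 open import Data.Fin using (Fin; toℕ; fromℕ<)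
 open import Data.Fin.Properties using (toℕ-fromℕ<)
 open import Data.Bool using (if_then_else_)
 open import Data.Sum using (_⊎_; inj₁; inj₂)
 open import Data.Product using (_×_; _,_; proj₁; proj₂; ∃-syntax)
 open import Data.Empty using (⊥-elim)
 open import Relation.Nullary using (Dec; yes; no)
 open import Relation.Nullary.Decidable using (dec-true)
 open import Relation.Binary.PropositionalEquality

 module Counting (g : ℕ) (D : ℕ → Fin g) where

  ϖ-mono : ∀ a t → ϖ g D a ≤ ϖ g D (t + a)
  ϖ-mono a zero = ≤-refl
  ϖ-mono a (suc t) = ≤-trans (ϖ-mono a t) (NP.m≤m+n _ _)

  ϖ-primes : ∀ a t → (∀ n → a < n → n ≤ t + a → Prime (u g D n)) → t + ϖ g D a ≤ ϖ g D (t + a)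
  ϖ-primes a zero _ = ≤-refl
  ϖ-primes a (suc t) h = ≤-trans (≤-reflexive (NP.+-comm 1 (t + ϖ g D a))) (NP.+-mono-≤ (ϖ-primes a t (λ n lo hi → h n lo (NP.m≤n⇒m≤1+n hi)))
   (≤-reflexive (sym (cong (λ c → if c then 1 else 0) (dec-true (prime? (u g D (suc t + a))) (h (suc t + a) (s≤s (NP.m≤n+m a t)) ≤-refl))))))

  nonzero-digit : ∀ a t → (u g D (t + a) ≡ u g D a) ⊎ (∃[ i ] (a ≤ i × toℕ (D i) ≢ 0))
  nonzero-digit a zero = inj₁ refl
  nonzero-digit a (suc t) with nonzero-digit a t
  ... | inj₂ r = inj₂ r
  ... | inj₁ e with toℕ (D (t + a)) N.≟ 0
  ... | no nz = inj₂ (t + a , NP.m≤n+m a t , nz)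
  ... | yes z = inj₁ (trans (cong (λ d → u g D (t + a) + d * g ^ (t + a)) z) (trans (NP.+-identityʳ _) e))

 module Construction (g : ℕ) (g≥2 : 2 ≤ g)
  (T : ∀ b → ∃[ n ] (b ≤ n × (∀ a → Coprime a g → ∃[ p ] (Prime p × g ^ n ≤ p × p < 2 ^ (2 ^ n) × (∀ {{_ : NonZero (g ^ n)}} → p % (g ^ n) ≡ a % (g ^ n)))))) where

  instance
   nzg : NonZero g
   nzg = N.>-nonZero (NP.<⇒≤ g≥2)

  infixl 7 _mod_ _quo_
  _mod_ _quo_ : ℕ → ℕ → ℕ
  a mod N = _%_ a (g ^ N) {{NP.m^n≢0 g N}}
  a quo N = _/_ a (g ^ N) {{NP.m^n≢0 g N}}

  digit-step : ∀ p N → p mod suc N ≡ p mod N + (p quo N % g) * g ^ N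
  digit-step p N = trans (m≡m%n+[m/n]*n (p % g ^ suc N) (g ^ N))
   (cong₂ (λ a b → a + b * g ^ N) (m∣n⇒o%n%m≡o%m (g ^ N) (g ^ suc N) p (n∣m*n g)) (m%[n*o]/o≡m/o%n p g (g ^ N)))
   where
   instance
    nzN : NonZero (g ^ N)
    nzN = NP.m^n≢0 g N
    nzsN : NonZero (g ^ suc N)
    nzsN = NP.m^n≢0 g (suc N)

  -- `L` is only an upper bound for the number of digits of p. It is taken as 2^n, so that the
  -- counting never needs the true length.
  record Stage : Set where
   field
    p L : ℕ
    prime : Prime p
    coprime : Coprime p g
    p< : p < g ^ L
  open Stage

  mod-mono : ∀ {M N a b} → M ≤ N → a mod N ≡ b mod N → a mod M ≡ b mod M
  mod-mono {M} {N} {a} {b} h e = trans (sym (m∣n⇒o%n%m≡o%m (g ^ M) (g ^ N) a d)) (trans (cong (_mod M) e) (m∣n⇒o%n%m≡o%m (g ^ M) (g ^ N) b d))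
   where
   instance
    nzM : NonZero (g ^ M)
    nzM = NP.m^n≢0 g M
    nzN : NonZero (g ^ N)
    nzN = NP.m^n≢0 g N
   d : g ^ M ∣ g ^ N
   d = divides (g ^ (N ∸ M)) (trans (cong (g ^_) (sym (NP.m∸n+n≡m h))) (NP.^-distribˡ-+-* g (N ∸ M) M))

  extend : ∀ b → 1 ≤ b → ∀ a → Coprime a g → Stage
  extend b b≥1 a c with T b
  ... | n , b≤n , primes with primes a (λ {i} → c {i})
  ... | q , pq , lo , hi , e = record { p = q ; L = 2 ^ n ; prime = pq
    ; coprime = λ {i} → coprime-≈ g {a} {q} (sym modg) (λ {j} → c {j}) {i}
    ; p< = NP.<-≤-trans hi (NP.^-monoˡ-≤ (2 ^ n) g≥2) }
   where
   modg : q % g ≡ a % g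
   modg = trans (sym (%-cong' q)) (trans (mod-mono {1} {n} (≤-trans b≥1 b≤n) (e {{NP.m^n≢0 g n}})) (%-cong' a))
    where
    %-cong' : ∀ x → x mod 1 ≡ x % g
    %-cong' x = %-congʳ {o = x} {{NP.m^n≢0 g 1}} {{nzg}} (NP.*-identityʳ g)

  -- The summand i + 1 makes digit i settled at stage i; the factor i + 2 makes the proportion of
  -- indices lost to the previous prime's digits tend to 0.
  bound : ℕ → Stage → ℕ
  bound i s = suc i + suc (suc i) * L s

  chain : ℕ → Stage
  chain zero = extend 1 ≤-refl 1 (λ {i} → coprime-1 g {i})
  chain (suc i) = extend (bound i (chain i)) (s≤s z≤n) (p (chain i)) (λ {j} → coprime (chain i) {j})

  n : ℕ → ℕ
  n i = proj₁ (T (bound i (chain i)))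

  n≥ : ∀ i → bound i (chain i) ≤ n i
  n≥ i = proj₁ (proj₂ (T (bound i (chain i))))

  p≥ : ∀ i → g ^ n i ≤ p (chain (suc i))
  p≥ i = proj₁ (proj₂ (proj₂ (proj₂ (proj₂ (T (bound i (chain i)))) (p (chain i)) (λ {j} → coprime (chain i) {j}))))

  p≡ : ∀ i → p (chain (suc i)) mod n i ≡ p (chain i) mod n i
  p≡ i = proj₂ (proj₂ (proj₂ (proj₂ (proj₂ (proj₂ (T (bound i (chain i)))) (p (chain i)) (λ {j} → coprime (chain i) {j}))))) {{NP.m^n≢0 g (n i)}}

  n<2^n : ∀ n → n < 2 ^ n
  n<2^n zero = s≤s z≤n
  n<2^n (suc n) = ≤-trans (NP.+-mono-≤ (NP.m^n>0 2 n) (n<2^n n)) (≤-reflexive (cong (2 ^ n +_) (sym (NP.+-identityʳ _))))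

  suc-i≤n : ∀ i → suc i ≤ n i
  suc-i≤n i = ≤-trans (NP.m≤m+n (suc i) _) (n≥ i)

  L≤n : ∀ i → suc (suc i) * L (chain i) ≤ n i
  L≤n i = ≤-trans (NP.m≤n+m _ (suc i)) (n≥ i)

  L≤n' : ∀ i → L (chain i) ≤ n i
  L≤n' i = ≤-trans (NP.m≤n*m (L (chain i)) (suc (suc i))) (L≤n i)

  n<L : ∀ i → n i < L (chain (suc i))
  n<L i = n<2^n (n i)

  n-mono : ∀ i → n i ≤ n (suc i)
  n-mono i = ≤-trans (NP.<⇒≤ (n<L i)) (L≤n' (suc i))

  i≤L : ∀ i → i ≤ L (chain i)
  i≤L zero = z≤n
  i≤L (suc i) = ≤-trans (suc-i≤n i) (NP.<⇒≤ (n<L i))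

  stable : ∀ i k → p (chain (k + i)) mod n i ≡ p (chain i) mod n i
  stable i zero = refl
  stable i (suc k) = trans (mod-mono {n i} {n (k + i)} (mono k) (p≡ (k + i))) (stable i k)
   where
   mono : ∀ k → n i ≤ n (k + i)
   mono zero = ≤-refl
   mono (suc k) = ≤-trans (mono k) (n-mono (k + i))

  -- The digit at N may be read from the prime at stage N: since n N ≥ N + 1, all later primes agree
  -- with it there.
  D : ℕ → Fin g
  D N = fromℕ< {p (chain N) quo N % g} (m%n<n (p (chain N) quo N) g)

  open Counting g D

  u≡ : ∀ N → u g D N ≡ p (chain N) mod N
  u≡ zero = sym (n%1≡0 (p (chain 0)))
  u≡ (suc N) = trans (cong₂ (λ a b → a + b * g ^ N) (u≡ N) (toℕ-fromℕ< (m%n<n (p (chain N) quo N) g)))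
   (trans (sym (digit-step (p (chain N)) N)) (sym (mod-mono {suc N} {n N} (suc-i≤n N) (p≡ N))))

  u-plateau : ∀ i N → L (chain i) ≤ N → N ≤ n i → u g D N ≡ p (chain i)
  u-plateau i N lo hi = trans (u≡ N) (trans (cong (λ k → p (chain k) mod N) (sym (NP.m∸n+n≡m i≤N)))
   (trans (mod-mono {N} {n i} hi (stable i (N ∸ i))) (m<n⇒m%n≡m {{NP.m^n≢0 g N}} (NP.<-≤-trans (p< (chain i)) (NP.^-monoʳ-≤ g lo)))))
   where
   i≤N : i ≤ N
   i≤N = ≤-trans (i≤L i) lo

  -- If all digits between `n m` and the length of the next prime vanished, both primes would be
  -- equal, although the next one is at least g^(n m) and the present one is smaller.
  infinitely-many-nonzero : ∀ m → ∃[ i ] (m ≤ i × toℕ (D i) ≢ 0)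
  infinitely-many-nonzero m with nonzero-digit (n m) (L (chain (suc m)) ∸ n m)
  ... | inj₂ (i , h , nz) = i , ≤-trans (≤-trans (NP.n≤1+n m) (suc-i≤n m)) h , nz
  ... | inj₁ e = ⊥-elim (NP.<⇒≱ (p< (chain m)) (≤-trans (NP.^-monoʳ-≤ g (L≤n' m)) (≤-trans (p≥ m) (≤-reflexive same))))
   where
   same : p (chain (suc m)) ≡ p (chain m)
   same = trans (sym (u-plateau (suc m) (L (chain (suc m))) ≤-refl (L≤n' (suc m)))) (trans (cong (u g D) (sym (NP.m∸n+n≡m (NP.<⇒≤ (n<L m))))) (trans e (u-plateau m (n m) (L≤n' m) ≤-refl)))

  plateau-prime : ∀ i N → L (chain i) ≤ N → N ≤ n i → Prime (u g D N)
  plateau-prime i N lo hi = subst Prime (sym (u-plateau i N lo hi)) (prime (chain i))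

  ϖ-plateau : ∀ i N → L (chain i) ≤ N → N ≤ n i → N ∸ L (chain i) + ϖ g D (L (chain i)) ≤ ϖ g D N
  ϖ-plateau i N lo hi = subst (λ M → N ∸ L (chain i) + ϖ g D (L (chain i)) ≤ ϖ g D M) (NP.m∸n+n≡m lo)
   (ϖ-primes (L (chain i)) (N ∸ L (chain i)) (λ k a b → plateau-prime i k (NP.<⇒≤ a) (≤-trans b (≤-trans (≤-reflexive (NP.m∸n+n≡m lo)) hi))))

  ϖ-≤ : ∀ {M N} → M ≤ N → ϖ g D M ≤ ϖ g D N
  ϖ-≤ {M} {N} h = subst (λ K → ϖ g D M ≤ ϖ g D K) (NP.m∸n+n≡m h) (ϖ-mono M (N ∸ M))

  locate : ∀ d i N → n i ≤ N → N ≤ n (d + i) → ∃[ j ] (i ≤ j × n j ≤ N × N ≤ n (suc j))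
  locate zero i N lo hi = i , ≤-refl , lo , ≤-trans hi (n-mono i)
  locate (suc d) i N lo hi with N N.≤? n (d + i)
  ... | yes le = locate d i N lo le
  ... | no nle = d + i , NP.m≤n+m i d , NP.<⇒≤ (NP.≰⇒> nle) , hi

  L+t≤ : ∀ a t → 2 ^ a + t ≤ 2 ^ (t + a)
  L+t≤ a zero = ≤-reflexive (NP.+-identityʳ _)
  L+t≤ a (suc t) = ≤-trans (≤-reflexive (trans (NP.+-suc (2 ^ a) t) (NP.+-comm 1 _))) (≤-trans (NP.+-mono-≤ (L+t≤ a t) (NP.m^n>0 2 (t + a))) (≤-reflexive (cong (2 ^ (t + a) +_) (sym (NP.+-identityʳ _)))))

  -- With a = n_j this is the worst case of the count: at N = 2^a the exponent is a, and from there
  -- each further index adds a whole unit to the exponent.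
  N≤2^ : ∀ a N → N ≤ 2 ^ (N ∸ 2 ^ a + a)
  N≤2^ a N = ≤-trans (NP.m≤n+m∸n N (2 ^ a)) (L+t≤ a (N ∸ 2 ^ a))

  -- The indices from the length of the j-th prime to n_j all count, and so do those from 2^(n_j) to
  -- N, where the next prime stands; the truncated difference covers N below 2^(n_j).
  ϖ-lower : ∀ j N → n j ≤ N → N ≤ n (suc j) → (N ∸ 2 ^ n j) + (n j ∸ L (chain j)) ≤ ϖ g D N
  ϖ-lower j N lo hi = by (2 ^ n j N.≤? N)
   where
   base : n j ∸ L (chain j) ≤ ϖ g D (n j)
   base = ≤-trans (NP.m≤m+n _ _) (ϖ-plateau j (n j) (L≤n' j) ≤-refl)
   by : Dec (2 ^ n j ≤ N) → (N ∸ 2 ^ n j) + (n j ∸ L (chain j)) ≤ ϖ g D N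
   by (yes le) = ≤-trans (NP.+-monoʳ-≤ (N ∸ 2 ^ n j) (≤-trans base (ϖ-≤ (NP.<⇒≤ (n<L j))))) (ϖ-plateau (suc j) N le hi)
   by (no nle) = ≤-trans (≤-reflexive (cong (_+ (n j ∸ L (chain j))) (NP.m≤n⇒m∸n≡0 (NP.<⇒≤ (NP.≰⇒> nle))))) (≤-trans base (ϖ-≤ lo))

  -- Equivalent to ϖ(N) ≥ k/(k+1) · log₂ N: of the n_j indices at most the fraction 1/(j+2) is lost,
  -- and j ≥ k.
  power-bound : ∀ k j N → k ≤ j → n j ≤ N → N ≤ n (suc j) → N ^ k ≤ 2 ^ (ϖ g D N * suc k)
  power-bound k j N kj lo hi = ≤-trans (NP.^-monoˡ-≤ k (N≤2^ (n j) N)) (≤-trans (≤-reflexive (NP.^-*-assoc 2 (t + n j) k))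
    (NP.^-monoʳ-≤ 2 (≤-trans expo (NP.*-monoˡ-≤ (suc k) (ϖ-lower j N lo hi)))))
   where
   t l : ℕ
   t = N ∸ 2 ^ n j
   l = L (chain j)
   gap : ℕ
   gap = n j ∸ l
   kl : suc k * l ≤ n j
   kl = ≤-trans (NP.*-monoˡ-≤ l (≤-trans (s≤s kj) (NP.n≤1+n (suc j)))) (L≤n j)
   gap≡ : gap + l ≡ n j
   gap≡ = NP.m∸n+n≡m (L≤n' j)
   -- (k + 1) l ≤ n gives k n ≤ (k + 1)(n - l)
   key : (gap + l) * k ≤ gap * suc k
   key = NP.+-cancelʳ-≤ l _ _ (≤-trans (≤-reflexive (e1 gap l k)) (≤-trans (NP.+-monoʳ-≤ (gap * k) (≤-trans kl (≤-reflexive (sym gap≡)))) (≤-reflexive (e2 gap l k))))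
    where
    e1 : ∀ a l k → (a + l) * k + l ≡ a * k + suc k * l
    e1 = solveℕ
    e2 : ∀ a l k → a * k + (a + l) ≡ a * suc k + l
    e2 = solveℕ
   expo : (t + n j) * k ≤ (t + gap) * suc k
   expo = ≤-trans (≤-reflexive (NP.*-distribʳ-+ k t (n j))) (≤-trans (NP.+-mono-≤ (NP.*-monoʳ-≤ t (NP.n≤1+n k)) (≤-trans (≤-reflexive (cong (_* k) (sym gap≡))) key)) (≤-reflexive (sym (NP.*-distribʳ-+ (suc k) t gap))))

  growth : ∀ k → 1 ≤ k → ∃[ N₀ ] (∀ N → N₀ ≤ N → 5 ^ (ϖ g D N * k) * N ^ (k ∸ 1) ≤ 12 ^ (ϖ g D N * k))
  -- From n_k on, the current stage is at least k. The search for the stage ends by stage N + k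
  -- because n_i ≥ i + 1. The constant 12/5 then enters through 5 · 2 ≤ 12.
  growth (suc k) _ = n k , λ N h → by N (locate N k N h (≤-trans (≤-trans (NP.m≤m+n N k) (NP.n≤1+n _)) (suc-i≤n (N + k))))
   where
   by : ∀ N → ∃[ j ] (k ≤ j × n j ≤ N × N ≤ n (suc j)) → 5 ^ (ϖ g D N * suc k) * N ^ k ≤ 12 ^ (ϖ g D N * suc k)
   by N (j , kj , lo , hi) = ≤-trans (NP.*-monoʳ-≤ (5 ^ (ϖ g D N * suc k)) (power-bound k j N kj lo hi))
    (10≤12 (ϖ g D N * suc k))
    where
    10≤12 : ∀ n → 5 ^ n * 2 ^ n ≤ 12 ^ n
    10≤12 zero = ≤-refl
    10≤12 (suc n) = ≤-trans (≤-reflexive (rearrange 5 2 (5 ^ n) (2 ^ n))) (NP.*-mono-≤ (NP.m≤m+n 10 2) (10≤12 n))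
     where
     rearrange : ∀ a b c d → a * c * (b * d) ≡ a * b * (c * d)
     rearrange = solveℕ

open import Defs
open import Data.Nat using (ℕ; _≤_; _*_; _^_; _∸_)
open import Data.Fin using (Fin; toℕ)
open import Data.Product using (Σ; _×_; ∃-syntax; _,_)
open import Relation.Binary.PropositionalEquality using (_≢_)

theorem2p1 : (g : ℕ) → 2 ≤ g →
  Σ (ℕ → Fin g) λ D →
    ((m : ℕ) → ∃[ i ] (m ≤ i × toℕ (D i) ≢ 0)) ×
    ((k : ℕ) → 1 ≤ k → ∃[ N₀ ] ((N : ℕ) → N₀ ≤ N →
      5 ^ (ϖ g D N * k) * N ^ (k ∸ 1) ≤ 12 ^ (ϖ g D N * k)))
theorem2p1 g g≥2 = D , infinitely-many-nonzero , growth
  where open Chain.Construction g g≥2 (Dirichlet.primes-modulo-powers g g≥2)
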